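{- Let $\widetilde{\mathcal T}$ be a tagged triangulation of $S_\odot$ whose arcs, transported to plain arcs via the bijection $D^1_{ij}\leftrightarrow D_{ij}$, $D^1_{i0}\leftrightarrow D_{i0}$, $D^{ -1}_{i0}\leftrightarrow D_{ii}$, form a slice, and let $\mathbf x$ be the corresponding cluster of the cluster algebra $\mathcal A$ of type $D_N$ with trivial coefficients. Then $F(\widetilde{\mathcal T})=F_c(\widetilde{\mathcal T})$, i.e. for every plain arc $D$ of $S_\odot$ the number assigned to $D$ by $F(\widetilde{\mathcal T})$ equals the integer $u_D$ obtained from the cluster variable of $D$ by specialising all elements of $\mathbf x$ to $1$.
   Context: $S_\odot$ is a closed disc with $N\ge 3$ marked boundary points $1,\dots,N$ (clockwise, indices mod $N$) and a puncture $0$. For boundary vertices $k,l$, $B_{kl}$ is the clockwise boundary path from $k$ to $l$ ($B_{kk}$ the whole boundary) and $V_{kl}=\{k,k+1,\dots,l\}$ its marked points. Plain arcs (up to isotopy, simple, interiors avoiding boundary and marked points): $D_{ij}$ for boundary $i,j$ with $j\ne i+1$ (possibly $j=i$), the arc from $i$ to $j$ bounding together with $B_{ij}$ a disc not containing the puncture ($D_{ii}$ is the loop at $i$ around the puncture), and central arcs $D_{i0}$. A triangulation $\mathcal T$ is a maximal set of pairwise non-crossing plain arcs; it has $N$ triangles (possibly one self-folded triangle with sides $D_{i0},D_{ii}$, occurring exactly when $D_{i0}$ is the only central arc); $d_0$ is the number of triangles incident with $0$. A (piece of a) triangle is incident with a marked point if that point is a corner of it lying on its closure. A matching between a set $I$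 of marked points and a set $R$ of regions is an injective map $I\to R$ sending each point to an incident region; $\mathcal M(I,R)$ is the set of these. For $i\ne j$, $j\ne i+1$: $S_{ij}$ is the unpunctured disc bounded by $D_{ij}$ and $B_{ij}$, and $\mathcal T|_{S_{ij}}$ is the set of connected components of intersections of triangles of $\mathcal T$ with $S_{ij}$ (a triangle crossed by $D_{ij}$ may give two pieces). $P(i)$: if $\mathcal T$ has $\ge2$ central arcs, with $k$ the first boundary vertex anticlockwise from $i$ (starting at $i$) with $D_{k0}\in\mathcal T$ and $j$ the first boundary vertex strictly clockwise from $i$ with $D_{j0}\in\mathcal T$, $P(i)$ is the disc bounded by $B_{kj},D_{j0},D_{k0}$ with marked points $V_{kj}\cup\{0\}$; if $\mathcal T$ has exactly one central arc $D_{k0}$, $P(i)$ is $S_\odot$ cut open along $D_{k0}$, with marked points clockwise $k',k+1,\dots,k-1,k,0$; in both cases triangulated by the triangles of $\mathcal T$. Matching numbers of $\mathcal T$: $m_{i,i+1}=1$; $m_{ij}=|\mathcal M(V_{i+1,j-1},\mathcal T|_{S_{ij}})|$ ($i\ne j$, $j\neq i+1$); $m_{ii}=|\mathcal M((\{1,\dots,N\}\setminus\{i\})\cup\{0\},\text{triangles of }\mathcal T)|$; $m_{i0}=|\mathcal M(V(P(i))\setminus\{i,0\},\text{triangles of }P(i))|$. $F(\mathcal T)$ denotes the assignment $D_{ij}\mapsto m_{ij}$, $D_{i0}\mapsto m_{i0}$. Tagged arcs: $D^1_{ij}$ ($j\ne i,i+1$), $D^1_{i0}$, $D^{ -1}_{i0}$,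 in bijection with plain arcs as in the claim. Tagged triangulations come from triangulations $\mathcal T$: if $d_0=1$ (so $D_{i0},D_{ii}\in\mathcal T$), replace $D_{ii}$ by $D^{ -1}_{i0}$, all others tagged $1$; if $d_0\ge2$, tag non-central arcs $1$ and either all central arcs $1$ or all central arcs $-1$. $F(\widetilde{\mathcal T})$: if $\widetilde{\mathcal T}$ has at most one arc tagged $-1$, it is $F(\mathcal T)$ for the triangulation $\mathcal T$ corresponding under the bijection; if it has at least two arcs tagged $-1$, let $\mathcal T'$ consist of the $D_{i0}$ with $D^{ -1}_{i0}\in\widetilde{\mathcal T}$ and the $D_{ij}$ with $D^1_{ij}\in\widetilde{\mathcal T}$, and $F(\widetilde{\mathcal T})$ assigns $m_{ij}(\mathcal T')$ to $D_{ij}$ for $i\ne j$, $m_{i0}(\mathcal T')$ to $D_{ii}$ and $m_{ii}(\mathcal T')$ to $D_{i0}$ (the values on $D_{ii}$ and $D_{i0}$ interchanged). Cluster side: by Fomin–Shapiro–Thurston and Schiffler, cluster variables of $\mathcal A$ correspond bijectively to tagged arcs and clusters to tagged triangulations (standard bijection); via the bijection with plain arcs, each plain arc $D$ has a cluster variable $x_D$, a Laurent polynomial in the elements of $\mathbf x$; $u_D$ is its value at all elements of $\mathbf x$ equal to $1$, and $F_c(\widetilde{\mathcal T})$ is the assignment $D\mapsto u_D$. Slice: a set $\{E_1,\dots,E_N\}$ of plain arcs with $E_1=D_{a,a+2}$ for some $a$; for $2\le k\le N-2$, if $E_{k-1}=D_{p,q}$ then $E_k\in\{D_{p,q+1},D_{p-1,q}\}$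 (so $E_{N-2}=D_{i,i-1}$); and $\{E_{N-1},E_N\}$ is one of $\{D_{i0},D_{ii}\}$, $\{D_{i-1,0},D_{i-1,i-1}\}$, $\{D_{i0},D_{i-1,0}\}$, $\{D_{ii},D_{i-1,i-1}\}$. (This is the paper's notion of slice positions in the frieze array, expressed via arcs; equivalently, the quiver of the seed is an orientation of the Dynkin diagram $D_N$.)
   Formalization: In m_ii, when T has a self-folded triangle (d_0=1), the puncture also counts as incident with the other triangle having the loop D_kk as a side; with corners only the claim fails (N=3, arcs D_02, D_00, radius at 0: m_11=2 but u=3). -}

module Defs where

-- Combinatorial model of the once-punctured disc S_⊙ with N boundary
-- marked points, its (tagged) triangulations, the matching numbers of the
-- paper, and the type D_N cluster algebra (via the surface model of
-- Fomin-Shapiro-Thurston), all via explicit finite computations.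
--
-- Conventions:
--  * boundary marked points are labelled 0,…,N-1 (paper: 1,…,N), clockwise;
--    the puncture is a separate point.
--  * Universal cover model: the cover of S_⊙ minus the puncture is an
--    "∞-gon" with vertices the integers (position p lies over boundary point
--    p mod N, positions increasing clockwise) together with a vertex ∞ (the
--    puncture).  The arc D_{i,i+L} (2 ≤ L ≤ N, L = N the loop D_ii) lifts to
--    the chords (p, p+L), p ≡ i; the central arc D_{i0} lifts to the chords
--    (p, ∞), p ≡ i; the boundary segment from i to i+1 lifts to (p, p+1).

open import Data.Nat using (ℕ; zero; suc; _+_; _*_; _∸_; _≤_; _<_; _≡ᵇ_; _<ᵇ_; _≤ᵇ_)
open import Data.Nat.DivMod using (_%_)
open import Data.Bool using (Bool; true; false; _∧_; _∨_; not; if_then_else_)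
open import Data.List using (List; []; _∷_; _++_; map; length; foldl; concatMap; upTo; filterᵇ)
open import Data.Bool.ListAction using (any; all)
open import Data.Nat.ListAction using (sum)
open import Data.List.Membership.Propositional using (_∈_)
open import Data.List.Relation.Unary.All using (All)
open import Data.Maybe using (Maybe; just; nothing)
open import Data.Product using (Σ; _×_; _,_; proj₁; proj₂)
open import Data.Sum using (_⊎_)
open import Data.Unit using (⊤)
open import Data.Integer using (ℤ; -[1+_]) renaming (+_ to pos; _+_ to _+ℤ_; -_ to -ℤ_; _*_ to _*ℤ_)
open import Relation.Binary.PropositionalEquality using (_≡_)
open import Relation.Nullary using (¬_)

md : ℕ → ℕ → ℕ
md zero    x = x
md (suc n) x = x % suc n

range : ℕ → ℕ → List ℕ
range lo hi = map (lo +_) (upTo (suc hi ∸ lo))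

findFirst : (ℕ → Bool) → List ℕ → ℕ → ℕ
findFirst p []       d = d
findFirst p (x ∷ xs) d = if p x then x else findFirst p xs d

memℕ : ℕ → List ℕ → Bool
memℕ x = any (_≡ᵇ x)

data Arc : Set where
  nc : ℕ → ℕ → Arc   -- nc i L = D_{i, i+L mod N}  (2 ≤ L ≤ N; L = N : loop D_ii)
  ct : ℕ → Arc       -- ct i   = D_{i0}

validArc : ℕ → Arc → Bool
validArc N (nc i L) = (i <ᵇ N) ∧ ((2 ≤ᵇ L) ∧ (L ≤ᵇ N))
validArc N (ct i)   = i <ᵇ N

arcEq : Arc → Arc → Bool
arcEq (nc i L) (nc j M) = (i ≡ᵇ j) ∧ (L ≡ᵇ M)
arcEq (ct i)   (ct j)   = i ≡ᵇ j
arcEq _        _        = false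

memA : Arc → List Arc → Bool
memA a = any (arcEq a)

-- the paper's D_{ij} for boundary vertices i, j (read mod N), j ≠ i+1
Dij : ℕ → ℕ → ℕ → Arc
Dij N i j = nc (md N i) (if d ≡ᵇ 0 then N else d)
  where d = md N (j + N ∸ md N i)

D0 : ℕ → ℕ → Arc
D0 N i = ct (md N i)

allArcs : ℕ → List Arc
allArcs N = concatMap (λ i → ct i ∷ map (nc i) (range 2 N)) (upTo N)

-- Crossing (= some lifts to the cover cross)

chordsCross : ℕ → ℕ → ℕ → ℕ → Bool
chordsCross a b c d = ((a <ᵇ c) ∧ ((c <ᵇ b) ∧ (b <ᵇ d))) ∨ ((c <ᵇ a) ∧ ((a <ᵇ d) ∧ (d <ᵇ b)))

shifts : List ℕ
shifts = 0 ∷ 1 ∷ 2 ∷ []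

chordRayCross : ℕ → ℕ → ℕ → Bool
chordRayCross a b c = (a <ᵇ c) ∧ (c <ᵇ b)

cross : ℕ → Arc → Arc → Bool
cross N (nc i L) (nc j M) =
  any (λ s → chordsCross (i + N) (i + N + L) (j + s * N) (j + s * N + M)) shifts
cross N (nc i L) (ct j) = any (λ s → chordRayCross (i + N) (i + N + L) (j + s * N)) shifts
cross N (ct j) (nc i L) = any (λ s → chordRayCross (i + N) (i + N + L) (j + s * N)) shifts
cross N (ct _) (ct _) = false

IsTriangulation : ℕ → List Arc → Set
IsTriangulation N T =
  All (λ a → validArc N a ≡ true) T
  × (∀ a b → a ∈ T → b ∈ T → cross N a b ≡ false)
  × (∀ a → validArc N a ≡ true → (∀ b → b ∈ T → cross N a b ≡ false) → a ∈ T)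

data LTri : Set where
  tri  : ℕ → ℕ → ℕ → LTri   -- vertices x < y < z (positions)
  trip : ℕ → ℕ → LTri       -- vertices x < y and ∞ (the puncture)

verts : LTri → List ℕ
verts (tri x y z) = x ∷ y ∷ z ∷ []
verts (trip x y)  = x ∷ y ∷ []

isTrip : LTri → Bool
isTrip (tri _ _ _) = false
isTrip (trip _ _)  = true

-- the chord (x,y), x < y, is a boundary segment or a lift of an arc of T
chordIn : ℕ → List Arc → ℕ → ℕ → Bool
chordIn N T x y = ((y ∸ x) ≡ᵇ 1) ∨ ((2 ≤ᵇ (y ∸ x)) ∧ (((y ∸ x) ≤ᵇ N) ∧ memA (nc (md N x) (y ∸ x)) T))

rayIn : ℕ → List Arc → ℕ → Bool
rayIn N T x = memA (ct (md N x)) T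

trisFrom : ℕ → List Arc → ℕ → List LTri
trisFrom N T x =
  concatMap (λ y → concatMap (λ z → if chordIn N T x y ∧ (chordIn N T y z ∧ chordIn N T x z)
                                     then tri x y z ∷ [] else [])
                             (range (suc y) (x + N)))
            (range (suc x) (x + N))
  ++ concatMap (λ y → if rayIn N T x ∧ (rayIn N T y ∧ chordIn N T x y) then trip x y ∷ [] else [])
               (range (suc x) (x + N))

trisIn : ℕ → List Arc → ℕ → ℕ → List LTri
trisIn N T lo hi = concatMap (trisFrom N T) (range lo hi)

-- the triangles of T (one lift each)
triangles : ℕ → List Arc → List LTri
triangles N T = trisIn N T 0 (N ∸ 1)

d0 : ℕ → List Arc → ℕ
d0 N T = length (filterᵇ isTrip (triangles N T))

picks : {R : Set} → List R → List (R × List R)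
picks []       = []
picks (r ∷ rs) = (r , rs) ∷ map (λ p → proj₁ p , r ∷ proj₂ p) (picks rs)

-- |M(I,R)| : number of injective maps I → R sending each point to an
-- incident region (I, R given as duplicate-free lists)
countMatch : {P R : Set} → (P → R → Bool) → List P → List R → ℕ
countMatch inc []       rs = 1
countMatch inc (p ∷ ps) rs =
  sum (map (λ q → if inc p (proj₁ q) then countMatch inc ps (proj₂ q) else 0) (picks rs))

data Pt : Set where
  bd   : ℕ → Pt
  punc : Pt

-- incidence of a marked point of S_⊙ with a triangle of T.
-- Boundary points: being a corner.  Puncture: being a corner, and in
-- addition (READING) the triangle having the loop D_kk of a
-- self-folded triangle as a side (tri x y z with z = x + N) counts as
-- incident with the puncture.
incSurf : ℕ → Pt → LTri → Bool
incSurf N (bd p) Δ = any (λ v → md N v ≡ᵇ p) (verts Δ)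
incSurf N punc (tri x y z) = (z ∸ x) ≡ᵇ N
incSurf N punc (trip x y)  = true

incPos : ℕ → LTri → Bool
incPos p Δ = memℕ p (verts Δ)

-- m_{ij} for j = i+L, 2 ≤ L ≤ N-1.  S_{ij} lifts to the region P under the
-- chord (n, n+L), n = i+N; the pieces of T|S_{ij} are the sets Δ̂ ∩ P for
-- lifted triangles Δ̂ whose interior meets P, i.e. which have a vertex in
-- the open range (n, n+L).
mNC : ℕ → List Arc → ℕ → ℕ → ℕ
mNC N T i L = countMatch incPos pts regs
  where
    n = i + N
    pts = range (suc n) (n + L ∸ 1)
    regs = filterᵇ (λ Δ → any (λ v → (n <ᵇ v) ∧ (v <ᵇ n + L)) (verts Δ))
                   (trisIn N T (suc n ∸ N) (n + L ∸ 1))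

mLoop : ℕ → List Arc → ℕ → ℕ
mLoop N T i = countMatch (incSurf N) pts (triangles N T)
  where pts = map bd (filterᵇ (λ p → not (p ≡ᵇ i)) (upTo N)) ++ (punc ∷ [])

-- m_{i0}.  P(i) lifts to the polygon with vertices the positions k̂ … ĵ and
-- ∞, where k̂ ≤ i+N < ĵ are consecutive lifts of central arcs of T.
mCt : ℕ → List Arc → ℕ → ℕ
mCt N T i = countMatch incPos pts regs
  where
    x  = i + N
    kh = findFirst (rayIn N T) (map (x ∸_) (upTo N)) x
    jh = findFirst (rayIn N T) (range (suc x) (x + N)) x
    pts = filterᵇ (λ p → not (p ≡ᵇ x)) (range kh jh)
    regs = filterᵇ (λ Δ → all (λ v → (kh ≤ᵇ v) ∧ (v ≤ᵇ jh)) (verts Δ)) (trisIn N T kh jh)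

FT : ℕ → List Arc → Arc → ℕ
FT N T (nc i L) = if L ≡ᵇ N then mLoop N T i else mNC N T i L
FT N T (ct i)   = mCt N T i

data Tag : Set where
  pl nt : Tag     -- tag 1, tag -1

tagEq : Tag → Tag → Bool
tagEq pl pl = true
tagEq nt nt = true
tagEq _  _  = false

data TArc : Set where
  tnc : ℕ → ℕ → TArc      -- D^1_{i,i+L}, 2 ≤ L ≤ N-1
  tct : ℕ → Tag → TArc    -- D^{±1}_{i0}

validTArc : ℕ → TArc → Bool
validTArc N (tnc i L) = (i <ᵇ N) ∧ ((2 ≤ᵇ L) ∧ (suc L ≤ᵇ N))
validTArc N (tct i _) = i <ᵇ N

tEq : TArc → TArc → Bool
tEq (tnc i L) (tnc j M) = (i ≡ᵇ j) ∧ (L ≡ᵇ M)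
tEq (tct i s) (tct j r) = (i ≡ᵇ j) ∧ tagEq s r
tEq _ _ = false

memT : TArc → List TArc → Bool
memT a = any (tEq a)

allTArcs : ℕ → List TArc
allTArcs N = concatMap (λ i → tct i pl ∷ tct i nt ∷ map (tnc i) (range 2 (N ∸ 1))) (upTo N)

toPlain : ℕ → TArc → Arc
toPlain N (tnc i L)  = nc i L
toPlain N (tct i pl) = ct i
toPlain N (tct i nt) = nc i N

ofPlain : ℕ → Arc → TArc
ofPlain N (nc i L) = if L ≡ᵇ N then tct i nt else tnc i L
ofPlain N (ct i)   = tct i pl

untag : TArc → Arc
untag (tnc i L) = nc i L
untag (tct i _) = ct i

tagRule : List Arc → Tag → TArc → Bool
tagRule T s (tnc i L)  = memA (nc i L) T
tagRule T s (tct i s') = tagEq s s' ∧ memA (ct i) T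

IsTaggedTriangulation : ℕ → List TArc → Set
IsTaggedTriangulation N Tt =
  All (λ t → validTArc N t ≡ true) Tt
  × Σ (List Arc) λ T → IsTriangulation N T
      × ((d0 N T ≡ 1 × (∀ t → validTArc N t ≡ true →
                          (t ∈ Tt → memA (toPlain N t) T ≡ true)
                          × (memA (toPlain N t) T ≡ true → t ∈ Tt)))
         ⊎ (2 ≤ d0 N T × Σ Tag λ s → ∀ t → validTArc N t ≡ true →
                          (t ∈ Tt → tagRule T s t ≡ true)
                          × (tagRule T s t ≡ true → t ∈ Tt)))

numNotched : ℕ → List TArc → ℕ
numNotched N Tt = length (filterᵇ (λ i → memT (tct i nt) Tt) (upTo N))

FTag : ℕ → List TArc → Arc → ℕ
FTag N Tt D = if numNotched N Tt ≤ᵇ 1 then FT N (map (toPlain N) Tt) D else G D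
  where
    T' = map untag Tt
    G : Arc → ℕ
    G (nc i L) = if L ≡ᵇ N then mCt N T' i else mNC N T' i L
    G (ct i)   = mLoop N T' i

data LastPair : Set where
  lp1 lp2 lp3 lp4 : LastPair

-- E_1 = D_{p,q}, then each step: true ↦ D_{p,q+1}, false ↦ D_{p-1,q}
sliceChain : ℕ → ℕ → ℕ → List Bool → List Arc
sliceChain N p q []       = Dij N p q ∷ []
sliceChain N p q (b ∷ bs) =
  Dij N p q ∷ (if b then sliceChain N p (suc q) bs else sliceChain N (p + (N ∸ 1)) q bs)

-- the vertex i with E_{N-2} = D_{i,i-1}
chainEnd : ℕ → ℕ → List Bool → ℕ
chainEnd N p []       = md N p
chainEnd N p (b ∷ bs) = if b then chainEnd N p bs else chainEnd N (p + (N ∸ 1)) bs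

lastArcs : ℕ → ℕ → LastPair → List Arc
lastArcs N i lp1 = D0 N i ∷ Dij N i i ∷ []
lastArcs N i lp2 = D0 N (i + (N ∸ 1)) ∷ Dij N (i + (N ∸ 1)) (i + (N ∸ 1)) ∷ []
lastArcs N i lp3 = D0 N i ∷ D0 N (i + (N ∸ 1)) ∷ []
lastArcs N i lp4 = Dij N i i ∷ Dij N (i + (N ∸ 1)) (i + (N ∸ 1)) ∷ []

sliceArcs : ℕ → ℕ → List Bool → LastPair → List Arc
sliceArcs N a bs l = sliceChain N a (a + 2) bs ++ lastArcs N (chainEnd N a bs) l

IsSlice : ℕ → List Arc → Set
IsSlice N S = Σ ℕ λ a → a < N × Σ (List Bool) λ bs → length bs ≡ N ∸ 3 × Σ LastPair λ l →
  ∀ D → (D ∈ S → D ∈ sliceArcs N a bs l) × (D ∈ sliceArcs N a bs l → D ∈ S)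

chordArc : ℕ → ℕ → ℕ → Maybe Arc
chordArc N x y = if (y ∸ x) ≡ᵇ 1 then nothing else just (nc (md N x) (y ∸ x))

-- sides of a lifted triangle in cyclic order
sides : ℕ → LTri → Maybe Arc × Maybe Arc × Maybe Arc
sides N (tri x y z) = chordArc N x y , chordArc N y z , chordArc N x z
sides N (trip x y)  = chordArc N x y , just (ct (md N y)) , just (ct (md N x))

isA : Arc → Maybe Arc → Bool
isA a nothing  = false
isA a (just b) = arcEq a b

bPair : Arc → Arc → Maybe Arc → Maybe Arc → ℤ
bPair α β s s' = (if isA α s ∧ isA β s' then pos 1 else pos 0) +ℤ (if isA α s' ∧ isA β s then -[1+ 0 ] else pos 0)

bTri : ℕ → LTri → Arc → Arc → ℤ
bTri N Δ α β with sides N Δ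
... | s₁ , s₂ , s₃ = bPair α β s₁ s₂ +ℤ (bPair α β s₂ s₃ +ℤ bPair α β s₃ s₁)

selfFolded : ℕ → LTri → Bool
selfFolded N (tri _ _ _) = false
selfFolded N (trip x y)  = (y ∸ x) ≡ᵇ N

-- π_T : a radius of a self-folded triangle is replaced by its loop
piT : ℕ → List Arc → Arc → Arc
piT N T (ct k)   = if memA (nc k N) T then nc k N else ct k
piT N T (nc i L) = nc i L

sumℤ : List ℤ → ℤ
sumℤ = foldl _+ℤ_ (pos 0)

Bplain : ℕ → List Arc → Arc → Arc → ℤ
Bplain N T α β =
  sumℤ (map (λ Δ → bTri N Δ (piT N T α) (piT N T β))
            (filterᵇ (λ Δ → not (selfFolded N Δ)) (triangles N T)))

-- the ideal-triangulation label of a tagged arc of T̃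
labelT : ℕ → List TArc → TArc → Arc
labelT N Tt t = if 2 ≤ᵇ numNotched N Tt then untag t else toPlain N t

Btag : ℕ → List TArc → TArc → TArc → ℤ
Btag N Tt s t = Bplain N (map (labelT N Tt) Tt) (labelT N Tt s) (labelT N Tt t)

-- Seeds, mutation, evaluated in the semifield of positive fractions
-- (a, b) ↦ a / b (subtraction-free, so the specialisation x ↦ 1 of every
-- cluster variable is computed exactly).

Frac : Set
Frac = ℕ × ℕ

oneF : Frac
oneF = 1 , 1

mulF : Frac → Frac → Frac
mulF (a , b) (c , d) = a * c , b * d

addF : Frac → Frac → Frac
addF (a , b) (c , d) = a * d + c * b , b * d

divF : Frac → Frac → Frac
divF (a , b) (c , d) = a * d , b * c

powF : Frac → ℕ → Frac
powF f zero    = oneF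
powF f (suc n) = mulF f (powF f n)

prodF : List Frac → Frac
prodF = foldl mulF oneF

posPart : ℤ → ℕ
posPart (pos n)    = n
posPart -[1+ n ] = 0

record Seed : Set where
  constructor seed
  field
    arcs : List TArc
    mat  : TArc → TArc → ℤ
    val  : TArc → Frac
open Seed public

initSeed : ℕ → List TArc → Seed
initSeed N Tt = seed Tt (Btag N Tt) (λ _ → oneF)

exch : ℕ → Seed → TArc → Frac
exch N S γ = divF (addF (prodF pls) (prodF mns)) (val S γ)
  where
    cur = filterᵇ (λ δ → memT δ (arcs S)) (allTArcs N)
    pls = map (λ δ → powF (val S δ) (posPart (mat S δ γ))) cur
    mns = map (λ δ → powF (val S δ) (posPart (-ℤ (mat S δ γ)))) cur

corr : ℤ → ℤ → ℤ
corr (pos (suc m)) (pos (suc n)) = pos (suc m * suc n)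
corr -[1+ m ] -[1+ n ]   = -ℤ (pos (suc m * suc n))
corr _ _ = pos 0

-- matrix mutation at γ, with the new arc γ' taking over the index of γ
mutMat : TArc → TArc → (TArc → TArc → ℤ) → TArc → TArc → ℤ
mutMat γ γ' B a b =
  if tEq a' γ ∨ tEq b' γ then -ℤ (B a' b') else B a' b' +ℤ corr (B a' γ) (B γ b')
  where
    a' = if tEq a γ' then γ else a
    b' = if tEq b γ' then γ else b

removeT : TArc → List TArc → List TArc
removeT γ = filterᵇ (λ t → not (tEq t γ))

step : ℕ → Seed → TArc × TArc → Seed
step N S (γ , γ') =
  seed (γ' ∷ removeT γ (arcs S)) (mutMat γ γ' (mat S)) (λ a → if tEq a γ' then exch N S γ else val S a)

runFlips : ℕ → Seed → List (TArc × TArc) → Seed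
runFlips N = foldl (step N)

ValidFlips : ℕ → List TArc → List (TArc × TArc) → Set
ValidFlips N Tt [] = ⊤
ValidFlips N Tt ((γ , γ') ∷ fs) =
  γ ∈ Tt × ¬ (γ' ∈ Tt) × IsTaggedTriangulation N (γ' ∷ removeT γ Tt)
  × ValidFlips N (γ' ∷ removeT γ Tt) fs

Reaches : ℕ → List TArc → List (TArc × TArc) → Arc → Set
Reaches N Tt fs D = ValidFlips N Tt fs × ofPlain N D ∈ arcs (runFlips N (initSeed N Tt) fs)

clusterValue : ℕ → List TArc → List (TArc × TArc) → Arc → Frac
clusterValue N Tt fs D = val (runFlips N (initSeed N Tt) fs) (ofPlain N D)

{-# OPTIONS --safe #-}
module Submission where

-- Attach to every position y of the universal cover a vector W y ∈ ℤ², with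
-- det (W y) (W (y + 1)) = 1 and W (y + N) = W y sheared along the puncture (0, 1).
-- Then det (W y) (W (y + L)) for the arcs and c s · proj₁ (W y) for the central arcs
-- tagged s satisfy the Ptolemy relations, which are the exchange relations of flips;
-- so if the initial arcs all have value 1, these numbers are the specialised
-- cluster variables. For a slice such a W exists: fix W at the two ends of
-- the longest chord of the slice and put W y = W x + W z whenever the slice cuts off the
-- ear (x, y, z). Matching numbers obey the same ear recursion: adding an ear, its tip
-- can only be matched to the new triangle, while leaving the tip out frees that triangle
-- for x or z. So W computes both sides.

open import Defs
open import Data.Nat using (ℕ; zero; suc; _+_; _*_; _∸_; _≤_; _<_; z≤n; s≤s; _≡ᵇ_; _<ᵇ_; _≤ᵇ_; >-nonZero)
open import Data.Nat.Properties
open import Data.Nat.DivMod as DivMod using (_/_; m%n<n; m<n⇒m%n≡m; [m+kn]%n≡m%n; m≡m%n+[m/n]*n)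
open import Data.Nat.ListAction using (sum)
open import Data.Nat.Tactic.RingSolver using () renaming (solve-∀ to solve-∀ℕ)
open import Data.Bool as Bool using (Bool; true; false; if_then_else_; _∧_; _∨_; not)
open import Data.Bool.ListAction using (any; all)
open import Data.Bool.Properties using (∨-zeroʳ)
open import Data.Integer using (ℤ; 0ℤ; 1ℤ; -1ℤ; -[1+_]) renaming (+_ to pos; _+_ to _+Z_; _*_ to _*Z_; _-_ to _-Z_; -_ to -Z_)
import Data.Integer.Properties as ℤₚ
open import Data.Integer.Tactic.RingSolver using (solve-∀)
open import Data.Empty using (⊥; ⊥-elim)
open import Data.List using (List; []; _∷_; _++_; length; replicate; map; foldl; concatMap; filterᵇ; upTo; applyUpTo)
open import Data.List.Properties using (map-∘; map-upTo; map-cong)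
open import Data.List.Membership.Propositional using (_∈_; _∉_)
open import Data.List.Membership.Propositional.Properties using (∈-map⁺; ∈-map⁻; ∈-upTo⁺; ∈-upTo⁻; ∈-++⁺ˡ; ∈-++⁺ʳ; ∈-++⁻; ∈-filter⁺; ∈-filter⁻; ∈-∃++)
open import Data.List.Relation.Unary.Any using (here; there)
open import Data.List.Relation.Unary.All as All using (All; []; _∷_)
open import Data.List.Relation.Unary.Unique.Propositional using (Unique; []; _∷_)
import Data.List.Relation.Unary.Unique.Propositional.Properties as Uniqueₚ
open import Data.List.Relation.Binary.Permutation.Propositional as Perm using (_↭_; ↭-refl; ↭-sym; ↭-trans; ↭-reflexive; prep; swap)
open import Data.List.Relation.Binary.Permutation.Propositional.Properties as Permₚ using (∈-resp-↭; All-resp-↭; shift; drop-∷; ↭-length; ++⁺ˡ; ++⁺ʳ)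
open import Data.Maybe using (just; nothing)
open import Data.Product using (Σ; _×_; _,_; ∃; ∃-syntax) renaming (proj₁ to fst; proj₂ to snd)
open import Data.Product using (proj₁; proj₂)
open import Data.Sum using (_⊎_) renaming (inj₁ to inl; inj₂ to inr)
open import Data.Unit using (⊤; tt)
open import Function using (_∘_)
open import Relation.Binary.Definitions using (tri<; tri≈; tri>)
open import Relation.Binary.PropositionalEquality
open import Relation.Nullary using (¬_; yes; no)
open import Relation.Nullary.Decidable using (T?)

-- The theorem speaks of every admissible sequence of exchanges, so values alone do not suffice: the
-- exchange matrix has to be followed too. A tagged triangulation is therefore kept as triangles
-- glued along half-edges, its matrix is the signed adjacency form of these triangles, and every
-- exchange is identified as one of six local flips. The vectors are lambda lengths in disguise: `W`
-- develops the decorated boundary points into the plane, the monodromy of the puncture is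
-- parabolic, and (0, 1) is its fixed vector. Changing a tag passes to the conjugate horocycle at
-- the puncture, which rescales all central values by one constant; the product of the two constants
-- `c` is forced to be the parameter of the monodromy. The matching numbers need two inductions.

pattern 0th = here refl
pattern 1st = there 0th
pattern 2nd = there 1st
pattern 3rd = there 2nd
pattern 4th = there 3rd

<-absurd : {A : Set} {n : ℕ} -> n < n -> A
<-absurd h = ⊥-elim (<-irrefl refl h)

m+n<m+[n+o] : ∀ m n {o} -> 0 < o -> m + n < m + (n + o)
m+n<m+[n+o] m n h = +-monoʳ-< m (m<m+n n h)

m+n+o≡m+o+n : ∀ m n o -> m + n + o ≡ m + o + n
m+n+o≡m+o+n m n o = trans (+-assoc m n o) (trans (cong (m +_) (+-comm n o)) (sym (+-assoc m o n)))

-- Linear arithmetic over the natural numbers by reflection.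

module Lia where
 open import Data.Nat as ℕ using (ℕ; zero; suc)
 import Data.Nat.Properties as ℕₚ
 open import Data.Integer as ℤ using (ℤ; -[1+_]; 0ℤ; 1ℤ) renaming (+_ to pos)
 open import Data.Bool using (Bool; true; false; _∧_; _∨_; T)
 open import Data.Fin using (Fin)
 open import Data.List using (List; []; _∷_; _++_; map; concatMap)
 import Data.List.Relation.Unary.All.Properties as Allₚ
 open import Data.Vec using (Vec; []; _∷_; lookup; allFin)
 import Data.Vec as Vec
 open import Data.Vec.N-ary using (N-ary; _$ⁿ_; ∀ⁿ; curryⁿ; curryⁿ-cong)
 -- Fourier-Motzkin refutation of systems of linear inequalities Σ cᵢ xᵢ + c ≥ 0.

 Lin : ℕ -> Set
 Lin n = Vec ℤ n × ℤ

 evalV : ∀ {n} -> Vec ℤ n -> Vec ℤ n -> ℤ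
 evalV [] [] = 0ℤ
 evalV (c ∷ cs) (x ∷ xs) = c *Z x +Z evalV cs xs

 eval : ∀ {n} -> Vec ℤ n -> Lin n -> ℤ
 eval ρ (cs , c) = evalV cs ρ +Z c

 Pos : ∀ {n} -> Vec ℤ n -> Lin n -> Set
 Pos ρ l = 0ℤ ℤ.≤ eval ρ l

 infixl 6 _⊞_
 infixl 7 _⊠_

 _⊞_ : ∀ {n} -> Lin n -> Lin n -> Lin n
 (u , c) ⊞ (v , d) = Vec.zipWith _+Z_ u v , c +Z d

 _⊠_ : ∀ {n} -> ℤ -> Lin n -> Lin n
 k ⊠ (u , c) = Vec.map (k *Z_) u , k *Z c

 evalV-+ : ∀ {n} (u v ρ : Vec ℤ n) -> evalV (Vec.zipWith _+Z_ u v) ρ ≡ evalV u ρ +Z evalV v ρ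
 evalV-+ [] [] [] = refl
 evalV-+ (a ∷ u) (b ∷ v) (x ∷ ρ) rewrite evalV-+ u v ρ = lemma a b x (evalV u ρ) (evalV v ρ) where
  lemma : ∀ a b x p q -> (a +Z b) *Z x +Z (p +Z q) ≡ a *Z x +Z p +Z (b *Z x +Z q)
  lemma = solve-∀

 evalV-* : ∀ {n} k (u ρ : Vec ℤ n) -> evalV (Vec.map (k *Z_) u) ρ ≡ k *Z evalV u ρ
 evalV-* k [] [] = sym (ℤₚ.*-zeroʳ k)
 evalV-* k (a ∷ u) (x ∷ ρ) rewrite evalV-* k u ρ = lemma k a x (evalV u ρ) where
  lemma : ∀ k a x p -> k *Z a *Z x +Z k *Z p ≡ k *Z (a *Z x +Z p)
  lemma = solve-∀

 eval-⊞ : ∀ {n} (l m : Lin n) ρ -> eval ρ (l ⊞ m) ≡ eval ρ l +Z eval ρ m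
 eval-⊞ (u , c) (v , d) ρ rewrite evalV-+ u v ρ = lemma (evalV u ρ) (evalV v ρ) c d where
  lemma : ∀ p q c d -> p +Z q +Z (c +Z d) ≡ p +Z c +Z (q +Z d)
  lemma = solve-∀

 eval-⊠ : ∀ {n} k (l : Lin n) ρ -> eval ρ (k ⊠ l) ≡ k *Z eval ρ l
 eval-⊠ k (u , c) ρ rewrite evalV-* k u ρ = sym (ℤₚ.*-distribˡ-+ k (evalV u ρ) c)

 record Split (n : ℕ) : Set where
  constructor split
  field
   zeros : List (Lin n)
   poss negs : List (ℕ × Lin n)  -- (k , l) stands for (k+1) x + l, resp. -(k+1) x + l
 open Split

 classify : ∀ {n} -> List (Lin (suc n)) -> Split n
 classify [] = split [] [] []
 classify ((pos zero ∷ u , c) ∷ cs) = let r = classify cs in split ((u , c) ∷ zeros r) (poss r) (negs r)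
 classify ((pos (suc k) ∷ u , c) ∷ cs) = let r = classify cs in split (zeros r) ((k , u , c) ∷ poss r) (negs r)
 classify ((-[1+ k ] ∷ u , c) ∷ cs) = let r = classify cs in split (zeros r) (poss r) ((k , u , c) ∷ negs r)

 PosP PosN : ∀ {n} -> ℤ -> Vec ℤ n -> ℕ × Lin n -> Set
 PosP x ρ (k , l) = 0ℤ ℤ.≤ pos (suc k) *Z x +Z eval ρ l
 PosN x ρ (k , l) = 0ℤ ℤ.≤ -[1+ k ] *Z x +Z eval ρ l

 classify-sound : ∀ {n} x (ρ : Vec ℤ n) cs -> All (Pos (x ∷ ρ)) cs -> All (Pos ρ) (zeros (classify cs)) × All (PosP x ρ) (poss (classify cs)) × All (PosN x ρ) (negs (classify cs))
 classify-sound x ρ [] [] = [] , [] , []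
 classify-sound x ρ ((pos zero ∷ u , c) ∷ cs) (p ∷ ps) with classify-sound x ρ cs ps
 ... | a , b , d = subst (0ℤ ℤ.≤_) (cong (_+Z c) (ℤₚ.+-identityˡ (evalV u ρ))) p ∷ a , b , d
 classify-sound x ρ ((pos (suc k) ∷ u , c) ∷ cs) (p ∷ ps) with classify-sound x ρ cs ps
 ... | a , b , d = a , subst (0ℤ ℤ.≤_) (ℤₚ.+-assoc (pos (suc k) *Z x) (evalV u ρ) c) p ∷ b , d
 classify-sound x ρ ((-[1+ k ] ∷ u , c) ∷ cs) (p ∷ ps) with classify-sound x ρ cs ps
 ... | a , b , d = a , b , subst (0ℤ ℤ.≤_) (ℤₚ.+-assoc (-[1+ k ] *Z x) (evalV u ρ) c) p ∷ d

 -- Cross-multiplication by the two leading coefficients, both made positive, cancels the eliminated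
 -- variable.
 resolve : ∀ {n} -> ℕ × Lin n -> ℕ × Lin n -> Lin n
 resolve (k , l) (j , m) = pos (suc j) ⊠ l ⊞ pos (suc k) ⊠ m

 resolve-sound : ∀ {n} x (ρ : Vec ℤ n) p q -> PosP x ρ p -> PosN x ρ q -> Pos ρ (resolve p q)
 resolve-sound x ρ (k , l) (j , m) p q rewrite eval-⊞ (pos (suc j) ⊠ l) (pos (suc k) ⊠ m) ρ | eval-⊠ (pos (suc j)) l ρ | eval-⊠ (pos (suc k)) m ρ = subst (0ℤ ℤ.≤_) (lemma (pos (suc j)) (pos (suc k)) x (eval ρ l) (eval ρ m)) (ℤₚ.+-mono-≤ (scale j p) (scale k q)) where
  scale : ∀ i {z} -> 0ℤ ℤ.≤ z -> 0ℤ ℤ.≤ pos (suc i) *Z z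
  scale i {z} h = subst (ℤ._≤ pos (suc i) *Z z) (ℤₚ.*-zeroʳ (pos (suc i))) (ℤₚ.*-monoˡ-≤-nonNeg (pos (suc i)) h)
  lemma : ∀ j k x l m -> j *Z (k *Z x +Z l) +Z k *Z ((-Z j) *Z x +Z m) ≡ j *Z l +Z k *Z m
  lemma = solve-∀

 eliminate : ∀ {n} -> List (Lin (suc n)) -> List (Lin n)
 eliminate cs = concatMap (\ p -> map (resolve p) (negs (classify cs))) (poss (classify cs)) ++ zeros (classify cs)

 eliminate-sound : ∀ {n} x (ρ : Vec ℤ n) cs -> All (Pos (x ∷ ρ)) cs -> All (Pos ρ) (eliminate cs)
 eliminate-sound x ρ cs h with classify-sound x ρ cs h
 ... | hz , hp , hn = Allₚ.++⁺ (go hp) hz where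
  row : ∀ {p qs} -> PosP x ρ p -> All (PosN x ρ) qs -> All (Pos ρ) (map (resolve p) qs)
  row hp [] = []
  row {p} {q ∷ _} hp (h ∷ hs) = resolve-sound x ρ p q hp h ∷ row {p} hp hs
  go : ∀ {ps} -> All (PosP x ρ) ps -> All (Pos ρ) (concatMap (\ p -> map (resolve p) (negs (classify cs))) ps)
  go [] = []
  go {p ∷ ps} (h ∷ hs) = Allₚ.++⁺ (row {p} h hn) (go hs)

 negative : ℤ -> Bool
 negative (pos _) = false
 negative -[1+ _ ] = true

 anyNegative : List (Lin 0) -> Bool
 anyNegative [] = false
 anyNegative ((_ , c) ∷ cs) = negative c ∨ anyNegative cs

 -- The refutation works over the rationals; integrality enters only through `lt`, which sharpens a
 -- < b to 1 + a ≤ b.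
 unsat : ∀ n -> List (Lin n) -> Bool
 unsat zero cs = anyNegative cs
 unsat (suc n) cs = unsat n (eliminate cs)

 unsat-sound : ∀ n (cs : List (Lin n)) ρ -> unsat n cs ≡ true -> All (Pos ρ) cs -> ⊥
 unsat-sound zero (([] , pos _) ∷ cs) [] e (p ∷ ps) = unsat-sound zero cs [] e ps
 unsat-sound zero (([] , -[1+ _ ]) ∷ cs) [] e (() ∷ ps)
 unsat-sound (suc n) cs (x ∷ ρ) e h = unsat-sound n (eliminate cs) ρ e (eliminate-sound x ρ cs h)

 infixl 7 _:*_
 infixl 6 _:+_
 infix 4 _:≤_ _:<_ _:≡_
 infix 2 _⊢_

 data Expr (n : ℕ) : Set where
  var : Fin n -> Expr n
  #_ : ℕ -> Expr n
  _:+_ : Expr n -> Expr n -> Expr n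
  _:*_ : ℕ -> Expr n -> Expr n

 data Atom (n : ℕ) : Set where
  _:≤_ _:<_ _:≡_ : Expr n -> Expr n -> Atom n
  :⊥ : Atom n

 record Problem (n : ℕ) : Set where
  constructor _⊢_
  field
   hyps : List (Atom n)
   goal : Atom n
 open Problem

 ⟦_⟧ : ∀ {n} -> Expr n -> Vec ℕ n -> ℕ
 ⟦ var i ⟧ ρ = lookup ρ i
 ⟦ # k ⟧ ρ = k
 ⟦ a :+ b ⟧ ρ = ⟦ a ⟧ ρ ℕ.+ ⟦ b ⟧ ρ
 ⟦ k :* a ⟧ ρ = k ℕ.* ⟦ a ⟧ ρ

 ⟦_⟧ᵃ : ∀ {n} -> Atom n -> Vec ℕ n -> Set
 ⟦ a :≤ b ⟧ᵃ ρ = ⟦ a ⟧ ρ ℕ.≤ ⟦ b ⟧ ρ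
 ⟦ a :< b ⟧ᵃ ρ = ⟦ a ⟧ ρ ℕ.< ⟦ b ⟧ ρ
 ⟦ a :≡ b ⟧ᵃ ρ = ⟦ a ⟧ ρ ≡ ⟦ b ⟧ ρ
 ⟦ :⊥ ⟧ᵃ ρ = ⊥

 Holds : ∀ {n} -> List (Atom n) -> Atom n -> Vec ℕ n -> Set
 Holds [] g ρ = ⟦ g ⟧ᵃ ρ
 Holds (h ∷ hs) g ρ = ⟦ h ⟧ᵃ ρ -> Holds hs g ρ

 unit : ∀ {n} -> Fin n -> Vec ℤ n
 unit Fin.zero = 1ℤ ∷ Vec.replicate _ 0ℤ
 unit (Fin.suc i) = 0ℤ ∷ unit i

 lin : ∀ {n} -> Expr n -> Lin n
 lin (var i) = unit i , 0ℤ
 lin (# k) = Vec.replicate _ 0ℤ , pos k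
 lin (a :+ b) = lin a ⊞ lin b
 lin (k :* a) = pos k ⊠ lin a

 evalV-0 : ∀ {n} (ρ : Vec ℤ n) -> evalV (Vec.replicate n 0ℤ) ρ ≡ 0ℤ
 evalV-0 [] = refl
 evalV-0 (x ∷ ρ) = trans (ℤₚ.+-identityˡ _) (evalV-0 ρ)

 evalV-unit : ∀ {n} (i : Fin n) (ρ : Vec ℕ n) -> evalV (unit i) (Vec.map pos ρ) ≡ pos (lookup ρ i)
 evalV-unit Fin.zero (x ∷ ρ) rewrite evalV-0 (Vec.map pos ρ) = trans (ℤₚ.+-identityʳ _) (ℤₚ.*-identityˡ (pos x))
 evalV-unit (Fin.suc i) (x ∷ ρ) = trans (ℤₚ.+-identityˡ _) (evalV-unit i ρ)

 lin-sound : ∀ {n} (e : Expr n) ρ -> eval (Vec.map pos ρ) (lin e) ≡ pos (⟦ e ⟧ ρ)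
 lin-sound (var i) ρ rewrite evalV-unit i ρ = ℤₚ.+-identityʳ _
 lin-sound (# k) ρ rewrite evalV-0 (Vec.map pos ρ) = refl
 lin-sound (a :+ b) ρ rewrite eval-⊞ (lin a) (lin b) (Vec.map pos ρ) | lin-sound a ρ | lin-sound b ρ = refl
 lin-sound (k :* a) ρ rewrite eval-⊠ (pos k) (lin a) (Vec.map pos ρ) | lin-sound a ρ = sym (ℤₚ.pos-* k (⟦ a ⟧ ρ))

 le lt : ∀ {n} -> Expr n -> Expr n -> Lin n
 le a b = lin b ⊞ ℤ.-1ℤ ⊠ lin a
 lt a b = le (# 1 :+ a) b

 le-sound : ∀ {n} (a b : Expr n) ρ -> ⟦ a ⟧ ρ ℕ.≤ ⟦ b ⟧ ρ -> Pos (Vec.map pos ρ) (le a b)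
 le-sound a b ρ h rewrite eval-⊞ (lin b) (ℤ.-1ℤ ⊠ lin a) (Vec.map pos ρ) | eval-⊠ ℤ.-1ℤ (lin a) (Vec.map pos ρ) | lin-sound a ρ | lin-sound b ρ | ℤₚ.-1*i≡-i (pos (⟦ a ⟧ ρ)) = ℤₚ.i≤j⇒0≤j-i (ℤ.+≤+ h)

 constraints : ∀ {n} -> Atom n -> List (Lin n)
 constraints (a :≤ b) = le a b ∷ []
 constraints (a :< b) = lt a b ∷ []
 constraints (a :≡ b) = le a b ∷ le b a ∷ []
 constraints :⊥ = (Vec.replicate _ 0ℤ , -[1+ 0 ]) ∷ []

 constraints-sound : ∀ {n} (a : Atom n) ρ -> ⟦ a ⟧ᵃ ρ -> All (Pos (Vec.map pos ρ)) (constraints a)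
 constraints-sound (a :≤ b) ρ h = le-sound a b ρ h ∷ []
 constraints-sound (a :< b) ρ h = le-sound (# 1 :+ a) b ρ h ∷ []
 constraints-sound (a :≡ b) ρ h = le-sound a b ρ (ℕₚ.≤-reflexive h) ∷ le-sound b a ρ (ℕₚ.≤-reflexive (sym h)) ∷ []

 -- The variables stand for natural numbers, so each one contributes an inequality of its own.
 nonNegs : ∀ n -> List (Lin n)
 nonNegs n = map (\ i -> unit i , 0ℤ) (Vec.toList (allFin n))

 nonNegs-sound : ∀ {n} (ρ : Vec ℕ n) -> All (Pos (Vec.map pos ρ)) (nonNegs n)
 nonNegs-sound {n} ρ = go (Vec.toList (allFin n)) where
  go : ∀ is -> All (Pos (Vec.map pos ρ)) (map (\ i -> unit i , 0ℤ) is)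
  go [] = []
  go (i ∷ is) = subst (0ℤ ℤ.≤_) (sym (lin-sound (var i) ρ)) (ℤ.+≤+ ℕ.z≤n) ∷ go is

 entails : ∀ {n} -> List (Lin n) -> Atom n -> Bool
 entails {n} cs (a :≤ b) = unsat n (lt b a ∷ cs)
 entails {n} cs (a :< b) = unsat n (le b a ∷ cs)
 entails {n} cs (a :≡ b) = unsat n (lt b a ∷ cs) ∧ unsat n (lt a b ∷ cs)
 entails {n} cs :⊥ = unsat n cs

 ∧-split : ∀ {a b} -> a ∧ b ≡ true -> a ≡ true × b ≡ true
 ∧-split {true} {true} refl = refl , refl

 entails-sound : ∀ {n} cs (g : Atom n) ρ -> entails cs g ≡ true -> All (Pos (Vec.map pos ρ)) cs -> ⟦ g ⟧ᵃ ρ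
 entails-sound {n} cs (a :≤ b) ρ e h = ℕₚ.≮⇒≥ \ b<a -> unsat-sound n _ _ e (le-sound (# 1 :+ b) a ρ b<a ∷ h)
 entails-sound {n} cs (a :< b) ρ e h = ℕₚ.≰⇒> \ b≤a -> unsat-sound n _ _ e (le-sound b a ρ b≤a ∷ h)
 entails-sound {n} cs (a :≡ b) ρ e h with ∧-split e
 ... | e₁ , e₂ = ℕₚ.≤-antisym (ℕₚ.≮⇒≥ \ b<a -> unsat-sound n _ _ e₁ (le-sound (# 1 :+ b) a ρ b<a ∷ h)) (ℕₚ.≮⇒≥ \ a<b -> unsat-sound n _ _ e₂ (le-sound (# 1 :+ a) b ρ a<b ∷ h))
 entails-sound {n} cs :⊥ ρ e h = unsat-sound n cs _ e h

 decide : ∀ {n} -> Problem n -> Bool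
 decide {n} (hs ⊢ g) = entails (concatMap constraints hs ++ nonNegs n) g

 holds : ∀ {n} hs (g : Atom n) ρ cs -> (All (Pos (Vec.map pos ρ)) (concatMap constraints hs ++ cs) -> ⟦ g ⟧ᵃ ρ) -> All (Pos (Vec.map pos ρ)) cs -> Holds hs g ρ
 holds [] g ρ cs k c = k c
 holds (h ∷ hs) g ρ cs k c = \ p -> holds hs g ρ cs (\ q -> k (subst (All _) (sym (assoc (constraints h) _ cs)) (Allₚ.++⁺ (constraints-sound h ρ p) q))) c where
  assoc : ∀ {A : Set} (xs ys zs : List A) -> (xs ++ ys) ++ zs ≡ xs ++ (ys ++ zs)
  assoc [] ys zs = refl
  assoc (x ∷ xs) ys zs = cong (x ∷_) (assoc xs ys zs)

 -- A problem is given as a function of its variables, so that every use of `lia` displays its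
 -- hypotheses and its goal as an ordinary lambda term.
 close : ∀ n -> N-ary n (Expr n) (Problem n) -> Problem n
 close n f = f $ⁿ Vec.map var (allFin n)

 all⁺ : ∀ n {P : Vec ℕ n -> Set} -> (∀ ρ -> P ρ) -> ∀ⁿ n (curryⁿ {n = n} P)
 all⁺ zero h = h []
 all⁺ (suc n) h = \ x -> all⁺ n \ ρ -> h (x ∷ ρ)

 holds! : ∀ {b} -> T b -> b ≡ true
 holds! {true} _ = refl

 abstract
  lia : ∀ n (f : N-ary n (Expr n) (Problem n)) {_ : T (decide (close n f))} -> ∀ⁿ n (curryⁿ {n = n} \ ρ -> Holds (hyps (close n f)) (goal (close n f)) ρ)
  lia n f {e} = all⁺ n \ ρ -> holds (hyps (close n f)) (goal (close n f)) ρ (nonNegs n) (entails-sound _ (goal (close n f)) ρ (holds! e)) (nonNegs-sound ρ)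

open Lia using (lia; _⊢_; _:≤_; _:<_; _:≡_; _:+_; _:*_; #_; :⊥)

-- Duplicate-free lists up to permutation.

∈-extract : {A : Set} {x : A} {ys : List A} -> x ∈ ys -> ∃[ zs ] ys ↭ x ∷ zs
∈-extract {x = x} p with ∈-∃++ p
... | as , bs , refl = as ++ bs , shift x as bs

Unique-resp-↭ : {A : Set} {xs ys : List A} -> xs ↭ ys -> Unique xs -> Unique ys
Unique-resp-↭ Perm.refl u = u
Unique-resp-↭ (prep x p) (a ∷ u) = All-resp-↭ p a ∷ Unique-resp-↭ p u
Unique-resp-↭ (swap x y p) ((x≢y ∷ a) ∷ b ∷ u) = ((x≢y ∘ sym) ∷ All-resp-↭ p b) ∷ All-resp-↭ p a ∷ Unique-resp-↭ p u
Unique-resp-↭ (Perm.trans p q) u = Unique-resp-↭ q (Unique-resp-↭ p u)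

Unique-head : {A : Set} {x : A} {xs : List A} -> Unique (x ∷ xs) -> x ∉ xs
Unique-head (a ∷ _) p = All.lookup a p refl

Unique-tail : {A : Set} {x : A} {xs : List A} -> Unique (x ∷ xs) -> Unique xs
Unique-tail (_ ∷ u) = u

Unique-∷ : {A : Set} {x : A} {xs : List A} -> x ∉ xs -> Unique xs -> Unique (x ∷ xs)
Unique-∷ {x = x} x∉ u = All.tabulate (\ { p refl -> x∉ p }) ∷ u

Unique-↭ : {A : Set} {xs ys : List A} -> Unique xs -> Unique ys -> (∀ {v} -> v ∈ xs -> v ∈ ys) -> (∀ {v} -> v ∈ ys -> v ∈ xs) -> xs ↭ ys
Unique-↭ {xs = []} {[]} _ _ _ _ = ↭-refl
Unique-↭ {xs = []} {y ∷ ys} _ _ _ g with g 0th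
... | ()
Unique-↭ {xs = x ∷ xs} {ys} u v f g with ∈-extract (f 0th)
... | zs , p = ↭-trans (prep x (Unique-↭ (Unique-tail u) (Unique-tail v') f' g')) (↭-sym p) where
 v' = Unique-resp-↭ p v
 f' : ∀ {w} -> w ∈ xs -> w ∈ zs
 f' w∈ with ∈-resp-↭ p (f (there w∈))
 ... | 0th = ⊥-elim (Unique-head u w∈)
 ... | there q = q
 g' : ∀ {w} -> w ∈ zs -> w ∈ xs
 g' w∈ with g (∈-resp-↭ (↭-sym p) (there w∈))
 ... | 0th = ⊥-elim (Unique-head v' w∈)
 ... | there q = q

-- Counting matchings by expansion along a point or along a region.

sumPicks : {R : Set} -> (R -> List R -> ℕ) -> List R -> ℕ
sumPicks g [] = 0
sumPicks g (r ∷ rs) = g r rs + sumPicks (\ q qs -> g q (r ∷ qs)) rs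

-- Replaces the sum over `picks` by a recursion that hands the skipped entries to `g`; all
-- inductions below run on this form.
sumPicks-picks : {R : Set} (g : R -> List R -> ℕ) (rs : List R) -> sum (map (\ q -> g (fst q) (snd q)) (picks rs)) ≡ sumPicks g rs
sumPicks-picks g [] = refl
sumPicks-picks g (r ∷ rs) = cong (g r rs +_) (trans (cong sum (sym (map-∘ (picks rs)))) (sumPicks-picks (\ q qs -> g q (r ∷ qs)) rs))

sumPicks-cong : {R : Set} {g h : R -> List R -> ℕ} (rs : List R) -> (∀ {r qs} -> r ∈ rs -> g r qs ≡ h r qs) -> sumPicks g rs ≡ sumPicks h rs
sumPicks-cong [] e = refl
sumPicks-cong (r ∷ rs) e = cong₂ _+_ (e 0th) (sumPicks-cong rs (\ p -> e (there p)))

sumPicks-zero : {R : Set} {g : R -> List R -> ℕ} (rs : List R) -> (∀ {r qs} -> r ∈ rs -> g r qs ≡ 0) -> sumPicks g rs ≡ 0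
sumPicks-zero [] e = refl
sumPicks-zero (r ∷ rs) e = cong₂ _+_ (e 0th) (sumPicks-zero rs (\ p -> e (there p)))

sumPicks-+ : {R : Set} (g h : R -> List R -> ℕ) (rs : List R) -> sumPicks (\ r qs -> g r qs + h r qs) rs ≡ sumPicks g rs + sumPicks h rs
sumPicks-+ g h [] = refl
sumPicks-+ g h (r ∷ rs) rewrite sumPicks-+ (\ q qs -> g q (r ∷ qs)) (\ q qs -> h q (r ∷ qs)) rs = lemma (g r rs) (h r rs) (sumPicks (\ q qs -> g q (r ∷ qs)) rs) (sumPicks (\ q qs -> h q (r ∷ qs)) rs) where
 lemma : ∀ a b c d -> a + b + (c + d) ≡ a + c + (b + d)
 lemma = solve-∀ℕ

sumPicks-comm : {P R : Set} (g : P -> List P -> R -> List R -> ℕ) (ps : List P) (rs : List R) -> sumPicks (\ r rs' -> sumPicks (\ p ps' -> g p ps' r rs') ps) rs ≡ sumPicks (\ p ps' -> sumPicks (\ r rs' -> g p ps' r rs') rs) ps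
sumPicks-comm g [] rs = sumPicks-zero rs (\ _ -> refl)
sumPicks-comm g (p ∷ ps) rs = trans (sumPicks-+ (\ r rs' -> g p ps r rs') (\ r rs' -> sumPicks (\ q qs -> g q (p ∷ qs) r rs') ps) rs) (cong (sumPicks (\ r rs' -> g p ps r rs') rs +_) (sumPicks-comm (\ q qs -> g q (p ∷ qs)) ps rs))

sumPicks-if : {R : Set} (b : Bool) (g : R -> List R -> ℕ) (rs : List R) -> (if b then sumPicks g rs else 0) ≡ sumPicks (\ r qs -> if b then g r qs else 0) rs
sumPicks-if true g rs = refl
sumPicks-if false g rs = sym (sumPicks-zero rs (\ _ -> refl))

Respects↭ : {R : Set} -> (R -> List R -> ℕ) -> Set
Respects↭ g = ∀ r {qs qs'} -> qs ↭ qs' -> g r qs ≡ g r qs'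

sumPicks-↭ : {R : Set} (g : R -> List R -> ℕ) -> Respects↭ g -> ∀ {rs rs'} -> rs ↭ rs' -> sumPicks g rs ≡ sumPicks g rs'
sumPicks-↭ g e Perm.refl = refl
sumPicks-↭ g e (prep x p) = cong₂ _+_ (e x p) (sumPicks-↭ (\ q qs -> g q (x ∷ qs)) (\ r q -> e r (prep x q)) p)
sumPicks-↭ g e (swap {xs} {ys} x y p) = trans (cong₂ _+_ (e x (prep y p)) (cong₂ _+_ (e y (prep x p)) (trans (sumPicks-cong xs (\ {r} _ -> e r (swap x y ↭-refl))) (sumPicks-↭ (\ q qs -> g q (y ∷ x ∷ qs)) (\ r q -> e r (prep y (prep x q))) p))))
 (trans (sym (+-assoc (g x (y ∷ ys)) (g y (x ∷ ys)) s)) (trans (cong (_+ s) (+-comm (g x (y ∷ ys)) (g y (x ∷ ys)))) (+-assoc (g y (x ∷ ys)) (g x (y ∷ ys)) s))) where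
 s = sumPicks (\ q qs -> g q (y ∷ x ∷ qs)) ys
sumPicks-↭ g e (Perm.trans p q) = trans (sumPicks-↭ g e p) (sumPicks-↭ g e q)

module Matchings {P R : Set} (inc : P -> R -> Bool) where

 M : List P -> List R -> ℕ
 M = countMatch inc

 byPoint : P -> List P -> List R -> ℕ
 byPoint p ps = sumPicks (\ r qs -> if inc p r then M ps qs else 0)

 M-∷ : ∀ p ps rs -> M (p ∷ ps) rs ≡ byPoint p ps rs
 M-∷ p ps rs = sumPicks-picks (\ r qs -> if inc p r then M ps qs else 0) rs

 M-↭ʳ : ∀ ps {rs rs'} -> rs ↭ rs' -> M ps rs ≡ M ps rs'
 M-↭ʳ [] p = refl
 M-↭ʳ (x ∷ ps) {rs} {rs'} p = trans (M-∷ x ps rs) (trans (sumPicks-↭ _ (\ r q -> cong (if inc x r then_else 0) (M-↭ʳ ps q)) p) (sym (M-∷ x ps rs')))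

 byRegion : R -> List R -> List P -> ℕ
 byRegion Δ rs = sumPicks (\ p ps -> if inc p Δ then M ps rs else 0)

 M-region : ∀ ps Δ rs -> M ps (Δ ∷ rs) ≡ M ps rs + byRegion Δ rs ps
 M-region [] Δ rs = refl
 M-region (p ∷ ps) Δ rs = trans (M-∷ p ps (Δ ∷ rs)) (trans (cong (used +_) (trans (sumPicks-cong rs (\ {r} {qs} _ -> split r qs)) (sumPicks-+ _ _ rs))) (trans (lemma used (byPoint p ps rs) _) (cong₂ _+_ (sym (M-∷ p ps rs)) (cong (used +_) exchange)))) where
  used = if inc p Δ then M ps rs else 0
  rest = \ r qs -> sumPicks (\ q qs' -> if inc p r then (if inc q Δ then M qs' qs else 0) else 0) ps
  split : ∀ r qs -> (if inc p r then M ps (Δ ∷ qs) else 0) ≡ (if inc p r then M ps qs else 0) + rest r qs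
  split r qs with inc p r
  ... | true = M-region ps Δ qs
  ... | false = sym (sumPicks-zero ps (\ _ -> refl))
  lemma : ∀ a b c -> a + (b + c) ≡ b + (a + c)
  lemma = solve-∀ℕ
  flipIf : ∀ (a b : Bool) (n : ℕ) -> (if a then (if b then n else 0) else 0) ≡ (if b then (if a then n else 0) else 0)
  flipIf true b n = refl
  flipIf false true n = refl
  flipIf false false n = refl
  -- Choosing a region for p and choosing a point for Δ commute; this turns the sum over the regions
  -- of p back into an expansion along Δ.
  exchange = trans (sumPicks-comm (\ q qs' r qs -> if inc p r then (if inc q Δ then M qs' qs else 0) else 0) ps rs) (sumPicks-cong ps \ {q} {qs'} _ -> trans (sumPicks-cong rs (\ {r} {qs} _ -> flipIf (inc p r) (inc q Δ) (M qs' qs)))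
   (trans (sym (sumPicks-if (inc q Δ) (\ r qs -> if inc p r then M qs' qs else 0) rs)) (cong (if inc q Δ then_else 0) (sym (M-∷ p qs' rs)))))

 -- The recursion on points hides the symmetry in the points. Expanding along a region instead makes
 -- it an induction on the regions.
 M-↭ˡ : ∀ {ps ps'} rs -> ps ↭ ps' -> M ps rs ≡ M ps' rs
 M-↭ˡ [] p = noRegion p where
  noRegion : ∀ {ps ps'} -> ps ↭ ps' -> M ps [] ≡ M ps' []
  noRegion Perm.refl = refl
  noRegion (prep x p) = refl
  noRegion (swap x y p) = refl
  noRegion (Perm.trans p q) = trans (noRegion p) (noRegion q)
 M-↭ˡ {ps} {ps'} (Δ ∷ rs) p = trans (M-region ps Δ rs) (trans (cong₂ _+_ (M-↭ˡ rs p) (sumPicks-↭ _ (\ r q -> cong (if inc r Δ then_else 0) (M-↭ˡ rs q)) p)) (sym (M-region ps' Δ rs)))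

 M-drop : ∀ ps Δ rs -> (∀ {p} -> p ∈ ps -> inc p Δ ≡ false) -> M ps (Δ ∷ rs) ≡ M ps rs
 M-drop ps Δ rs e = trans (M-region ps Δ rs) (trans (cong (M ps rs +_) (sumPicks-zero ps (\ {p} {qs} p∈ -> cong (if_then M qs rs else 0) (e p∈)))) (+-identityʳ _))

 M-forced : ∀ p ps Δ rs -> inc p Δ ≡ true -> (∀ {r} -> r ∈ rs -> inc p r ≡ false) -> M (p ∷ ps) (Δ ∷ rs) ≡ M ps rs
 M-forced p ps Δ rs t e = trans (M-∷ p ps (Δ ∷ rs)) (trans (cong₂ _+_ (cong (if_then M ps rs else 0) t) (sumPicks-zero rs (\ {r} {qs} r∈ -> cong (if_then M ps (Δ ∷ qs) else 0) (e r∈)))) (+-identityʳ _))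

 M-one : ∀ p ps Δ rs -> inc p Δ ≡ true -> (∀ {q} -> q ∈ ps -> inc q Δ ≡ false) -> M (p ∷ ps) (Δ ∷ rs) ≡ M (p ∷ ps) rs + M ps rs
 M-one p ps Δ rs t e = trans (M-region (p ∷ ps) Δ rs) (cong (M (p ∷ ps) rs +_) (trans (cong₂ _+_ (cong (if_then M ps rs else 0) t) (sumPicks-zero ps (\ {q} {qs} q∈ -> cong (if_then M (p ∷ qs) rs else 0) (e q∈)))) (+-identityʳ _)))

 M-two : ∀ p q ps Δ rs -> inc p Δ ≡ true -> inc q Δ ≡ true -> (∀ {q'} -> q' ∈ ps -> inc q' Δ ≡ false) -> M (p ∷ q ∷ ps) (Δ ∷ rs) ≡ M (p ∷ q ∷ ps) rs + (M (q ∷ ps) rs + M (p ∷ ps) rs)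
 M-two p q ps Δ rs t t' e = trans (M-region (p ∷ q ∷ ps) Δ rs) (cong (M (p ∷ q ∷ ps) rs +_) (cong₂ _+_ (cong (if_then M (q ∷ ps) rs else 0) t) (trans (cong₂ _+_ (cong (if_then M (p ∷ ps) rs else 0) t')
  (sumPicks-zero ps (\ {q'} {qs} q∈ -> cong (if_then M (p ∷ q ∷ qs) rs else 0) (e q∈)))) (+-identityʳ _))))

 M-pigeon : ∀ ps rs -> length rs < length ps -> M ps rs ≡ 0
 M-pigeon (p ∷ ps) rs (s≤s h) = trans (M-∷ p ps rs) (zeroSum (length ps) h) where
  ifZero : ∀ (b : Bool) {m} -> m ≡ 0 -> (if b then m else 0) ≡ 0
  ifZero true e = e
  ifZero false e = refl
  go : ∀ (g : R -> List R -> ℕ) (rs : List R) -> (∀ r qs -> suc (length qs) ≡ length rs -> g r qs ≡ 0) -> sumPicks g rs ≡ 0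
  go g [] e = refl
  go g (r ∷ rs) e = cong₂ _+_ (e r rs refl) (go (\ q qs -> g q (r ∷ qs)) rs (\ q qs l -> e q (r ∷ qs) (cong suc l)))
  zeroSum : ∀ n -> length rs ≤ length ps -> byPoint p ps rs ≡ 0
  zeroSum n h = go _ rs (\ r qs l -> ifZero (inc p r) (M-pigeon ps qs (subst (_≤ length ps) (sym l) h)))

-- Plane vectors and their determinants.

ℤ² : Set
ℤ² = ℤ × ℤ

infixl 6 _⊕_

_⊕_ : ℤ² -> ℤ² -> ℤ²
(a , b) ⊕ (c , d) = a +Z c , b +Z d

det : ℤ² -> ℤ² -> ℤ
det (a , b) (c , d) = a *Z d -Z b *Z c

det-⊕ˡ : ∀ u v w -> det (u ⊕ v) w ≡ det u w +Z det v w
det-⊕ˡ (a , b) (c , d) (e , f) = lemma a b c d e f where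
 lemma : ∀ a b c d e f -> (a +Z c) *Z f -Z (b +Z d) *Z e ≡ (a *Z f -Z b *Z e) +Z (c *Z f -Z d *Z e)
 lemma = solve-∀

det-⊕ʳ : ∀ u v w -> det w (u ⊕ v) ≡ det w u +Z det w v
det-⊕ʳ (a , b) (c , d) (e , f) = lemma a b c d e f where
 lemma : ∀ a b c d e f -> e *Z (b +Z d) -Z f *Z (a +Z c) ≡ (e *Z b -Z f *Z a) +Z (e *Z d -Z f *Z c)
 lemma = solve-∀

det-self : ∀ u -> det u u ≡ 0ℤ
det-self (a , b) = lemma a b where
 lemma : ∀ a b -> a *Z b -Z b *Z a ≡ 0ℤ
 lemma = solve-∀

false≢true : ∀ {b} -> b ≡ false -> b ≡ true -> ⊥
false≢true refl ()

¬true⇒false : ∀ {b} -> ¬ (b ≡ true) -> b ≡ false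
¬true⇒false {true} h = ⊥-elim (h refl)
¬true⇒false {false} h = refl

-- Matchings under the addition of an ear.

module _ {R : Set} (inc : ℕ -> R -> Bool) where
 open Matchings inc

 Strictly : List ℕ -> ℕ -> ℕ -> List ℕ -> Set
 Strictly vs n n' ps = Unique ps × (∀ {v} -> v ∈ ps -> v ∈ vs × n < v × v < n') × (∀ {v} -> v ∈ vs -> n < v -> v < n' -> v ∈ ps)

 -- The points to be matched are given by any enumeration, because extracting the tip of an ear or
 -- one of its neighbours reorders them.
 Between : (ℕ -> ℤ²) -> List ℕ -> List R -> Set
 Between w vs Ts = ∀ {n n'} -> n ∈ vs -> n' ∈ vs -> n < n' -> ∀ ps -> Strictly vs n n' ps -> pos (M ps Ts) ≡ det (w n) (w n')

 -- Δ is glued with tip y to the side joining the neighbours x and z. Incidence of z with Δ is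
 -- demanded only if a vertex lies beyond z: the last vertex may stand for the puncture, which is
 -- never strictly between two others and so never to be matched.
 record Ear (vs : List ℕ) (Ts : List R) (x y z : ℕ) (Δ : R) : Set where
  field
   x∈ : x ∈ vs
   z∈ : z ∈ vs
   x<y : x < y
   y<z : y < z
   gap : ∀ {v} -> v ∈ vs -> v ≤ x ⊎ z ≤ v
   y∉Ts : ∀ {r} -> r ∈ Ts -> inc y r ≡ false
   xΔ : inc x Δ ≡ true
   yΔ : inc y Δ ≡ true
   zΔ : ∀ {v} -> v ∈ vs -> z < v -> inc z Δ ≡ true
   onlyΔ : ∀ {v} -> v ∈ vs -> inc v Δ ≡ true -> v ≡ x ⊎ v ≡ z

 between-ear : ∀ {w vs Ts x y z Δ} -> Ear vs Ts x y z Δ -> w y ≡ w x ⊕ w z -> Between w vs Ts -> Between w (y ∷ vs) (Δ ∷ Ts)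
 between-ear {w} {vs} {Ts} {x} {y} {z} {Δ} ear wy IH = go where
  open Ear ear
  y∉vs : y ∉ vs
  y∉vs p with gap p
  ... | inl h = <-irrefl refl (<-≤-trans x<y h)
  ... | inr h = <-irrefl refl (<-≤-trans y<z h)
  above : ∀ {v} -> v ∈ vs -> y < v -> z ≤ v
  above p h with gap p
  ... | inl q = <-absurd (<-trans x<y (<-≤-trans h q))
  ... | inr q = q
  below : ∀ {v} -> v ∈ vs -> v < y -> v ≤ x
  below p h with gap p
  ... | inl q = q
  ... | inr q = <-absurd (<-trans (<-≤-trans y<z q) h)
  old : ∀ {n n' ps v} -> Strictly (y ∷ vs) n n' ps -> y ∉ ps -> v ∈ ps -> v ∈ vs
  old (_ , f , _) y∉ p with fst (f p)
  ... | 0th = ⊥-elim (y∉ p)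
  ... | there q = q

  outside : ∀ {n n'} -> n ∈ vs -> n' ∈ vs -> n < n' -> ∀ ps -> Strictly (y ∷ vs) n n' ps -> y ∉ ps -> pos (M ps (Δ ∷ Ts)) ≡ det (w n) (w n')
  outside {n} {n'} n∈ n'∈ n<n' ps S@(u , f , g) y∉ = trans (cong pos (M-drop ps Δ Ts notΔ)) (IH n∈ n'∈ n<n' ps (u , (\ p -> old S y∉ p , snd (f p)) , \ p -> g (there p))) where
   notΔ : ∀ {v} -> v ∈ ps -> inc v Δ ≡ false
   notΔ {v} p = ¬true⇒false \ t -> contra (onlyΔ (old S y∉ p) t) where
    contra : v ≡ x ⊎ v ≡ z -> ⊥
    contra (inl refl) with f p
    ... | _ , n<x , x<n' = y∉ (g 0th (<-trans n<x x<y) (<-≤-trans y<z (above' (gap n'∈)))) where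
     above' : n' ≤ x ⊎ z ≤ n' -> z ≤ n'
     above' (inl q) = <-absurd (<-≤-trans x<n' q)
     above' (inr q) = q
    contra (inr refl) with f p
    ... | _ , n<z , z<n' = y∉ (g 0th (≤-<-trans (below' (gap n∈)) x<y) (<-trans y<z z<n')) where
     below' : n ≤ x ⊎ z ≤ n -> n ≤ x
     below' (inl q) = q
     below' (inr q) = <-absurd (<-≤-trans n<z q)

  inside : ∀ {n n'} -> n ∈ vs -> n' ∈ vs -> n < n' -> ∀ ps -> Strictly (y ∷ vs) n n' ps -> y ∈ ps -> pos (M ps (Δ ∷ Ts)) ≡ det (w n) (w n')
  inside {n} {n'} n∈ n'∈ n<n' ps (u , f , g) y∈ with ∈-extract y∈
  ... | qs , e = trans (cong pos (trans (M-↭ˡ (Δ ∷ Ts) e) (M-forced y qs Δ Ts yΔ y∉Ts))) (IH n∈ n'∈ n<n' qs (Unique-tail u' , f' , g')) where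
   u' = Unique-resp-↭ e u
   f' : ∀ {v} -> v ∈ qs -> v ∈ vs × n < v × v < n'
   f' p with f (∈-resp-↭ (↭-sym e) (there p))
   ... | 0th , _ = ⊥-elim (Unique-head u' p)
   ... | there q , r = q , r
   g' : ∀ {v} -> v ∈ vs -> n < v -> v < n' -> v ∈ qs
   g' p a b with ∈-resp-↭ e (g (there p) a b)
   ... | 0th = ⊥-elim (y∉vs p)
   ... | there q = q

  left : ∀ {n'} -> n' ∈ vs -> y < n' -> ∀ ps -> Strictly (y ∷ vs) y n' ps -> pos (M ps (Δ ∷ Ts)) ≡ det (w y) (w n')
  left {n'} n'∈ y<n' ps S@(u , f , g) = trans core (sym (trans (cong (\ a -> det a (w n')) wy) (det-⊕ˡ (w x) (w z) (w n')))) where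
   y∉ps : y ∉ ps
   y∉ps p = <-irrefl refl (fst (snd (f p)))
   z≤n' = above n'∈ y<n'
   IHx = IH x∈ n'∈ (<-trans x<y y<n') ps (u , (\ p -> old S y∉ps p , <-trans x<y (fst (snd (f p))) , snd (snd (f p))) , \ {v} p a b -> g (there p) (<-≤-trans y<z (up p a)) b) where
    up : ∀ {v} -> v ∈ vs -> x < v -> z ≤ v
    up p a with gap p
    ... | inl q = <-absurd (<-≤-trans a q)
    ... | inr q = q
   core : pos (M ps (Δ ∷ Ts)) ≡ det (w x) (w n') +Z det (w z) (w n')
   core with m≤n⇒m<n∨m≡n z≤n'
   -- If z is itself the second end, no point to be matched meets Δ, and the summand det (w z) (w z)
   -- that would account for its use vanishes.
   ... | inr refl = trans (cong pos (M-drop ps Δ Ts notΔ)) (trans IHx (sym (trans (cong (det (w x) (w z) +Z_) (det-self (w z))) (ℤₚ.+-identityʳ _)))) where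
    notΔ : ∀ {v} -> v ∈ ps -> inc v Δ ≡ false
    notΔ p = ¬true⇒false \ t -> contra p (onlyΔ (old S y∉ps p) t) where
     contra : ∀ {v} -> v ∈ ps -> v ≡ x ⊎ v ≡ z -> ⊥
     contra p (inl refl) = <-irrefl refl (<-trans x<y (fst (snd (f p))))
     contra p (inr refl) = <-irrefl refl (snd (snd (f p)))
   ... | inl z<n' with ∈-extract (g (there z∈) y<z z<n')
   -- Either Δ stays free, which counts the matchings between x and n', or z takes Δ, and the points
   -- between z and n' remain for the old regions.
   ... | qs , e = trans (cong pos (trans (M-↭ˡ (Δ ∷ Ts) e) (trans (M-one z qs Δ Ts (zΔ n'∈ z<n') notΔ) (cong (_+ M qs Ts) (M-↭ˡ Ts (↭-sym e)))))) (cong₂ _+Z_ IHx (IH z∈ n'∈ z<n' qs (Unique-tail u' , f' , g'))) where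
    u' = Unique-resp-↭ e u
    back : ∀ {v} -> v ∈ qs -> v ∈ ps
    back p = ∈-resp-↭ (↭-sym e) (there p)
    notΔ : ∀ {v} -> v ∈ qs -> inc v Δ ≡ false
    notΔ p = ¬true⇒false \ t -> contra p (onlyΔ (old S y∉ps (back p)) t) where
     contra : ∀ {v} -> v ∈ qs -> v ≡ x ⊎ v ≡ z -> ⊥
     contra p (inl refl) = <-irrefl refl (<-trans x<y (fst (snd (f (back p)))))
     contra p (inr refl) = Unique-head u' p
    f' : ∀ {v} -> v ∈ qs -> v ∈ vs × z < v × v < n'
    f' {v} p = v∈ , lt (m≤n⇒m<n∨m≡n (above v∈ (fst (snd (f (back p)))))) , snd (snd (f (back p))) where
     v∈ = old S y∉ps (back p)
     lt : z < v ⊎ z ≡ v -> z < v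
     lt (inl h) = h
     lt (inr refl) = ⊥-elim (Unique-head u' p)
    g' : ∀ {v} -> v ∈ vs -> z < v -> v < n' -> v ∈ qs
    g' p a b with ∈-resp-↭ e (g (there p) (<-trans y<z a) b)
    ... | 0th = <-absurd a
    ... | there q = q

  right : ∀ {n} -> n ∈ vs -> n < y -> ∀ ps -> Strictly (y ∷ vs) n y ps -> pos (M ps (Δ ∷ Ts)) ≡ det (w n) (w y)
  right {n} n∈ n<y ps S@(u , f , g) = trans core (sym (trans (cong (det (w n)) wy) (det-⊕ʳ (w x) (w z) (w n)))) where
   y∉ps : y ∉ ps
   y∉ps p = <-irrefl refl (snd (snd (f p)))
   n≤x = below n∈ n<y
   IHz = IH n∈ z∈ (<-trans n<y y<z) ps (u , (\ p -> old S y∉ps p , fst (snd (f p)) , <-trans (snd (snd (f p))) y<z) , \ {v} p a b -> g (there p) a (≤-<-trans (dn p b) x<y)) where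
    dn : ∀ {v} -> v ∈ vs -> v < z -> v ≤ x
    dn p a with gap p
    ... | inl q = q
    ... | inr q = <-absurd (<-≤-trans a q)
   core : pos (M ps (Δ ∷ Ts)) ≡ det (w n) (w x) +Z det (w n) (w z)
   core with m≤n⇒m<n∨m≡n n≤x
   ... | inr refl = trans (cong pos (M-drop ps Δ Ts notΔ)) (trans IHz (sym (trans (cong (_+Z det (w x) (w z)) (det-self (w x))) (ℤₚ.+-identityˡ _)))) where
    notΔ : ∀ {v} -> v ∈ ps -> inc v Δ ≡ false
    notΔ p = ¬true⇒false \ t -> contra p (onlyΔ (old S y∉ps p) t) where
     contra : ∀ {v} -> v ∈ ps -> v ≡ x ⊎ v ≡ z -> ⊥
     contra p (inl refl) = <-irrefl refl (fst (snd (f p)))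
     contra p (inr refl) = <-irrefl refl (<-trans y<z (snd (snd (f p))))
   ... | inl n<x with ∈-extract (g (there x∈) n<x x<y)
   ... | qs , e = trans (cong pos (trans (M-↭ˡ (Δ ∷ Ts) e) (trans (M-one x qs Δ Ts xΔ notΔ) (cong (_+ M qs Ts) (M-↭ˡ Ts (↭-sym e)))))) (trans (cong₂ _+Z_ IHz (IH n∈ x∈ n<x qs (Unique-tail u' , f' , g'))) (ℤₚ.+-comm (det (w n) (w z)) (det (w n) (w x)))) where
    u' = Unique-resp-↭ e u
    back : ∀ {v} -> v ∈ qs -> v ∈ ps
    back p = ∈-resp-↭ (↭-sym e) (there p)
    notΔ : ∀ {v} -> v ∈ qs -> inc v Δ ≡ false
    notΔ p = ¬true⇒false \ t -> contra p (onlyΔ (old S y∉ps (back p)) t) where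
     contra : ∀ {v} -> v ∈ qs -> v ≡ x ⊎ v ≡ z -> ⊥
     contra p (inl refl) = Unique-head u' p
     contra p (inr refl) = <-irrefl refl (<-trans y<z (snd (snd (f (back p)))))
    f' : ∀ {v} -> v ∈ qs -> v ∈ vs × n < v × v < x
    f' {v} p = v∈ , fst (snd (f (back p))) , lt (m≤n⇒m<n∨m≡n (below v∈ (snd (snd (f (back p)))))) where
     v∈ = old S y∉ps (back p)
     lt : v < x ⊎ v ≡ x -> v < x
     lt (inl h) = h
     lt (inr refl) = ⊥-elim (Unique-head u' p)
    g' : ∀ {v} -> v ∈ vs -> n < v -> v < x -> v ∈ qs
    g' p a b with ∈-resp-↭ e (g (there p) a (<-trans b x<y))
    ... | 0th = <-absurd b
    ... | there q = q

  go : Between w (y ∷ vs) (Δ ∷ Ts)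
  go 0th 0th n<n' ps S = <-absurd n<n'
  go 0th (there n'∈) n<n' ps S = left n'∈ n<n' ps S
  go (there n∈) 0th n<n' ps S = right n∈ n<n' ps S
  go {n} {n'} (there n∈) (there n'∈) n<n' ps S@(u , f , g) with n <? y | y <? n'
  ... | yes a | yes b = inside n∈ n'∈ n<n' ps S (g 0th a b)
  ... | no a | _ = outside n∈ n'∈ n<n' ps S (\ p -> a (fst (snd (f p))))
  ... | yes _ | no b = outside n∈ n'∈ n<n' ps S (\ p -> b (snd (snd (f p))))

 between-base : ∀ {w x y} -> x < y -> det (w x) (w y) ≡ 1ℤ -> Between w (x ∷ y ∷ []) []
 between-base {w} {x} {y} x<y d = go where
  empty : ∀ {n n'} ps -> Strictly (x ∷ y ∷ []) n n' ps -> x ≤ n -> n' ≤ y -> ps ≡ []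
  empty [] S a b = refl
  empty (p ∷ ps) (_ , f , _) a b with f 0th
  ... | 0th , h , k = <-absurd (≤-<-trans a h)
  ... | 1st , h , k = <-absurd (<-≤-trans k b)
  go : Between w (x ∷ y ∷ []) []
  go 0th 0th h ps S = <-absurd h
  go 0th 1st h ps S with empty ps S ≤-refl ≤-refl
  ... | refl = sym d
  go 1st 0th h ps S = <-absurd (<-trans h x<y)
  go 1st 1st h ps S = <-absurd h

module _ {P R : Set} (inc : P -> R -> Bool) where
 open Matchings inc

 -- X consists of points always to be matched; one of the points vs is left out.
 Perfect : (P -> ℤ) -> List P -> List P -> List R -> Set
 Perfect w X vs Ts = length (X ++ vs) ≡ suc (length Ts) × (∀ {n} -> n ∈ vs -> ∀ ps -> n ∷ ps ↭ X ++ vs -> pos (M ps Ts) ≡ w n)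

 record PEar (us : List P) (Ts : List R) (x y z : P) (Δ : R) : Set where
  field
   uniq : Unique (y ∷ us)
   x≢z : x ≢ z
   y∉Ts : ∀ {r} -> r ∈ Ts -> inc y r ≡ false
   xΔ : inc x Δ ≡ true
   yΔ : inc y Δ ≡ true
   zΔ : inc z Δ ≡ true
   onlyΔ : ∀ {v} -> v ∈ us -> inc v Δ ≡ true -> v ≡ x ⊎ v ≡ z

 -- Points exceed regions by one, so once y is left out Δ cannot stay idle and must go to x or z. If
 -- x takes it, the other points are matched as though x had been left out of the old polygon, and
 -- likewise for z.
 perfect-ear : ∀ {w X vs Ts x y z Δ} -> PEar (X ++ vs) Ts x y z Δ -> x ∈ vs -> z ∈ vs -> w y ≡ w x +Z w z -> Perfect w X vs Ts -> Perfect w X (y ∷ vs) (Δ ∷ Ts)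
 perfect-ear {w} {X} {vs} {Ts} {x} {y} {z} {Δ} ear x∈ z∈ wy (len , IH) = trans (↭-length (shift y X vs)) (cong suc len) , go where
  open PEar ear
  go : ∀ {n} -> n ∈ y ∷ vs -> ∀ ps -> n ∷ ps ↭ X ++ y ∷ vs -> pos (M ps (Δ ∷ Ts)) ≡ w n
  go 0th ps e = new where
   e' = drop-∷ (↭-trans e (shift y X vs))
   inX : ∀ {v} -> v ∈ vs -> v ∈ X ++ vs
   inX = go' X where
    go' : ∀ X {v} -> v ∈ vs -> v ∈ X ++ vs
    go' [] p = p
    go' (_ ∷ X) p = there (go' X p)
   new : pos (M ps (Δ ∷ Ts)) ≡ w y
   new with ∈-extract (inX x∈)
   ... | us , e₁ with ∈-resp-↭ e₁ (inX z∈)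
   ... | here z≡x = ⊥-elim (x≢z (sym z≡x))
   ... | there z∈us with ∈-extract z∈us
   ... | qs , e₂ = trans (cong pos (trans (M-↭ˡ (Δ ∷ Ts) (↭-trans e' e₃)) (trans (M-two x z qs Δ Ts xΔ zΔ notΔ) (cong (_+ (M (z ∷ qs) Ts + M (x ∷ qs) Ts)) (M-pigeon (x ∷ z ∷ qs) Ts long)))))
    (trans (cong₂ _+Z_ (IH x∈ (z ∷ qs) (↭-sym e₃)) (IH z∈ (x ∷ qs) (↭-trans (swap z x ↭-refl) (↭-sym e₃)))) (sym wy)) where
    e₃ = ↭-trans e₁ (prep x e₂)
    u₃ = Unique-resp-↭ e₃ (Unique-tail uniq)
    notΔ : ∀ {v} -> v ∈ qs -> inc v Δ ≡ false
    notΔ p = ¬true⇒false \ t -> contra p (onlyΔ (∈-resp-↭ (↭-sym e₃) (there (there p))) t) where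
     contra : ∀ {v} -> v ∈ qs -> v ≡ x ⊎ v ≡ z -> ⊥
     contra p (inl refl) = Unique-head u₃ (there p)
     contra p (inr refl) = Unique-head (Unique-tail u₃) p
    long : length Ts < length (x ∷ z ∷ qs)
    long = subst (length Ts <_) (trans (sym len) (↭-length e₃)) ≤-refl
  go {n} (there n∈) ps e with ∈-resp-↭ (↭-sym e) (∈-resp-↭ (↭-sym (shift y X vs)) 0th)
  ... | 0th = ⊥-elim (Unique-head uniq (inX n∈)) where
   inX : ∀ {v} -> v ∈ vs -> v ∈ X ++ vs
   inX = go' X where
    go' : ∀ X {v} -> v ∈ vs -> v ∈ X ++ vs
    go' [] p = p
    go' (_ ∷ X) p = there (go' X p)
  ... | there y∈ with ∈-extract y∈
  ... | qs , e' = trans (cong pos (trans (M-↭ˡ (Δ ∷ Ts) e') (M-forced y qs Δ Ts yΔ y∉Ts))) (IH n∈ qs (drop-∷ (↭-trans (swap y n ↭-refl) (↭-trans (prep n (↭-sym e')) (↭-trans e (shift y X vs))))))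

-- Boolean tests as propositions.

T⇒true : ∀ {b} -> Bool.T b -> b ≡ true
T⇒true {true} _ = refl

true⇒T : ∀ {b} -> b ≡ true -> Bool.T b
true⇒T refl = tt

<⇒<ᵇ≡ : ∀ {m n} -> m < n -> (m <ᵇ n) ≡ true
<⇒<ᵇ≡ h = T⇒true (<⇒<ᵇ h)

<ᵇ≡⇒< : ∀ {m n} -> (m <ᵇ n) ≡ true -> m < n
<ᵇ≡⇒< {m} {n} e = <ᵇ⇒< m n (true⇒T e)

≤⇒≤ᵇ≡ : ∀ {m n} -> m ≤ n -> (m ≤ᵇ n) ≡ true
≤⇒≤ᵇ≡ h = T⇒true (≤⇒≤ᵇ h)

≤ᵇ≡⇒≤ : ∀ {m n} -> (m ≤ᵇ n) ≡ true -> m ≤ n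
≤ᵇ≡⇒≤ {m} {n} e = ≤ᵇ⇒≤ m n (true⇒T e)

≡⇒≡ᵇ≡ : ∀ {m n} -> m ≡ n -> (m ≡ᵇ n) ≡ true
≡⇒≡ᵇ≡ {m} {n} e = T⇒true (≡⇒≡ᵇ m n e)

≡ᵇ≡⇒≡ : ∀ {m n} -> (m ≡ᵇ n) ≡ true -> m ≡ n
≡ᵇ≡⇒≡ {m} {n} e = ≡ᵇ⇒≡ m n (true⇒T e)

≢⇒≡ᵇ≡ : ∀ {m n} -> m ≢ n -> (m ≡ᵇ n) ≡ false
≢⇒≡ᵇ≡ h = ¬true⇒false (\ e -> h (≡ᵇ≡⇒≡ e))

∧⁺ : ∀ {a b} -> a ≡ true -> b ≡ true -> a ∧ b ≡ true
∧⁺ refl refl = refl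

∧⁻ : ∀ {a b} -> a ∧ b ≡ true -> a ≡ true × b ≡ true
∧⁻ {true} {true} refl = refl , refl

∨⁻ : ∀ {a b} -> a ∨ b ≡ true -> a ≡ true ⊎ b ≡ true
∨⁻ {true} e = inl refl
∨⁻ {false} e = inr e

∨⁺ˡ : ∀ {a b} -> a ≡ true -> a ∨ b ≡ true
∨⁺ˡ refl = refl

∨⁺ʳ : ∀ {a b} -> b ≡ true -> a ∨ b ≡ true
∨⁺ʳ {a} refl = ∨-zeroʳ a

any⁺ : {A : Set} {f : A -> Bool} {x : A} {xs : List A} -> x ∈ xs -> f x ≡ true -> any f xs ≡ true
any⁺ 0th e = ∨⁺ˡ e
any⁺ {f = f} {xs = x ∷ xs} (there p) e = ∨⁺ʳ {f x} (any⁺ {f = f} p e)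

any⁻ : {A : Set} (f : A -> Bool) (xs : List A) -> any f xs ≡ true -> ∃[ x ] x ∈ xs × f x ≡ true
any⁻ f (x ∷ xs) e with ∨⁻ {f x} e
... | inl p = x , 0th , p
... | inr p with any⁻ f xs p
... | y , q , r = y , there q , r

arcEq⇒≡ : ∀ a b -> arcEq a b ≡ true -> a ≡ b
arcEq⇒≡ (nc i L) (nc j M) e with ∧⁻ {i ≡ᵇ j} e
... | p , q = cong₂ nc (≡ᵇ≡⇒≡ p) (≡ᵇ≡⇒≡ q)
arcEq⇒≡ (ct i) (ct j) e = cong ct (≡ᵇ≡⇒≡ e)

arcEq-refl : ∀ a -> arcEq a a ≡ true
arcEq-refl (nc i L) = ∧⁺ (≡⇒≡ᵇ≡ {i} refl) (≡⇒≡ᵇ≡ {L} refl)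
arcEq-refl (ct i) = ≡⇒≡ᵇ≡ {i} refl

memA⇒∈ : ∀ {a T} -> memA a T ≡ true -> a ∈ T
memA⇒∈ {a} {T} e with any⁻ (arcEq a) T e
... | b , p , q with arcEq⇒≡ a b q
... | refl = p

∈⇒memA : ∀ {a T} -> a ∈ T -> memA a T ≡ true
∈⇒memA {a} p = any⁺ {f = arcEq a} p (arcEq-refl a)

tagEq⇒≡ : ∀ s r -> tagEq s r ≡ true -> s ≡ r
tagEq⇒≡ pl pl e = refl
tagEq⇒≡ nt nt e = refl

tagEq-refl : ∀ s -> tagEq s s ≡ true
tagEq-refl pl = refl
tagEq-refl nt = refl

tct-inj : ∀ {i s j s'} -> tct i s ≡ tct j s' -> i ≡ j
tct-inj refl = refl

opp : Tag -> Tag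
opp pl = nt
opp nt = pl

opp-invol : ∀ s -> opp (opp s) ≡ s
opp-invol pl = refl
opp-invol nt = refl

tag-cases : ∀ s r -> r ≡ s ⊎ r ≡ opp s
tag-cases pl pl = inl refl
tag-cases pl nt = inr refl
tag-cases nt pl = inr refl
tag-cases nt nt = inl refl

tEq⇒≡ : ∀ a b -> tEq a b ≡ true -> a ≡ b
tEq⇒≡ (tnc i L) (tnc j M) e with ∧⁻ {i ≡ᵇ j} e
... | p , q = cong₂ tnc (≡ᵇ≡⇒≡ p) (≡ᵇ≡⇒≡ q)
tEq⇒≡ (tct i s) (tct j r) e with ∧⁻ {i ≡ᵇ j} e
... | p , q = cong₂ tct (≡ᵇ≡⇒≡ p) (tagEq⇒≡ s r q)

tEq-refl : ∀ a -> tEq a a ≡ true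
tEq-refl (tnc i L) = ∧⁺ (≡⇒≡ᵇ≡ {i} refl) (≡⇒≡ᵇ≡ {L} refl)
tEq-refl (tct i s) = ∧⁺ (≡⇒≡ᵇ≡ {i} refl) (tagEq-refl s)

≢⇒tEq : ∀ {a b} -> a ≢ b -> tEq a b ≡ false
≢⇒tEq {a} {b} h = ¬true⇒false (\ e -> h (tEq⇒≡ a b e))

memT⇒∈ : ∀ {a T} -> memT a T ≡ true -> a ∈ T
memT⇒∈ {a} {T} e with any⁻ (tEq a) T e
... | b , p , q with tEq⇒≡ a b q
... | refl = p

∈⇒memT : ∀ {a T} -> a ∈ T -> memT a T ≡ true
∈⇒memT {a} p = any⁺ {f = tEq a} p (tEq-refl a)

∉⇒memT : ∀ {a T} -> a ∉ T -> memT a T ≡ false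
∉⇒memT h = ¬true⇒false (\ e -> h (memT⇒∈ e))

∈T? : ∀ a T -> a ∈ T ⊎ a ∉ T
∈T? a T with memT a T in e
... | true = inl (memT⇒∈ e)
... | false = inr (\ p -> false≢true e (∈⇒memT p))

-- Residues and crossings of lifted arcs.

module Residues (N : ℕ) (N>0 : 0 < N) where

 md-< : ∀ x -> md N x < N
 md-< x = go N N>0 where
  go : ∀ n -> 0 < n -> md n x < n
  go (suc n) _ = m%n<n x (suc n)

 md-small : ∀ {x} -> x < N -> md N x ≡ x
 md-small {x} = go N where
  go : ∀ n -> x < n -> md n x ≡ x
  go (suc n) h = m<n⇒m%n≡m h

 md-+kN : ∀ x k -> md N (x + k * N) ≡ md N x
 md-+kN x k = go N N>0 where
  go : ∀ n -> 0 < n -> md n (x + k * n) ≡ md n x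
  go (suc n) _ = [m+kn]%n≡m%n x k (suc n)

 md-+N : ∀ x -> md N (x + N) ≡ md N x
 md-+N x = trans (cong (\ n -> md N (x + n)) (sym (+-identityʳ N))) (md-+kN x 1)

 md-decomp : ∀ x -> ∃[ k ] x ≡ md N x + k * N
 md-decomp x = go N N>0 where
  go : ∀ n -> 0 < n -> ∃[ k ] x ≡ md n x + k * n
  go (suc n) _ = x / suc n , m≡m%n+[m/n]*n x (suc n)

 md-idem : ∀ x -> md N (md N x) ≡ md N x
 md-idem x = md-small (md-< x)

 private
  shuffle : ∀ r k l -> r + k + l ≡ r + l + k
  shuffle = solve-∀ℕ

 md-md+ : ∀ x L -> md N (md N x + L) ≡ md N (x + L)
 md-md+ x L with md-decomp x
 ... | k , e = sym (trans (cong (\ y -> md N (y + L)) e) (trans (cong (md N) (shuffle (md N x) (k * N) L)) (md-+kN (md N x + L) k)))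

 md-cong : ∀ {x y} L -> md N x ≡ md N y -> md N (x + L) ≡ md N (y + L)
 md-cong {x} {y} L e = trans (sym (md-md+ x L)) (trans (cong (\ z -> md N (z + L)) e) (md-md+ y L))

 -- Adding L another N - 1 times completes L full turns and thereby undoes the shift by L.
 md-cancel : ∀ {x y} L -> md N (x + L) ≡ md N (y + L) -> md N x ≡ md N y
 md-cancel {x} {y} L e = trans (sym (cycle x)) (trans (md-cong (L * (N ∸ 1)) e) (cycle y)) where
  mult = trans (sym (*-suc L (N ∸ 1))) (cong (L *_) (m+[n∸m]≡n N>0))
  cycle : ∀ z -> md N (z + L + L * (N ∸ 1)) ≡ md N z
  cycle z = trans (cong (md N) (trans (+-assoc z L _) (cong (z +_) mult))) (md-+kN z L)

 md-diff : ∀ x {d e} -> d < N -> e < N -> md N (x + d) ≡ md N (x + e) -> d ≡ e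
 md-diff x {d} {e} d<N e<N h = trans (sym (md-small d<N)) (trans (md-cancel x (trans (cong (md N) (+-comm d x)) (trans h (cong (md N) (+-comm x e))))) (md-small e<N))

 md-window : ∀ {x y} -> md N x ≡ md N y -> x ≤ y -> y < x + N -> x ≡ y
 md-window {x} {y} e x≤y y<x+N with m≤n⇒∃[o]m+o≡n x≤y
 ... | d , refl with md-diff x {d} {0} (+-cancelˡ-< x d N y<x+N) N>0 (trans (sym e) (cong (md N) (sym (+-identityʳ x))))
 ... | refl = sym (+-identityʳ x)

 md-step : ∀ x {d} -> d < N -> md N (x + d) ≡ md N x + d ⊎ md N (x + d) + N ≡ md N x + d
 md-step x {d} d<N with md N x + d <? N
 ... | yes h = inl (trans (sym (md-md+ x d)) (md-small h))
 ... | no h with m≤n⇒∃[o]m+o≡n (≮⇒≥ h)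
 ... | o , e = inr (trans (cong (_+ N) (trans (sym (md-md+ x d)) (trans (cong (md N) (trans (sym e) (+-comm N o))) (trans (md-+N o) (md-small o<N))))) (trans (+-comm o N) e)) where
  o<N : o < N
  o<N = lia 4 (\ r d N o -> (r :< N) ∷ (d :< N) ∷ (N :+ o :≡ r :+ d) ∷ [] ⊢ o :< N) (md N x) d N o (md-< x) d<N e

 any₀ : (f : ℕ -> Bool) -> f 0 ≡ true -> any f shifts ≡ true
 any₀ f e = any⁺ {f = f} {x = 0} {xs = shifts} 0th e

 any₁ : (f : ℕ -> Bool) -> f 1 ≡ true -> any f shifts ≡ true
 any₁ f e = any⁺ {f = f} {x = 1} {xs = shifts} 1st e

 any₂ : (f : ℕ -> Bool) -> f 2 ≡ true -> any f shifts ≡ true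
 any₂ f e = any⁺ {f = f} {x = 2} {xs = shifts} 2nd e

 chordsCross₁ : ∀ a b c d -> a < c -> c < b -> b < d -> chordsCross a b c d ≡ true
 chordsCross₁ a b c d p q r = ∨⁺ˡ (∧⁺ (<⇒<ᵇ≡ p) (∧⁺ (<⇒<ᵇ≡ q) (<⇒<ᵇ≡ r)))

 chordsCross₂ : ∀ a b c d -> c < a -> a < d -> d < b -> chordsCross a b c d ≡ true
 chordsCross₂ a b c d p q r = ∨⁺ʳ {(a <ᵇ c) ∧ ((c <ᵇ b) ∧ (b <ᵇ d))} (∧⁺ (<⇒<ᵇ≡ p) (∧⁺ (<⇒<ᵇ≡ q) (<⇒<ᵇ≡ r)))

 -- `cross` compares one lift, based at `md N x + N`, with three shifts of the other. For u = x + d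
 -- with d < N the right shift is one turn, or two turns if the residue of x + d wraps around.
 cross-nn₁ : ∀ {x u L M} -> x < u -> u < x + L -> x + L < u + M -> L ≤ N -> cross N (nc (md N x) L) (nc (md N u) M) ≡ true
 cross-nn₁ {x} {u} {L} {M} a b c L≤N with m≤n⇒∃[o]m+o≡n (<⇒≤ a)
 ... | d , refl with md-step x {d} (<-≤-trans (+-cancelˡ-< x d L b) L≤N)
 ... | inl e = any₁ (\ s -> chordsCross (md N x + N) (md N x + N + L) (md N (x + d) + s * N) (md N (x + d) + s * N + M)) (chordsCross₁ (md N x + N) (md N x + N + L) (md N (x + d) + 1 * N) (md N (x + d) + 1 * N + M)
  (lia 5 (\ x d i j N -> (x :< x :+ d) ∷ (j :≡ i :+ d) ∷ [] ⊢ i :+ N :< j :+ 1 :* N) x d (md N x) (md N (x + d)) N a e) (lia 6 (\ x d i j N L -> (x :+ d :< x :+ L) ∷ (j :≡ i :+ d) ∷ [] ⊢ j :+ 1 :* N :< i :+ N :+ L) x d (md N x) (md N (x + d)) N L b e)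
  (lia 7 (\ x d i j N L M -> (x :+ L :< x :+ d :+ M) ∷ (j :≡ i :+ d) ∷ [] ⊢ i :+ N :+ L :< j :+ 1 :* N :+ M) x d (md N x) (md N (x + d)) N L M c e))
 ... | inr e = any₂ (\ s -> chordsCross (md N x + N) (md N x + N + L) (md N (x + d) + s * N) (md N (x + d) + s * N + M)) (chordsCross₁ (md N x + N) (md N x + N + L) (md N (x + d) + 2 * N) (md N (x + d) + 2 * N + M)
  (lia 5 (\ x d i j N -> (x :< x :+ d) ∷ (j :+ N :≡ i :+ d) ∷ [] ⊢ i :+ N :< j :+ 2 :* N) x d (md N x) (md N (x + d)) N a e) (lia 6 (\ x d i j N L -> (x :+ d :< x :+ L) ∷ (j :+ N :≡ i :+ d) ∷ [] ⊢ j :+ 2 :* N :< i :+ N :+ L) x d (md N x) (md N (x + d)) N L b e)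
  (lia 7 (\ x d i j N L M -> (x :+ L :< x :+ d :+ M) ∷ (j :+ N :≡ i :+ d) ∷ [] ⊢ i :+ N :+ L :< j :+ 2 :* N :+ M) x d (md N x) (md N (x + d)) N L M c e))

 -- Here the second chord starts first, so a wrap-around of residues lowers the required shift from
 -- one turn to none.
 cross-nn₂ : ∀ {x u L M} -> u < x -> x < u + M -> u + M < x + L -> M ≤ N -> cross N (nc (md N x) L) (nc (md N u) M) ≡ true
 cross-nn₂ {x} {u} {L} {M} a b c M≤N with m≤n⇒∃[o]m+o≡n (<⇒≤ a)
 ... | d , refl with md-step u {d} (<-≤-trans (+-cancelˡ-< u d M b) M≤N)
 ... | inl e = any₁ (\ s -> chordsCross (md N (u + d) + N) (md N (u + d) + N + L) (md N u + s * N) (md N u + s * N + M)) (chordsCross₂ (md N (u + d) + N) (md N (u + d) + N + L) (md N u + 1 * N) (md N u + 1 * N + M)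
  (lia 5 (\ u d i j N -> (u :< u :+ d) ∷ (i :≡ j :+ d) ∷ [] ⊢ j :+ 1 :* N :< i :+ N) u d (md N (u + d)) (md N u) N a e) (lia 6 (\ u d i j N M -> (u :+ d :< u :+ M) ∷ (i :≡ j :+ d) ∷ [] ⊢ i :+ N :< j :+ 1 :* N :+ M) u d (md N (u + d)) (md N u) N M b e)
  (lia 7 (\ u d i j N L M -> (u :+ M :< u :+ d :+ L) ∷ (i :≡ j :+ d) ∷ [] ⊢ j :+ 1 :* N :+ M :< i :+ N :+ L) u d (md N (u + d)) (md N u) N L M c e))
 ... | inr e = any₀ (\ s -> chordsCross (md N (u + d) + N) (md N (u + d) + N + L) (md N u + s * N) (md N u + s * N + M)) (chordsCross₂ (md N (u + d) + N) (md N (u + d) + N + L) (md N u + 0 * N) (md N u + 0 * N + M)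
  (lia 5 (\ u d i j N -> (u :< u :+ d) ∷ (i :+ N :≡ j :+ d) ∷ [] ⊢ j :+ 0 :* N :< i :+ N) u d (md N (u + d)) (md N u) N a e) (lia 6 (\ u d i j N M -> (u :+ d :< u :+ M) ∷ (i :+ N :≡ j :+ d) ∷ [] ⊢ i :+ N :< j :+ 0 :* N :+ M) u d (md N (u + d)) (md N u) N M b e)
  (lia 7 (\ u d i j N L M -> (u :+ M :< u :+ d :+ L) ∷ (i :+ N :≡ j :+ d) ∷ [] ⊢ j :+ 0 :* N :+ M :< i :+ N :+ L) u d (md N (u + d)) (md N u) N L M c e))

 cross-nr : ∀ {x u L} -> x < u -> u < x + L -> L ≤ N -> cross N (nc (md N x) L) (ct (md N u)) ≡ true
 cross-nr {x} {u} {L} a b L≤N with m≤n⇒∃[o]m+o≡n (<⇒≤ a)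
 ... | d , refl with md-step x {d} (<-≤-trans (+-cancelˡ-< x d L b) L≤N)
 ... | inl e = any₁ (\ s -> chordRayCross (md N x + N) (md N x + N + L) (md N (x + d) + s * N)) (∧⁺ (<⇒<ᵇ≡ {md N x + N} {md N (x + d) + 1 * N} (lia 5 (\ x d i j N -> (x :< x :+ d) ∷ (j :≡ i :+ d) ∷ [] ⊢ i :+ N :< j :+ 1 :* N) x d (md N x) (md N (x + d)) N a e))
  (<⇒<ᵇ≡ {md N (x + d) + 1 * N} {md N x + N + L} (lia 6 (\ x d i j N L -> (x :+ d :< x :+ L) ∷ (j :≡ i :+ d) ∷ [] ⊢ j :+ 1 :* N :< i :+ N :+ L) x d (md N x) (md N (x + d)) N L b e)))
 ... | inr e = any₂ (\ s -> chordRayCross (md N x + N) (md N x + N + L) (md N (x + d) + s * N)) (∧⁺ (<⇒<ᵇ≡ {md N x + N} {md N (x + d) + 2 * N} (lia 5 (\ x d i j N -> (x :< x :+ d) ∷ (j :+ N :≡ i :+ d) ∷ [] ⊢ i :+ N :< j :+ 2 :* N) x d (md N x) (md N (x + d)) N a e))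
  (<⇒<ᵇ≡ {md N (x + d) + 2 * N} {md N x + N + L} (lia 6 (\ x d i j N L -> (x :+ d :< x :+ L) ∷ (j :+ N :≡ i :+ d) ∷ [] ⊢ j :+ 2 :* N :< i :+ N :+ L) x d (md N x) (md N (x + d)) N L b e)))

 ChordsCross : ℕ -> ℕ -> ℕ -> ℕ -> Set
 ChordsCross x L u M = (x < u × u < x + L × x + L < u + M) ⊎ (u < x × x < u + M × u + M < x + L)

 cross-nn⁻ : ∀ {i j L M} -> j < N -> cross N (nc i L) (nc j M) ≡ true -> ∃[ u ] md N u ≡ j × ChordsCross (i + N) L u M
 cross-nn⁻ {i} {j} {L} {M} j<N e with any⁻ (\ s -> chordsCross (i + N) (i + N + L) (j + s * N) (j + s * N + M)) shifts e
 ... | s , _ , h = j + s * N , trans (md-+kN j s) (md-small j<N) , go (∨⁻ {(i + N <ᵇ j + s * N) ∧ ((j + s * N <ᵇ i + N + L) ∧ (i + N + L <ᵇ j + s * N + M))} h) where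
  go : _ -> ChordsCross (i + N) L (j + s * N) M
  go (inl p) with ∧⁻ {i + N <ᵇ j + s * N} p
  ... | a , q with ∧⁻ {j + s * N <ᵇ i + N + L} q
  ... | b , c = inl (<ᵇ≡⇒< a , <ᵇ≡⇒< b , <ᵇ≡⇒< c)
  go (inr p) with ∧⁻ {j + s * N <ᵇ i + N} p
  ... | a , q with ∧⁻ {i + N <ᵇ j + s * N + M} q
  ... | b , c = inr (<ᵇ≡⇒< a , <ᵇ≡⇒< b , <ᵇ≡⇒< c)

 cross-nr⁻ : ∀ {i j L} -> j < N -> cross N (nc i L) (ct j) ≡ true -> ∃[ u ] md N u ≡ j × i + N < u × u < i + N + L
 cross-nr⁻ {i} {j} {L} j<N e with any⁻ (\ s -> chordRayCross (i + N) (i + N + L) (j + s * N)) shifts e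
 ... | s , _ , h with ∧⁻ {i + N <ᵇ j + s * N} h
 ... | a , b = j + s * N , trans (md-+kN j s) (md-small j<N) , <ᵇ≡⇒< a , <ᵇ≡⇒< b

-- Membership in the enumerations of lifted triangles.

∈-concatMap⁺ : {A B : Set} {f : A -> List B} {x : A} {xs : List A} {v : B} -> x ∈ xs -> v ∈ f x -> v ∈ concatMap f xs
∈-concatMap⁺ 0th q = ∈-++⁺ˡ q
∈-concatMap⁺ {f = f} {xs = y ∷ _} (there p) q = ∈-++⁺ʳ (f y) (∈-concatMap⁺ p q)

∈-concatMap⁻ : {A B : Set} (f : A -> List B) (xs : List A) {v : B} -> v ∈ concatMap f xs -> ∃[ x ] x ∈ xs × v ∈ f x
∈-concatMap⁻ f (x ∷ xs) p with ∈-++⁻ (f x) p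
... | inl q = x , 0th , q
... | inr q with ∈-concatMap⁻ f xs q
... | y , a , b = y , there a , b

Unique-concatMap : {A B : Set} {f : A -> List B} {xs : List A} -> Unique xs -> (∀ x -> Unique (f x)) -> (∀ {x y v} -> v ∈ f x -> v ∈ f y -> x ≡ y) -> Unique (concatMap f xs)
Unique-concatMap {xs = []} u uf inj = []
Unique-concatMap {f = f} {xs = x ∷ xs} u uf inj = Uniqueₚ.++⁺ (uf x) (Unique-concatMap (Unique-tail u) uf inj) disj where
 disj : ∀ {v} -> ¬ (v ∈ f x × v ∈ concatMap f xs)
 disj (a , b) with ∈-concatMap⁻ f xs b
 ... | y , y∈ , c with inj a c
 ... | refl = Unique-head u y∈

∈-range⁺ : ∀ {lo hi v} -> lo ≤ v -> v ≤ hi -> v ∈ range lo hi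
∈-range⁺ {lo} {hi} {v} a b with m≤n⇒∃[o]m+o≡n a
... | o , refl = ∈-map⁺ (lo +_) (∈-upTo⁺ (m+n≤o⇒n≤o∸m' lo (s≤s b))) where
 m+n≤o⇒n≤o∸m' : ∀ m {n o} -> suc (m + n) ≤ o -> suc n ≤ o ∸ m
 m+n≤o⇒n≤o∸m' m {n} {o} h = m+n≤o⇒m≤o∸n (suc n) (subst (_≤ o) (cong suc (+-comm m n)) h)

∈-range⁻ : ∀ {lo hi v} -> v ∈ range lo hi -> lo ≤ v × v ≤ hi
∈-range⁻ {lo} {hi} p with ∈-map⁻ (lo +_) p
... | o , q , refl with ∈-upTo⁻ q
... | h with lo ≤? suc hi
... | yes l = m≤m+n lo o , ≤-pred (subst (suc (lo + o) ≤_) (m+[n∸m]≡n l) (subst (_≤ lo + (suc hi ∸ lo)) (+-suc lo o) (+-monoʳ-≤ lo h)))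
... | no l with subst (o <_) (m≤n⇒m∸n≡0 (<⇒≤ (≰⇒> l))) h
... | ()

Unique-range : ∀ lo hi -> Unique (range lo hi)
Unique-range lo hi = Uniqueₚ.map⁺ (+-cancelˡ-≡ lo _ _) (Uniqueₚ.upTo⁺ (suc hi ∸ lo))

Unique-if : {A : Set} (b : Bool) (x : A) -> Unique (if b then x ∷ [] else [])
Unique-if true x = [] ∷ []
Unique-if false x = []

∈-if⁻ : {A : Set} {b : Bool} {x v : A} -> v ∈ (if b then x ∷ [] else []) -> b ≡ true × v ≡ x
∈-if⁻ {b = true} 0th = refl , refl

∈-if⁺ : {A : Set} {b : Bool} {x : A} -> b ≡ true -> x ∈ (if b then x ∷ [] else [])
∈-if⁺ refl = 0th

∈-filterᵇ⁺ : {A : Set} (p : A -> Bool) {x : A} {xs : List A} -> x ∈ xs -> p x ≡ true -> x ∈ filterᵇ p xs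
∈-filterᵇ⁺ p a b = ∈-filter⁺ (T? ∘ p) a (true⇒T b)

∈-filterᵇ⁻ : {A : Set} (p : A -> Bool) {x : A} {xs : List A} -> x ∈ filterᵇ p xs -> x ∈ xs × p x ≡ true
∈-filterᵇ⁻ p a with ∈-filter⁻ (T? ∘ p) a
... | b , c = b , T⇒true c

Unique-filterᵇ : {A : Set} (p : A -> Bool) {xs : List A} -> Unique xs -> Unique (filterᵇ p xs)
Unique-filterᵇ p u = Uniqueₚ.filter⁺ (T? ∘ p) u

nonempty : {A : Set} (xs : List A) -> 1 ≤ length xs -> ∃[ x ] x ∈ xs
nonempty (x ∷ xs) h = x , 0th

two-elements : {A : Set} {xs : List A} -> Unique xs -> 2 ≤ length xs -> ∃[ x ] ∃[ y ] x ∈ xs × y ∈ xs × x ≢ y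
two-elements {xs = x ∷ []} u (s≤s ())
two-elements {xs = x ∷ y ∷ xs} u h = x , y , 0th , 1st , \ { refl -> Unique-head u 0th }

module Lifts (N : ℕ) (T : List Arc) where

 -- The conditions tested by `trisFrom`, freed from the enumeration; membership in `trisIn` becomes
 -- this predicate together with a range for the first vertex.
 LiftTri : LTri -> Set
 LiftTri (tri x y z) = x < y × y < z × z ≤ x + N × chordIn N T x y ≡ true × chordIn N T y z ≡ true × chordIn N T x z ≡ true
 LiftTri (trip x y) = x < y × y ≤ x + N × rayIn N T x ≡ true × rayIn N T y ≡ true × chordIn N T x y ≡ true

 start : LTri -> ℕ
 start (tri x _ _) = x
 start (trip x _) = x

 private
  tri2 : ℕ -> ℕ -> ℕ -> List LTri
  tri2 x y z = if chordIn N T x y ∧ (chordIn N T y z ∧ chordIn N T x z) then tri x y z ∷ [] else []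
  tri1 : ℕ -> ℕ -> List LTri
  tri1 x y = concatMap (tri2 x y) (range (suc y) (x + N))
  trip1 : ℕ -> ℕ -> List LTri
  trip1 x y = if rayIn N T x ∧ (rayIn N T y ∧ chordIn N T x y) then trip x y ∷ [] else []

 ∈-trisFrom⁻ : ∀ x {Δ} -> Δ ∈ trisFrom N T x -> start Δ ≡ x × LiftTri Δ
 ∈-trisFrom⁻ x p with ∈-++⁻ (concatMap (tri1 x) (range (suc x) (x + N))) p
 ... | inl q with ∈-concatMap⁻ (tri1 x) (range (suc x) (x + N)) q
 ... | y , y∈ , q₁ with ∈-concatMap⁻ (tri2 x y) (range (suc y) (x + N)) q₁
 ... | z , z∈ , q₂ with ∈-if⁻ q₂
 ... | e , refl with ∧⁻ {chordIn N T x y} e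
 ... | e₁ , e' with ∧⁻ {chordIn N T y z} e'
 ... | e₂ , e₃ = refl , fst (∈-range⁻ y∈) , fst (∈-range⁻ z∈) , snd (∈-range⁻ {suc y} z∈) , e₁ , e₂ , e₃
 ∈-trisFrom⁻ x p | inr q with ∈-concatMap⁻ (trip1 x) (range (suc x) (x + N)) q
 ... | y , y∈ , q₂ with ∈-if⁻ q₂
 ... | e , refl with ∧⁻ {rayIn N T x} e
 ... | e₁ , e' with ∧⁻ {rayIn N T y} e'
 ... | e₂ , e₃ = refl , fst (∈-range⁻ y∈) , snd (∈-range⁻ {suc x} y∈) , e₁ , e₂ , e₃

 ∈-trisFrom⁺ : ∀ {Δ} -> LiftTri Δ -> Δ ∈ trisFrom N T (start Δ)
 ∈-trisFrom⁺ {tri x y z} (a , b , c , e₁ , e₂ , e₃) = ∈-++⁺ˡ (∈-concatMap⁺ {f = tri1 x} (∈-range⁺ a (≤-trans (<⇒≤ b) c)) (∈-concatMap⁺ {f = tri2 x y} (∈-range⁺ b c) (∈-if⁺ (∧⁺ e₁ (∧⁺ e₂ e₃)))))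
 ∈-trisFrom⁺ {trip x y} (a , c , e₁ , e₂ , e₃) = ∈-++⁺ʳ (concatMap (tri1 x) (range (suc x) (x + N))) (∈-concatMap⁺ {f = trip1 x} (∈-range⁺ a c) (∈-if⁺ (∧⁺ e₁ (∧⁺ e₂ e₃))))

 ∈-trisIn⁻ : ∀ {lo hi Δ} -> Δ ∈ trisIn N T lo hi -> lo ≤ start Δ × start Δ ≤ hi × LiftTri Δ
 ∈-trisIn⁻ {lo} {hi} p with ∈-concatMap⁻ (trisFrom N T) (range lo hi) p
 ... | x , x∈ , q with ∈-trisFrom⁻ x q
 ... | refl , l = fst (∈-range⁻ x∈) , snd (∈-range⁻ {lo} x∈) , l

 ∈-trisIn⁺ : ∀ {lo hi Δ} -> lo ≤ start Δ -> start Δ ≤ hi -> LiftTri Δ -> Δ ∈ trisIn N T lo hi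
 ∈-trisIn⁺ a b l = ∈-concatMap⁺ {f = trisFrom N T} (∈-range⁺ a b) (∈-trisFrom⁺ l)

 Unique-trisFrom : ∀ x -> Unique (trisFrom N T x)
 Unique-trisFrom x = Uniqueₚ.++⁺ (Unique-concatMap (Unique-range (suc x) (x + N)) (\ y -> Unique-concatMap (Unique-range (suc y) (x + N)) (\ z -> Unique-if (chordIn N T x y ∧ (chordIn N T y z ∧ chordIn N T x z)) (tri x y z)) (inj₂' y)) inj₁')
  (Unique-concatMap (Unique-range (suc x) (x + N)) (\ y -> Unique-if (rayIn N T x ∧ (rayIn N T y ∧ chordIn N T x y)) (trip x y)) inj₃') disj where
  inj₂' : ∀ y {z z' v} -> v ∈ tri2 x y z -> v ∈ tri2 x y z' -> z ≡ z'
  inj₂' y p q with ∈-if⁻ p | ∈-if⁻ q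
  ... | _ , refl | _ , refl = refl
  inj₁' : ∀ {y y' v} -> v ∈ tri1 x y -> v ∈ tri1 x y' -> y ≡ y'
  inj₁' {y} {y'} p q with ∈-concatMap⁻ (tri2 x y) (range (suc y) (x + N)) p | ∈-concatMap⁻ (tri2 x y') (range (suc y') (x + N)) q
  ... | _ , _ , a | _ , _ , b with ∈-if⁻ a | ∈-if⁻ b
  ... | _ , refl | _ , refl = refl
  inj₃' : ∀ {y y' v} -> v ∈ trip1 x y -> v ∈ trip1 x y' -> y ≡ y'
  inj₃' p q with ∈-if⁻ p | ∈-if⁻ q
  ... | _ , refl | _ , refl = refl
  disj : ∀ {v} -> ¬ (v ∈ concatMap (tri1 x) (range (suc x) (x + N)) × v ∈ concatMap (trip1 x) (range (suc x) (x + N)))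
  disj (p , q) with ∈-concatMap⁻ (tri1 x) (range (suc x) (x + N)) p | ∈-concatMap⁻ (trip1 x) (range (suc x) (x + N)) q
  ... | y , _ , a | _ , _ , b with ∈-concatMap⁻ (tri2 x y) (range (suc y) (x + N)) a
  ... | z , _ , c with ∈-if⁻ c | ∈-if⁻ b
  ... | _ , refl | _ , ()

 Unique-trisIn : ∀ lo hi -> Unique (trisIn N T lo hi)
 Unique-trisIn lo hi = Unique-concatMap (Unique-range lo hi) Unique-trisFrom (\ {x} {y} p q -> trans (sym (fst (∈-trisFrom⁻ x p))) (fst (∈-trisFrom⁻ y q)))

-- Tagged triangulations as maximal sets of compatible tagged arcs.

module Compat (N : ℕ) (3≤N : 3 ≤ N) where

 N>0 : 0 < N
 N>0 = ≤-trans (s≤s z≤n) 3≤N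

 open Residues N N>0 public

 -- Compatibility in the sense of Fomin, Shapiro and Thurston: central arcs conflict exactly if both
 -- their tags and their ends differ.
 tcross : TArc -> TArc -> Bool
 tcross (tct i s) (tct j r) = not (tagEq s r) ∧ not (i ≡ᵇ j)
 tcross a b = cross N (untag a) (untag b)

 N-1 : ℕ
 N-1 = N ∸ 1

 Valid NonCrossing : List TArc -> Set
 Valid A = ∀ {t} -> t ∈ A -> validTArc N t ≡ true
 NonCrossing A = ∀ {t t'} -> t ∈ A -> t' ∈ A -> tcross t t' ≡ false

 -- An intrinsic description without an underlying plain triangulation. In this form two tagged
 -- triangulations that differ in one arc can be compared directly.
 record TagTri (A : List TArc) : Set where
  field
   valid : Valid A
   compat : NonCrossing A
   maximal : ∀ {t} -> validTArc N t ≡ true -> (∀ {t'} -> t' ∈ A -> tcross t t' ≡ false) -> t ∈ A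

 validTnc : ∀ {i L} -> validTArc N (tnc i L) ≡ true -> i < N × 2 ≤ L × L < N
 validTnc {i} {L} e with ∧⁻ {i <ᵇ N} e
 ... | a , b with ∧⁻ {2 ≤ᵇ L} b
 ... | c , d = <ᵇ≡⇒< a , ≤ᵇ≡⇒≤ {2} c , ≤ᵇ≡⇒≤ {suc L} d

 validTnc⁺ : ∀ {i L} -> i < N -> 2 ≤ L -> L < N -> validTArc N (tnc i L) ≡ true
 validTnc⁺ a b c = ∧⁺ (<⇒<ᵇ≡ a) (∧⁺ (≤⇒≤ᵇ≡ b) (≤⇒≤ᵇ≡ c))

 validNc : ∀ {i L} -> validArc N (nc i L) ≡ true -> i < N × 2 ≤ L × L ≤ N
 validNc {i} {L} e with ∧⁻ {i <ᵇ N} e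
 ... | a , b with ∧⁻ {2 ≤ᵇ L} b
 ... | c , d = <ᵇ≡⇒< a , ≤ᵇ≡⇒≤ {2} c , ≤ᵇ≡⇒≤ {L} d

 no-cross-nn : ∀ {x L u M} -> cross N (nc (md N x) L) (nc (md N u) M) ≡ false -> L ≤ N -> M ≤ N -> ¬ ChordsCross x L u M
 no-cross-nn e l m (inl (a , b , c)) = false≢true e (cross-nn₁ a b c l)
 no-cross-nn e l m (inr (a , b , c)) = false≢true e (cross-nn₂ a b c m)

 no-cross-nr : ∀ {x L u} -> cross N (nc (md N x) L) (ct (md N u)) ≡ false -> L ≤ N -> x < u -> u < x + L -> ⊥
 no-cross-nr e l a b = false≢true e (cross-nr a b l)

 compat-rr : ∀ {i j s} -> tcross (tct i s) (tct j (opp s)) ≡ false -> i ≡ j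
 compat-rr {i} {j} {s} e with i ≡ᵇ j in h
 ... | true = ≡ᵇ≡⇒≡ h
 compat-rr {i} {j} {pl} () | false
 compat-rr {i} {j} {nt} () | false

 compat-same : ∀ {i j s} -> tcross (tct i s) (tct j s) ≡ false
 compat-same {s = pl} = refl
 compat-same {s = nt} = refl

 compat-at : ∀ {i s r} -> tcross (tct i s) (tct i r) ≡ false
 compat-at {i} {s} {r} rewrite ≡⇒≡ᵇ≡ {i} {i} refl with tagEq s r
 ... | true = refl
 ... | false = refl

 -- A lifted loop spans a full turn, so some lift of every other boundary point lies strictly under
 -- it.
 loop-cross-r : ∀ {i j} -> i < N -> j < N -> cross N (nc i N) (ct j) ≡ false -> i ≡ j
 loop-cross-r {i} {j} i<N j<N e with <-cmp i j
 ... | tri≈ _ p _ = p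
 ... | tri< h _ _ = ⊥-elim (no-cross-nr {i} {N} {j} (subst₂ (\ a b -> cross N (nc a N) (ct b) ≡ false) (sym (md-small i<N)) (sym (md-small j<N)) e) ≤-refl h (≤-trans j<N (m≤n+m N i)))
 ... | tri> _ _ h = ⊥-elim (no-cross-nr {i} {N} {j + N} (subst₂ (\ a b -> cross N (nc a N) (ct b) ≡ false) (sym (md-small i<N)) (sym (trans (md-+N j) (md-small j<N))) e) ≤-refl (≤-trans i<N (m≤n+m N j)) (+-monoˡ-< N h))

 module _ {T : List Arc} where
  open Lifts N T

  private
   isTrip⁻ : ∀ Δ -> Δ ∈ filterᵇ isTrip (triangles N T) -> ∃[ x ] ∃[ y ] Δ ≡ trip x y × x < N × x < y × y ≤ x + N × ct (md N x) ∈ T × ct (md N y) ∈ T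
   isTrip⁻ Δ p with ∈-filterᵇ⁻ isTrip {Δ} {triangles N T} p
   isTrip⁻ (tri _ _ _) p | _ , ()
   isTrip⁻ (trip x y) p | q , _ with ∈-trisIn⁻ {0} {N-1} {trip x y} q
   ... | _ , x≤ , x<y , y≤ , rx , ry , _ = x , y , refl , ≤-trans (s≤s x≤) (≤-reflexive (m+[n∸m]≡n N>0)) , x<y , y≤ , memA⇒∈ rx , memA⇒∈ ry

  rays-of-d0 : 1 ≤ d0 N T -> ∃[ i ] i < N × ct i ∈ T
  rays-of-d0 h with nonempty (filterᵇ isTrip (triangles N T)) h
  ... | Δ , p with isTrip⁻ Δ p
  ... | x , y , _ , _ , _ , _ , r , _ = md N x , md-< x , r

  -- If all corners of two triangles at the puncture had one residue, both triangles would run from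
  -- x to x + N with the same x below N, and would be equal.
  two-rays-of-d0 : 2 ≤ d0 N T -> ∃[ i ] ∃[ j ] i < N × j < N × i ≢ j × ct i ∈ T × ct j ∈ T
  two-rays-of-d0 h with two-elements {xs = filterᵇ isTrip (triangles N T)} (Unique-filterᵇ isTrip {triangles N T} (Unique-trisIn 0 N-1)) h
  ... | Δ , Δ' , p , p' , u with isTrip⁻ Δ p | isTrip⁻ Δ' p'
  ... | x , y , refl , x<N , x<y , y≤ , rx , ry | x' , y' , refl , x'<N , x'<y' , y'≤ , rx' , ry' with md N x ≟ md N y
  ... | no ne = md N x , md N y , md-< x , md-< y , ne , rx , ry
  ... | yes eq with md N x' ≟ md N y'
  ... | no ne = md N x' , md N y' , md-< x' , md-< y' , ne , rx' , ry'
  ... | yes eq' with md N x ≟ md N x'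
  ... | no ne = md N x , md N x' , md-< x , md-< x' , ne , rx , rx'
  ... | yes ee = ⊥-elim (u (cong₂ trip xx (trans (whole x<y y≤ eq) (trans (cong (_+ N) xx) (sym (whole x'<y' y'≤ eq')))))) where
   xx : x ≡ x'
   xx = trans (sym (md-small x<N)) (trans ee (md-small x'<N))
   whole : ∀ {a b} -> a < b -> b ≤ a + N -> md N a ≡ md N b -> b ≡ a + N
   whole {a} {b} a<b b≤ e with m≤n⇒m<n∨m≡n b≤
   ... | inr r = r
   ... | inl r = ⊥-elim (<-irrefl (md-window e (<⇒≤ a<b) r) a<b)

 toPlain-ofPlain : ∀ a -> toPlain N (ofPlain N a) ≡ a
 toPlain-ofPlain (ct i) = refl
 toPlain-ofPlain (nc i L) with L ≡ᵇ N in e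
 ... | true = cong (nc i) (sym (≡ᵇ≡⇒≡ e))
 ... | false = refl

 valid-ofPlain : ∀ {a} -> validArc N a ≡ true -> validTArc N (ofPlain N a) ≡ true
 valid-ofPlain {ct i} e = e
 valid-ofPlain {nc i L} e with validNc {i} {L} e | L ≡ᵇ N in h
 ... | a , b , c | true = <⇒<ᵇ≡ a
 ... | a , b , c | false = validTnc⁺ a b (≤∧≢⇒< c (\ { refl -> false≢true h (≡⇒≡ᵇ≡ {N} refl) }))

 valid-toPlain : ∀ {t} -> validTArc N t ≡ true -> validArc N (toPlain N t) ≡ true
 valid-toPlain {tct i pl} e = e
 valid-toPlain {tct i nt} e = ∧⁺ e (∧⁺ (≤⇒≤ᵇ≡ (≤-trans (s≤s (s≤s z≤n)) 3≤N)) (≤⇒≤ᵇ≡ {N} ≤-refl))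
 valid-toPlain {tnc i L} e with validTnc {i} e
 ... | a , b , c = ∧⁺ (<⇒<ᵇ≡ a) (∧⁺ (≤⇒≤ᵇ≡ b) (≤⇒≤ᵇ≡ (<⇒≤ c)))

 loop-self : ∀ {i} -> i < N -> cross N (nc i N) (nc i N) ≡ false
 loop-self {i} i<N = ¬true⇒false \ e -> bad (cross-nn⁻ {i} {i} {N} {N} i<N e) where
  bad : ∃[ u ] md N u ≡ i × ChordsCross (i + N) N u N -> ⊥
  bad (u , e , inl (a , b , _)) = <-irrefl (md-window (trans (md-+N i) (trans (md-small i<N) (sym e))) (<⇒≤ a) b) a
  bad (u , e , inr (a , b , _)) = <-irrefl (md-window (trans e (sym (trans (md-+N i) (md-small i<N)))) (<⇒≤ a) b) a

 loop-ray-self : ∀ {i} -> i < N -> cross N (nc i N) (ct i) ≡ false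
 loop-ray-self {i} i<N = ¬true⇒false \ e -> bad (cross-nr⁻ {i} {i} {N} i<N e) where
  bad : ∃[ u ] md N u ≡ i × i + N < u × u < i + N + N -> ⊥
  bad (u , e , a , b) = <-irrefl (md-window (trans (md-+N i) (trans (md-small i<N) (sym e))) (<⇒≤ a) b) a

 -- One end of the lifted loop lies strictly under the chord, and the central arc at that end can
 -- only leave through the chord.
 chord-loop : ∀ {i L j} -> i < N -> 2 ≤ L -> L < N -> j < N -> cross N (nc i L) (nc j N) ≡ true -> cross N (nc i L) (ct j) ≡ true
 chord-loop {i} {L} {j} i<N l L<N j<N e with cross-nn⁻ {i} {j} {L} {N} j<N e
 ... | u , refl , inl (a , b , c) = subst (\ k -> cross N (nc k L) (ct (md N u)) ≡ true) (trans (md-+N i) (md-small i<N)) (cross-nr {i + N} {u} a b (<⇒≤ L<N))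
 ... | u , refl , inr (a , b , c) = subst₂ (\ k l -> cross N (nc k L) (ct l) ≡ true) (trans (md-+N i) (md-small i<N)) (md-+N u) (cross-nr {i + N} {u + N} b c (<⇒≤ L<N))

 loop-chord : ∀ {i L j} -> i < N -> 2 ≤ L -> L < N -> j < N -> cross N (nc j N) (nc i L) ≡ true -> cross N (nc i L) (ct j) ≡ true
 loop-chord {i} {L} {j} i<N l L<N j<N e with cross-nn⁻ {j} {i} {N} {L} i<N e
 ... | u , refl , inl (a , b , c) = subst (\ l -> cross N (nc (md N u) L) (ct l) ≡ true) (trans (md-+N (j + N)) (trans (md-+N j) (md-small j<N))) (cross-nr {u} {j + N + N} b c (<⇒≤ L<N))
 ... | u , refl , inr (a , b , c) = subst (\ l -> cross N (nc (md N u) L) (ct l) ≡ true) (trans (md-+N j) (md-small j<N)) (cross-nr {u} {j + N} a b (<⇒≤ L<N))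

 -- A loop of T must be based at k, since it crosses every other central arc. It represents the
 -- second tag at k, and an arc that avoids the central arc at k avoids this loop as well.
 tagTri₁ : ∀ {A} T -> All (\ t -> validTArc N t ≡ true) A -> IsTriangulation N T -> (∃[ k ] k < N × ct k ∈ T) -> (∀ t -> validTArc N t ≡ true -> (t ∈ A -> memA (toPlain N t) T ≡ true) × (memA (toPlain N t) T ≡ true -> t ∈ A)) -> TagTri A
 tagTri₁ {A} T val (valT , ncr , mx) (k , k<N , k∈) iff = record { valid = valid ; compat = compat ; maximal = maximal } where
  valid : Valid A
  valid = All.lookup val
  toT : ∀ {t} -> t ∈ A -> toPlain N t ∈ T
  toT {t} p = memA⇒∈ (fst (iff t (valid p)) p)
  fromT : ∀ {a} -> a ∈ T -> ofPlain N a ∈ A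
  fromT {a} p = snd (iff (ofPlain N a) (valid-ofPlain {a} (All.lookup valT p))) (∈⇒memA (subst (_∈ T) (sym (toPlain-ofPlain a)) p))
  compat : NonCrossing A
  compat {tnc i L} {tnc j M} p q = ncr _ _ (toT p) (toT q)
  compat {tnc i L} {tct j pl} p q = ncr _ _ (toT p) (toT q)
  compat {tct i pl} {tnc j L} p q = ncr _ _ (toT p) (toT q)
  compat {tct i pl} {tct j pl} p q = refl
  compat {tct i nt} {tct j nt} p q = refl
  compat {tct i pl} {tct j nt} p q with loop-cross-r (<ᵇ≡⇒< (valid q)) (<ᵇ≡⇒< (valid p)) (ncr (nc j N) (ct i) (toT q) (toT p))
  ... | refl = compat-at {i} {pl} {nt}
  compat {tct i nt} {tct j pl} p q with loop-cross-r (<ᵇ≡⇒< (valid p)) (<ᵇ≡⇒< (valid q)) (ncr (nc i N) (ct j) (toT p) (toT q))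
  ... | refl = compat-at {i} {nt} {pl}
  compat {tnc i L} {tct j nt} p q with loop-cross-r (<ᵇ≡⇒< (valid q)) k<N (ncr (nc j N) (ct k) (toT q) k∈)
  ... | refl = ncr (nc i L) (ct j) (toT p) k∈
  compat {tct j nt} {tnc i L} p q with loop-cross-r (<ᵇ≡⇒< (valid p)) k<N (ncr (nc j N) (ct k) (toT p) k∈)
  ... | refl = ncr (ct j) (nc i L) k∈ (toT q)
  maximal : ∀ {t} -> validTArc N t ≡ true -> (∀ {t'} -> t' ∈ A -> tcross t t' ≡ false) -> t ∈ A
  maximal {t} v c = snd (iff t v) (∈⇒memA (mx (toPlain N t) (valid-toPlain {t} v) (free t v c))) where
   free : ∀ t -> validTArc N t ≡ true -> (∀ {t'} -> t' ∈ A -> tcross t t' ≡ false) -> ∀ b -> b ∈ T -> cross N (toPlain N t) b ≡ false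
   free (tnc i L) v c (ct j) p = c (fromT p)
   free (tnc i L) v c (nc j M) p with validNc {j} {M} (All.lookup valT p) | M ≟ N
   ... | j<N , 2≤M , M≤N | no ne = c {tnc j M} (subst (_∈ A) (cong (if_then tct j nt else tnc j M) (≢⇒≡ᵇ≡ ne)) (fromT p))
   ... | j<N , 2≤M , M≤N | yes refl with validTnc {i} v
   ... | a , b , d with loop-cross-r j<N k<N (ncr (nc j N) (ct k) p k∈)
   ... | refl = ¬true⇒false \ e -> false≢true (c (fromT k∈)) (chord-loop a b d j<N e)
   free (tct i pl) v c (ct j) p = refl
   free (tct i pl) v c (nc j M) p with validNc {j} {M} (All.lookup valT p) | M ≟ N
   ... | j<N , 2≤M , M≤N | no ne = c {tnc j M} (subst (_∈ A) (cong (if_then tct j nt else tnc j M) (≢⇒≡ᵇ≡ ne)) (fromT p))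
   ... | j<N , 2≤M , M≤N | yes refl with compat-rr {i} {j} {pl} (c {tct j nt} (subst (_∈ A) (cong (if_then tct j nt else tnc j N) (≡⇒≡ᵇ≡ {N} refl)) (fromT p)))
   ... | refl = loop-ray-self j<N
   free (tct i nt) v c (ct j) p with compat-rr {i} {j} {nt} (c (fromT p))
   ... | refl = loop-ray-self (<ᵇ≡⇒< v)
   free (tct i nt) v c (nc j M) p with validNc {j} {M} (All.lookup valT p) | M ≟ N
   ... | j<N , 2≤M , M≤N | yes refl with compat-rr {i} {k} {nt} (c (fromT k∈)) | loop-cross-r j<N k<N (ncr (nc j N) (ct k) p k∈)
   ... | refl | refl = loop-self k<N
   free (tct i nt) v c (nc j M) p | j<N , 2≤M , M≤N | no ne = ¬true⇒false \ e -> false≢true (c {tnc j M} (subst (_∈ A) (cong (if_then tct j nt else tnc j M) (≢⇒≡ᵇ≡ ne)) (fromT p))) (loop-chord j<N 2≤M (≤∧≢⇒< M≤N ne) (<ᵇ≡⇒< v) e)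
 -- Two central arcs with different ends exclude every loop from T, and they also conflict with each
 -- central arc of the opposite tag.
 tagTri₂ : ∀ {A} T s -> All (\ t -> validTArc N t ≡ true) A -> IsTriangulation N T -> (∃[ i ] ∃[ j ] i < N × j < N × i ≢ j × ct i ∈ T × ct j ∈ T) -> (∀ t -> validTArc N t ≡ true -> (t ∈ A -> tagRule T s t ≡ true) × (tagRule T s t ≡ true -> t ∈ A)) -> TagTri A
 tagTri₂ {A} T s val (valT , ncr , mx) (a , b , a<N , b<N , a≢b , a∈ , b∈) iff = record { valid = valid ; compat = compat ; maximal = maximal } where
  valid : Valid A
  valid = All.lookup val
  tags : ∀ {i r} -> tct i r ∈ A -> r ≡ s × ct i ∈ T
  tags {i} {r} p with ∧⁻ {tagEq s r} (fst (iff (tct i r) (valid p)) p)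
  ... | a , b = sym (tagEq⇒≡ s r a) , memA⇒∈ b
  chord : ∀ {i L} -> tnc i L ∈ A -> nc i L ∈ T
  chord {i} {L} p = memA⇒∈ (fst (iff (tnc i L) (valid p)) p)
  fromRay : ∀ {i} -> i < N -> ct i ∈ T -> tct i s ∈ A
  fromRay {i} h p = snd (iff (tct i s) (<⇒<ᵇ≡ h)) (∧⁺ (tagEq-refl s) (∈⇒memA p))
  fromChord : ∀ {i L} -> i < N -> 2 ≤ L -> L < N -> nc i L ∈ T -> tnc i L ∈ A
  fromChord {i} {L} a b c p = snd (iff (tnc i L) (validTnc⁺ a b c)) (∈⇒memA p)
  compat : NonCrossing A
  compat {tnc i L} {tnc j M} p q = ncr _ _ (chord p) (chord q)
  compat {tnc i L} {tct j r} p q = ncr _ _ (chord p) (snd (tags q))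
  compat {tct j r} {tnc i L} p q = ncr _ _ (snd (tags p)) (chord q)
  compat {tct i r} {tct j r'} p q with fst (tags p) | fst (tags q)
  ... | refl | refl = compat-same {i} {j} {s}
  noLoop : ∀ {i} -> i < N -> nc i N ∉ T
  noLoop i<N p with loop-cross-r i<N a<N (ncr _ _ p a∈) | loop-cross-r i<N b<N (ncr _ _ p b∈)
  ... | refl | refl = a≢b refl
  maximal : ∀ {t} -> validTArc N t ≡ true -> (∀ {t'} -> t' ∈ A -> tcross t t' ≡ false) -> t ∈ A
  maximal {tnc i L} v c with validTnc {i} v
  ... | p , q , r = fromChord p q r (mx (nc i L) (∧⁺ (<⇒<ᵇ≡ p) (∧⁺ (≤⇒≤ᵇ≡ q) (≤⇒≤ᵇ≡ (<⇒≤ r)))) free) where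
   free : ∀ b -> b ∈ T -> cross N (nc i L) b ≡ false
   free (ct j) p = c (fromRay (<ᵇ≡⇒< (All.lookup valT p)) p)
   free (nc j M) p with validNc {j} {M} (All.lookup valT p) | M ≟ N
   ... | j<N , 2≤M , M≤N | no ne = c (fromChord j<N 2≤M (≤∧≢⇒< M≤N ne) p)
   ... | j<N , 2≤M , M≤N | yes refl = ⊥-elim (noLoop j<N p)
  maximal {tct i r} v c = snd (iff (tct i r) v) (∧⁺ same (∈⇒memA (mx (ct i) v free))) where
   same : tagEq s r ≡ true
   same with tag-cases s r
   ... | inl refl = tagEq-refl s
   ... | inr refl with compat-rr {i} {a} {opp s} (c (subst (\ q -> tct a q ∈ A) (sym (opp-invol s)) (fromRay a<N a∈))) | compat-rr {i} {b} {opp s} (c (subst (\ q -> tct b q ∈ A) (sym (opp-invol s)) (fromRay b<N b∈)))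
   ... | refl | refl = ⊥-elim (a≢b refl)
   free : ∀ b -> b ∈ T -> cross N (ct i) b ≡ false
   free (ct j) p = refl
   free (nc j M) p with validNc {j} {M} (All.lookup valT p) | M ≟ N
   ... | j<N , 2≤M , M≤N | no ne = c (fromChord j<N 2≤M (≤∧≢⇒< M≤N ne) p)
   ... | j<N , 2≤M , M≤N | yes refl = ⊥-elim (noLoop j<N p)

 tagTri : ∀ {A} -> IsTaggedTriangulation N A -> TagTri A
 tagTri (val , T , tr , inl (d1 , iff)) = tagTri₁ T val tr (rays-of-d0 {T} (≤-reflexive (sym d1))) iff
 tagTri (val , T , tr , inr (d2 , s , iff)) = tagTri₂ T s val tr (two-rays-of-d0 {T} d2) iff

-- Triangles glued along half-edges.

data Tri : Set where
 tr : ℕ -> ℕ -> ℕ -> Tri  -- tr i L M : vertices i, i+L, i+L+M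
 tp : ℕ -> ℕ -> Tag -> Tri  -- tp i L s : vertices i, i+L, puncture; central sides tagged s

-- A half-edge: an arc or boundary segment seen from one of its two sides.
data Half : Set where
 up dn : ℕ -> ℕ -> Half  -- chord (i, i+L) seen from the puncture side / from the boundary side
 lp : ℕ -> Half  -- the loop at i enclosing two differently tagged central arcs
 rr rl : ℕ -> Tag -> Half  -- central arc seen from its clockwise / anticlockwise side

module Geometry (N : ℕ) (3≤N : 3 ≤ N) where
 open Compat N 3≤N public

 top : ℕ -> ℕ -> Half
 top i K = if K ≡ᵇ N then lp i else dn i K

 halves : Tri -> List Half
 halves (tr i L M) = up i L ∷ up (md N (i + L)) M ∷ top i (L + M) ∷ []
 halves (tp i L s) = up i L ∷ rl (md N (i + L)) s ∷ rr i s ∷ []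

 -- The self-folded triangle is not listed. Two differently tagged arcs with one end, called twins
 -- below, are hidden behind the half-edge `lp`, so a triangle at the puncture always has L < N.
 TriOK : Tri -> Set
 TriOK (tr i L M) = i < N × 1 ≤ L × 1 ≤ M × L + M ≤ N
 TriOK (tp i L s) = i < N × 1 ≤ L × L < N

 -- Twins are seen from outside only through their loop, so the sides of a central arc are expected
 -- only in the absence of its twin.
 Expected : List TArc -> Half -> Set
 Expected A (up i L) = i < N × (L ≡ 1 ⊎ tnc i L ∈ A)
 Expected A (dn i L) = tnc i L ∈ A
 Expected A (lp i) = tct i pl ∈ A × tct i nt ∈ A
 Expected A (rr i s) = tct i s ∈ A × tct i (opp s) ∉ A
 Expected A (rl i s) = tct i s ∈ A × tct i (opp s) ∉ A

 -- That every half-edge occurs exactly once is enough to step from a triangle to its neighbours;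
 -- planarity is supplied later by the compatibility of the arcs.
 record Triangles (A : List TArc) (Ts : List Tri) : Set where
  field
   ok : ∀ {Δ} -> Δ ∈ Ts -> TriOK Δ
   uniq : Unique (concatMap halves Ts)
   sound : ∀ {h} -> h ∈ concatMap halves Ts -> Expected A h
   complete : ∀ {h} -> Expected A h -> h ∈ concatMap halves Ts

 Side : List TArc -> ℕ -> ℕ -> Set
 Side A i L = L ≡ 1 ⊎ tnc i L ∈ A

 -- The loop is not itself an arc of A; it serves as a side as soon as both tags are present at its
 -- base.
 Top : List TArc -> ℕ -> ℕ -> Set
 Top A i K = (K ≡ N × tct i pl ∈ A × tct i nt ∈ A) ⊎ (K < N × tnc i K ∈ A)

 both : ∀ {A i} -> tct i pl ∈ A -> tct i nt ∈ A -> ∀ s -> tct i s ∈ A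
 both p q pl = p
 both p q nt = q

 top-loop : ∀ {i K} -> K ≡ N -> top i K ≡ lp i
 top-loop {i} {K} e = cong (if_then lp i else dn i K) (≡⇒≡ᵇ≡ e)

 top-chord : ∀ {i K} -> K ≢ N -> top i K ≡ dn i K
 top-chord {i} {K} e = cong (if_then lp i else dn i K) (≢⇒≡ᵇ≡ e)

 module Crossing {A : List TArc} (valid : Valid A) (compat : NonCrossing A) where

  side-top : ∀ {i L} -> Side A i L -> 2 ≤ L -> Top A i L
  side-top (inl refl) (s≤s ())
  side-top (inr p) _ = inr (snd (snd (validTnc (valid p))) , p)

  chord-ray : ∀ {x L u s} -> tnc (md N x) L ∈ A -> tct (md N u) s ∈ A -> x < u -> u < x + L -> ⊥
  chord-ray p q = no-cross-nr (compat p q) (<⇒≤ (snd (snd (validTnc (valid p)))))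

  opposite-rays : ∀ {i j s} -> tct i s ∈ A -> tct j (opp s) ∈ A -> i ≡ j
  opposite-rays {i} {j} {s} p q = compat-rr {i} {j} {s} (compat p q)

  top-ray : ∀ {x K u s} -> Top A (md N x) K -> tct (md N u) s ∈ A -> x < u -> u < x + K -> ⊥
  top-ray (inr (_ , p)) q a b = chord-ray p q a b
  top-ray {s = s} (inl (refl , p , p')) q a b = <-irrefl (md-window (sym (opposite-rays q (both p p' (opp s)))) (<⇒≤ a) b) a

  -- A loop is traded for a central arc at its base, which the other chord crosses as well; two
  -- loops are traded for central arcs with opposite tags.
  top-top : ∀ {x K u M} -> Top A (md N x) K -> Top A (md N u) M -> ChordsCross x K u M -> ⊥
  top-top (inr (k , p)) (inr (m , q)) c = no-cross-nn (compat p q) (<⇒≤ k) (<⇒≤ m) c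
  top-top {x} {K} {u} {M} (inl (refl , p , p')) (inr (m , q)) (inl (a , b , c)) = chord-ray {u} {M} {x + N} q (subst (\ i -> tct i pl ∈ A) (sym (md-+N x)) p) b c
  top-top {x} {K} {u} {M} (inl (refl , p , p')) (inr (m , q)) (inr (a , b , c)) = chord-ray q p a b
  top-top {x} {K} {u} {M} (inr (m , q)) (inl (refl , p , p')) (inl (a , b , c)) = chord-ray q p a b
  top-top {x} {K} {u} {M} (inr (m , q)) (inl (refl , p , p')) (inr (a , b , c)) = chord-ray {x} {K} {u + N} q (subst (\ i -> tct i pl ∈ A) (sym (md-+N u)) p) b c
  top-top (inl (refl , p , p')) (inl (refl , q , q')) (inl (a , b , c)) = <-irrefl (md-window (opposite-rays p q') (<⇒≤ a) b) a
  top-top (inl (refl , p , p')) (inl (refl , q , q')) (inr (a , b , c)) = <-irrefl (md-window (opposite-rays q p') (<⇒≤ a) b) a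

 module Structure {A : List TArc} {Ts : List Tri} (TT : Triangles A Ts) where
  open Triangles TT public

  half : ∀ {Δ h} -> Δ ∈ Ts -> h ∈ halves Δ -> Expected A h
  half p q = sound (∈-concatMap⁺ {f = halves} p q)

  top-expected : ∀ {i K} -> K ≤ N -> Expected A (top i K) -> Top A i K
  top-expected {i} {K} k e with K ≟ N
  ... | yes r = inl (r , subst (Expected A) (top-loop r) e)
  ... | no r = inr (≤∧≢⇒< k r , subst (Expected A) (top-chord r) e)

  tr-sides : ∀ {x L M} -> tr (md N x) L M ∈ Ts -> Side A (md N x) L × Side A (md N (x + L)) M × Top A (md N x) (L + M)
  tr-sides {x} {L} {M} p = snd (half p 0th) , subst (\ i -> Side A i M) (md-md+ x L) (snd (half p 1st)) , top-expected (snd (snd (snd (ok p)))) (half p 2nd)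

  tp-sides : ∀ {x L s} -> tp (md N x) L s ∈ Ts -> Side A (md N x) L × (tct (md N x) s ∈ A × tct (md N x) (opp s) ∉ A) × (tct (md N (x + L)) s ∈ A × tct (md N (x + L)) (opp s) ∉ A)
  tp-sides {x} {L} {s} p = snd (half p 0th) , half p 2nd , subst (\ i -> tct i s ∈ A × tct i (opp s) ∉ A) (md-md+ x L) (half p 1st)

  data Above (x L : ℕ) : Set where
   right : ∀ M -> tr (md N x) L M ∈ Ts -> Above x L
   left : ∀ a K -> a + K ≡ x -> tr (md N a) K L ∈ Ts -> Above x L
   center : ∀ s -> tp (md N x) L s ∈ Ts -> Above x L

  up≢top : ∀ {i L j K} -> up i L ≢ top j K
  up≢top {j = j} {K} e with K ≡ᵇ N | e
  ... | true | ()
  ... | false | ()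

  -- The lower bound on x keeps the first vertex a natural number when the triangle found starts to
  -- the left of x.
  above : ∀ {x L} -> N ≤ x -> Side A (md N x) L -> Above x L
  above {x} {L} N≤x s with ∈-concatMap⁻ halves Ts (complete {up (md N x) L} (md-< x , s))
  ... | tr i K M , p , here refl = right M p
  ... | tr i K M , p , there (there (here e)) = ⊥-elim (up≢top e)
  ... | tp i K s , p , here refl = center s p
  ... | tp i K s , p , there (there (there ()))
  ... | tr i K M , p , there (here e) with up-inj e where
   up-inj : ∀ {i L j K} -> up i L ≡ up j K -> i ≡ j × L ≡ K
   up-inj refl = refl , refl
  ... | e' , refl = left (x ∸ K) K (m∸n+n≡m K≤x) (subst (\ j -> tr j K L ∈ Ts) i≡ p) where
   K≤x : K ≤ x
   K≤x = ≤-trans (≤-trans (m≤m+n K M) (snd (snd (snd (ok p))))) N≤x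
   i≡ = trans (sym (md-small (fst (ok p)))) (md-cancel K (trans (sym e') (cong (md N) (sym (m∸n+n≡m K≤x)))))

  up≢ : ∀ {i j K L M} -> dn i K ∈ halves (tr j L M) -> i ≡ j × L + M ≡ K × K ≢ N
  up≢ (there (there (here e))) = go _ _ e where
   go : ∀ {i K} j K' -> dn i K ≡ top j K' -> i ≡ j × K' ≡ K × K ≢ N
   go j K' e with K' ≡ᵇ N in h | e
   ... | false | refl = refl , refl , \ { refl -> false≢true h (≡⇒≡ᵇ≡ {N} refl) }

  below : ∀ {i K} -> tnc i K ∈ A -> ∃[ L ] ∃[ M ] L + M ≡ K × tr i L M ∈ Ts
  below {i} {K} q with ∈-concatMap⁻ halves Ts (complete {dn i K} q)
  ... | tr j L M , p , h with up≢ h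
  ... | refl , e , _ = L , M , e , p
  below {i} {K} q | tp j L s , p , there (there (there ()))

  loop-below : ∀ {i} -> tct i pl ∈ A -> tct i nt ∈ A -> ∃[ L ] ∃[ M ] L + M ≡ N × tr i L M ∈ Ts
  loop-below {i} q q' with ∈-concatMap⁻ halves Ts (complete {lp i} (q , q'))
  ... | tp j L s , p , there (there (there ()))
  ... | tr j L M , p , there (there (here e)) with go j (L + M) e where
   go : ∀ {i} j K' -> lp i ≡ top j K' -> i ≡ j × K' ≡ N
   go j K' e with K' ≡ᵇ N in h | e
   ... | true | refl = refl , ≡ᵇ≡⇒≡ h
  ... | refl , e' = L , M , e' , p

  ray-right : ∀ {i s} -> tct i s ∈ A -> tct i (opp s) ∉ A -> ∃[ L ] tp i L s ∈ Ts
  ray-right {i} {s} q q' with ∈-concatMap⁻ halves Ts (complete {rr i s} (q , q'))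
  ... | tp j L s , p , there 1st = L , p
  ... | tr j L M , p , there (there (here e)) = ⊥-elim (go j (L + M) e) where
   go : ∀ j K' -> rr i s ≡ top j K' -> ⊥
   go j K' e with K' ≡ᵇ N | e
   ... | true | ()
   ... | false | ()

  ray-left : ∀ {x s} -> N ≤ x -> tct (md N x) s ∈ A -> tct (md N x) (opp s) ∉ A -> ∃[ a ] ∃[ L ] a + L ≡ x × tp (md N a) L s ∈ Ts
  ray-left {x} {s} N≤x q q' with ∈-concatMap⁻ halves Ts (complete {rl (md N x) s} (q , q'))
  ... | tr j L M , p , there (there (here e)) = ⊥-elim (go j (L + M) e) where
   go : ∀ j K' -> rl (md N x) s ≡ top j K' -> ⊥
   go j K' e with K' ≡ᵇ N | e
   ... | true | ()
   ... | false | ()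
  ... | tp j L r , p , there (there (there ()))
  ... | tp j L r , p , there (here e) with inj e where
   inj : ∀ {i s j r} -> rl i s ≡ rl j r -> i ≡ j × s ≡ r
   inj refl = refl , refl
  ... | e' , refl = x ∸ L , L , m∸n+n≡m L≤x , subst (\ j -> tp j L s ∈ Ts) j≡ p where
   L≤x : L ≤ x
   L≤x = ≤-trans (<⇒≤ (snd (snd (ok p)))) N≤x
   j≡ = trans (sym (md-small (fst (ok p)))) (md-cancel L (trans (sym e') (cong (md N) (sym (m∸n+n≡m L≤x)))))

  ok-tr : ∀ {i L M} -> tr i L M ∈ Ts -> 1 ≤ L × 1 ≤ M × L + M ≤ N
  ok-tr p = snd (ok p)

 module Geo {A : List TArc} {Ts : List Tri} (TT : Triangles A Ts) (valid : Valid A) (compat : NonCrossing A) where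
  open Structure TT public
  open Crossing valid compat public

  -- The triangle above the first side is the only candidate. With any other third corner, one of
  -- its sides would cross one of the two remaining given sides.
  lift-tr : ∀ {x L M} -> N ≤ x -> 1 ≤ L -> 1 ≤ M -> Side A (md N x) L -> Side A (md N (x + L)) M -> Top A (md N x) (L + M) -> tr (md N x) L M ∈ Ts
  lift-tr {x} {L} {M} N≤x 1≤L 1≤M sL sM tLM with above N≤x sL
  ... | center s p = ⊥-elim (top-ray {x} {L + M} {x + L} tLM (fst (snd (snd (tp-sides p)))) (m<m+n x 1≤L) (m+n<m+[n+o] x L 1≤M))
  ... | left a K refl p = ⊥-elim (top-top {a} {K + L} {a + K} {L + M} (snd (snd (tr-sides p))) tLM (inl (m<m+n a (fst (ok-tr p)) , m+n<m+[n+o] a K 1≤L , lia 4 (\ a K L M -> (# 1 :≤ M) ∷ [] ⊢ a :+ (K :+ L) :< a :+ K :+ (L :+ M)) a K L M 1≤M)))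
  ... | right M' p with <-cmp M M'
  ... | tri≈ _ refl _ = p
  ... | tri< h _ _ = ⊥-elim (top-top {x} {L + M} {x + L} {M'} tLM (side-top (fst (snd (tr-sides p))) (≤-trans (s≤s 1≤M) h)) (inl (m<m+n x 1≤L , m+n<m+[n+o] x L 1≤M , lia 4 (\ x L M M' -> (M :< M') ∷ [] ⊢ x :+ (L :+ M) :< x :+ L :+ M') x L M M' h)))
  ... | tri> _ _ h = ⊥-elim (top-top {x} {L + M'} {x + L} {M} (snd (snd (tr-sides p))) (side-top sM (≤-trans (s≤s (fst (snd (ok-tr p)))) h)) (inl (m<m+n x 1≤L , m+n<m+[n+o] x L (fst (snd (ok-tr p))) , lia 4 (\ x L M M' -> (M' :< M) ∷ [] ⊢ x :+ (L :+ M') :< x :+ L :+ M) x L M M' h)))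

  lift-tp : ∀ {x L s s'} -> N ≤ x -> 1 ≤ L -> Side A (md N x) L -> tct (md N x) s ∈ A -> tct (md N (x + L)) s' ∈ A -> ∃[ r ] tp (md N x) L r ∈ Ts
  lift-tp {x} {L} N≤x 1≤L sL px pL with above N≤x sL
  ... | center s p = s , p
  ... | right M p = ⊥-elim (top-ray {x} {L + M} {x + L} (snd (snd (tr-sides p))) pL (m<m+n x 1≤L) (m+n<m+[n+o] x L (fst (snd (ok-tr p)))))
  ... | left a K refl p = ⊥-elim (top-ray {a} {K + L} {a + K} (snd (snd (tr-sides p))) px (m<m+n a (fst (ok-tr p))) (m+n<m+[n+o] a K 1≤L))

  module Maximal where
   chord-top : ∀ {x K u M} -> K < N -> (∀ {t'} -> t' ∈ A -> tcross (tnc (md N x) K) t' ≡ false) -> Top A (md N u) M -> ChordsCross x K u M -> ⊥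
   chord-top k c (inr (m , p)) cr = no-cross-nn (c p) (<⇒≤ k) (<⇒≤ m) cr
   chord-top k c (inl (refl , p , _)) (inl (a , b , _)) = no-cross-nr (c p) (<⇒≤ k) a b
   chord-top {x} {K} {u} k c (inl (refl , p , _)) (inr (_ , a , b)) = no-cross-nr {x} {K} {u + N} (c (subst (\ i -> tct i pl ∈ A) (sym (md-+N u)) p)) (<⇒≤ k) a b
   -- Follow the triangles at x, starting from the boundary, until the chord of length K is reached.
   chord : ∀ {x K} -> N ≤ x -> 2 ≤ K -> K < N -> (∀ {t'} -> t' ∈ A -> tcross (tnc (md N x) K) t' ≡ false) -> tnc (md N x) K ∈ A
   chord {x} {K} N≤x 2≤K K<N c = go K 1 ≤-refl (≤-trans (s≤s z≤n) 2≤K) (m≤n+m K 1) (inl refl) where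
    go : ∀ fuel L -> 1 ≤ L -> L ≤ K -> K ≤ L + fuel -> Side A (md N x) L -> tnc (md N x) K ∈ A
    go zero L 1≤L L≤K f s with ≤-antisym L≤K (subst (K ≤_) (+-identityʳ L) f)
    go zero L 1≤L L≤K f (inl refl) | refl = <-absurd 2≤K
    go zero L 1≤L L≤K f (inr p) | refl = p
    go (suc fuel) L 1≤L L≤K f s with m≤n⇒m<n∨m≡n L≤K
    go (suc fuel) L 1≤L L≤K f (inl refl) | inr refl = <-absurd 2≤K
    go (suc fuel) L 1≤L L≤K f (inr p) | inr refl = p
    go (suc fuel) L 1≤L L≤K f s | inl L<K with above N≤x s
    ... | center r p = ⊥-elim (no-cross-nr {x} {K} {x + L} (c (fst (snd (snd (tp-sides p))))) (<⇒≤ K<N) (m<m+n x 1≤L) (+-monoʳ-< x L<K))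
    ... | left a J refl p = ⊥-elim (chord-top {a + J} {K} {a} {J + L} K<N c (snd (snd (tr-sides p))) (inr (m<m+n a (fst (ok-tr p)) , m+n<m+[n+o] a J 1≤L , lia 4 (\ a J L K -> (L :< K) ∷ [] ⊢ a :+ (J :+ L) :< a :+ J :+ K) a J L K L<K)))
    ... | right M p with L + M ≤? K
    ... | yes h = go fuel (L + M) (≤-trans 1≤L (m≤m+n L M)) h (lia 4 (\ L M K f -> (# 1 :≤ M) ∷ (K :≤ L :+ (# 1 :+ f)) ∷ [] ⊢ K :≤ L :+ M :+ f) L M K fuel (fst (snd (ok-tr p))) f) (inside (snd (snd (tr-sides p)))) where
     inside : Top A (md N x) (L + M) -> Side A (md N x) (L + M)
     inside (inl (e , _)) = ⊥-elim (<-irrefl e (≤-<-trans h K<N))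
     inside (inr (_ , q)) = inr q
    ... | no h = ⊥-elim (chord-top {x} {K} {x + L} {M} K<N c (side-top (fst (snd (tr-sides p))) (lia 3 (\ L M K -> (L :< K) ∷ (K :< L :+ M) ∷ [] ⊢ # 2 :≤ M) L M K L<K (≰⇒> h))) (inl (m<m+n x 1≤L , +-monoʳ-< x L<K , lia 4 (\ x L M K -> (K :< L :+ M) ∷ [] ⊢ x :+ K :< x :+ L :+ M) x L M K (≰⇒> h))))
   -- Walk through the triangles at x until one touches the puncture or closes up to a loop at x. A
   -- triangle whose far side passes over x can only have a loop there, and compatibility with the
   -- twins inside identifies the two bases.
   ray : ∀ {x s} -> N ≤ x -> (∀ {t'} -> t' ∈ A -> tcross (tct (md N x) s) t' ≡ false) -> ∃[ r ] tct (md N x) r ∈ A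
   ray {x} {s} N≤x c = go N 1 ≤-refl (m≤n+m N 1) (inl refl) where
    go : ∀ fuel L -> 1 ≤ L -> N ≤ L + fuel -> Side A (md N x) L -> ∃[ r ] tct (md N x) r ∈ A
    go fuel L 1≤L f sd with above N≤x sd
    ... | center r p = r , fst (fst (snd (tp-sides p)))
    ... | left a J refl p with snd (snd (tr-sides p))
    ... | inr (k , q) = ⊥-elim (no-cross-nr {a} {J + L} {a + J} (c q) (<⇒≤ k) (m<m+n a (fst (ok-tr p))) (m+n<m+[n+o] a J 1≤L))
    ... | inl (e , q , q') = s , subst (\ i -> tct i s ∈ A) (sym (compat-rr {md N (a + J)} {md N a} {s} (c (both q q' (opp s))))) (both q q' s)
    go fuel L 1≤L f sd | right M p with snd (snd (tr-sides p))
    ... | inl (e , q , q') = pl , q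
    go zero L 1≤L f sd | right M p | inr (k , q) = ⊥-elim (lia 3 (\ N L M -> (N :≤ L :+ # 0) ∷ (L :+ M :< N) ∷ [] ⊢ :⊥) N L M f k)
    go (suc fuel) L 1≤L f sd | right M p | inr (k , q) = go fuel (L + M) (≤-trans 1≤L (m≤m+n L M)) (lia 4 (\ L M N f -> (# 1 :≤ M) ∷ (N :≤ L :+ (# 1 :+ f)) ∷ [] ⊢ N :≤ L :+ M :+ f) L M N fuel (fst (snd (ok-tr p))) f) (inr q)

-- Fractions with an integral value.

infix 4 _≈ᶠ_

record _≈ᶠ_ (f : Frac) (z : ℤ) : Set where
 constructor frac
 field
  fraction : pos (fst f) ≡ z *Z pos (snd f)

one-≈ : oneF ≈ᶠ 1ℤ
one-≈ = frac refl

mul-≈ : ∀ {f g y z} -> f ≈ᶠ y -> g ≈ᶠ z -> mulF f g ≈ᶠ y *Z z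
mul-≈ {a , b} {c , d} {y} {z} (frac p) (frac q) = frac ( trans (ℤₚ.pos-* a c) (trans (cong₂ _*Z_ p q) (trans (lemma y (pos b) z (pos d)) (cong (y *Z z *Z_) (sym (ℤₚ.pos-* b d)))))) where
 lemma : ∀ y b z d -> (y *Z b) *Z (z *Z d) ≡ y *Z z *Z (b *Z d)
 lemma = solve-∀

add-≈ : ∀ {f g y z} -> f ≈ᶠ y -> g ≈ᶠ z -> addF f g ≈ᶠ y +Z z
add-≈ {a , b} {c , d} {y} {z} (frac p) (frac q) = frac ( trans (cong₂ _+Z_ (trans (ℤₚ.pos-* a d) (cong (_*Z pos d) p)) (trans (ℤₚ.pos-* c b) (cong (_*Z pos b) q))) (trans (lemma y (pos b) z (pos d)) (cong ((y +Z z) *Z_) (sym (ℤₚ.pos-* b d))))) where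
 lemma : ∀ y b z d -> (y *Z b) *Z d +Z (z *Z d) *Z b ≡ (y +Z z) *Z (b *Z d)
 lemma = solve-∀

-- No denominator has to be nonzero: the relation f ≈ᶠ z is stated without division.
div-≈ : ∀ {f g y z w} -> f ≈ᶠ y -> g ≈ᶠ z -> z *Z w ≡ y -> divF f g ≈ᶠ w
div-≈ {a , b} {c , d} {y} {z} {w} (frac p) (frac q) e = frac ( trans (ℤₚ.pos-* a d) (trans (cong (_*Z pos d) (trans p (cong (_*Z pos b) (sym e)))) (trans (lemma z w (pos b) (pos d)) (trans (cong (\ t -> w *Z (pos b *Z t)) (sym q)) (cong (w *Z_) (sym (ℤₚ.pos-* b c))))))) where
 lemma : ∀ z w b d -> (z *Z w *Z b) *Z d ≡ w *Z (b *Z (z *Z d))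
 lemma = solve-∀

pow : ℤ -> ℕ -> ℤ
pow z zero = 1ℤ
pow z (suc n) = z *Z pow z n

pow-≈ : ∀ {f z} n -> f ≈ᶠ z -> powF f n ≈ᶠ pow z n
pow-≈ zero p = one-≈
pow-≈ {f} (suc n) p = mul-≈ {f} {powF f n} p (pow-≈ n p)

pow-+ : ∀ z m n -> pow z (m + n) ≡ pow z m *Z pow z n
pow-+ z zero n = sym (ℤₚ.*-identityˡ _)
pow-+ z (suc m) n = trans (cong (z *Z_) (pow-+ z m n)) (sym (ℤₚ.*-assoc z _ _))

prodℤ : {A : Set} -> (A -> ℤ) -> List A -> ℤ
prodℤ g [] = 1ℤ
prodℤ g (x ∷ xs) = g x *Z prodℤ g xs

prodF-≈ : {A : Set} (φ : A -> Frac) (g : A -> ℤ) (xs : List A) -> (∀ {x} -> x ∈ xs -> φ x ≈ᶠ g x) -> prodF (map φ xs) ≈ᶠ prodℤ g xs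
prodF-≈ φ g xs h = subst (prodF (map φ xs) ≈ᶠ_) (ℤₚ.*-identityˡ _) (go xs oneF 1ℤ one-≈ h) where
 go : ∀ xs f z -> f ≈ᶠ z -> (∀ {x} -> x ∈ xs -> φ x ≈ᶠ g x) -> foldl mulF f (map φ xs) ≈ᶠ z *Z prodℤ g xs
 go [] f z e h = subst (f ≈ᶠ_) (sym (ℤₚ.*-identityʳ z)) e
 go (x ∷ xs) f z e h = subst (foldl mulF (mulF f (φ x)) (map φ xs) ≈ᶠ_) (ℤₚ.*-assoc z (g x) _) (go xs (mulF f (φ x)) (z *Z g x) (mul-≈ {f} {φ x} e (h 0th)) (\ p -> h (there p)))

prodℤ-* : {A : Set} (g h : A -> ℤ) (xs : List A) -> prodℤ (\ x -> g x *Z h x) xs ≡ prodℤ g xs *Z prodℤ h xs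
prodℤ-* g h [] = refl
prodℤ-* g h (x ∷ xs) = trans (cong (g x *Z h x *Z_) (prodℤ-* g h xs)) (lemma (g x) (h x) _ _) where
 lemma : ∀ a b c d -> a *Z b *Z (c *Z d) ≡ a *Z c *Z (b *Z d)
 lemma = solve-∀

prodℤ-cong : {A : Set} {g h : A -> ℤ} (xs : List A) -> (∀ {x} -> x ∈ xs -> g x ≡ h x) -> prodℤ g xs ≡ prodℤ h xs
prodℤ-cong [] e = refl
prodℤ-cong (x ∷ xs) e = cong₂ _*Z_ (e 0th) (prodℤ-cong xs (\ p -> e (there p)))

prodℤ-1 : {A : Set} {g : A -> ℤ} (xs : List A) -> (∀ {x} -> x ∈ xs -> g x ≡ 1ℤ) -> prodℤ g xs ≡ 1ℤ
prodℤ-1 [] e = refl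
prodℤ-1 (x ∷ xs) e = cong₂ _*Z_ (e 0th) (prodℤ-1 xs (\ p -> e (there p)))

prodℤ-↭ : {A : Set} (g : A -> ℤ) {xs ys : List A} -> xs ↭ ys -> prodℤ g xs ≡ prodℤ g ys
prodℤ-↭ g Perm.refl = refl
prodℤ-↭ g (prep x p) = cong (g x *Z_) (prodℤ-↭ g p)
prodℤ-↭ g (swap x y p) = trans (cong (\ t -> g x *Z (g y *Z t)) (prodℤ-↭ g p)) (lemma (g x) (g y) _) where
 lemma : ∀ a b c -> a *Z (b *Z c) ≡ b *Z (a *Z c)
 lemma = solve-∀
prodℤ-↭ g (Perm.trans p q) = trans (prodℤ-↭ g p) (prodℤ-↭ g q)

-- The signed adjacency form of glued triangles and its mutation.

arcsOf : Half -> List TArc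
arcsOf (up i L) = tnc i L ∷ []
arcsOf (dn i L) = tnc i L ∷ []
arcsOf (lp i) = tct i pl ∷ tct i nt ∷ []
arcsOf (rr i s) = tct i s ∷ []
arcsOf (rl i s) = tct i s ∷ []

-- Twins share the half-edge `lp` and therefore get equal rows and columns, as in the matrix of a
-- triangulation with a self-folded triangle.
ind : Half -> TArc -> ℕ
ind h t = if memT t (arcsOf h) then 1 else 0

ind-∈ : ∀ {h t} -> t ∈ arcsOf h -> ind h t ≡ 1
ind-∈ p = cong (if_then 1 else 0) (∈⇒memT p)

ind-∉ : ∀ {h t} -> t ∉ arcsOf h -> ind h t ≡ 0
ind-∉ p = cong (if_then 1 else 0) (∉⇒memT p)

indℤ : Half -> TArc -> ℤ
indℤ h t = pos (ind h t)

-- Applied to indicators of three sides in cyclic order, this is the contribution of a single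
-- triangle to the signed adjacency matrix.
F3 : ℤ -> ℤ -> ℤ -> ℤ -> ℤ -> ℤ -> ℤ
F3 x₁ x₂ x₃ y₁ y₂ y₃ = (x₁ *Z y₂ -Z x₂ *Z y₁) +Z ((x₂ *Z y₃ -Z x₃ *Z y₂) +Z (x₃ *Z y₁ -Z x₁ *Z y₃))

T3 : Half -> Half -> Half -> TArc -> TArc -> ℤ
T3 a b c α β = F3 (indℤ a α) (indℤ b α) (indℤ c α) (indℤ a β) (indℤ b β) (indℤ c β)

formOf : List Half -> TArc -> TArc -> ℤ
formOf (a ∷ b ∷ c ∷ []) α β = T3 a b c α β
formOf _ α β = 0ℤ

T3-rot : ∀ a b c α β -> T3 a b c α β ≡ T3 b c a α β
T3-rot a b c α β = lemma (indℤ a α) (indℤ b α) (indℤ c α) (indℤ a β) (indℤ b β) (indℤ c β) where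
 lemma : ∀ x₁ x₂ x₃ y₁ y₂ y₃ -> ((x₁ *Z y₂ -Z x₂ *Z y₁) +Z ((x₂ *Z y₃ -Z x₃ *Z y₂) +Z (x₃ *Z y₁ -Z x₁ *Z y₃))) ≡ ((x₂ *Z y₃ -Z x₃ *Z y₂) +Z ((x₃ *Z y₁ -Z x₁ *Z y₃) +Z (x₁ *Z y₂ -Z x₂ *Z y₁)))
 lemma = solve-∀

T3-skew : ∀ a b c α β -> T3 a b c β α ≡ -Z T3 a b c α β
T3-skew a b c α β = lemma (indℤ a α) (indℤ b α) (indℤ c α) (indℤ a β) (indℤ b β) (indℤ c β) where
 lemma : ∀ x₁ x₂ x₃ y₁ y₂ y₃ -> ((y₁ *Z x₂ -Z y₂ *Z x₁) +Z ((y₂ *Z x₃ -Z y₃ *Z x₂) +Z (y₃ *Z x₁ -Z y₁ *Z x₃))) ≡ -Z ((x₁ *Z y₂ -Z x₂ *Z y₁) +Z ((x₂ *Z y₃ -Z x₃ *Z y₂) +Z (x₃ *Z y₁ -Z x₁ *Z y₃)))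
 lemma = solve-∀

T3-row : ∀ g a b γ β -> ind g γ ≡ 1 -> ind a γ ≡ 0 -> ind b γ ≡ 0 -> T3 g a b γ β ≡ indℤ a β -Z indℤ b β
T3-row g a b γ β p q r rewrite p | q | r = lemma (indℤ g β) (indℤ a β) (indℤ b β) where
 lemma : ∀ y₁ y₂ y₃ -> ((1ℤ *Z y₂ -Z 0ℤ *Z y₁) +Z ((0ℤ *Z y₃ -Z 0ℤ *Z y₂) +Z (0ℤ *Z y₁ -Z 1ℤ *Z y₃))) ≡ y₂ -Z y₃
 lemma = solve-∀

T3-without : ∀ g a b α β -> ind g α ≡ 0 -> ind g β ≡ 0 -> T3 g a b α β ≡ indℤ a α *Z indℤ b β -Z indℤ b α *Z indℤ a β
T3-without g a b α β p q rewrite p | q = lemma (indℤ a α) (indℤ b α) (indℤ a β) (indℤ b β) where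
 lemma : ∀ x₂ x₃ y₂ y₃ -> ((0ℤ *Z y₂ -Z x₂ *Z 0ℤ) +Z ((x₂ *Z y₃ -Z x₃ *Z y₂) +Z (x₃ *Z 0ℤ -Z 0ℤ *Z y₃))) ≡ x₂ *Z y₃ -Z x₃ *Z y₂
 lemma = solve-∀

T3-free : ∀ a b c α β -> ind a α ≡ 0 -> ind b α ≡ 0 -> ind c α ≡ 0 -> T3 a b c α β ≡ 0ℤ
T3-free a b c α β p q r rewrite p | q | r = lemma (indℤ a β) (indℤ b β) (indℤ c β) where
 lemma : ∀ y₁ y₂ y₃ -> ((0ℤ *Z y₂ -Z 0ℤ *Z y₁) +Z ((0ℤ *Z y₃ -Z 0ℤ *Z y₂) +Z (0ℤ *Z y₁ -Z 0ℤ *Z y₃))) ≡ 0ℤ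
 lemma = solve-∀

-- `corr` is defined by signs. On differences of disjoint positive and negative parts it becomes
-- bilinear, so mutation turns into a polynomial identity.
corr-split : ∀ x y z w -> (x ≡ 0 ⊎ y ≡ 0) -> (z ≡ 0 ⊎ w ≡ 0) -> corr (pos x -Z pos y) (pos z -Z pos w) ≡ pos x *Z pos z -Z pos y *Z pos w
corr-split x y z w p q = trans (cong₂ corr (norm x y p) (norm z w q)) (go x y z w p q) where
 half : ℕ -> ℕ -> ℤ
 half zero y = -Z pos y
 half (suc x) y = pos (suc x)
 norm : ∀ x y -> (x ≡ 0 ⊎ y ≡ 0) -> pos x -Z pos y ≡ half x y
 norm zero y h = ℤₚ.+-identityˡ _
 norm (suc x) zero h = ℤₚ.+-identityʳ _
 norm (suc x) (suc y) (inl ())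
 norm (suc x) (suc y) (inr ())
 go : ∀ x y z w -> (x ≡ 0 ⊎ y ≡ 0) -> (z ≡ 0 ⊎ w ≡ 0) -> corr (half x y) (half z w) ≡ pos x *Z pos z -Z pos y *Z pos w
 go (suc x) (suc y) z w (inl ()) _
 go (suc x) (suc y) z w (inr ()) _
 go x y (suc z) (suc w) _ (inl ())
 go x y (suc z) (suc w) _ (inr ())
 go zero zero zero zero _ _ = refl
 go zero zero zero (suc w) _ _ = refl
 go zero zero (suc z) zero _ _ = refl
 go zero (suc y) zero zero _ _ = sym (cong (\ t -> 0ℤ -Z t) (ℤₚ.*-zeroʳ (pos (suc y))))
 go zero (suc y) zero (suc w) _ _ = sym (trans (ℤₚ.+-identityˡ _) (cong -Z_ (sym (ℤₚ.pos-* (suc y) (suc w)))))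
 go zero (suc y) (suc z) zero _ _ = sym (cong (\ t -> 0ℤ -Z t) (ℤₚ.*-zeroʳ (pos (suc y))))
 go (suc x) zero zero zero _ _ = sym (trans (ℤₚ.+-identityʳ _) (ℤₚ.*-zeroʳ (pos (suc x))))
 go (suc x) zero zero (suc w) _ _ = sym (trans (ℤₚ.+-identityʳ _) (ℤₚ.*-zeroʳ (pos (suc x))))
 go (suc x) zero (suc z) zero _ _ = sym (trans (ℤₚ.+-identityʳ _) (sym (ℤₚ.pos-* (suc x) (suc z))))

posPart-split : ∀ x y -> (x ≡ 0 ⊎ y ≡ 0) -> posPart (pos x -Z pos y) ≡ x
posPart-split zero zero h = refl
posPart-split zero (suc y) h = refl
posPart-split (suc x) zero h = cong suc (+-identityʳ x)
posPart-split (suc x) (suc y) (inl ())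
posPart-split (suc x) (suc y) (inr ())

∈-remove⁺ : ∀ {γ t} {A : List TArc} -> t ∈ A -> t ≢ γ -> t ∈ removeT γ A
∈-remove⁺ {γ} {t} {A} p ne = ∈-filterᵇ⁺ (\ t -> not (tEq t γ)) {t} {A} p (cong not (≢⇒tEq {t} {γ} ne))

∈-remove⁻ : ∀ {γ t} {A : List TArc} -> t ∈ removeT γ A -> t ∈ A × t ≢ γ
∈-remove⁻ {γ} {t} {A} p with ∈-filterᵇ⁻ (\ t -> not (tEq t γ)) {t} {A} p
... | a , b = a , \ { refl -> false≢true (cong not (tEq-refl γ)) b }

flipArcs : TArc -> TArc -> List TArc -> List TArc
flipArcs γ γ' A = γ' ∷ removeT γ A

Skew : (TArc -> TArc -> ℤ) -> Set
Skew f = ∀ α β -> f β α ≡ -Z f α β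

skew-diag : ∀ {f} -> Skew f -> ∀ α -> f α α ≡ 0ℤ
skew-diag {f} s α = self (f α α) (s α α) where
 self : ∀ z -> z ≡ -Z z -> z ≡ 0ℤ
 self (pos zero) e = refl
 self (pos (suc n)) ()
 self -[1+ n ] ()

-- U and V are the positive and negative parts of the row of γ, and `rest` is matrix mutation in
-- terms of them. By `disj` nothing cancels within an entry, so these parts can be read off from the
-- matrix.
record Mutates (A : List TArc) (γ γ' : TArc) (f f' : TArc -> TArc -> ℤ) (U V : TArc -> ℕ) : Set where
 field
  skew : Skew f
  skew' : Skew f'
  row : ∀ {β} -> β ∈ A -> f γ β ≡ pos (U β) -Z pos (V β)
  disj : ∀ {β} -> β ∈ A -> U β ≡ 0 ⊎ V β ≡ 0
  row' : ∀ {β} -> β ∈ A -> β ≢ γ -> f' γ' β ≡ pos (V β) -Z pos (U β)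
  rest : ∀ {α β} -> α ∈ A -> β ∈ A -> α ≢ γ -> β ≢ γ -> f' α β ≡ f α β +Z (pos (V α) *Z pos (U β) -Z pos (U α) *Z pos (V β))

 neg-sub : ∀ x y -> -Z (x -Z y) ≡ y -Z x
 neg-sub = solve-∀

 col : ∀ {β} -> β ∈ A -> f β γ ≡ pos (V β) -Z pos (U β)
 col {β} p = trans (skew γ β) (trans (cong -Z_ (row p)) (neg-sub (pos (U β)) (pos (V β))))

 mutated : ∀ B -> γ ∈ A -> γ' ∉ A -> (∀ {α β} -> α ∈ A -> β ∈ A -> B α β ≡ f α β) -> ∀ {α β} -> α ∈ flipArcs γ γ' A -> β ∈ flipArcs γ γ' A -> mutMat γ γ' B α β ≡ f' α β
 mutated B γ∈ γ'∉ BF = go where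
  ne' : ∀ {t} -> t ∈ A -> t ≢ γ'
  ne' p refl = γ'∉ p
  go : ∀ {α β} -> α ∈ flipArcs γ γ' A -> β ∈ flipArcs γ γ' A -> mutMat γ γ' B α β ≡ f' α β
  go {α} {β} 0th 0th rewrite tEq-refl γ' | tEq-refl γ = trans (cong -Z_ (trans (BF γ∈ γ∈) (skew-diag {f} skew γ))) (sym (skew-diag {f'} skew' γ'))
  go {α} {β} 0th (there q) with ∈-remove⁻ {γ} {β} {A} q
  ... | β∈ , β≢ rewrite tEq-refl γ' | tEq-refl γ | ≢⇒tEq (ne' β∈) = trans (cong -Z_ (trans (BF γ∈ β∈) (row β∈))) (trans (neg-sub (pos (U β)) (pos (V β))) (sym (row' β∈ β≢)))
  go {α} {β} (there p) 0th with ∈-remove⁻ {γ} {α} {A} p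
  ... | α∈ , α≢ rewrite tEq-refl γ' | tEq-refl γ | ≢⇒tEq (ne' α∈) | ≢⇒tEq α≢ = trans (cong -Z_ (trans (BF α∈ γ∈) (col α∈))) (trans (neg-sub (pos (V α)) (pos (U α))) (sym (trans (skew' γ' α) (trans (cong -Z_ (row' α∈ α≢)) (neg-sub (pos (V α)) (pos (U α)))))))
  go {α} {β} (there p) (there q) with ∈-remove⁻ {γ} {α} {A} p | ∈-remove⁻ {γ} {β} {A} q
  ... | α∈ , α≢ | β∈ , β≢ rewrite ≢⇒tEq (ne' α∈) | ≢⇒tEq (ne' β∈) | ≢⇒tEq α≢ | ≢⇒tEq β≢ = trans (cong₂ _+Z_ (BF α∈ β∈) (trans (cong₂ corr (trans (BF α∈ γ∈) (col α∈)) (trans (BF γ∈ β∈) (row β∈))) (corr-split (V α) (U α) (U β) (V β) (sw (disj α∈)) (disj β∈)))) (sym (rest α∈ β∈ α≢ β≢)) where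
   sw : ∀ {P Q : Set} -> P ⊎ Q -> Q ⊎ P
   sw (inl x) = inr x
   sw (inr y) = inl y

module _ {A : List TArc} {γ γ' : TArc} {f f' R : TArc -> TArc -> ℤ} (skf : Skew f) (skf' : Skew f') (Rγ : ∀ {β} -> β ∈ A -> R γ β ≡ 0ℤ) (Rγ' : ∀ {β} -> β ∈ A -> R γ' β ≡ 0ℤ) where

 -- γ and γ' are the diagonals of the quadrilateral with sides a, b, c, d, each given by its two
 -- half-edges, and R collects the triangles outside. The flip only regroups the sides into other
 -- triangles, and the difference of the forms is the product term of mutation.
 quad-mutates : ∀ g₁ g₂ g₁' g₂' a b c d -> (∀ α β -> f α β ≡ T3 g₁ a b α β +Z (T3 g₂ c d α β +Z R α β)) -> (∀ α β -> f' α β ≡ T3 g₁' b c α β +Z (T3 g₂' d a α β +Z R α β)) -> (∀ {g} -> g ∈ g₁ ∷ g₂ ∷ [] -> ind g γ ≡ 1 × (∀ {t} -> t ∈ A -> t ≢ γ -> ind g t ≡ 0)) ->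
  (∀ {g} -> g ∈ g₁' ∷ g₂' ∷ [] -> ind g γ' ≡ 1 × (∀ {t} -> t ∈ A -> t ≢ γ -> ind g t ≡ 0)) -> (∀ {h} -> h ∈ a ∷ b ∷ c ∷ d ∷ [] -> ind h γ ≡ 0 × ind h γ' ≡ 0) -> (∀ {t} -> t ∈ A -> ind a t + ind c t ≡ 0 ⊎ ind b t + ind d t ≡ 0) ->
  Mutates A γ γ' f f' (\ t -> ind a t + ind c t) (\ t -> ind b t + ind d t)
 quad-mutates g₁ g₂ g₁' g₂' a b c d ef ef' G G' O disj = record { skew = skf ; skew' = skf' ; row = row ; disj = disj ; row' = row' ; rest = rest } where
  oa = O 0th
  ob = O 1st
  oc = O 2nd
  od = O 3rd
  row : ∀ {β} -> β ∈ A -> f γ β ≡ pos (ind a β + ind c β) -Z pos (ind b β + ind d β)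
  row {β} p = trans (ef γ β) (trans (cong₂ _+Z_ (T3-row g₁ a b γ β (fst (G 0th)) (fst oa) (fst ob)) (cong₂ _+Z_ (T3-row g₂ c d γ β (fst (G 1st)) (fst oc) (fst od)) (Rγ p))) (lemma (indℤ a β) (indℤ b β) (indℤ c β) (indℤ d β))) where
   lemma : ∀ a b c d -> a -Z b +Z (c -Z d +Z 0ℤ) ≡ (a +Z c) -Z (b +Z d)
   lemma = solve-∀
  row' : ∀ {β} -> β ∈ A -> β ≢ γ -> f' γ' β ≡ pos (ind b β + ind d β) -Z pos (ind a β + ind c β)
  row' {β} p _ = trans (ef' γ' β) (trans (cong₂ _+Z_ (T3-row g₁' b c γ' β (fst (G' 0th)) (snd ob) (snd oc)) (cong₂ _+Z_ (T3-row g₂' d a γ' β (fst (G' 1st)) (snd od) (snd oa)) (Rγ' p))) (lemma (indℤ a β) (indℤ b β) (indℤ c β) (indℤ d β))) where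
   lemma : ∀ a b c d -> b -Z c +Z (d -Z a +Z 0ℤ) ≡ (b +Z d) -Z (a +Z c)
   lemma = solve-∀
  rest : ∀ {α β} -> α ∈ A -> β ∈ A -> α ≢ γ -> β ≢ γ -> f' α β ≡ f α β +Z (pos (ind b α + ind d α) *Z pos (ind a β + ind c β) -Z pos (ind a α + ind c α) *Z pos (ind b β + ind d β))
  rest {α} {β} p q p≢ q≢ = trans (ef' α β) (trans (cong₂ _+Z_ (T3-without g₁' b c α β (snd (G' 0th) p p≢) (snd (G' 0th) q q≢)) (cong (_+Z R α β) (T3-without g₂' d a α β (snd (G' 1st) p p≢) (snd (G' 1st) q q≢))))
   (trans (lemma (indℤ a α) (indℤ b α) (indℤ c α) (indℤ d α) (indℤ a β) (indℤ b β) (indℤ c β) (indℤ d β) (R α β)) (cong (_+Z (pos (ind b α + ind d α) *Z pos (ind a β + ind c β) -Z pos (ind a α + ind c α) *Z pos (ind b β + ind d β)))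
   (sym (trans (ef α β) (cong₂ _+Z_ (T3-without g₁ a b α β (snd (G 0th) p p≢) (snd (G 0th) q q≢)) (cong (_+Z R α β) (T3-without g₂ c d α β (snd (G 1st) p p≢) (snd (G 1st) q q≢))))))))) where
   lemma : ∀ a b c d a' b' c' d' r -> (b *Z c' -Z c *Z b') +Z ((d *Z a' -Z a *Z d') +Z r) ≡ ((a *Z b' -Z b *Z a') +Z ((c *Z d' -Z d *Z c') +Z r)) +Z ((b +Z d) *Z (a' +Z c') -Z (a +Z c) *Z (b' +Z d'))
   lemma = solve-∀

 -- l is the loop around the two central arcs γ and p; γ' is the central arc with halves q₁, q₂.
 digon-mutates : ∀ l a c q₁ q₂ p₁ p₂ -> (∀ α β -> f α β ≡ T3 l a c α β +Z R α β) -> (∀ α β -> f' α β ≡ T3 q₁ p₁ a α β +Z (T3 q₂ c p₂ α β +Z R α β)) -> ind l γ ≡ 1 -> ind a γ ≡ 0 -> ind c γ ≡ 0 -> ind a γ' ≡ 0 -> ind c γ' ≡ 0 ->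
  (∀ {g} -> g ∈ q₁ ∷ q₂ ∷ [] -> ind g γ' ≡ 1 × (∀ {t} -> t ∈ A -> t ≢ γ -> ind g t ≡ 0)) -> (∀ {g} -> g ∈ p₁ ∷ p₂ ∷ [] -> ind g γ' ≡ 0 × (∀ {t} -> t ∈ A -> t ≢ γ -> ind g t ≡ ind l t)) -> (∀ {t} -> t ∈ A -> ind a t ≡ 0 ⊎ ind c t ≡ 0) -> Mutates A γ γ' f f' (ind a) (ind c)
 digon-mutates l a c q₁ q₂ p₁ p₂ ef ef' lγ aγ cγ aγ' cγ' Q P disj = record { skew = skf ; skew' = skf' ; row = row ; disj = disj ; row' = row' ; rest = rest } where
  row : ∀ {β} -> β ∈ A -> f γ β ≡ indℤ a β -Z indℤ c β
  row {β} p = trans (ef γ β) (trans (cong₂ _+Z_ (T3-row l a c γ β lγ aγ cγ) (Rγ p)) (ℤₚ.+-identityʳ _))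
  row' : ∀ {β} -> β ∈ A -> β ≢ γ -> f' γ' β ≡ indℤ c β -Z indℤ a β
  row' {β} p ne = trans (ef' γ' β) (trans (cong₂ _+Z_ (T3-row q₁ p₁ a γ' β (fst (Q 0th)) (fst (P 0th)) aγ') (cong₂ _+Z_ (T3-row q₂ c p₂ γ' β (fst (Q 1st)) cγ' (fst (P 1st))) (Rγ' p)))
   (trans (cong₂ (\ x y -> pos x -Z indℤ a β +Z (indℤ c β -Z pos y +Z 0ℤ)) (snd (P 0th) p ne) (snd (P 1st) p ne)) (lemma (indℤ l β) (indℤ a β) (indℤ c β)))) where
   lemma : ∀ l a c -> l -Z a +Z (c -Z l +Z 0ℤ) ≡ c -Z a
   lemma = solve-∀
  rest : ∀ {α β} -> α ∈ A -> β ∈ A -> α ≢ γ -> β ≢ γ -> f' α β ≡ f α β +Z (indℤ c α *Z indℤ a β -Z indℤ a α *Z indℤ c β)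
  rest {α} {β} p q p≢ q≢ = trans (ef' α β) (trans (cong₂ _+Z_ (T3-without q₁ p₁ a α β (snd (Q 0th) p p≢) (snd (Q 0th) q q≢)) (cong (_+Z R α β) (T3-without q₂ c p₂ α β (snd (Q 1st) p p≢) (snd (Q 1st) q q≢))))
   (trans (cong₂ (\ x y -> (pos x *Z indℤ a β -Z indℤ a α *Z pos y) +Z (indℤ c α *Z indℤ p₂ β -Z indℤ p₂ α *Z indℤ c β +Z R α β)) (snd (P 0th) p p≢) (snd (P 0th) q q≢))
   (trans (cong₂ (\ x y -> (indℤ l α *Z indℤ a β -Z indℤ a α *Z indℤ l β) +Z (indℤ c α *Z pos y -Z pos x *Z indℤ c β +Z R α β)) (snd (P 1st) p p≢) (snd (P 1st) q q≢)) (trans (lemma (indℤ l α) (indℤ a α) (indℤ c α) (indℤ l β) (indℤ a β) (indℤ c β) (R α β))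
   (cong (_+Z (indℤ c α *Z indℤ a β -Z indℤ a α *Z indℤ c β)) (sym (ef α β))))))) where
   lemma : ∀ l a c l' a' c' r -> (l *Z a' -Z a *Z l') +Z (c *Z l' -Z l *Z c' +Z r) ≡ (((l *Z a' -Z a *Z l') +Z ((a *Z c' -Z c *Z a') +Z (c *Z l' -Z l *Z c'))) +Z r) +Z (c *Z a' -Z a *Z c')
   lemma = solve-∀

-- Mutation is an involution; the passage from two central arcs back to twins thus reuses the
-- calculation for the opposite direction.
Mutates-sym : ∀ {A A' γ γ' f f' U V} -> γ ∈ A -> (∀ {t} -> t ∈ A' -> t ≡ γ' ⊎ (t ∈ A × t ≢ γ)) -> U γ' ≡ 0 -> V γ' ≡ 0 -> Mutates A γ γ' f f' U V -> Mutates A' γ' γ f' f V U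
Mutates-sym {A} {A'} {γ} {γ'} {f} {f'} {U} {V} γ∈ A'⊆ U0 V0 m = record { skew = skew' ; skew' = skew ; row = \ p -> row₀ p (A'⊆ p) ; disj = \ p -> disj₀ (A'⊆ p) ; row' = \ p ne -> row'₀ (A'⊆ p) ne ; rest = \ p q p≢ q≢ -> rest₀ (A'⊆ p) (A'⊆ q) p≢ q≢ } where
 open Mutates m
 row₀ : ∀ {β} -> β ∈ A' -> β ≡ γ' ⊎ (β ∈ A × β ≢ γ) -> f' γ' β ≡ pos (V β) -Z pos (U β)
 row₀ p (inl refl) = trans (skew-diag {f'} skew' γ') (sym (cong₂ (\ x y -> pos x -Z pos y) V0 U0))
 row₀ p (inr (q , ne)) = row' q ne
 disj₀ : ∀ {β} -> β ≡ γ' ⊎ (β ∈ A × β ≢ γ) -> V β ≡ 0 ⊎ U β ≡ 0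
 disj₀ (inl refl) = inl V0
 disj₀ (inr (q , ne)) with disj q
 ... | inl x = inr x
 ... | inr x = inl x
 row'₀ : ∀ {β} -> β ≡ γ' ⊎ (β ∈ A × β ≢ γ) -> β ≢ γ' -> f γ β ≡ pos (U β) -Z pos (V β)
 row'₀ (inl e) ne = ⊥-elim (ne e)
 row'₀ (inr (q , _)) ne = row q
 rest₀ : ∀ {α β} -> α ≡ γ' ⊎ (α ∈ A × α ≢ γ) -> β ≡ γ' ⊎ (β ∈ A × β ≢ γ) -> α ≢ γ' -> β ≢ γ' -> f α β ≡ f' α β +Z (pos (U α) *Z pos (V β) -Z pos (V α) *Z pos (U β))
 rest₀ (inl e) _ ne _ = ⊥-elim (ne e)
 rest₀ (inr _) (inl e) _ ne = ⊥-elim (ne e)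
 rest₀ {α} {β} (inr (p , p≢)) (inr (q , q≢)) _ _ = trans (lemma (f α β) (pos (V α) *Z pos (U β)) (pos (U α) *Z pos (V β))) (cong (_+Z (pos (U α) *Z pos (V β) -Z pos (V α) *Z pos (U β))) (sym (rest p q p≢ q≢))) where
  lemma : ∀ f a b -> f ≡ f +Z (a -Z b) +Z (b -Z a)
  lemma = solve-∀

-- Weights, exchange relations and the invariant of a run.

record Weights (N : ℕ) : Set where
 field
  W : ℕ -> ℤ²
  c : Tag -> ℤ
  periodic : ∀ x -> W (x + N) ≡ (fst (W x) , snd (W x) +Z c pl *Z c nt *Z fst (W x))
  unit : ∀ x -> det (W x) (W (x + 1)) ≡ 1ℤ

-- `halves` starts at a fixed corner, whereas a flip needs the sides listed from the diagonal
-- onwards.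
data Rot (x y z : Half) : List Half -> Set where
 r0 : Rot x y z (x ∷ y ∷ z ∷ [])
 r1 : Rot x y z (z ∷ x ∷ y ∷ [])
 r2 : Rot x y z (y ∷ z ∷ x ∷ [])

rot-form : ∀ {x y z hs} -> Rot x y z hs -> ∀ α β -> formOf hs α β ≡ T3 x y z α β
rot-form r0 α β = refl
rot-form {x} {y} {z} r1 α β = T3-rot z x y α β
rot-form {x} {y} {z} r2 α β = sym (T3-rot x y z α β)

rot-↭ : ∀ {x y z hs} -> Rot x y z hs -> ∀ R -> hs ++ R ↭ x ∷ y ∷ z ∷ R
rot-↭ r0 R = ↭-refl
rot-↭ {x} {y} {z} r1 R = ↭-sym (shift z (x ∷ y ∷ []) R)
rot-↭ {x} {y} {z} r2 R = shift x (y ∷ z ∷ []) R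

module Exchange (N : ℕ) (3≤N : 3 ≤ N) where
 open Geometry N 3≤N public

 form : List Tri -> TArc -> TArc -> ℤ
 form [] α β = 0ℤ
 form (Δ ∷ Ts) α β = formOf (halves Δ) α β +Z form Ts α β

 form-↭ : ∀ {Ts Ts'} -> Ts ↭ Ts' -> ∀ α β -> form Ts α β ≡ form Ts' α β
 form-↭ Perm.refl α β = refl
 form-↭ (prep Δ p) α β = cong (formOf (halves Δ) α β +Z_) (form-↭ p α β)
 form-↭ (swap Δ Δ' p) α β = trans (cong (\ t -> formOf (halves Δ) α β +Z (formOf (halves Δ') α β +Z t)) (form-↭ p α β)) (lemma (formOf (halves Δ) α β) (formOf (halves Δ') α β) _) where
  lemma : ∀ a b c -> a +Z (b +Z c) ≡ b +Z (a +Z c)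
  lemma = solve-∀
 form-↭ (Perm.trans p q) α β = trans (form-↭ p α β) (form-↭ q α β)

 formOf-skew : ∀ Δ α β -> formOf (halves Δ) β α ≡ -Z formOf (halves Δ) α β
 formOf-skew (tr i L M) α β = T3-skew (up i L) (up (md N (i + L)) M) (top i (L + M)) α β
 formOf-skew (tp i L s) α β = T3-skew (up i L) (rl (md N (i + L)) s) (rr i s) α β

 form-skew : ∀ Ts -> Skew (form Ts)
 form-skew [] α β = refl
 form-skew (Δ ∷ Ts) α β = trans (cong₂ _+Z_ (formOf-skew Δ α β) (form-skew Ts α β)) (sym (ℤₚ.neg-distrib-+ (formOf (halves Δ) α β) (form Ts α β)))

 form-free : ∀ Ts {α} β -> (∀ {h} -> h ∈ concatMap halves Ts -> α ∉ arcsOf h) -> form Ts α β ≡ 0ℤ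
 form-free [] β e = refl
 form-free (Δ ∷ Ts) {α} β e = cong₂ _+Z_ (go Δ (\ p -> e (∈-++⁺ˡ p))) (form-free Ts β (\ p -> e (∈-++⁺ʳ (halves Δ) p))) where
  go : ∀ Δ -> (∀ {h} -> h ∈ halves Δ -> α ∉ arcsOf h) -> formOf (halves Δ) α β ≡ 0ℤ
  go (tr i L M) e = T3-free (up i L) (up (md N (i + L)) M) (top i (L + M)) α β (ind-∉ {up i L} (e 0th)) (ind-∉ {up (md N (i + L)) M} (e 1st)) (ind-∉ {top i (L + M)} (e 2nd))
  go (tp i L s) e = T3-free (up i L) (rl (md N (i + L)) s) (rr i s) α β (ind-∉ {up i L} (e 0th)) (ind-∉ {rl (md N (i + L)) s} (e 1st)) (ind-∉ {rr i s} (e 2nd))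

 ∈-allTArcs : ∀ {t} -> validTArc N t ≡ true -> t ∈ allTArcs N
 ∈-allTArcs {tct i pl} v = ∈-concatMap⁺ {f = \ i -> tct i pl ∷ tct i nt ∷ map (tnc i) (range 2 N-1)} {xs = upTo N} (∈-upTo⁺ {N} (<ᵇ≡⇒< {i} {N} v)) 0th
 ∈-allTArcs {tct i nt} v = ∈-concatMap⁺ {f = \ i -> tct i pl ∷ tct i nt ∷ map (tnc i) (range 2 N-1)} {xs = upTo N} (∈-upTo⁺ {N} (<ᵇ≡⇒< {i} {N} v)) 1st
 ∈-allTArcs {tnc i L} v with validTnc {i} {L} v
 ... | i<N , 2≤L , L<N = ∈-concatMap⁺ {f = \ i -> tct i pl ∷ tct i nt ∷ map (tnc i) (range 2 N-1)} {xs = upTo N} (∈-upTo⁺ {N} i<N) (there (there (∈-map⁺ (tnc i) (∈-range⁺ 2≤L (≤-pred (subst (suc L ≤_) (sym (m+[n∸m]≡n N>0)) L<N))))))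

 Unique-allTArcs : Unique (allTArcs N)
 Unique-allTArcs = Unique-concatMap (Uniqueₚ.upTo⁺ N) row inj where
  row : ∀ i -> Unique (tct i pl ∷ tct i nt ∷ map (tnc i) (range 2 N-1))
  row i = Unique-∷ (\ { (there p) -> no-tct p }) (Unique-∷ no-tct (Uniqueₚ.map⁺ (\ { refl -> refl }) (Unique-range 2 N-1))) where
   no-tct : ∀ {j s} -> tct j s ∉ map (tnc i) (range 2 N-1)
   no-tct p with ∈-map⁻ (tnc i) p
   ... | _ , _ , ()
  base : ∀ {i t} -> t ∈ tct i pl ∷ tct i nt ∷ map (tnc i) (range 2 N-1) -> (∃[ s ] t ≡ tct i s) ⊎ (∃[ L ] t ≡ tnc i L)
  base 0th = inl (pl , refl)
  base 1st = inl (nt , refl)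
  base {i} (there (there p)) with ∈-map⁻ (tnc i) p
  ... | L , _ , refl = inr (L , refl)
  inj : ∀ {i j t} -> t ∈ tct i pl ∷ tct i nt ∷ map (tnc i) (range 2 N-1) -> t ∈ tct j pl ∷ tct j nt ∷ map (tnc j) (range 2 N-1) -> i ≡ j
  inj p q with base p | base q
  ... | inl (_ , refl) | inl (_ , refl) = refl
  ... | inr (_ , refl) | inr (_ , refl) = refl

 -- The exchange products run over this list. As a sublist of all tagged arcs it has no repetitions,
 -- even if the list of arcs of the seed has some.
 current : List TArc -> List TArc
 current A = filterᵇ (\ δ -> memT δ A) (allTArcs N)

 module Values (weights : Weights N) where
  open Weights weights public

  r : ℕ -> ℤ
  r x = fst (W x)

  len : ℕ -> ℕ -> ℤ
  len x L = det (W x) (W (x + L))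

  r-+N : ∀ x -> r (x + N) ≡ r x
  r-+N x = cong fst (periodic x)

  private
   shear : ∀ x y -> det (W (x + N)) (W (y + N)) ≡ det (W x) (W y)
   shear x y = trans (cong₂ det (periodic x) (periodic y)) (lemma (r x) (snd (W x)) (r y) (snd (W y)) (c pl *Z c nt)) where
    lemma : ∀ a b p q k -> a *Z (q +Z k *Z p) -Z (b +Z k *Z a) *Z p ≡ a *Z q -Z b *Z p
    lemma = solve-∀
   comm : ∀ x L -> x + N + L ≡ x + L + N
   comm x L = trans (+-assoc x N L) (trans (cong (x +_) (+-comm N L)) (sym (+-assoc x L N)))

  len-+N : ∀ x L -> len (x + N) L ≡ len x L
  len-+N x L = trans (cong (\ y -> det (W (x + N)) (W y)) (comm x L)) (shear x (x + L))

  private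
   invariant : (g : ℕ -> ℤ) -> (∀ x -> g (x + N) ≡ g x) -> ∀ x -> g (md N x) ≡ g x
   invariant g e x with md-decomp x
   ... | k , q = trans (sym (go k (md N x))) (cong g (sym q)) where
    go : ∀ k y -> g (y + k * N) ≡ g y
    go zero y = cong g (+-identityʳ y)
    go (suc k) y = trans (cong g (sym (+-assoc y N (k * N)))) (trans (go k (y + N)) (e y))

  r-md : ∀ x -> r (md N x) ≡ r x
  r-md = invariant r r-+N

  len-md : ∀ x L -> len (md N x) L ≡ len x L
  len-md x L = invariant (\ y -> len y L) (\ y -> len-+N y L) x

  v : TArc -> ℤ
  v (tnc i L) = len i L
  v (tct i s) = c s *Z r i

  vH : Half -> ℤ
  vH (up i L) = len i L
  vH (dn i L) = len i L
  vH (lp i) = c pl *Z c nt *Z (r i *Z r i)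
  vH (rr i s) = c s *Z r i
  vH (rl i s) = c s *Z r i

  -- This explains the parameter of the monodromy: the loop around twins must have the product of
  -- their values.
  len-loop : ∀ x -> len x N ≡ c pl *Z c nt *Z (r x *Z r x)
  len-loop x = trans (cong (det (W x)) (periodic x)) (lemma (r x) (snd (W x)) (c pl *Z c nt)) where
   lemma : ∀ a b k -> a *Z (b +Z k *Z a) -Z b *Z a ≡ k *Z (a *Z a)
   lemma = solve-∀

  vH-top : ∀ {i K} -> vH (top i K) ≡ len i K
  vH-top {i} {K} with K ≟ N
  ... | yes refl = trans (cong vH (top-loop {i} {N} refl)) (sym (len-loop i))
  ... | no ne = cong vH (top-chord {i} {K} ne)

  module _ {A : List TArc} (valid : Valid A) where
   ∈-current : ∀ {t} -> t ∈ A -> t ∈ current A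
   ∈-current {t} p = ∈-filterᵇ⁺ (\ δ -> memT δ A) {t} {allTArcs N} (∈-allTArcs (valid p)) (∈⇒memT p)
   current⁻ : ∀ {t} -> t ∈ current A -> t ∈ A
   current⁻ {t} p = memT⇒∈ (snd (∈-filterᵇ⁻ (\ δ -> memT δ A) {t} {allTArcs N} p))
   Unique-current = Unique-filterᵇ (\ δ -> memT δ A) Unique-allTArcs
   power : (TArc -> ℕ) -> ℤ
   power U = prodℤ (\ δ -> pow (v δ) (U δ)) (current A)
   private
    pow-ind1 : ∀ {h t} -> t ∈ arcsOf h -> pow (v t) (ind h t) ≡ v t
    pow-ind1 {h} {t} p = trans (cong (pow (v t)) (ind-∈ {h} p)) (ℤₚ.*-identityʳ (v t))
    pow-ind0 : ∀ {h t} -> t ∉ arcsOf h -> pow (v t) (ind h t) ≡ 1ℤ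
    pow-ind0 {h} {t} p = cong (pow (v t)) (ind-∉ {h} p)
    single : ∀ h t -> arcsOf h ≡ t ∷ [] -> t ∈ A -> power (ind h) ≡ v t
    single h t e p with ∈-extract (∈-current p)
    ... | rest , q = trans (prodℤ-↭ _ q) (trans (cong₂ _*Z_ (pow-ind1 {h} (subst (t ∈_) (sym e) 0th)) (prodℤ-1 rest (\ {x} x∈ -> pow-ind0 {h} (\ x∈h -> absurd x∈ (subst (x ∈_) e x∈h))))) (ℤₚ.*-identityʳ (v t))) where
     absurd : ∀ {x} -> x ∈ rest -> x ∈ t ∷ [] -> ⊥
     absurd x∈ 0th = Unique-head (Unique-resp-↭ q Unique-current) x∈
    boundary : ∀ i -> power (ind (up i 1)) ≡ 1ℤ
    boundary i = prodℤ-1 (current A) (\ {x} p -> pow-ind0 {up i 1} {x} (\ { 0th -> bad (fst (snd (validTnc {i} {1} (valid (current⁻ p))))) })) where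
     bad : ¬ (2 ≤ 1)
     bad (s≤s ())
    double : ∀ i -> tct i pl ∈ A -> tct i nt ∈ A -> power (ind (lp i)) ≡ v (tct i pl) *Z v (tct i nt)
    double i p p' with ∈-extract (∈-current p)
    ... | rest , q with ∈-resp-↭ q (∈-current p')
    ... | here ()
    ... | there p'' with ∈-extract p''
    ... | rest' , q' = trans (prodℤ-↭ _ q) (cong₂ _*Z_ (pow-ind1 {lp i} {tct i pl} 0th) (trans (prodℤ-↭ _ q') (trans (cong₂ _*Z_ (pow-ind1 {lp i} {tct i nt} 1st) (prodℤ-1 rest' (\ {x} x∈ -> pow-ind0 {lp i} {x} (absurd x∈)))) (ℤₚ.*-identityʳ (v (tct i nt)))))) where
     u = Unique-resp-↭ (↭-trans q (prep _ q')) Unique-current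
     absurd : ∀ {x} -> x ∈ rest' -> x ∉ arcsOf (lp i)
     absurd x∈ 0th = Unique-head u (there x∈)
     absurd x∈ 1st = Unique-head (Unique-tail u) x∈
   power-ind : ∀ {h} -> Expected A h -> power (ind h) ≡ vH h
   power-ind {up i L} (i<N , inl refl) = trans (boundary i) (sym (unit i))
   power-ind {up i L} (i<N , inr p) = single (up i L) (tnc i L) refl p
   power-ind {dn i L} p = single (dn i L) (tnc i L) refl p
   power-ind {rr i s} (p , _) = single (rr i s) (tct i s) refl p
   power-ind {rl i s} (p , _) = single (rl i s) (tct i s) refl p
   power-ind {lp i} (p , p') = trans (double i p p') (lemma (c pl) (c nt) (r i)) where
    lemma : ∀ a b r -> a *Z r *Z (b *Z r) ≡ a *Z b *Z (r *Z r)
    lemma = solve-∀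
   power-ind₂ : ∀ {h h'} -> Expected A h -> Expected A h' -> power (\ t -> ind h t + ind h' t) ≡ vH h *Z vH h'
   power-ind₂ {h} {h'} p p' = trans (prodℤ-cong (current A) (\ {x} _ -> pow-+ (v x) (ind h x) (ind h' x))) (trans (prodℤ-* _ _ (current A)) (cong₂ _*Z_ (power-ind p) (power-ind p')))

  -- The matrix is controlled on the current arcs only, because mutation leaves stale entries at
  -- arcs that have been exchanged away.
  record Good (S : Seed) (Ts : List Tri) : Set where
   field
    TT : Triangles (arcs S) Ts
    matOK : ∀ {α β} -> α ∈ arcs S -> β ∈ arcs S -> mat S α β ≡ form Ts α β
    valOK : ∀ {t} -> t ∈ arcs S -> val S t ≈ᶠ v t

  record Flipped (A : List TArc) (Ts : List Tri) (γ γ' : TArc) (valid : Valid A) : Set where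
   field
    Ts' : List Tri
    TT' : Triangles (flipArcs γ γ' A) Ts'
    U V : TArc -> ℕ
    mut : Mutates A γ γ' (form Ts) (form Ts') U V
    value : v γ *Z v γ' ≡ power {A} valid V +Z power {A} valid U

  good-step : ∀ {S Ts γ γ'} (valid : ∀ {t} -> t ∈ arcs S -> validTArc N t ≡ true) -> γ ∈ arcs S -> γ' ∉ arcs S -> Good S Ts -> (F : Flipped (arcs S) Ts γ γ' valid) -> Good (step N S (γ , γ')) (Flipped.Ts' F)
  good-step {S} {Ts} {γ} {γ'} valid γ∈ γ'∉ good F = record { TT = TT' ; matOK = Mutates.mutated mut (mat S) γ∈ γ'∉ (Good.matOK good) ; valOK = valOK' } where
   open Flipped F
   open Mutates mut using (col; row; disj)
   swap⊎ : ∀ {P Q : Set} -> P ⊎ Q -> Q ⊎ P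
   swap⊎ (inl x) = inr x
   swap⊎ (inr x) = inl x
   entry : ∀ {δ} -> δ ∈ arcs S -> mat S δ γ ≡ pos (V δ) -Z pos (U δ)
   entry p = trans (Good.matOK good p γ∈) (col p)
   neg-sub : ∀ x y -> -Z (x -Z y) ≡ y -Z x
   neg-sub = solve-∀
   plus = prodF-≈ (\ δ -> powF (val S δ) (posPart (mat S δ γ))) (\ δ -> pow (v δ) (V δ)) (current (arcs S)) \ {δ} p -> let δ∈ = current⁻ valid p in subst (\ k -> powF (val S δ) k ≈ᶠ pow (v δ) (V δ)) (sym (trans (cong posPart (entry δ∈)) (posPart-split (V δ) (U δ) (swap⊎ (disj δ∈)))))
    (pow-≈ (V δ) (Good.valOK good δ∈))
   minus = prodF-≈ (\ δ -> powF (val S δ) (posPart (-Z mat S δ γ))) (\ δ -> pow (v δ) (U δ)) (current (arcs S)) \ {δ} p -> let δ∈ = current⁻ valid p in subst (\ k -> powF (val S δ) k ≈ᶠ pow (v δ) (U δ))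
    (sym (trans (cong posPart (trans (cong -Z_ (entry δ∈)) (neg-sub (pos (V δ)) (pos (U δ))))) (posPart-split (U δ) (V δ) (disj δ∈)))) (pow-≈ (U δ) (Good.valOK good δ∈))
   exch-≈ = div-≈ (add-≈ plus minus) (Good.valOK good γ∈) value
   valOK' : ∀ {t} -> t ∈ flipArcs γ γ' (arcs S) -> (if tEq t γ' then exch N S γ else val S t) ≈ᶠ v t
   valOK' 0th rewrite tEq-refl γ' = exch-≈
   valOK' {t} (there p) with ∈-remove⁻ {γ} {t} {arcs S} p
   ... | t∈ , t≢ rewrite ≢⇒tEq {t} {γ'} (\ { refl -> γ'∉ t∈ }) = Good.valOK good t∈

  -- A flip replaces the half-edges G by G' and keeps the others. Whether the new triangles are
  -- glued correctly is thereby reduced to conditions on single half-edges.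
  record Change (A A' : List TArc) (G G' : List Half) : Set where
   field
    uniqG' : Unique G'
    keep : ∀ {h} -> Expected A h -> h ∉ G -> Expected A' h
    new : ∀ {h} -> h ∈ G' -> Expected A' h
    fresh : ∀ {h} -> h ∈ G' -> ¬ Expected A h
    old : ∀ {h} -> Expected A' h -> h ∈ G' ⊎ (Expected A h × h ∉ G)

  module _ {A A' : List TArc} {Ts : List Tri} (TT : Triangles A Ts) where
   open Triangles TT
   outside : ∀ {G K h} -> concatMap halves Ts ↭ G ++ K -> h ∈ K -> Expected A h × h ∉ G
   outside {G} {K} e p = sound (∈-resp-↭ (↭-sym e) (∈-++⁺ʳ G p)) , \ q -> disjoint G (Unique-resp-↭ e uniq) q p where
    disjoint : ∀ {h} G -> Unique (G ++ K) -> h ∈ G -> h ∈ K -> ⊥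
    disjoint (g ∷ G) u 0th q = Unique-head u (∈-++⁺ʳ G q)
    disjoint (g ∷ G) u (there p) q = disjoint G (Unique-tail u) p q
   change : ∀ {G G' K Ts'} -> Change A A' G G' -> concatMap halves Ts ↭ G ++ K -> concatMap halves Ts' ↭ G' ++ K -> (∀ {Δ} -> Δ ∈ Ts' -> TriOK Δ) -> Triangles A' Ts'
   change {G} {G'} {K} {Ts'} ch e e' ok' = record { ok = ok' ; uniq = Unique-resp-↭ (↭-sym e') (Uniqueₚ.++⁺ uniqG' (drop-G G (Unique-resp-↭ e uniq)) (\ (p , q) -> fresh p (fst (outside {G} {K} e q)))) ; sound = \ p -> kept (∈-++⁻ G' (∈-resp-↭ e' p))
    ; complete = \ p -> ∈-resp-↭ (↭-sym e') (cmp (old p)) } where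
    open Change ch
    drop-G : ∀ G -> Unique (G ++ K) -> Unique K
    drop-G [] u = u
    drop-G (g ∷ G) u = drop-G G (Unique-tail u)
    kept : ∀ {h} -> h ∈ G' ⊎ h ∈ K -> Expected A' h
    kept (inl p) = new p
    kept (inr p) = keep (fst (outside {G} {K} e p)) (snd (outside {G} {K} e p))
    cmp : ∀ {h} -> h ∈ G' ⊎ (Expected A h × h ∉ G) -> h ∈ G' ++ K
    cmp (inl p) = ∈-++⁺ˡ p
    cmp (inr (p , q)) with ∈-++⁻ G (∈-resp-↭ e (complete p))
    ... | inl g = ⊥-elim (q g)
    ... | inr k = ∈-++⁺ʳ G' k

  arcs-of-expected : ∀ {A h t} -> Expected A h -> t ∈ arcsOf h -> t ∈ A ⊎ (∃[ i ] t ≡ tnc i 1)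
  arcs-of-expected {h = up i L} (_ , inl refl) 0th = inr (i , refl)
  arcs-of-expected {h = up i L} (_ , inr p) 0th = inl p
  arcs-of-expected {h = dn i L} p 0th = inl p
  arcs-of-expected {h = lp i} (p , q) 0th = inl p
  arcs-of-expected {h = lp i} (p , q) 1st = inl q
  arcs-of-expected {h = rr i s} (p , q) 0th = inl p
  arcs-of-expected {h = rl i s} (p , q) 0th = inl p

  not-yet : ∀ {A h t} -> validTArc N t ≡ true -> t ∉ A -> Expected A h -> t ∉ arcsOf h
  not-yet v∈ t∉ e p with arcs-of-expected e p
  ... | inl q = t∉ q
  ... | inr (i , refl) with validTnc {i} {1} v∈
  ... | _ , s≤s () , _

  Disj : Half -> Half -> Set
  Disj h h' = ∀ {t} -> t ∈ arcsOf h -> t ∉ arcsOf h'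

  ind-disj : ∀ a b c d t -> Disj a b -> Disj a d -> Disj c b -> Disj c d -> ind a t + ind c t ≡ 0 ⊎ ind b t + ind d t ≡ 0
  ind-disj a b c d t ab ad cb cd with ∈T? t (arcsOf a) | ∈T? t (arcsOf c)
  ... | inl p | _ = inr (cong₂ _+_ (ind-∉ {b} (ab p)) (ind-∉ {d} (ad p)))
  ... | inr p | inl q = inr (cong₂ _+_ (ind-∉ {b} (cb q)) (ind-∉ {d} (cd q)))
  ... | inr p | inr q = inl (cong₂ _+_ (ind-∉ {a} p) (ind-∉ {c} q))

  only : ∀ {h t t'} -> arcsOf h ≡ t ∷ [] -> t' ≢ t -> ind h t' ≡ 0
  only {h} {t} {t'} e ne = ind-∉ {h} \ p -> bad (subst (t' ∈_) e p) where
   bad : t' ∉ t ∷ []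
   bad (here q) = ne q

  only₁ : ∀ {h t} -> arcsOf h ≡ t ∷ [] -> ind h t ≡ 1
  only₁ {h} {t} e = ind-∈ {h} (subst (t ∈_) (sym e) 0th)

  module _ {A : List TArc} {Ts : List Tri} (TT : Triangles A Ts) (valid : Valid A) where
   open Triangles TT
   -- The four flips in a quadrilateral differ only in the types of its sides and diagonals, so
   -- their bookkeeping is done once for arbitrary half-edges.
   quadFlip : ∀ {γ γ' Δ₁ Δ₂ Δ₁' Δ₂' g₁ g₂ g₁' g₂' a b c d} -> γ ∈ A -> γ' ∉ A -> validTArc N γ' ≡ true -> Δ₁ ∈ Ts -> Δ₂ ∈ Ts -> Δ₁ ≢ Δ₂ -> Rot g₁ a b (halves Δ₁) -> Rot g₂ c d (halves Δ₂) -> Rot g₁' b c (halves Δ₁') -> Rot g₂' d a (halves Δ₂') ->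
    TriOK Δ₁' -> TriOK Δ₂' -> Change A (flipArcs γ γ' A) (g₁ ∷ g₂ ∷ []) (g₁' ∷ g₂' ∷ []) -> arcsOf g₁ ≡ γ ∷ [] -> arcsOf g₂ ≡ γ ∷ [] -> arcsOf g₁' ≡ γ' ∷ [] -> arcsOf g₂' ≡ γ' ∷ [] -> (∀ {h} -> Expected A h -> γ ∈ arcsOf h -> h ∈ g₁ ∷ g₂ ∷ []) -> Disj a b -> Disj a d -> Disj c b -> Disj c d ->
    v γ *Z v γ' ≡ vH b *Z vH d +Z vH a *Z vH c -> Flipped A Ts γ γ' valid
   quadFlip {γ} {γ'} {Δ₁} {Δ₂} {Δ₁'} {Δ₂'} {g₁} {g₂} {g₁'} {g₂'} {a} {b} {c} {d} γ∈ γ'∉ vγ' p₁ p₂ p≢ ρ₁ ρ₂ ρ₁' ρ₂' ok₁ ok₂ ch A₁ A₂ A₁' A₂' onlyγ ab ad cb cd ve with ∈-extract p₁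
   ... | us , e₁ with ∈-resp-↭ e₁ p₂
   ... | here q = ⊥-elim (p≢ (sym q))
   ... | there p₂' with ∈-extract p₂'
   ... | rest , e₂ = record { Ts' = Δ₁' ∷ Δ₂' ∷ rest ; TT' = change TT ch eH eH' ok' ; mut = quad-mutates (form-skew Ts) (form-skew (Δ₁' ∷ Δ₂' ∷ rest)) (\ {β} _ -> form-free rest β freeγ) (\ {β} _ -> form-free rest β freeγ')
    g₁ g₂ g₁' g₂' a b c d ef ef' G G' O (\ {t} _ -> ind-disj a b c d t ab ad cb cd) ; value = trans ve (sym (cong₂ _+Z_ (power-ind₂ valid {b} {d} (expd 1st) (expd 3rd)) (power-ind₂ valid {a} {c} (expd 0th) (expd 2nd)))) } where
    e = ↭-trans e₁ (prep Δ₁ e₂)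
    K = a ∷ b ∷ c ∷ d ∷ concatMap halves rest
    hs : ∀ {Ts Ts'} -> Ts ↭ Ts' -> concatMap halves Ts ↭ concatMap halves Ts'
    hs Perm.refl = ↭-refl
    hs (prep Δ p) = Permₚ.++⁺ˡ (halves Δ) (hs p)
    hs (swap Δ Δ' p) = ↭-trans (Permₚ.shifts (halves Δ) (halves Δ')) (Permₚ.++⁺ˡ (halves Δ') (Permₚ.++⁺ˡ (halves Δ) (hs p)))
    hs (Perm.trans p q) = ↭-trans (hs p) (hs q)
    eH = ↭-trans (hs e) (↭-trans (rot-↭ ρ₁ (halves Δ₂ ++ concatMap halves rest)) (prep g₁ (↭-trans (prep a (prep b (rot-↭ ρ₂ (concatMap halves rest)))) (shift g₂ (a ∷ b ∷ []) (c ∷ d ∷ concatMap halves rest)))))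
    eH' = ↭-trans (rot-↭ ρ₁' (halves Δ₂' ++ concatMap halves rest)) (prep g₁' (↭-trans (prep b (prep c (rot-↭ ρ₂' (concatMap halves rest)))) (↭-trans (shift g₂' (b ∷ c ∷ []) (d ∷ a ∷ concatMap halves rest)) (prep g₂' (shift a (b ∷ c ∷ d ∷ []) (concatMap halves rest))))))
    out : ∀ {h} -> h ∈ K -> Expected A h × h ∉ g₁ ∷ g₂ ∷ []
    out = outside {A} {A} TT {g₁ ∷ g₂ ∷ []} {K} eH
    expd : ∀ {h} -> h ∈ K -> Expected A h
    expd p = fst (out p)
    noγ : ∀ {h} -> h ∈ K -> γ ∉ arcsOf h
    noγ p q = snd (out p) (onlyγ (expd p) q)
    noγ' : ∀ {h} -> h ∈ K -> γ' ∉ arcsOf h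
    noγ' p = not-yet vγ' γ'∉ (expd p)
    inK : ∀ {h} -> h ∈ concatMap halves rest -> h ∈ K
    inK p = there (there (there (there p)))
    freeγ : ∀ {h} -> h ∈ concatMap halves rest -> γ ∉ arcsOf h
    freeγ p = noγ (inK p)
    freeγ' : ∀ {h} -> h ∈ concatMap halves rest -> γ' ∉ arcsOf h
    freeγ' p = noγ' (inK p)
    ef : ∀ α β -> form Ts α β ≡ T3 g₁ a b α β +Z (T3 g₂ c d α β +Z form rest α β)
    ef α β = trans (form-↭ e α β) (cong₂ _+Z_ (rot-form ρ₁ α β) (cong (_+Z form rest α β) (rot-form ρ₂ α β)))
    ef' : ∀ α β -> form (Δ₁' ∷ Δ₂' ∷ rest) α β ≡ T3 g₁' b c α β +Z (T3 g₂' d a α β +Z form rest α β)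
    ef' α β = cong₂ _+Z_ (rot-form ρ₁' α β) (cong (_+Z form rest α β) (rot-form ρ₂' α β))
    G : ∀ {g} -> g ∈ g₁ ∷ g₂ ∷ [] -> ind g γ ≡ 1 × (∀ {t} -> t ∈ A -> t ≢ γ -> ind g t ≡ 0)
    G 0th = only₁ {g₁} A₁ , \ {t} _ ne -> only {g₁} {t' = t} A₁ ne
    G 1st = only₁ {g₂} A₂ , \ {t} _ ne -> only {g₂} {t' = t} A₂ ne
    G' : ∀ {g} -> g ∈ g₁' ∷ g₂' ∷ [] -> ind g γ' ≡ 1 × (∀ {t} -> t ∈ A -> t ≢ γ -> ind g t ≡ 0)
    G' 0th = only₁ {g₁'} A₁' , \ {t} p _ -> only {g₁'} {t' = t} A₁' (\ { refl -> γ'∉ p })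
    G' 1st = only₁ {g₂'} A₂' , \ {t} p _ -> only {g₂'} {t' = t} A₂' (\ { refl -> γ'∉ p })
    O : ∀ {h} -> h ∈ a ∷ b ∷ c ∷ d ∷ [] -> ind h γ ≡ 0 × ind h γ' ≡ 0
    O {h} p = ind-∉ {h} (noγ (∈-++⁺ˡ p)) , ind-∉ {h} (noγ' (∈-++⁺ˡ p))
    ok' : ∀ {Δ} -> Δ ∈ Δ₁' ∷ Δ₂' ∷ rest -> TriOK Δ
    ok' 0th = ok₁
    ok' 1st = ok₂
    ok' (there (there p)) = ok (∈-resp-↭ (↭-sym e) (there (there p)))

-- The Plücker relation of four vectors in the plane.
ptolemy : ∀ P Q R S -> det P R *Z det Q S ≡ det Q R *Z det P S +Z det P Q *Z det R S
ptolemy (a , b) (c , d) (e , f) (g , h) = lemma a b c d e f g h where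
 lemma : ∀ a b c d e f g h -> (a *Z f -Z b *Z e) *Z (c *Z h -Z d *Z g) ≡ (c *Z f -Z d *Z e) *Z (a *Z h -Z b *Z g) +Z (a *Z d -Z b *Z c) *Z (e *Z h -Z f *Z g)
 lemma = solve-∀

-- The same relation with the fourth vector equal to (0, 1), scaled by k.
ptolemy-ray : ∀ k P Q R -> det P R *Z (k *Z fst Q) ≡ det Q R *Z (k *Z fst P) +Z det P Q *Z (k *Z fst R)
ptolemy-ray k (a , b) (c , d) (e , f) = lemma k a b c d e f where
 lemma : ∀ k a b c d e f -> (a *Z f -Z b *Z e) *Z (k *Z c) ≡ (c *Z f -Z d *Z e) *Z (k *Z a) +Z (a *Z d -Z b *Z c) *Z (k *Z e)
 lemma = solve-∀

tnc-inj : ∀ {i L j M} -> tnc i L ≡ tnc j M -> i ≡ j × L ≡ M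
tnc-inj refl = refl , refl

opp≢ : ∀ s -> s ≢ opp s
opp≢ pl ()
opp≢ nt ()

-- The effect of each kind of flip on half-edges.

module Flip (N : ℕ) (3≤N : 3 ≤ N) (weights : Weights N) where
 open Exchange N 3≤N public
 open Values weights public

 md-≢ : ∀ {x d} -> 1 ≤ d -> d < N -> md N x ≢ md N (x + d)
 md-≢ {x} {d} 1≤d d<N e = <-irrefl (md-window e (m≤m+n x d) (+-monoʳ-< x d<N)) (m<m+n x 1≤d)

 disj-up : ∀ {i L j M} -> i ≢ j -> Disj (up i L) (up j M)
 disj-up ne 0th 0th = ne refl

 disj-top : ∀ {i L j K} -> (i ≢ j ⊎ L ≢ K) -> Disj (up i L) (top j K)
 disj-top {i} {L} {j} {K} ne {t} 0th p with K ≡ᵇ N | p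
 ... | false | 0th = absurd ne where
  absurd : (i ≢ i ⊎ L ≢ L) -> ⊥
  absurd (inl x) = x refl
  absurd (inr x) = x refl
 ... | true | there (there ())

 disj-sym : ∀ {h h'} -> Disj h h' -> Disj h' h
 disj-sym d p q = d q p

 mem⁻ : ∀ {γ γ' A t} -> t ∈ flipArcs γ γ' A -> t ≡ γ' ⊎ (t ∈ A × t ≢ γ)
 mem⁻ (here e) = inl e
 mem⁻ {γ} {γ'} {A} {t} (there p) = inr (∈-remove⁻ {γ} {t} {A} p)

 mem⁺ : ∀ {γ γ' A t} -> t ∈ A -> t ≢ γ -> t ∈ flipArcs γ γ' A
 mem⁺ {γ} {γ'} {A} {t} p ne = there (∈-remove⁺ {γ} {t} {A} p ne)

 change-swap : ∀ {A A' G x y} -> Change A A' G (x ∷ y ∷ []) -> Change A A' G (y ∷ x ∷ [])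
 change-swap {A} {A'} {G} {x} {y} ch = record { uniqG' = Unique-resp-↭ (swap x y ↭-refl) uniqG' ; keep = keep ; new = \ p -> new (sw p) ; fresh = \ p -> fresh (sw p) ; old = \ p -> sw' (old p) } where
  open Change ch
  sw : ∀ {h x y} -> h ∈ y ∷ x ∷ [] -> h ∈ x ∷ y ∷ []
  sw (here e) = there (here e)
  sw (there (here e)) = here e
  sw' : ∀ {h} -> h ∈ x ∷ y ∷ [] ⊎ (Expected A h × h ∉ G) -> h ∈ y ∷ x ∷ [] ⊎ (Expected A h × h ∉ G)
  sw' (inl p) = inl (sw p)
  sw' (inr p) = inr p

 -- In these names C is a chord, R a central arc and L the loop around twins; the first letter is
 -- what disappears, the second what is inserted.
 change-CC : ∀ {A i K j M} -> 2 ≤ K -> tnc j M ∉ A -> j < N -> 2 ≤ M -> Change A (flipArcs (tnc i K) (tnc j M) A) (dn i K ∷ up i K ∷ []) (dn j M ∷ up j M ∷ [])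
 change-CC {A} {i} {K} {j} {M} 2≤K j∉ j<N 2≤M = record { uniqG' = Unique-∷ (\ { (here ()) ; (there ()) }) (Unique-∷ (\ ()) []) ; keep = keep ; new = new ; fresh = fresh ; old = old } where
  A' = flipArcs (tnc i K) (tnc j M) A
  ray⁺ : ∀ {k s} -> tct k s ∈ A -> tct k s ∈ A'
  ray⁺ p = mem⁺ p (\ ())
  ray⁻ : ∀ {k s} -> tct k s ∈ A' -> tct k s ∈ A
  ray⁻ p with mem⁻ p
  ... | inr (q , _) = q
  keep : ∀ {h} -> Expected A h -> h ∉ dn i K ∷ up i K ∷ [] -> Expected A' h
  keep {up k L} (k<N , inl e) ne = k<N , inl e
  keep {up k L} (k<N , inr p) ne = k<N , inr (mem⁺ p (\ { refl -> ne 1st }))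
  keep {dn k L} p ne = mem⁺ p (\ { refl -> ne 0th })
  keep {lp k} (p , q) ne = ray⁺ p , ray⁺ q
  keep {rr k s} (p , q) ne = ray⁺ p , \ r -> q (ray⁻ r)
  keep {rl k s} (p , q) ne = ray⁺ p , \ r -> q (ray⁻ r)
  new : ∀ {h} -> h ∈ dn j M ∷ up j M ∷ [] -> Expected A' h
  new 0th = 0th
  new 1st = j<N , inr 0th
  fresh : ∀ {h} -> h ∈ dn j M ∷ up j M ∷ [] -> ¬ Expected A h
  fresh 0th p = j∉ p
  fresh 1st (_ , inl refl) = <-irrefl refl 2≤M
  fresh 1st (_ , inr p) = j∉ p
  old : ∀ {h} -> Expected A' h -> h ∈ dn j M ∷ up j M ∷ [] ⊎ (Expected A h × h ∉ dn i K ∷ up i K ∷ [])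
  old {up k L} (k<N , inr p) with mem⁻ p
  ... | inl refl = inl 1st
  ... | inr (q , ne) = inr ((k<N , inr q) , \ { 1st -> ne refl })
  old {up k L} (k<N , inl refl) = inr ((k<N , inl refl) , \ { 1st -> <-irrefl refl 2≤K })
  old {dn k L} p with mem⁻ p
  ... | inl refl = inl 0th
  ... | inr (q , ne) = inr (q , \ { 0th -> ne refl ; (there (there ())) })
  old {lp k} (p , q) = inr ((ray⁻ p , ray⁻ q) , \ { (there (here ())) ; (there (there ())) })
  old {rr k s} (p , q) = inr ((ray⁻ p , \ r -> q (ray⁺ r)) , \ { (there (there ())) })
  old {rl k s} (p , q) = inr ((ray⁻ p , \ r -> q (ray⁺ r)) , \ { (there (there ())) })

 change-CR : ∀ {A i K j s} -> 2 ≤ K -> tct j s ∉ A -> tct j (opp s) ∉ A -> Change A (flipArcs (tnc i K) (tct j s) A) (dn i K ∷ up i K ∷ []) (rr j s ∷ rl j s ∷ [])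
 change-CR {A} {i} {K} {j} {s} 2≤K j∉ j'∉ = record { uniqG' = Unique-∷ (\ { (here ()) ; (there ()) }) (Unique-∷ (\ ()) []) ; keep = keep ; new = new ; fresh = fresh ; old = old } where
  A' = flipArcs (tnc i K) (tct j s) A
  ray⁺ : ∀ {k r} -> tct k r ∈ A -> tct k r ∈ A'
  ray⁺ p = mem⁺ p (\ ())
  j'∉A' : tct j (opp s) ∉ A'
  j'∉A' p with mem⁻ p
  ... | inl e = opp≢ s (sym (tag e)) where
   tag : ∀ {a b r q} -> tct a r ≡ tct b q -> r ≡ q
   tag refl = refl
  ... | inr (q , _) = j'∉ q
  only-s : ∀ {k r} -> tct k r ∈ A -> tct k (opp r) ∉ A -> tct k (opp r) ∉ A'
  only-s {k} {r} p p' q with mem⁻ q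
  ... | inr (q' , _) = p' q'
  ... | inl refl = j'∉ (subst (\ u -> tct j u ∈ A) (sym (opp-invol r)) p)
  keep : ∀ {h} -> Expected A h -> h ∉ dn i K ∷ up i K ∷ [] -> Expected A' h
  keep {up k L} (k<N , inl e) ne = k<N , inl e
  keep {up k L} (k<N , inr p) ne = k<N , inr (mem⁺ p (\ { refl -> ne 1st }))
  keep {dn k L} p ne = mem⁺ p (\ { refl -> ne 0th })
  keep {lp k} (p , q) ne = ray⁺ p , ray⁺ q
  keep {rr k r} (p , q) ne = ray⁺ p , only-s p q
  keep {rl k r} (p , q) ne = ray⁺ p , only-s p q
  new : ∀ {h} -> h ∈ rr j s ∷ rl j s ∷ [] -> Expected A' h
  new 0th = 0th , j'∉A'
  new 1st = 0th , j'∉A'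
  fresh : ∀ {h} -> h ∈ rr j s ∷ rl j s ∷ [] -> ¬ Expected A h
  fresh 0th (p , _) = j∉ p
  fresh 1st (p , _) = j∉ p
  old : ∀ {h} -> Expected A' h -> h ∈ rr j s ∷ rl j s ∷ [] ⊎ (Expected A h × h ∉ dn i K ∷ up i K ∷ [])
  old {up k L} (k<N , inr p) with mem⁻ p
  ... | inr (q , ne) = inr ((k<N , inr q) , \ { 1st -> ne refl })
  old {up k L} (k<N , inl refl) = inr ((k<N , inl refl) , \ { 1st -> <-irrefl refl 2≤K })
  old {dn k L} p with mem⁻ p
  ... | inr (q , ne) = inr (q , \ { 0th -> ne refl ; (there (there ())) })
  old {lp k} (p , q) with mem⁻ p | mem⁻ q
  ... | inr (p' , _) | inr (q' , _) = inr ((p' , q') , \ { (there (there ())) })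
  ... | inl refl | inr (q' , _) = ⊥-elim (j'∉ q')
  ... | inr (p' , _) | inl refl = ⊥-elim (j'∉ p')
  ... | inl refl | inl ()
  old {rr k r} (p , q) with mem⁻ p
  ... | inl refl = inl 0th
  ... | inr (p' , _) = inr ((p' , \ u -> q (ray⁺ u)) , \ { (there (there ())) })
  old {rl k r} (p , q) with mem⁻ p
  ... | inl refl = inl 1st
  ... | inr (p' , _) = inr ((p' , \ u -> q (ray⁺ u)) , \ { (there (there ())) })

 change-RC : ∀ {A i s j M} -> tct i (opp s) ∉ A -> tnc j M ∉ A -> j < N -> 2 ≤ M -> Change A (flipArcs (tct i s) (tnc j M) A) (rl i s ∷ rr i s ∷ []) (dn j M ∷ up j M ∷ [])
 change-RC {A} {i} {s} {j} {M} i'∉ j∉ j<N 2≤M = record { uniqG' = Unique-∷ (\ { (here ()) ; (there ()) }) (Unique-∷ (\ ()) []) ; keep = keep ; new = new ; fresh = fresh ; old = old } where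
  A' = flipArcs (tct i s) (tnc j M) A
  ray⁻ : ∀ {k r} -> tct k r ∈ A' -> tct k r ∈ A × tct k r ≢ tct i s
  ray⁻ p with mem⁻ p
  ... | inr q = q
  both-ne : ∀ {k r} -> tct k r ∈ A -> tct k (opp r) ∈ A -> tct k r ≢ tct i s
  both-ne p q refl = i'∉ q
  keep : ∀ {h} -> Expected A h -> h ∉ rl i s ∷ rr i s ∷ [] -> Expected A' h
  keep {up k L} (k<N , inl e) ne = k<N , inl e
  keep {up k L} (k<N , inr p) ne = k<N , inr (mem⁺ p (\ ()))
  keep {dn k L} p ne = mem⁺ p (\ ())
  keep {lp k} (p , q) ne = mem⁺ p (both-ne p q) , mem⁺ q (both-ne q p)
  keep {rr k r} (p , q) ne = mem⁺ p (\ { refl -> ne 1st }) , \ u -> q (fst (ray⁻ u))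
  keep {rl k r} (p , q) ne = mem⁺ p (\ { refl -> ne 0th }) , \ u -> q (fst (ray⁻ u))
  new : ∀ {h} -> h ∈ dn j M ∷ up j M ∷ [] -> Expected A' h
  new 0th = 0th
  new 1st = j<N , inr 0th
  fresh : ∀ {h} -> h ∈ dn j M ∷ up j M ∷ [] -> ¬ Expected A h
  fresh 0th p = j∉ p
  fresh 1st (_ , inl refl) = <-irrefl refl 2≤M
  fresh 1st (_ , inr p) = j∉ p
  back : ∀ {k r} -> tct k r ∈ A × tct k r ≢ tct i s -> tct k (opp r) ∉ A' -> tct k (opp r) ∉ A
  back {k} {r} (p , ne) q u with ∈T? (tct k (opp r)) A'
  ... | inl z = q z
  ... | inr z = z (mem⁺ u (\ { refl -> i'∉ (subst (\ w -> tct i w ∈ A) (sym (opp-invol r)) p) }))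
  old : ∀ {h} -> Expected A' h -> h ∈ dn j M ∷ up j M ∷ [] ⊎ (Expected A h × h ∉ rl i s ∷ rr i s ∷ [])
  old {up k L} (k<N , inr p) with mem⁻ p
  ... | inl refl = inl 1st
  ... | inr (q , ne) = inr ((k<N , inr q) , \ { (there (there ())) })
  old {up k L} (k<N , inl refl) = inr ((k<N , inl refl) , \ { (there (there ())) })
  old {dn k L} p with mem⁻ p
  ... | inl refl = inl 0th
  ... | inr (q , ne) = inr (q , \ { (there (there ())) })
  old {lp k} (p , q) = inr ((fst (ray⁻ p) , fst (ray⁻ q)) , \ { (there (there ())) })
  old {rr k r} (p , q) = inr ((fst (ray⁻ p) , back (ray⁻ p) q) , \ { 1st -> snd (ray⁻ p) refl })
  old {rl k r} (p , q) = inr ((fst (ray⁻ p) , back (ray⁻ p) q) , \ { 0th -> snd (ray⁻ p) refl ; (there (there ())) })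

 tct-tag : ∀ {a b r q} -> tct a r ≡ tct b q -> r ≡ q
 tct-tag refl = refl

 -- The kept twin is no longer enclosed and regains both of its sides, so one old half-edge is
 -- replaced by four.
 change-LR : ∀ {A i j s} -> tct i s ∈ A -> tct i (opp s) ∈ A -> i ≢ j -> (∀ {k r} -> tct k r ∈ A -> k ≡ i) -> Change A (flipArcs (tct i (opp s)) (tct j s) A) (lp i ∷ []) (rl j s ∷ rr j s ∷ rr i s ∷ rl i s ∷ [])
 change-LR {A} {i} {j} {s} i∈ i'∈ i≢j at-i = record { uniqG' = Unique-∷ (\ { (there (there (here e))) -> i≢j (sym (rl-inj e)) ; (there (there (there ()))) }) (Unique-∷ (\ { (here e) -> i≢j (sym (rr-inj e)) ; (there (there ())) }) (Unique-∷ (\ { (there ()) }) (Unique-∷ (\ ()) [])))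
  ; keep = keep ; new = new ; fresh = fresh ; old = old } where
  rl-inj : ∀ {a b r q} -> rl a r ≡ rl b q -> a ≡ b
  rl-inj refl = refl
  rr-inj : ∀ {a b r q} -> rr a r ≡ rr b q -> a ≡ b
  rr-inj refl = refl
  A' = flipArcs (tct i (opp s)) (tct j s) A
  i∈A' = mem⁺ i∈ (\ e -> opp≢ s (tct-tag e))
  i'∉A' : tct i (opp s) ∉ A'
  i'∉A' p with mem⁻ {tct i (opp s)} {tct j s} {A} p
  ... | inl e = opp≢ s (sym (tct-tag e))
  ... | inr (_ , ne) = ne refl
  j'∉A' : tct j (opp s) ∉ A'
  j'∉A' p with mem⁻ p
  ... | inl e = opp≢ s (sym (tct-tag e))
  ... | inr (q , _) = i≢j (sym (at-i q))
  no-single : ∀ {k r} -> tct k r ∈ A -> tct k (opp r) ∉ A -> ⊥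
  no-single {k} {r} p q with at-i p | tag-cases s r
  ... | refl | inl refl = q i'∈
  ... | refl | inr refl = q (subst (\ w -> tct i w ∈ A) (sym (opp-invol s)) i∈)
  keep : ∀ {h} -> Expected A h -> h ∉ lp i ∷ [] -> Expected A' h
  keep {up k L} (k<N , inl e) ne = k<N , inl e
  keep {up k L} (k<N , inr p) ne = k<N , inr (mem⁺ p (\ ()))
  keep {dn k L} p ne = mem⁺ p (\ ())
  keep {lp k} (p , q) ne = ⊥-elim (ne (here (cong lp (at-i p))))
  keep {rr k r} (p , q) ne = ⊥-elim (no-single p q)
  keep {rl k r} (p , q) ne = ⊥-elim (no-single p q)
  new : ∀ {h} -> h ∈ rl j s ∷ rr j s ∷ rr i s ∷ rl i s ∷ [] -> Expected A' h
  new 0th = 0th , j'∉A'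
  new 1st = 0th , j'∉A'
  new 2nd = i∈A' , i'∉A'
  new 3rd = i∈A' , i'∉A'
  fresh : ∀ {h} -> h ∈ rl j s ∷ rr j s ∷ rr i s ∷ rl i s ∷ [] -> ¬ Expected A h
  fresh 0th (p , q) = no-single p q
  fresh 1st (p , q) = no-single p q
  fresh 2nd (p , q) = no-single p q
  fresh 3rd (p , q) = no-single p q
  ray⁻ : ∀ {k r} -> tct k r ∈ A' -> (k ≡ j ⊎ k ≡ i) × r ≡ s
  ray⁻ {k} {r} p with mem⁻ p
  ... | inl refl = inl refl , refl
  ... | inr (q , ne) with at-i q | tag-cases s r
  ... | refl | inl refl = inr refl , refl
  ... | refl | inr refl = ⊥-elim (ne refl)
  old : ∀ {h} -> Expected A' h -> h ∈ rl j s ∷ rr j s ∷ rr i s ∷ rl i s ∷ [] ⊎ (Expected A h × h ∉ lp i ∷ [])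
  old {up k L} (k<N , inr p) with mem⁻ p
  ... | inr (q , ne) = inr ((k<N , inr q) , \ { (there ()) })
  old {up k L} (k<N , inl refl) = inr ((k<N , inl refl) , \ { (there ()) })
  old {dn k L} p with mem⁻ p
  ... | inr (q , ne) = inr (q , \ { (there ()) })
  old {lp k} (p , q) with snd (ray⁻ p) | snd (ray⁻ q)
  ... | refl | ()
  old {rr k r} (p , q) with ray⁻ p
  ... | inl refl , refl = inl 1st
  ... | inr refl , refl = inl 2nd
  old {rl k r} (p , q) with ray⁻ p
  ... | inl refl , refl = inl 0th
  ... | inr refl , refl = inl 3rd

 change-RL : ∀ {A i j s} -> tct i s ∈ A -> tct j s ∈ A -> i ≢ j -> (∀ {k r} -> tct k r ∈ A -> (k ≡ j ⊎ k ≡ i) × r ≡ s) -> Change A (flipArcs (tct j s) (tct i (opp s)) A) (rl j s ∷ rr j s ∷ rr i s ∷ rl i s ∷ []) (lp i ∷ [])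
 change-RL {A} {i} {j} {s} i∈ j∈ i≢j at = record { uniqG' = Unique-∷ (\ ()) [] ; keep = keep ; new = new ; fresh = fresh ; old = old } where
  A' = flipArcs (tct j s) (tct i (opp s)) A
  i∈A' = mem⁺ i∈ (\ { refl -> i≢j refl })
  loop : ∀ s -> tct i s ∈ A' -> tct i (opp s) ∈ A' -> tct i pl ∈ A' × tct i nt ∈ A'
  loop pl p q = p , q
  loop nt p q = q , p
  ray⁻ : ∀ {k r} -> tct k r ∈ A' -> k ≡ i
  ray⁻ p with mem⁻ p
  ... | inl refl = refl
  ... | inr (q , ne) with at q
  ... | inl refl , refl = ⊥-elim (ne refl)
  ... | inr refl , _ = refl
  keep : ∀ {h} -> Expected A h -> h ∉ rl j s ∷ rr j s ∷ rr i s ∷ rl i s ∷ [] -> Expected A' h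
  keep {up k L} (k<N , inl e) ne = k<N , inl e
  keep {up k L} (k<N , inr p) ne = k<N , inr (mem⁺ p (\ ()))
  keep {dn k L} p ne = mem⁺ p (\ ())
  keep {lp k} (p , q) ne with snd (at p) | snd (at q)
  ... | refl | ()
  keep {rr k r} (p , q) ne with at p
  ... | inl refl , refl = ⊥-elim (ne 1st)
  ... | inr refl , refl = ⊥-elim (ne 2nd)
  keep {rl k r} (p , q) ne with at p
  ... | inl refl , refl = ⊥-elim (ne 0th)
  ... | inr refl , refl = ⊥-elim (ne 3rd)
  new : ∀ {h} -> h ∈ lp i ∷ [] -> Expected A' h
  new 0th = loop s i∈A' 0th
  fresh : ∀ {h} -> h ∈ lp i ∷ [] -> ¬ Expected A h
  fresh 0th (p , q) with snd (at p) | snd (at q)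
  ... | refl | ()
  single : ∀ {k r} -> tct k r ∈ A' -> tct k (opp r) ∉ A' -> ⊥
  single {k} {r} p q with ray⁻ p | tag-cases s r
  ... | refl | inl refl = q 0th
  ... | refl | inr refl = q (subst (\ w -> tct i w ∈ A') (sym (opp-invol s)) i∈A')
  old : ∀ {h} -> Expected A' h -> h ∈ lp i ∷ [] ⊎ (Expected A h × h ∉ rl j s ∷ rr j s ∷ rr i s ∷ rl i s ∷ [])
  old {up k L} (k<N , inr p) with mem⁻ p
  ... | inr (q , ne) = inr ((k<N , inr q) , \ { (there (there (there (there ())))) })
  old {up k L} (k<N , inl refl) = inr ((k<N , inl refl) , \ { (there (there (there (there ())))) })
  old {dn k L} p with mem⁻ p
  ... | inr (q , ne) = inr (q , \ { (there (there (there (there ())))) })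
  old {lp k} (p , q) = inl (here (cong lp (ray⁻ p)))
  old {rr k r} (p , q) = ⊥-elim (single p q)
  old {rl k r} (p , q) = ⊥-elim (single p q)

 halves-↭ : ∀ {Ts Ts'} -> Ts ↭ Ts' -> concatMap halves Ts ↭ concatMap halves Ts'
 halves-↭ Perm.refl = ↭-refl
 halves-↭ (prep Δ p) = Permₚ.++⁺ˡ (halves Δ) (halves-↭ p)
 halves-↭ (swap Δ Δ' p) = ↭-trans (Permₚ.shifts (halves Δ) (halves Δ')) (Permₚ.++⁺ˡ (halves Δ') (Permₚ.++⁺ˡ (halves Δ) (halves-↭ p)))
 halves-↭ (Perm.trans p q) = ↭-trans (halves-↭ p) (halves-↭ q)

-- Flips inside a quadrilateral.

module FlipCases (N : ℕ) (3≤N : 3 ≤ N) (weights : Weights N) where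
 open Flip N 3≤N weights public

 halves-tr : ∀ x L M -> halves (tr (md N x) L M) ≡ up (md N x) L ∷ up (md N (x + L)) M ∷ top (md N x) (L + M) ∷ []
 halves-tr x L M = cong (\ i -> up (md N x) L ∷ up i M ∷ top (md N x) (L + M) ∷ []) (md-md+ x L)

 halves-trc : ∀ x L M -> L + M ≢ N -> halves (tr (md N x) L M) ≡ up (md N x) L ∷ up (md N (x + L)) M ∷ dn (md N x) (L + M) ∷ []
 halves-trc x L M ne = trans (halves-tr x L M) (cong (\ h -> up (md N x) L ∷ up (md N (x + L)) M ∷ h ∷ []) (top-chord ne))

 halves-tp : ∀ x L s -> halves (tp (md N x) L s) ≡ up (md N x) L ∷ rl (md N (x + L)) s ∷ rr (md N x) s ∷ []
 halves-tp x L s = cong (\ i -> up (md N x) L ∷ rl i s ∷ rr (md N x) s ∷ []) (md-md+ x L)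

 len-at : ∀ x L {y z} -> x ≡ y -> x + L ≡ z -> len (md N x) L ≡ det (W y) (W z)
 len-at x L refl refl = len-md x L

 top-at : ∀ x L {y z} -> x ≡ y -> x + L ≡ z -> vH (top (md N x) L) ≡ det (W y) (W z)
 top-at x L e e' = trans (vH-top {md N x} {L}) (len-at x L e e')

 ray-at : ∀ s x {y} -> x ≡ y -> c s *Z r (md N x) ≡ c s *Z r y
 ray-at s x refl = cong (c s *Z_) (r-md x)

 tr-inj : ∀ {i L M j L' M'} -> tr i L M ≡ tr j L' M' -> i ≡ j × L ≡ L' × M ≡ M'
 tr-inj refl = refl , refl , refl

 tp-inj : ∀ {i L s j L' s'} -> tp i L s ≡ tp j L' s' -> i ≡ j
 tp-inj refl = refl

 chord-halves : ∀ {A h i K} -> Expected A h -> tnc i K ∈ arcsOf h -> h ∈ dn i K ∷ up i K ∷ []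
 chord-halves {h = up i L} e 0th = 1st
 chord-halves {h = dn i L} e 0th = 0th
 chord-halves {h = lp i} e (there (there ()))
 chord-halves {h = rr i s} e (there ())
 chord-halves {h = rl i s} e (there ())

 module _ {A : List TArc} {Ts : List Tri} (TT : Triangles A Ts) (valid : Valid A) where
  open Structure TT using (ok; ok-tr; tr-sides; tp-sides)

  -- (x , x+L+M) is replaced by (x+L , x+L+M+R)
  flip-right : ∀ {x L M R} -> tr (md N x) L M ∈ Ts -> tr (md N x) (L + M) R ∈ Ts -> tnc (md N x) (L + M) ∈ A -> tnc (md N (x + L)) (M + R) ∉ A -> M + R < N -> Flipped A Ts (tnc (md N x) (L + M)) (tnc (md N (x + L)) (M + R)) valid
  flip-right {x} {L} {M} {R} p q γ∈ γ'∉ MR<N with ok p | ok q | validTnc (valid γ∈)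
  ... | _ , 1≤L , 1≤M , _ | _ , _ , 1≤R , LMR≤N | _ , 2≤LM , LM<N = quadFlip TT valid {Δ₁' = tr j M R} {Δ₂' = tr i L (M + R)} {a = up i L} {b = up j M} {c = up (md N (x + (L + M))) R} {d = top i (L + M + R)} γ∈ γ'∉ (validTnc⁺ (md-< _) 2≤MR MR<N) p q
   (\ e -> <-irrefl (fst (snd (tr-inj e))) (m<m+n L 1≤M)) (subst (Rot _ _ _) (sym (halves-trc x L M (<⇒≢ LM<N))) r2) (subst (Rot _ _ _) (sym (halves-tr x (L + M) R)) r0)
   (subst (Rot _ _ _) (sym (trans (halves-trc (x + L) M R (<⇒≢ MR<N)) (cong (\ k -> up j M ∷ up (md N k) R ∷ dn j (M + R) ∷ []) (+-assoc x L M)))) r2) (subst (Rot _ _ _) (sym (trans (halves-tr x L (M + R)) (cong (\ k -> up i L ∷ up j (M + R) ∷ top i k ∷ []) (sym (+-assoc L M R))))) r1)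
   (md-< _ , 1≤M , 1≤R , <⇒≤ MR<N) (md-< _ , 1≤L , ≤-trans 1≤M (m≤m+n M R) , subst (_≤ N) (+-assoc L M R) LMR≤N) (change-CC 2≤LM γ'∉ (md-< _) 2≤MR) refl refl refl refl chord-halves (disj-up (md-≢ 1≤L (≤-<-trans (m≤m+n L M) LM<N)))
   (disj-top (inr (<⇒≢ (lia 3 (\ L M R -> (# 1 :≤ M) ∷ [] ⊢ L :< L :+ M :+ R) L M R 1≤M)))) (disj-up (\ e -> md-≢ {x + L} 1≤M (≤-<-trans (m≤n+m M L) LM<N) (trans (sym e) (cong (md N) (sym (+-assoc x L M)))))) (disj-top (inl (\ e -> md-≢ {x} (≤-trans 1≤L (m≤m+n L M)) LM<N (sym e))))
   (trans (cong₂ _*Z_ (len-at x (L + M) refl refl) (len-at (x + L) (M + R) refl (lia 4 (\ x L M R -> [] ⊢ x :+ L :+ (M :+ R) :≡ x :+ (L :+ M :+ R)) x L M R))) (trans (ptolemy (W x) (W (x + L)) (W (x + (L + M))) (W (x + (L + M + R))))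
   (sym (cong₂ _+Z_ (cong₂ _*Z_ (len-at (x + L) M refl (+-assoc x L M)) (top-at x (L + M + R) refl refl)) (cong₂ _*Z_ (len-at x L refl refl) (len-at (x + (L + M)) R refl (+-assoc x (L + M) R))))))) where
   i = md N x
   j = md N (x + L)
   2≤MR = +-mono-≤ 1≤M 1≤R

  -- (a+J , a+J+L+M) is replaced by (a , a+J+L)
  flip-left : ∀ {a J L M} -> tr (md N (a + J)) L M ∈ Ts -> tr (md N a) J (L + M) ∈ Ts -> tnc (md N (a + J)) (L + M) ∈ A -> tnc (md N a) (J + L) ∉ A -> J + L < N -> Flipped A Ts (tnc (md N (a + J)) (L + M)) (tnc (md N a) (J + L)) valid
  flip-left {a} {J} {L} {M} p q γ∈ γ'∉ JL<N with ok p | ok q | validTnc (valid γ∈)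
  ... | _ , 1≤L , 1≤M , _ | _ , 1≤J , _ , JLM≤N | _ , 2≤LM , LM<N = quadFlip TT valid {Δ₁' = tr i (J + L) M} {Δ₂' = tr i J L} {a = up j L} {b = up k M} {c = top i (J + (L + M))} {d = up i J} γ∈ γ'∉ (validTnc⁺ (md-< _) 2≤JL JL<N) p q (\ e -> <-irrefl (snd (snd (tr-inj e))) (m<n+m M 1≤L))
   (subst (Rot _ _ _) (sym (halves-trc x L M (<⇒≢ LM<N))) r2) (subst (Rot _ _ _) (sym (halves-tr a J (L + M))) r1) (subst (Rot _ _ _) (sym (trans (halves-tr a (J + L) M) (cong₂ (\ k' l -> up i (J + L) ∷ up (md N k') M ∷ top i l ∷ []) (sym (+-assoc a J L)) (+-assoc J L M)))) r0)
   (subst (Rot _ _ _) (sym (halves-trc a J L (<⇒≢ JL<N))) r2) (md-< _ , ≤-trans 1≤J (m≤m+n J L) , 1≤M , subst (_≤ N) (sym (+-assoc J L M)) JLM≤N) (md-< _ , 1≤J , 1≤L , <⇒≤ JL<N) (change-swap (change-CC 2≤LM γ'∉ (md-< _) 2≤JL)) refl refl refl refl chord-halves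
   (disj-up (md-≢ 1≤L (≤-<-trans (m≤m+n L M) LM<N))) (disj-up (\ e -> md-≢ 1≤J J<N (sym e))) (disj-sym {up k M} {top i (J + (L + M))} (disj-top (inl (\ e -> md-≢ {a} (≤-trans 1≤J (m≤m+n J L)) JL<N (trans (sym e) (cong (md N) (+-assoc a J L)))))))
   (disj-sym {up i J} {top i (J + (L + M))} (disj-top (inr (<⇒≢ (lia 3 (\ J L M -> (# 1 :≤ L) ∷ [] ⊢ J :< J :+ (L :+ M)) J L M 1≤L))))) (trans (cong₂ _*Z_ (len-at x (L + M) refl (sym (+-assoc x L M))) (len-at a (J + L) refl (sym (+-assoc a J L))))
   (trans (ℤₚ.*-comm (det (W x) (W (x + L + M))) (det (W a) (W (x + L)))) (trans (ptolemy (W a) (W x) (W (x + L)) (W (x + L + M))) (trans (ℤₚ.+-comm (det (W x) (W (x + L)) *Z det (W a) (W (x + L + M))) _)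
   (sym (cong₂ _+Z_ (trans (cong₂ _*Z_ (len-at (x + L) M refl refl) (len-at a J refl refl)) (ℤₚ.*-comm (det (W (x + L)) (W (x + L + M))) (det (W a) (W x))))
   (cong₂ _*Z_ (len-at x L refl refl) (top-at a (J + (L + M)) refl (lia 4 (\ a J L M -> [] ⊢ a :+ (J :+ (L :+ M)) :≡ a :+ J :+ L :+ M) a J L M))))))))) where
   i = md N a
   j = md N (a + J)
   k = md N (a + J + L)
   x = a + J
   J<N : J < N
   J<N = ≤-<-trans (m≤m+n J L) JL<N
   2≤JL = +-mono-≤ 1≤J 1≤L

  -- (x , x+L+M) is replaced by the central arc at x+L
  flip-in : ∀ {x L M s} -> tr (md N x) L M ∈ Ts -> tp (md N x) (L + M) s ∈ Ts -> tnc (md N x) (L + M) ∈ A -> tct (md N (x + L)) s ∉ A -> tct (md N (x + L)) (opp s) ∉ A -> Flipped A Ts (tnc (md N x) (L + M)) (tct (md N (x + L)) s) valid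
  flip-in {x} {L} {M} {s} p q γ∈ γ'∉ γ''∉ with ok p | validTnc (valid γ∈)
  ... | _ , 1≤L , 1≤M , _ | _ , 2≤LM , LM<N = quadFlip TT valid {Δ₁' = tp j M s} {Δ₂' = tp i L s} {a = up i L} {b = up j M} {c = rl (md N (x + (L + M))) s} {d = rr i s} γ∈ γ'∉ (<⇒<ᵇ≡ (md-< _)) p q (\ ()) (subst (Rot _ _ _) (sym (halves-trc x L M (<⇒≢ LM<N))) r2)
   (subst (Rot _ _ _) (sym (halves-tp x (L + M) s)) r0) (subst (Rot _ _ _) (sym (trans (halves-tp (x + L) M s) (cong (\ k -> up j M ∷ rl (md N k) s ∷ rr j s ∷ []) (+-assoc x L M)))) r2) (subst (Rot _ _ _) (sym (halves-tp x L s)) r1)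
   (md-< _ , 1≤M , ≤-<-trans (m≤n+m M L) LM<N) (md-< _ , 1≤L , ≤-<-trans (m≤m+n L M) LM<N) (change-CR 2≤LM γ'∉ γ''∉) refl refl refl refl chord-halves (disj-up (md-≢ 1≤L (≤-<-trans (m≤m+n L M) LM<N))) (\ { 0th (there ()) }) (\ { 0th (there ()) })
   (\ { 0th (here e) -> md-≢ {x} (≤-trans 1≤L (m≤m+n L M)) LM<N (sym (tct-inj e)) }) (trans (cong₂ _*Z_ (len-at x (L + M) refl refl) (ray-at s (x + L) refl)) (trans (ptolemy-ray (c s) (W x) (W (x + L)) (W (x + (L + M))))
   (sym (cong₂ _+Z_ (cong₂ _*Z_ (len-at (x + L) M refl (+-assoc x L M)) (ray-at s x refl)) (cong₂ _*Z_ (len-at x L refl refl) (ray-at s (x + (L + M)) refl)))))) where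
   i = md N x
   j = md N (x + L)

  -- the central arc at a+J is replaced by (a , a+J+L)
  flip-out : ∀ {a J L s} -> tp (md N a) J s ∈ Ts -> tp (md N (a + J)) L s ∈ Ts -> tct (md N (a + J)) s ∈ A -> tnc (md N a) (J + L) ∉ A -> J + L < N -> Flipped A Ts (tct (md N (a + J)) s) (tnc (md N a) (J + L)) valid
  flip-out {a} {J} {L} {s} p q γ∈ γ'∉ JL<N with ok p | ok q
  ... | _ , 1≤J , J<N | _ , 1≤L , L<N = quadFlip TT valid {Δ₁' = tr i J L} {Δ₂' = tp i (J + L) s} {a = rr i s} {b = up i J} {c = up j L} {d = rl (md N (x + L)) s} γ∈ γ'∉ (validTnc⁺ (md-< _) 2≤JL JL<N) p q (\ e -> md-≢ 1≤J J<N (tp-inj e)) (subst (Rot _ _ _) (sym (halves-tp a J s)) r1)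
   (subst (Rot _ _ _) (sym (halves-tp x L s)) r2) (subst (Rot _ _ _) (sym (halves-trc a J L (<⇒≢ JL<N))) r2) (subst (Rot _ _ _) (sym (trans (halves-tp a (J + L) s) (cong (\ k -> up i (J + L) ∷ rl (md N k) s ∷ rr i s ∷ []) (sym (+-assoc a J L))))) r0)
   (md-< _ , 1≤J , 1≤L , <⇒≤ JL<N) (md-< _ , ≤-trans 1≤J (m≤m+n J L) , JL<N) (change-RC opp∉ γ'∉ (md-< _) 2≤JL) refl refl refl refl ray-halves (\ { 0th (there ()) }) (\ { 0th (here e) -> md-≢ {a} (≤-trans 1≤J (m≤m+n J L)) JL<N (trans (tct-inj e) (cong (md N) (+-assoc a J L))) })
   (disj-up (\ e -> md-≢ 1≤J J<N (sym e))) (\ { 0th (there ()) }) (trans (cong₂ _*Z_ (ray-at s x refl) (len-at a (J + L) refl (sym (+-assoc a J L)))) (trans (ℤₚ.*-comm (c s *Z r x) (det (W a) (W (x + L)))) (trans (ptolemy-ray (c s) (W a) (W x) (W (x + L)))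
   (trans (ℤₚ.+-comm (det (W x) (W (x + L)) *Z (c s *Z r a)) _) (sym (cong₂ _+Z_ (cong₂ _*Z_ (len-at a J refl refl) (ray-at s (x + L) refl)) (trans (cong₂ _*Z_ (ray-at s a refl) (len-at x L refl refl)) (ℤₚ.*-comm (c s *Z r a) (det (W x) (W (x + L))))))))))) where
   i = md N a
   j = md N (a + J)
   x = a + J
   opp∉ = snd (snd (snd (tp-sides p)))
   2≤JL = +-mono-≤ 1≤J 1≤L
   two : ∀ {i} -> tct i pl ∈ A × tct i nt ∈ A -> tct i (opp s) ∈ A
   two (u , w) = both u w (opp s)
   ray-halves : ∀ {h} -> Expected A h -> tct (md N x) s ∈ arcsOf h -> h ∈ rl (md N x) s ∷ rr (md N x) s ∷ []
   ray-halves {rr i s} e 0th = 1st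
   ray-halves {rl i s} e 0th = 0th
   ray-halves {up i L} e (there ())
   ray-halves {dn i L} e (there ())
   ray-halves {lp i} e 0th = ⊥-elim (opp∉ (two e))
   ray-halves {lp i} e 1st = ⊥-elim (opp∉ (two e))

-- Flips inside a once-punctured digon.

module FlipMain (N : ℕ) (3≤N : 3 ≤ N) (weights : Weights N) where
 open FlipCases N 3≤N weights public

 lift : ∀ a {k} -> k < N -> ∃[ d ] d < N × md N (a + d) ≡ k
 lift a {k} k<N = md N e , md-< e , trans (cong (md N) (+-comm a (md N e))) (trans (md-md+ e a) (trans (cong (md N) (+-comm e a)) (trans (sym (md-md+ a e)) (trans (cong (md N) shuffle) (trans (md-+N k) (md-small k<N)))))) where
  e = k + (N ∸ md N a)
  shuffle = trans (lia 3 (\ m k n -> [] ⊢ m :+ (k :+ n) :≡ k :+ (m :+ n)) (md N a) k (N ∸ md N a)) (cong (k +_) (m+[n∸m]≡n (<⇒≤ (md-< a))))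

 c-opp : ∀ s -> c (opp s) *Z c s ≡ c pl *Z c nt
 c-opp pl = ℤₚ.*-comm (c nt) (c pl)
 c-opp nt = refl

 -- The exchange relation of the once-punctured digon. The second side ends over a after one full
 -- turn, and the shear gained there is exactly the product of the diagonals.
 digon-value : ∀ s a J L -> J + L ≡ N -> c (opp s) *Z r (md N a) *Z (c s *Z r (md N (a + J))) ≡ len (md N (a + J)) L +Z len (md N a) J
 digon-value s a J L e = trans (cong₂ (\ x y -> c (opp s) *Z x *Z (c s *Z y)) (r-md a) (r-md (a + J))) (trans (lemma₁ (c (opp s)) (c s) (r a) (r (a + J))) (trans (cong (_*Z (r a *Z r (a + J))) (c-opp s))
  (sym (trans (cong₂ _+Z_ (len-at (a + J) L refl (trans (+-assoc a J L) (cong (a +_) e))) (len-at a J refl refl)) (trans (cong (\ w -> det (W (a + J)) w +Z det (W a) (W (a + J))) (periodic a)) (lemma₂ (r a) (snd (W a)) (r (a + J)) (snd (W (a + J))) (c pl *Z c nt))))))) where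
  lemma₁ : ∀ p q x y -> p *Z x *Z (q *Z y) ≡ p *Z q *Z (x *Z y)
  lemma₁ = solve-∀
  lemma₂ : ∀ a b x y k -> (x *Z (b +Z k *Z a) -Z y *Z a) +Z (a *Z y -Z b *Z x) ≡ k *Z (a *Z x)
  lemma₂ = solve-∀

 module Digon {x L M : ℕ} (s : Tag) (e : L + M ≡ N) (1≤L : 1 ≤ L) (1≤M : 1 ≤ M) where
  i = md N x
  j = md N (x + L)
  a = up i L
  b = up j M
  L<N : L < N
  L<N = lia 3 (\ L M N -> (L :+ M :≡ N) ∷ (# 1 :≤ M) ∷ [] ⊢ L :< N) L M N e 1≤M
  M<N : M < N
  M<N = lia 3 (\ L M N -> (L :+ M :≡ N) ∷ (# 1 :≤ L) ∷ [] ⊢ M :< N) L M N e 1≤L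
  i≢j : i ≢ j
  i≢j = md-≢ 1≤L L<N
  ρ : Rot (lp i) a b (halves (tr i L M))
  ρ = subst (Rot _ _ _) (sym (trans (halves-tr x L M) (cong (\ h -> a ∷ b ∷ h ∷ []) (top-loop e)))) r2
  ρ₁ : Rot (rl j s) (rr i s) a (halves (tp i L s))
  ρ₁ = subst (Rot _ _ _) (sym (halves-tp x L s)) r1
  ρ₂ : Rot (rr j s) b (rl i s) (halves (tp j M s))
  ρ₂ = subst (Rot _ _ _) (sym (trans (halves-tp (x + L) M s) (cong (\ k -> b ∷ rl k s ∷ rr j s ∷ []) end))) r2 where
   end = trans (cong (md N) (trans (+-assoc x L M) (cong (x +_) e))) (md-+N x)
  spokes : List Half
  spokes = rl j s ∷ rr j s ∷ rr i s ∷ rl i s ∷ []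
  spokes-↭ : ∀ R -> halves (tp i L s) ++ halves (tp j M s) ++ R ↭ spokes ++ (a ∷ b ∷ R)
  spokes-↭ R = ↭-trans (rot-↭ ρ₁ (halves (tp j M s) ++ R)) (prep _ (↭-trans (prep _ (prep _ (rot-↭ ρ₂ R))) (↭-trans (shift (rr j s) (rr i s ∷ a ∷ []) (b ∷ rl i s ∷ R)) (prep _ (prep _ (shift (rl i s) (a ∷ b ∷ []) R))))))
  in-lp : ∀ s -> tct i s ∈ arcsOf (lp i)
  in-lp pl = 0th
  in-lp nt = 1st
  ne' : tct j s ≢ tct i s
  ne' eq = i≢j (sym (inj eq)) where
   inj : ∀ {i s j s'} -> tct i s ≡ tct j s' -> i ≡ j
   inj refl = refl
  same : ∀ h -> arcsOf h ≡ tct i s ∷ [] -> ∀ t -> t ≢ tct i (opp s) -> ind h t ≡ ind (lp i) t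
  same h eh t ne with ∈T? t (arcsOf (lp i))
  ... | inl m = trans (go m) (sym (ind-∈ {lp i} m)) where
   go : t ∈ arcsOf (lp i) -> ind h t ≡ 1
   go 0th with tag-cases s pl
   ... | inl refl = only₁ {h} eh
   ... | inr eq = ⊥-elim (ne (cong (tct i) eq))
   go 1st with tag-cases s nt
   ... | inl refl = only₁ {h} eh
   ... | inr eq = ⊥-elim (ne (cong (tct i) eq))
  ... | inr m = trans (only {h} {t' = t} eh (\ { refl -> m (in-lp s) })) (sym (ind-∉ {lp i} m))
  sideDisj : ∀ t -> ind a t ≡ 0 ⊎ ind b t ≡ 0
  sideDisj t with ∈T? t (arcsOf a)
  ... | inl m = inr (ind-∉ {b} (disj-up i≢j m))
  ... | inr m = inl (ind-∉ {a} m)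

 module _ {A : List TArc} {Ts : List Tri} (TT : Triangles A Ts) (valid : Valid A) where
  open Structure TT using (ok; ok-tr; tr-sides; tp-sides)
  open Triangles TT using (uniq)

  -- The twins at x sit in a digon with corners x and x + L. One of them is exchanged for the
  -- central arc at x + L that carries the tag of the other.
  loop-to-rays : ∀ {x L M s} -> L + M ≡ N -> tr (md N x) L M ∈ Ts -> tct (md N x) s ∈ A -> tct (md N x) (opp s) ∈ A -> tct (md N (x + L)) s ∉ A -> (∀ {k q} -> tct k q ∈ A -> k ≡ md N x) -> Flipped A Ts (tct (md N x) (opp s)) (tct (md N (x + L)) s) valid
  loop-to-rays {x} {L} {M} {s} e p P∈ γ∈ γ'∉ at with ∈-extract p | ok p
  ... | rest , e₁ | _ , 1≤L , 1≤M , _ = record { Ts' = tp i L s ∷ tp j M s ∷ rest ; TT' = change TT (change-LR P∈ γ∈ i≢j at) eH eH' ok' ; U = ind a ; V = ind b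
   ; mut = digon-mutates (form-skew Ts) (form-skew (tp i L s ∷ tp j M s ∷ rest)) (\ {β} _ -> form-free rest β (\ q -> noγ (there (there q)))) (\ {β} _ -> form-free rest β (\ q -> noγ' (there (there q)))) (lp i) a b (rl j s) (rr j s) (rr i s) (rl i s)
   (\ α β -> trans (form-↭ e₁ α β) (cong (_+Z form rest α β) (rot-form ρ α β))) (\ α β -> cong₂ _+Z_ (rot-form ρ₁ α β) (cong (_+Z form rest α β) (rot-form ρ₂ α β))) (ind-∈ {lp i} (in-lp (opp s))) (ind-∉ {a} (noγ 0th)) (ind-∉ {b} (noγ 1st)) (ind-∉ {a} (noγ' 0th)) (ind-∉ {b} (noγ' 1st))
   (\ { 0th -> only₁ {rl j s} refl , (\ {t} q _ -> only {rl j s} {t' = t} refl (\ { refl -> γ'∉ q })) ; 1st -> only₁ {rr j s} refl , (\ {t} q _ -> only {rr j s} {t' = t} refl (\ { refl -> γ'∉ q })) }) (\ { 0th -> only {rr i s} refl ne' , (\ {t} q ne -> same (rr i s) refl t ne)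
   ; 1st -> only {rl i s} refl ne' , (\ {t} q ne -> same (rl i s) refl t ne) }) (\ {t} _ -> sideDisj t) ; value = trans (digon-value s x L M e) (sym (cong₂ _+Z_ (power-ind valid {b} (fst (out 1st))) (power-ind valid {a} (fst (out 0th))))) } where
   open Digon {x} {L} {M} s e 1≤L 1≤M
   R = concatMap halves rest
   eH = ↭-trans (halves-↭ e₁) (rot-↭ ρ R)
   eH' = spokes-↭ R
   ok' : ∀ {Δ} -> Δ ∈ tp i L s ∷ tp j M s ∷ rest -> TriOK Δ
   ok' 0th = md-< _ , 1≤L , L<N
   ok' 1st = md-< _ , 1≤M , M<N
   ok' (there (there q)) = ok (∈-resp-↭ (↭-sym e₁) (there q))
   out : ∀ {h} -> h ∈ a ∷ b ∷ R -> Expected A h × h ∉ lp i ∷ []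
   out = outside {A} {A} TT {lp i ∷ []} {a ∷ b ∷ R} eH
   noγ : ∀ {h} -> h ∈ a ∷ b ∷ R -> tct i (opp s) ∉ arcsOf h
   noγ {up _ _} q (there ())
   noγ {dn _ _} q (there ())
   noγ {lp k} q m with at (fst (fst (out q)))
   ... | refl = snd (out q) 0th
   noγ {rr _ _} q 0th = snd (fst (out q)) (subst (\ u -> tct i u ∈ A) (sym (opp-invol s)) P∈)
   noγ {rl _ _} q 0th = snd (fst (out q)) (subst (\ u -> tct i u ∈ A) (sym (opp-invol s)) P∈)
   noγ' : ∀ {h} -> h ∈ a ∷ b ∷ R -> tct j s ∉ arcsOf h
   noγ' q = not-yet (<⇒<ᵇ≡ (md-< (x + L))) γ'∉ (fst (out q))

  -- The inverse exchange in the same digon; its matrix is the previous mutation read backwards,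
  -- with the two sides of the digon trading places.
  rays-to-loop : ∀ {a J L s} -> J + L ≡ N -> tp (md N a) J s ∈ Ts -> tp (md N (a + J)) L s ∈ Ts -> tct (md N a) (opp s) ∉ A -> (∀ {k q} -> tct k q ∈ A -> (k ≡ md N (a + J) ⊎ k ≡ md N a) × q ≡ s) -> Flipped A Ts (tct (md N (a + J)) s) (tct (md N a) (opp s)) valid
  rays-to-loop {a} {J} {L} {s} e p q γ'∉ at with ∈-extract p
  ... | us , e₁ with ∈-resp-↭ e₁ q
  ... | here z = ⊥-elim (md-≢ {a} (fst (snd (ok p))) (snd (snd (ok p))) (sym (tp-inj z)))
  ... | there q' with ∈-extract q' | ok p | ok q
  ... | rest , e₂ | _ , 1≤J , J<N | _ , 1≤L , L<N = record { Ts' = tr i J L ∷ rest ; TT' = change TT (change-RL i∈ j∈ i≢j at) eH eH' ok' ; U = ind c' ; V = ind a' ; mut = Mutates-sym {A'} {A} {tct i (opp s)} {tct j s} 0th back (ind-∉ {a'} (noγ 0th)) (ind-∉ {c'} (noγ 1st))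
   (digon-mutates (form-skew (tr i J L ∷ rest)) (form-skew Ts) (\ {β} _ -> form-free rest β (\ z -> noγ' (there (there z)))) (\ {β} _ -> form-free rest β (\ z -> noγ (there (there z)))) (lp i) a' c' (rl j s) (rr j s) (rr i s) (rl i s) (\ α β -> cong (_+Z form rest α β) (rot-form ρ α β))
   (\ α β -> trans (form-↭ ee α β) (cong₂ _+Z_ (rot-form ρ₁ α β) (cong (_+Z form rest α β) (rot-form ρ₂ α β)))) (ind-∈ {lp i} (in-lp (opp s))) (ind-∉ {a'} (noγ' 0th)) (ind-∉ {c'} (noγ' 1st)) (ind-∉ {a'} (noγ 0th)) (ind-∉ {c'} (noγ 1st))
   (\ { 0th -> only₁ {rl j s} refl , (\ {t} z ne -> only {rl j s} {t' = t} refl (notj z ne)) ; 1st -> only₁ {rr j s} refl , (\ {t} z ne -> only {rr j s} {t' = t} refl (notj z ne)) }) (\ { 0th -> only {rr i s} refl ne' , (\ {t} z ne -> same (rr i s) refl t ne)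
   ; 1st -> only {rl i s} refl ne' , (\ {t} z ne -> same (rl i s) refl t ne) }) (\ {t} _ -> sideDisj t)) ; value = trans (ℤₚ.*-comm (c s *Z r j) (c (opp s) *Z r i)) (trans (digon-value s a J L e) (trans (ℤₚ.+-comm (len j L) (len i J))
   (sym (cong₂ _+Z_ (power-ind valid {a'} (fst (out 0th))) (power-ind valid {c'} (fst (out 1st))))))) } where
   open Digon {a} {J} {L} s e 1≤J 1≤L renaming (a to a'; b to c')
   A' = flipArcs (tct j s) (tct i (opp s)) A
   i∈ = fst (fst (snd (tp-sides p)))
   j∈ = fst (fst (snd (tp-sides q)))
   j'∉ = snd (fst (snd (tp-sides q)))
   ee = ↭-trans e₁ (prep _ e₂)
   R = concatMap halves rest
   eH' = rot-↭ ρ R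
   eH = ↭-trans (halves-↭ ee) (spokes-↭ R)
   ok' : ∀ {Δ} -> Δ ∈ tr i J L ∷ rest -> TriOK Δ
   ok' 0th = md-< _ , 1≤J , 1≤L , ≤-reflexive e
   ok' (there z) = ok (∈-resp-↭ (↭-sym ee) (there (there z)))
   out : ∀ {h} -> h ∈ a' ∷ c' ∷ R -> Expected A h × h ∉ spokes
   out = outside {A} {A} TT {spokes} {a' ∷ c' ∷ R} eH
   noγ : ∀ {h} -> h ∈ a' ∷ c' ∷ R -> tct j s ∉ arcsOf h
   noγ {up _ _} z (there ())
   noγ {dn _ _} z (there ())
   noγ {lp k} z m with snd (at (fst (fst (out z)))) | snd (at (snd (fst (out z))))
   ... | refl | ()
   noγ {rr _ _} z 0th = snd (out z) 1st
   noγ {rl _ _} z 0th = snd (out z) 0th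
   noγ' : ∀ {h} -> h ∈ a' ∷ c' ∷ R -> tct i (opp s) ∉ arcsOf h
   noγ' z = not-yet (<⇒<ᵇ≡ (md-< a)) γ'∉ (fst (out z))
   back : ∀ {t} -> t ∈ A -> t ≡ tct j s ⊎ (t ∈ A' × t ≢ tct i (opp s))
   back {t} z with tEq t (tct j s) in eq
   ... | true = inl (tEq⇒≡ t (tct j s) eq)
   ... | false = inr (mem⁺ z (\ { refl -> false≢true eq (tEq-refl t) }) , \ { refl -> γ'∉ z })
   notj : ∀ {t} -> t ∈ A' -> t ≢ tct i (opp s) -> t ≢ tct j s
   notj {t} z ne with mem⁻ {tct j s} {tct i (opp s)} {A} {t} z
   ... | inl eq = ⊥-elim (ne eq)
   ... | inr (_ , ne') = ne'

-- Every exchange between tagged triangulations is one of these flips.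

module Classify (N : ℕ) (3≤N : 3 ≤ N) (weights : Weights N) where
 open FlipMain N 3≤N weights public

 module _ {A : List TArc} {Ts : List Tri} {γ γ' : TArc} (ta : TagTri A) (ta' : TagTri (flipArcs γ γ' A)) (TT : Triangles A Ts) (γ∈ : γ ∈ A) (γ'∉ : γ' ∉ A) where
  open TagTri ta
  open Structure TT
  private
   A' = flipArcs γ γ' A
   module C = Crossing {A} valid compat
   module C' = Crossing {A'} (TagTri.valid ta') (TagTri.compat ta')
   γ'∈A' : γ' ∈ A'
   γ'∈A' = 0th
   -- γ' is compatible with all other arcs of A; if it were compatible with γ too, maximality would
   -- put it into A.
   crossing : tcross γ' γ ≡ true
   crossing with tcross γ' γ in e
   ... | true = refl
   ... | false = ⊥-elim (γ'∉ (maximal (TagTri.valid ta' γ'∈A') free)) where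
    free : ∀ {t'} -> t' ∈ A -> tcross γ' t' ≡ false
    free {t'} p with tEq t' γ in q
    ... | true with tEq⇒≡ t' γ q
    ... | refl = e
    free {t'} p | false = TagTri.compat ta' γ'∈A' (mem⁺ p (\ { refl -> false≢true q (tEq-refl t') }))
   side' : ∀ {i L} -> tnc i L ≢ γ -> Side A i L -> Side A' i L
   side' ne (inl e) = inl e
   side' ne (inr p) = inr (mem⁺ p ne)
   top' : ∀ {i K} -> tnc i K ≢ γ -> (∀ s -> tct i s ≢ γ) -> Top A i K -> Top A' i K
   top' ne ne' (inl (e , p , q)) = inl (e , mem⁺ p (ne' pl) , mem⁺ q (ne' nt))
   top' ne ne' (inr (e , p)) = inr (e , mem⁺ p ne)

  -- γ = (x , x+L+M), with x+L the third vertex of the triangle below it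
  module Chord {x L M : ℕ} (N≤x : N ≤ x) (eγ : γ ≡ tnc (md N x) (L + M)) (Δ∈ : tr (md N x) L M ∈ Ts) where
   private
    K = L + M
    1≤L = fst (ok-tr Δ∈)
    1≤M = fst (snd (ok-tr Δ∈))
    γ∈' : tnc (md N x) K ∈ A
    γ∈' = subst (_∈ A) eγ γ∈
    L≢K : L ≢ K
    L≢K = <⇒≢ (m<m+n L 1≤M)
    M≢K : M ≢ K
    M≢K = <⇒≢ (m<n+m M 1≤L)
    ne-len : ∀ {i J} -> J ≢ K -> tnc i J ≢ γ
    ne-len ne e = ne (snd (tnc-inj (trans e eγ)))
    no-ray : ∀ {i s} -> tct i s ≢ γ
    no-ray e with trans e eγ
    ... | ()
    sL = side' (ne-len L≢K) (fst (tr-sides Δ∈))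
    sM = side' (ne-len M≢K) (fst (snd (tr-sides Δ∈)))
   -- Both sides below γ survive, so a central arc crossing γ must end at their common corner. The
   -- triangle above γ must touch the puncture, since otherwise its far side survives and is crossed
   -- by the new arc.
   to-ray : ∀ {u s'} -> γ' ≡ tct (md N u) s' -> x < u -> u < x + K -> Flipped A Ts γ γ' valid
   to-ray {u} {s'} refl x<u u<xK = finish (u≡ (<-cmp u (x + L))) where
    u≡ : _ -> u ≡ x + L
    u≡ (tri≈ _ e _) = e
    u≡ (tri< h _ _) = ⊥-elim (C'.top-ray {x} {L} {u} (C'.side-top sL (lia 3 (\ x L u -> (x :< u) ∷ (u :< x :+ L) ∷ [] ⊢ # 2 :≤ L) x L u x<u h)) γ'∈A' x<u h)
    u≡ (tri> _ _ h) = ⊥-elim (C'.top-ray {x + L} {M} {u} (C'.side-top sM (lia 4 (\ x L M u -> (x :+ L :< u) ∷ (u :< x :+ (L :+ M)) ∷ [] ⊢ # 2 :≤ M) x L M u h u<xK)) γ'∈A' h (lia 4 (\ x L M u -> (u :< x :+ (L :+ M)) ∷ [] ⊢ u :< x :+ L :+ M) x L M u u<xK))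
    finish : u ≡ x + L -> Flipped A Ts γ γ' valid
    finish refl with above N≤x (inr γ∈')
    ... | right R p = ⊥-elim (C'.top-ray {x} {K + R} {x + L} (top' (ne-len (\ e -> <-irrefl (sym e) (lia 3 (\ L M R -> (# 1 :≤ R) ∷ [] ⊢ L :+ M :< L :+ M :+ R) L M R (fst (snd (ok-tr p)))))) (\ _ -> no-ray) (snd (snd (tr-sides p)))) γ'∈A' x<u
     (lia 4 (\ x L M R -> (# 1 :≤ M) ∷ [] ⊢ x :+ L :< x :+ (L :+ M :+ R)) x L M R 1≤M))
    ... | left a J refl p = ⊥-elim (C'.top-ray {a} {J + K} {x + L} (top' (ne-len (\ e -> <-irrefl (sym e) (m<n+m K (fst (ok-tr p))))) (\ _ -> no-ray) (snd (snd (tr-sides p)))) γ'∈A' (lia 3 (\ a J L -> (# 1 :≤ J) ∷ [] ⊢ a :< a :+ J :+ L) a J L (fst (ok-tr p)))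
     (lia 4 (\ a J L M -> (# 1 :≤ M) ∷ [] ⊢ a :+ J :+ L :< a :+ (J :+ (L :+ M))) a J L M 1≤M))
    ... | center s p with tag-cases s s'
    ... | inr refl = ⊥-elim (md-≢ {x} 1≤L (≤-<-trans (m≤m+n L M) (snd (snd (validTnc (valid γ∈'))))) (C'.opposite-rays (mem⁺ (fst (fst (snd (tp-sides p)))) no-ray) γ'∈A'))
    ... | inl refl = subst (\ g -> Flipped A Ts g (tct (md N (x + L)) s) valid) (sym eγ) (flip-in TT valid Δ∈ p γ∈' γ'∉ (\ q -> md-≢ {x} 1≤L (≤-<-trans (m≤m+n L M) (snd (snd (validTnc (valid γ∈'))))) (C.opposite-rays (fst (fst (snd (tp-sides p)))) q)))
   -- The surviving sides of the two triangles at γ force the new chord to join their third corners;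
   -- a triangle at the puncture above γ would contribute a central arc that the chord crosses.
   to-chord : ∀ {y E} -> γ' ≡ tnc (md N y) E -> ChordsCross y E x K -> Flipped A Ts γ γ' valid
   to-chord {y} {E} refl cr = go cr (above N≤x (inr γ∈')) where
    E<N = snd (snd (validTnc (TagTri.valid ta' γ'∈A')))
    tγ' : Top A' (md N y) E
    tγ' = inr (E<N , γ'∈A')
    start : x < y -> y < x + K -> x + K < y + E -> y ≡ x + L
    start p q s with <-cmp y (x + L)
    ... | tri≈ _ e _ = e
    ... | tri< h _ _ = ⊥-elim (C'.top-top {x} {L} {y} {E} (C'.side-top sL (lia 3 (\ x L u -> (x :< u) ∷ (u :< x :+ L) ∷ [] ⊢ # 2 :≤ L) x L y p h)) tγ' (inl (p , h , lia 5 (\ x L M y E -> (x :+ (L :+ M) :< y :+ E) ∷ [] ⊢ x :+ L :< y :+ E) x L M y E s)))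
    ... | tri> _ _ h = ⊥-elim (C'.top-top {x + L} {M} {y} {E} (C'.side-top sM (lia 4 (\ x L M u -> (x :+ L :< u) ∷ (u :< x :+ (L :+ M)) ∷ [] ⊢ # 2 :≤ M) x L M y h q)) tγ' (inl (h , subst (y <_) (sym (+-assoc x L M)) q , subst (_< y + E) (sym (+-assoc x L M)) s)))
    end : y < x -> x < y + E -> y + E < x + K -> y + E ≡ x + L
    end p q s with <-cmp (y + E) (x + L)
    ... | tri≈ _ e _ = e
    ... | tri< h _ _ = ⊥-elim (C'.top-top {y} {E} {x} {L} tγ' (C'.side-top sL (lia 4 (\ x L y E -> (x :< y :+ E) ∷ (y :+ E :< x :+ L) ∷ [] ⊢ # 2 :≤ L) x L y E q h)) (inl (p , q , h)))
    ... | tri> _ _ h = ⊥-elim (C'.top-top {y} {E} {x + L} {M} tγ' (C'.side-top sM (lia 5 (\ x L M y E -> (x :+ L :< y :+ E) ∷ (y :+ E :< x :+ (L :+ M)) ∷ [] ⊢ # 2 :≤ M) x L M y E h s)) (inl (<-≤-trans p (m≤m+n x L) , h , subst (y + E <_) (sym (+-assoc x L M)) s)))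
    go : ChordsCross y E x K -> Above x K -> Flipped A Ts γ (tnc (md N y) E) valid
    go (inl (a , b , d)) (center s p) = ⊥-elim (C'.chord-ray {y} {E} {x} γ'∈A' (mem⁺ (fst (fst (snd (tp-sides p)))) no-ray) a b)
    go (inr (a , b , d)) (center s p) = ⊥-elim (C'.chord-ray {y} {E} {x + K} γ'∈A' (mem⁺ (fst (snd (snd (tp-sides p)))) no-ray) b d)
    go (inl (a , b , d)) (right R p) = ⊥-elim (C'.top-top {y} {E} {x} {K + R} tγ' (top' (ne-len (\ e -> <-irrefl (sym e) (m<m+n K (fst (snd (ok-tr p)))))) (\ _ -> no-ray) (snd (snd (tr-sides p)))) (inl (a , b , lia 4 (\ e x K R -> (e :< x :+ K) ∷ [] ⊢ e :< x :+ (K :+ R)) (y + E) x K R d)))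
    go (inr (a , b , d)) (right R p) with start a b d
    ... | refl with <-cmp E (M + R)
    ... | tri≈ _ refl _ = subst (\ g -> Flipped A Ts g (tnc (md N (x + L)) (M + R)) valid) (sym eγ) (flip-right TT valid Δ∈ p γ∈' γ'∉ E<N)
    ... | tri< h _ _ = ⊥-elim (C'.top-top {x + L} {E} {x + K} {R} tγ' (C'.side-top (side' ne (fst (snd (tr-sides p)))) 2≤R) (inl (b , d , lia 5 (\ x L M R E -> (E :< M :+ R) ∷ [] ⊢ x :+ L :+ E :< x :+ (L :+ M) :+ R) x L M R E h))) where
     2≤R : 2 ≤ R
     2≤R = lia 5 (\ x L M R E -> (x :+ (L :+ M) :< x :+ L :+ E) ∷ (E :< M :+ R) ∷ [] ⊢ # 2 :≤ R) x L M R E d h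
     ne : tnc (md N (x + K)) R ≢ γ
     ne e = md-≢ {x} (≤-trans 1≤L (m≤m+n L M)) (snd (snd (validTnc (valid γ∈')))) (sym (fst (tnc-inj (trans e eγ))))
    ... | tri> _ _ h = ⊥-elim (C'.top-top {x} {K + R} {x + L} {E} (top' (ne-len (\ e -> <-irrefl (sym e) (m<m+n K (fst (snd (ok-tr p)))))) (\ _ -> no-ray) (snd (snd (tr-sides p)))) tγ' (inl (a , lia 4 (\ x L M R -> (# 1 :≤ M) ∷ [] ⊢ x :+ L :< x :+ (L :+ M :+ R)) x L M R 1≤M ,
     lia 5 (\ x L M R E -> (M :+ R :< E) ∷ [] ⊢ x :+ (L :+ M :+ R) :< x :+ L :+ E) x L M R E h)))
    go (inr (a , b , d)) (left w J refl p) with start a b d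
    ... | refl = ⊥-elim (C'.top-top {w} {J + K} {x + L} {E} (top' (ne-len (\ e -> <-irrefl (sym e) (m<n+m K (fst (ok-tr p))))) (\ _ -> no-ray) (snd (snd (tr-sides p)))) tγ' (inl (lia 3 (\ w J L -> (# 1 :≤ J) ∷ [] ⊢ w :< w :+ J :+ L) w J L (fst (ok-tr p)) ,
     lia 4 (\ w J L M -> (# 1 :≤ M) ∷ [] ⊢ w :+ J :+ L :< w :+ (J :+ (L :+ M))) w J L M 1≤M , subst (_< w + J + L + E) (+-assoc w J (L + M)) d)))
    go (inl (a , b , d)) (left w J refl p) with end a b d | <-cmp y w
    ... | e | tri< h _ _ = ⊥-elim (C'.top-top {y} {E} {w} {J + K} tγ' (top' (ne-len (\ e -> <-irrefl (sym e) (m<n+m K (fst (ok-tr p))))) (\ _ -> no-ray) (snd (snd (tr-sides p)))) (inl (h , ≤-<-trans (m≤m+n w J) b , subst (y + E <_) (+-assoc w J K) d)))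
    ... | e | tri> _ _ h = ⊥-elim (C'.top-top {w} {J} {y} {E} (C'.side-top (side' ne (fst (tr-sides p))) (lia 3 (\ w J y -> (w :< y) ∷ (y :< w :+ J) ∷ [] ⊢ # 2 :≤ J) w J y h a)) tγ' (inl (h , a , b))) where
     ne : tnc (md N w) J ≢ γ
     ne e = md-≢ {w} (fst (ok-tr p)) (lia 3 (\ J K N -> (J :+ K :≤ N) ∷ (# 1 :≤ K) ∷ [] ⊢ J :< N) J K N (snd (snd (ok-tr p))) (fst (snd (ok-tr p)))) (fst (tnc-inj (trans e eγ)))
    ... | e | tri≈ _ refl _ with +-cancelˡ-≡ w E (J + L) (trans e (+-assoc w J L))
    ... | refl = subst (\ g -> Flipped A Ts g (tnc (md N w) (J + L)) valid) (sym eγ) (flip-left TT valid Δ∈ p γ∈' γ'∉ E<N)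

  private
   -- The crossing lifts found are moved by a full turn, so that neighbouring triangles on the left
   -- still start at natural numbers.
   to-tcross : ∀ {i L j M} -> γ' ≡ tnc i L -> γ ≡ tnc j M -> i < N -> j < N -> cross N (nc i L) (nc j M) ≡ true -> Flipped A Ts γ γ' valid
   to-tcross {i} {L} {j} {M} eγ' eγ i<N j<N cr with cross-nn⁻ {i} {j} {L} {M} j<N cr | below (subst (_∈ A) eγ γ∈)
   ... | u , eu , ch | L₁ , M₁ , refl , p = Chord.to-chord {u + N} {L₁} {M₁} (m≤n+m N u) (trans eγ (cong (\ k -> tnc k (L₁ + M₁)) (sym eu'))) (subst (\ k -> tr k L₁ M₁ ∈ Ts) (sym eu') p)
    {i + N + N} {L} (trans eγ' (cong (\ k -> tnc k L) (sym (trans (md-+N (i + N)) (trans (md-+N i) (md-small i<N)))))) (shiftN ch) where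
    eu' = trans (md-+N u) eu
    shiftN : ∀ {x L u M} -> ChordsCross x L u M -> ChordsCross (x + N) L (u + N) M
    shiftN {x} {L} {u} {M} (inl (a , b , d)) = inl (+-monoˡ-< N a , lia 4 (\ x L u N -> (u :< x :+ L) ∷ [] ⊢ u :+ N :< x :+ N :+ L) x L u N b , lia 5 (\ x L u M N -> (x :+ L :< u :+ M) ∷ [] ⊢ x :+ N :+ L :< u :+ N :+ M) x L u M N d)
    shiftN {x} {L} {u} {M} (inr (a , b , d)) = inr (+-monoˡ-< N a , lia 4 (\ x M u N -> (x :< u :+ M) ∷ [] ⊢ x :+ N :< u :+ N :+ M) x M u N b , lia 5 (\ x L u M N -> (u :+ M :< x :+ L) ∷ [] ⊢ u :+ N :+ M :< x :+ N :+ L) x L u M N d)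
   to-rcross : ∀ {i s j M} -> γ' ≡ tct i s -> γ ≡ tnc j M -> i < N -> j < N -> cross N (nc j M) (ct i) ≡ true -> Flipped A Ts γ γ' valid
   to-rcross {i} {s} {j} {M} eγ' eγ i<N j<N cr with cross-nr⁻ {j} {i} {M} i<N cr | below (subst (_∈ A) eγ γ∈)
   ... | u , eu , a , b | L₁ , M₁ , refl , p = Chord.to-ray {j + N} {L₁} {M₁} (m≤n+m N j) (trans eγ (cong (\ k -> tnc k (L₁ + M₁)) (sym ej))) (subst (\ k -> tr k L₁ M₁ ∈ Ts) (sym ej) p) {u} {s} (trans eγ' (cong (\ k -> tct k s) (sym eu))) a b where
    ej = trans (md-+N j) (md-small j<N)

  -- γ is a central arc at x together with the other tag
  module Loop {x L M : ℕ} {s : Tag} (eγ : γ ≡ tct (md N x) (opp s)) (P∈ : tct (md N x) s ∈ A) (eN : L + M ≡ N) (Δ∈ : tr (md N x) L M ∈ Ts) where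
   private
    γ∈' : tct (md N x) (opp s) ∈ A
    γ∈' = subst (_∈ A) eγ γ∈
    P∈A' : tct (md N x) s ∈ A'
    P∈A' = mem⁺ P∈ (\ e -> opp≢ s (tct-tag (trans e eγ)))
    no-chord : ∀ {i L} -> tnc i L ≢ γ
    no-chord e with trans e eγ
    ... | ()
    at : ∀ {k q} -> tct k q ∈ A -> k ≡ md N x
    at {k} {q} p with tag-cases s q
    ... | inl refl = C.opposite-rays p γ∈'
    ... | inr refl = sym (C.opposite-rays P∈ p)
   -- Among the boundary points other than x, only the corner x + L is not cut off from the puncture
   -- by a side of the digon.
   to-ray : ∀ {k} -> γ' ≡ tct k s -> k < N -> k ≢ md N x -> Flipped A Ts γ γ' valid
   to-ray {k} eγ' k<N ne with lift x k<N
   ... | d , d<N , ek = subst₂ (\ g g' -> Flipped A Ts g g' valid) (sym eγ) (trans (cong (\ w -> tct (md N (x + w)) s) (sym d≡)) (sym eγ'')) (loop-to-rays TT valid eN Δ∈ P∈ γ∈' (subst (_∉ A) (trans eγ'' (cong (\ w -> tct (md N (x + w)) s) d≡)) γ'∉) at) where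
    eγ'' = trans eγ' (cong (\ w -> tct w s) (sym ek))
    γ'∈' : tct (md N (x + d)) s ∈ A'
    γ'∈' = subst (_∈ A') eγ'' γ'∈A'
    1≤d : 1 ≤ d
    1≤d = n≢0⇒n>0 (\ { refl -> ne (trans (sym ek) (cong (md N) (+-identityʳ x))) })
    d≡ : d ≡ L
    d≡ with <-cmp d L
    ... | tri≈ _ e _ = e
    ... | tri< h _ _ = ⊥-elim (C'.top-ray {x} {L} {x + d} (C'.side-top (side' no-chord (fst (tr-sides Δ∈))) (lia 2 (\ d L -> (# 1 :≤ d) ∷ (d :< L) ∷ [] ⊢ # 2 :≤ L) d L 1≤d h)) γ'∈' (m<m+n x 1≤d) (+-monoʳ-< x h))
    ... | tri> _ _ h = ⊥-elim (C'.top-ray {x + L} {M} {x + d} (C'.side-top (side' no-chord (fst (snd (tr-sides Δ∈)))) (lia 4 (\ d L M N -> (L :< d) ∷ (d :< N) ∷ (L :+ M :≡ N) ∷ [] ⊢ # 2 :≤ M) d L M N h d<N eN)) γ'∈'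
     (+-monoʳ-< x h) (lia 5 (\ x d L M N -> (d :< N) ∷ (L :+ M :≡ N) ∷ [] ⊢ x :+ d :< x :+ L :+ M) x d L M N d<N eN))

  -- γ is a central arc at x = a+J; its neighbours are the central arcs at a and x+L
  module Ray {a J L : ℕ} {s : Tag} (eγ : γ ≡ tct (md N (a + J)) s) (p : tp (md N a) J s ∈ Ts) (q : tp (md N (a + J)) L s ∈ Ts) where
   private
    x = a + J
    1≤J = fst (snd (ok p))
    J<N = snd (snd (ok p))
    1≤L = fst (snd (ok q))
    L<N = snd (snd (ok q))
    γ∈' : tct (md N x) s ∈ A
    γ∈' = subst (_∈ A) eγ γ∈
    a∈ = fst (fst (snd (tp-sides p)))
    c∈ = fst (snd (snd (tp-sides q)))
    no-chord : ∀ {i L} -> tnc i L ≢ γ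
    no-chord e with trans e eγ
    ... | ()
    a∈A' : tct (md N a) s ∈ A'
    a∈A' = mem⁺ a∈ (\ e -> md-≢ {a} 1≤J J<N (tct-inj (trans e eγ)))
    
    c∈A' : tct (md N (x + L)) s ∈ A'
    c∈A' = mem⁺ c∈ (\ e -> md-≢ {x} 1≤L L<N (sym (tct-inj (trans e eγ))))
    
    -- If the two triangles covered more than a turn, the next lift of the central arc at a would
    -- start strictly under the outer side of the second triangle.
    JL≤N : J + L ≤ N
    JL≤N with J + L ≤? N
    ... | yes h = h
    ... | no h = ⊥-elim (C.top-ray {x} {L} {a + N} (C.side-top (fst (tp-sides q)) (lia 3 (\ J L N -> (N :< J :+ L) ∷ (J :< N) ∷ [] ⊢ # 2 :≤ L) J L N (≰⇒> h) J<N))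
     (subst (\ k -> tct k s ∈ A) (sym (md-+N a)) a∈) (+-monoʳ-< a J<N) (lia 4 (\ a J L N -> (N :< J :+ L) ∷ [] ⊢ a :+ N :< a :+ J :+ L) a J L N (≰⇒> h)))
   -- The neighbouring central arcs and the outer sides of both triangles survive; between them they
   -- leave only the chord from a to x + L.
   to-chord : ∀ {y E} -> γ' ≡ tnc (md N y) E -> y < x -> x < y + E -> Flipped A Ts γ γ' valid
   to-chord {y} {E} refl y<x x<yE = finish start end where
    E<N = snd (snd (validTnc (TagTri.valid ta' γ'∈A')))
    tγ' : Top A' (md N y) E
    tγ' = inr (E<N , γ'∈A')
    start : y ≡ a
    start with <-cmp y a
    ... | tri≈ _ e _ = e
    ... | tri< h _ _ = ⊥-elim (C'.top-ray {y} {E} {a} tγ' a∈A' h (≤-<-trans (m≤m+n a J) x<yE))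
    ... | tri> _ _ h = ⊥-elim (C'.top-top {a} {J} {y} {E} (C'.side-top (side' no-chord (fst (tp-sides p))) (lia 3 (\ w J y -> (w :< y) ∷ (y :< w :+ J) ∷ [] ⊢ # 2 :≤ J) a J y h y<x)) tγ' (inl (h , y<x , x<yE)))
    end : y + E ≡ x + L
    end with <-cmp (y + E) (x + L)
    ... | tri≈ _ e _ = e
    ... | tri< h _ _ = ⊥-elim (C'.top-top {y} {E} {x} {L} tγ' (C'.side-top (side' no-chord (fst (tp-sides q))) (lia 4 (\ x L y E -> (x :< y :+ E) ∷ (y :+ E :< x :+ L) ∷ [] ⊢ # 2 :≤ L) x L y E x<yE h)) (inl (y<x , x<yE , h)))
    ... | tri> _ _ h = ⊥-elim (C'.top-ray {y} {E} {x + L} tγ' c∈A' (<-≤-trans y<x (m≤m+n x L)) h)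
    finish : y ≡ a -> y + E ≡ x + L -> Flipped A Ts γ (tnc (md N y) E) valid
    finish refl e with +-cancelˡ-≡ a E (J + L) (trans e (+-assoc a J L))
    ... | refl = subst (\ g -> Flipped A Ts g (tnc (md N a) (J + L)) valid) (sym eγ) (flip-out TT valid p q γ∈' γ'∉ E<N)
   -- An oppositely tagged arc is compatible with the two surviving neighbours only if it shares its
   -- end with both. The neighbours then coincide, and γ was one of just two central arcs.
   to-ray : ∀ {k} -> γ' ≡ tct k (opp s) -> Flipped A Ts γ γ' valid
   to-ray {k} eγ' = subst₂ (\ g g' -> Flipped A Ts g g' valid) (sym eγ) (sym eγ'') (rays-to-loop TT valid JL≡N p q (subst (_∉ A) eγ'' γ'∉) at) where
    γ'∈' : tct k (opp s) ∈ A'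
    γ'∈' = subst (_∈ A') eγ' γ'∈A'
    ka : md N a ≡ k
    ka = C'.opposite-rays a∈A' γ'∈'
    kc : md N (x + L) ≡ k
    kc = C'.opposite-rays c∈A' γ'∈'
    eγ'' = trans eγ' (cong (\ w -> tct w (opp s)) (sym ka))
    JL≡N : J + L ≡ N
    JL≡N with m≤n⇒m<n∨m≡n JL≤N
    ... | inr e = e
    ... | inl h = ⊥-elim (md-≢ {a} (≤-trans 1≤J (m≤m+n J L)) h (trans ka (trans (sym kc) (cong (md N) (+-assoc a J L)))))
    at : ∀ {k q} -> tct k q ∈ A -> (k ≡ md N x ⊎ k ≡ md N a) × q ≡ s
    at {k} {t} m with tag-cases s t
    ... | inr refl = ⊥-elim (md-≢ {a} 1≤J J<N (trans (C.opposite-rays a∈ m) (sym (C.opposite-rays γ∈' m))))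
    ... | inl refl with lift a (<ᵇ≡⇒< (valid m))
    ... | d , d<N , refl with d ≟ 0
    ... | yes refl = inr (cong (md N) (+-identityʳ a)) , refl
    ... | no d≢0 with <-cmp d J
    ... | tri≈ _ refl _ = inl refl , refl
    ... | tri< h _ _ = ⊥-elim (C.top-ray {a} {J} {a + d} (C.side-top (fst (tp-sides p)) (lia 2 (\ d L -> (# 1 :≤ d) ∷ (d :< L) ∷ [] ⊢ # 2 :≤ L) d J (n≢0⇒n>0 d≢0) h)) m (m<m+n a (n≢0⇒n>0 d≢0)) (+-monoʳ-< a h))
    ... | tri> _ _ h = ⊥-elim (C.top-ray {x} {L} {a + d} (C.side-top (fst (tp-sides q)) (lia 4 (\ d L M N -> (L :< d) ∷ (d :< N) ∷ (L :+ M :≡ N) ∷ [] ⊢ # 2 :≤ M) d J L N h d<N JL≡N)) m (+-monoʳ-< a h) (lia 5 (\ x d L M N -> (d :< N) ∷ (L :+ M :≡ N) ∷ [] ⊢ x :+ d :< x :+ L :+ M) a d J L N d<N JL≡N))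

  private
   ray-chord : ∀ {i s j E} -> γ ≡ tct i s -> γ' ≡ tnc j E -> i < N -> j < N -> cross N (nc j E) (ct i) ≡ true -> Flipped A Ts γ γ' valid
   ray-chord {i} {s} {j} {E} eγ eγ' i<N j<N cr with ∈T? (tct i (opp s)) A
   -- A twin of γ would survive the exchange and cross the new chord in place of γ.
   ... | inl m = ⊥-elim (false≢true (TagTri.compat ta' (subst (_∈ A') eγ' γ'∈A') (mem⁺ m (\ e -> opp≢ s (sym (tct-tag (trans e eγ)))))) cr)
   ... | inr m with cross-nr⁻ {j} {i} {E} i<N cr
   ... | u , refl , a , b with ray-left {u} {s} (<⇒≤ (≤-<-trans (m≤n+m N j) a)) (subst (_∈ A) eγ γ∈) m | ray-right (subst (_∈ A) eγ γ∈) m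
   ... | w , J , refl , p | L , q = Ray.to-chord {w} {J} {L} {s} eγ p q {j + N} {E} (trans eγ' (cong (\ k -> tnc k E) (sym (trans (md-+N j) (md-small j<N))))) a b
   ray-ray : ∀ {i s j r} -> γ ≡ tct i s -> γ' ≡ tct j r -> i < N -> j < N -> tcross (tct j r) (tct i s) ≡ true -> Flipped A Ts γ γ' valid
   ray-ray {i} {s} {j} {r} eγ eγ' i<N j<N cr with tag-cases s r
   ... | inl refl = ⊥-elim (false≢true (compat-same {j} {i} {s}) cr)
   ... | inr refl with ∈T? (tct i (opp s)) A
   ... | inl m = loop (subst (_∈ A) eγ γ∈) m where
    j≢i : j ≢ i
    j≢i refl = false≢true (compat-at {j} {opp s} {s}) cr
    two : ∀ s -> tct i s ∈ A -> tct i (opp s) ∈ A -> tct i pl ∈ A × tct i nt ∈ A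
    two pl p q = p , q
    two nt p q = q , p
    loop : tct i s ∈ A -> tct i (opp s) ∈ A -> Flipped A Ts γ γ' valid
    loop p q with loop-below (fst (two s p q)) (snd (two s p q))
    ... | L , M , e , Δ∈ = Loop.to-ray {i} {L} {M} {opp s} (trans eγ (cong₂ tct (sym (md-small i<N)) (sym (opp-invol s)))) (subst (\ k -> tct k (opp s) ∈ A) (sym (md-small i<N)) q) e (subst (\ k -> tr k L M ∈ Ts) (sym (md-small i<N)) Δ∈) eγ' j<N (\ e -> j≢i (trans e (md-small i<N)))
   ... | inr m with ray-left {i + N} {s} (m≤n+m N i) (subst (\ k -> tct k s ∈ A) (sym (trans (md-+N i) (md-small i<N))) (subst (_∈ A) eγ γ∈)) (subst (\ k -> tct k (opp s) ∉ A) (sym (trans (md-+N i) (md-small i<N))) m) | ray-right (subst (_∈ A) eγ γ∈) m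
   ... | w , J , e , p | L , q = Ray.to-ray {w} {J} {L} {s} (trans eγ (cong (\ k -> tct k s) (sym ei))) p (subst (\ k -> tp k L s ∈ Ts) (sym ei) q) eγ' where
    ei = trans (cong (md N) e) (trans (md-+N i) (md-small i<N))
   dispatch : ∀ g g' -> γ ≡ g -> γ' ≡ g' -> validTArc N g ≡ true -> validTArc N g' ≡ true -> tcross g' g ≡ true -> Flipped A Ts γ γ' valid
   dispatch (tnc i K) (tnc j M) e e' w w' cr = to-tcross e' e (fst (validTnc w')) (fst (validTnc w)) cr
   dispatch (tnc i K) (tct j s) e e' w w' cr = to-rcross e' e (<ᵇ≡⇒< w') (fst (validTnc w)) cr
   dispatch (tct i s) (tnc j M) e e' w w' cr = ray-chord e e' (<ᵇ≡⇒< w) (fst (validTnc w')) cr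
   dispatch (tct i s) (tct j r) e e' w w' cr = ray-ray e e' (<ᵇ≡⇒< w) (<ᵇ≡⇒< w') cr

  flipped : Flipped A Ts γ γ' valid
  flipped = dispatch γ γ' refl refl (valid γ∈) (TagTri.valid ta' γ'∈A') crossing

 run : ∀ {S Ts} fs -> TagTri (arcs S) -> Good S Ts -> ValidFlips N (arcs S) fs -> ∃[ Ts' ] Good (runFlips N S fs) Ts'
 run [] ta g _ = _ , g
 run {S} {Ts} ((γ , γ') ∷ fs) ta g (γ∈ , γ'∉ , it , vf) = run fs (tagTri it) (good-step (TagTri.valid ta) γ∈ γ'∉ g (flipped ta (tagTri it) (Good.TT g) γ∈ γ'∉)) vf

-- Slices and their triangles.

module Slice (N : ℕ) (3≤N : 3 ≤ N) where
 open Geometry N 3≤N public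

 N-1<N : N-1 < N
 N-1<N = subst (N-1 <_) (m+[n∸m]≡n N>0) ≤-refl

 2≤N-1 : 2 ≤ N-1
 2≤N-1 = ≤-pred (subst (3 ≤_) (sym (m+[n∸m]≡n N>0)) 3≤N)

 N-1+1 : N-1 + 1 ≡ N
 N-1+1 = trans (+-comm N-1 1) (m+[n∸m]≡n N>0)

 inner : Bool -> ℕ -> ℕ
 inner true x = x
 inner false x = suc x

 -- The arcs (y , y+L) of a slice below (x , x+1+length st), from the longest to the shortest:
 -- each step drops the last (true) or the first (false) point.
 arcsC : ℕ -> List Bool -> List TArc
 arcsC x [] = []
 arcsC x (b ∷ st) = tnc (md N x) (2 + length st) ∷ arcsC (inner b x) st

 trisC : ℕ -> List Bool -> List Tri
 trisC x [] = []
 trisC x (true ∷ st) = tr (md N x) (1 + length st) 1 ∷ trisC x st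
 trisC x (false ∷ st) = tr (md N x) 1 (1 + length st) ∷ trisC (suc x) st

 -- The ends of the longest chord are x and x - 1; the latter appears as x + N - 1 to avoid
 -- subtraction.
 leafArcs : ℕ -> LastPair -> List TArc
 leafArcs x lp1 = tct (md N x) pl ∷ tct (md N x) nt ∷ []
 leafArcs x lp2 = tct (md N (x + N-1)) pl ∷ tct (md N (x + N-1)) nt ∷ []
 leafArcs x lp3 = tct (md N x) pl ∷ tct (md N (x + N-1)) pl ∷ []
 leafArcs x lp4 = tct (md N x) nt ∷ tct (md N (x + N-1)) nt ∷ []

 leafTris : ℕ -> LastPair -> List Tri
 leafTris x lp1 = tr (md N x) N-1 1 ∷ []
 leafTris x lp2 = tr (md N (x + N-1)) 1 N-1 ∷ []
 leafTris x lp3 = tp (md N x) N-1 pl ∷ tp (md N (x + N-1)) 1 pl ∷ []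
 leafTris x lp4 = tp (md N x) N-1 nt ∷ tp (md N (x + N-1)) 1 nt ∷ []

 leafHalves : ℕ -> LastPair -> List Half
 leafHalves x lp1 = lp (md N x) ∷ []
 leafHalves x lp2 = lp (md N (x + N-1)) ∷ []
 leafHalves x lp3 = rl (md N (x + N-1)) pl ∷ rr (md N x) pl ∷ rl (md N x) pl ∷ rr (md N (x + N-1)) pl ∷ []
 leafHalves x lp4 = rl (md N (x + N-1)) nt ∷ rr (md N x) nt ∷ rl (md N x) nt ∷ rr (md N (x + N-1)) nt ∷ []

 sliceA : ℕ -> List Bool -> LastPair -> List TArc
 sliceA x st l = arcsC x st ++ leafArcs x l

 sliceT : ℕ -> List Bool -> LastPair -> List Tri
 sliceT x st l = leafTris x l ++ trisC x st

 halvesC : ℕ -> List Bool -> List Half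
 halvesC x [] = []
 halvesC x (b ∷ st) = up (md N x) (2 + length st) ∷ dn (md N x) (2 + length st) ∷ halvesC (inner b x) st

 boundary : ℕ -> ℕ -> List Half
 boundary x zero = []
 boundary x (suc n) = up (md N x) 1 ∷ boundary (suc x) n

 boundary-last : ∀ x n -> boundary x (suc n) ↭ up (md N (x + n)) 1 ∷ boundary x n
 boundary-last x zero = ↭-reflexive (cong (\ y -> up (md N y) 1 ∷ []) (sym (+-identityʳ x)))
 boundary-last x (suc n) = ↭-trans (prep _ (boundary-last (suc x) n)) (↭-trans (swap _ _ ↭-refl) (↭-reflexive (cong (\ y -> up (md N y) 1 ∷ up (md N x) 1 ∷ boundary (suc x) n) (sym (+-suc x n)))))

 md-suc : ∀ x -> md N (md N x + 1) ≡ md N (suc x)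
 md-suc x = trans (md-md+ x 1) (cong (md N) (+-comm x 1))

 -- With the puncture side of the longest chord adjoined, every chord of the chain is seen from both
 -- sides and only boundary segments are left over. In this form each step can pass the
 -- corresponding side on to the next.
 trisC-halves : ∀ x st -> 1 + length st < N -> up (md N x) (1 + length st) ∷ concatMap halves (trisC x st) ↭ halvesC x st ++ boundary x (1 + length st)
 trisC-halves x [] h = ↭-refl
 trisC-halves x (true ∷ st) h = prep _ (↭-trans (↭-reflexive (cong₂ (\ y t -> up (md N x) (1 + n) ∷ up y 1 ∷ t ∷ H) (md-md+ x (1 + n)) e)) (↭-trans (shift (dn (md N x) (2 + n)) (up (md N x) (1 + n) ∷ up (md N (x + (1 + n))) 1 ∷ []) H) (prep _
  (↭-trans (swap _ _ ↭-refl) (↭-trans (prep _ (trisC-halves x st (<⇒≤ h))) (↭-trans (↭-sym (shift (up (md N (x + (1 + n))) 1) (halvesC x st) (boundary x (1 + n)))) (++⁺ˡ (halvesC x st) (↭-sym (boundary-last x (1 + n)))))))))) where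
  n = length st
  H = concatMap halves (trisC x st)
  e = trans (cong (top (md N x)) (+-comm (1 + n) 1)) (top-chord (<⇒≢ h))
 trisC-halves x (false ∷ st) h = prep _ (↭-trans (↭-reflexive (cong₂ (\ y t -> up (md N x) 1 ∷ up y (1 + n) ∷ t ∷ H) (md-suc x) (top-chord (<⇒≢ h)))) (↭-trans (shift (dn (md N x) (2 + n)) (up (md N x) 1 ∷ up (md N (suc x)) (1 + n) ∷ []) H) (prep _
  (↭-trans (prep _ (trisC-halves (suc x) st (<⇒≤ h))) (↭-sym (shift (up (md N x) 1) (halvesC (suc x) st) (boundary (suc x) (1 + n)))))))) where
  n = length st
  H = concatMap halves (trisC (suc x) st)

 1+N-1 : suc N-1 ≡ N
 1+N-1 = m+[n∸m]≡n N>0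

 end-next : ∀ x -> md N (md N (x + N-1) + 1) ≡ md N x
 end-next x = trans (md-md+ (x + N-1) 1) (trans (cong (md N) (trans (+-assoc x N-1 1) (cong (x +_) N-1+1))) (md-+N x))

 sliceT-halves : ∀ x st l -> length st ≡ N ∸ 2 -> concatMap halves (sliceT x st l) ↭ leafHalves x l ++ (halvesC x st ++ boundary x N)
 sliceT-halves x st l e = go l where
  K = N-1
  H = concatMap halves (trisC x st)
  K≡ = trans (cong suc e) (sym (+-∸-assoc 1 {N} {2} (≤-trans (s≤s (s≤s z≤n)) 3≤N)))
  inside : up (md N x) K ∷ H ↭ halvesC x st ++ boundary x K
  inside = subst (\ k -> up (md N x) k ∷ H ↭ halvesC x st ++ boundary x k) K≡ (trisC-halves x st (subst (_< N) (sym K≡) N-1<N))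
  full = ↭-trans (prep _ inside) (↭-trans (↭-sym (shift (up (md N (x + K)) 1) (halvesC x st) (boundary x K))) (++⁺ˡ (halvesC x st) (subst (\ k -> up (md N (x + K)) 1 ∷ boundary x K ↭ boundary x k) 1+N-1 (↭-sym (boundary-last x K)))))
  digon : ∀ s -> concatMap halves (tp (md N x) K s ∷ tp (md N (x + K)) 1 s ∷ trisC x st) ↭ rl (md N (x + K)) s ∷ rr (md N x) s ∷ rl (md N x) s ∷ rr (md N (x + K)) s ∷ (halvesC x st ++ boundary x N)
  digon s = ↭-trans (↭-reflexive (cong₂ (\ i j -> up (md N x) K ∷ rl i s ∷ rr (md N x) s ∷ up (md N (x + K)) 1 ∷ rl j s ∷ rr (md N (x + K)) s ∷ H) (md-md+ x K) (end-next x))) (↭-trans (↭-sym (shift (up (md N x) K) (rl _ s ∷ rr _ s ∷ []) (up (md N (x + K)) 1 ∷ rl _ s ∷ rr _ s ∷ H)))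
   (prep _ (prep _ (↭-trans (swap _ _ ↭-refl) (↭-trans (↭-sym (shift (up (md N (x + K)) 1) (up (md N x) K ∷ rl _ s ∷ rr _ s ∷ []) H)) step2))))) where
   step2 : up (md N x) K ∷ rl (md N x) s ∷ rr (md N (x + K)) s ∷ up (md N (x + K)) 1 ∷ H ↭ rl (md N x) s ∷ rr (md N (x + K)) s ∷ (halvesC x st ++ boundary x N)
   step2 = ↭-trans (↭-sym (shift (up (md N x) K) (rl (md N x) s ∷ rr (md N (x + K)) s ∷ []) (up (md N (x + K)) 1 ∷ H))) (prep _ (prep _ (↭-trans (swap _ _ ↭-refl) full)))
  go : ∀ l -> concatMap halves (sliceT x st l) ↭ leafHalves x l ++ (halvesC x st ++ boundary x N)
  go lp1 = ↭-trans (↭-reflexive (cong₂ (\ i t -> up (md N x) K ∷ up i 1 ∷ t ∷ H) (md-md+ x K) (top-loop N-1+1))) (↭-trans (shift (lp (md N x)) (up (md N x) K ∷ up (md N (x + K)) 1 ∷ []) H) (prep _ (↭-trans (swap _ _ ↭-refl) full)))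
  go lp2 = ↭-trans (↭-reflexive (cong₂ (\ i t -> up (md N (x + K)) 1 ∷ up i K ∷ t ∷ H) (end-next x) (top-loop 1+N-1))) (↭-trans (shift (lp (md N (x + K))) (up (md N (x + K)) 1 ∷ up (md N x) K ∷ []) H) (prep _ full))
  go lp3 = digon pl
  go lp4 = digon nt

 ∈-arcsC : ∀ x st {t} -> t ∈ arcsC x st -> ∃[ y ] ∃[ L ] t ≡ tnc (md N y) L × x ≤ y × y + L ≤ x + (1 + length st) × 2 ≤ L × L ≤ 1 + length st
 ∈-arcsC x (b ∷ st) 0th = x , 2 + length st , refl , ≤-refl , ≤-refl , s≤s (s≤s z≤n) , ≤-refl
 ∈-arcsC x (true ∷ st) (there p) with ∈-arcsC x st p
 ... | y , L , e , a , b , c , d = y , L , e , a , lia 4 (\ y L x n -> (y :+ L :≤ x :+ (# 1 :+ n)) ∷ [] ⊢ y :+ L :≤ x :+ (# 2 :+ n)) y L x (length st) b , c , m≤n⇒m≤1+n d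
 ∈-arcsC x (false ∷ st) (there p) with ∈-arcsC (suc x) st p
 ... | y , L , e , a , b , c , d = y , L , e , <⇒≤ a , lia 4 (\ y L x n -> (y :+ L :≤ # 1 :+ x :+ (# 1 :+ n)) ∷ [] ⊢ y :+ L :≤ x :+ (# 2 :+ n)) y L x (length st) b , c , m≤n⇒m≤1+n d

 ∈-halvesC⁻ : ∀ x st {h} -> h ∈ halvesC x st -> ∃[ i ] ∃[ L ] (h ≡ up i L ⊎ h ≡ dn i L) × tnc i L ∈ arcsC x st
 ∈-halvesC⁻ x (b ∷ st) 0th = _ , _ , inl refl , 0th
 ∈-halvesC⁻ x (b ∷ st) 1st = _ , _ , inr refl , 0th
 ∈-halvesC⁻ x (b ∷ st) (there (there p)) with ∈-halvesC⁻ (inner b x) st p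
 ... | i , L , e , q = i , L , e , there q

 ∈-halvesC⁺ : ∀ x st {i L} -> tnc i L ∈ arcsC x st -> up i L ∈ halvesC x st × dn i L ∈ halvesC x st
 ∈-halvesC⁺ x (b ∷ st) 0th = 0th , 1st
 ∈-halvesC⁺ x (b ∷ st) (there p) with ∈-halvesC⁺ (inner b x) st p
 ... | q , q' = there (there q) , there (there q')

 short : ∀ x st {i L} -> tnc i L ∈ arcsC x st -> 2 ≤ L × L ≤ 1 + length st
 short x st p with ∈-arcsC x st p
 ... | y , L , refl , _ , _ , a , b = a , b

 Unique-halvesC : ∀ x st -> Unique (halvesC x st)
 Unique-halvesC x [] = []
 Unique-halvesC x (b ∷ st) = Unique-∷ (\ { (there p) -> long (inl refl) p }) (Unique-∷ (long (inr refl)) (Unique-halvesC (inner b x) st)) where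
  long : ∀ {i h} -> (h ≡ up i (2 + length st) ⊎ h ≡ dn i (2 + length st)) -> h ∉ halvesC (inner b x) st
  long {i} e p with ∈-halvesC⁻ (inner b x) st p
  long (inl refl) p | _ , _ , inl refl , q = <-irrefl refl (snd (short (inner b x) st q))
  long (inr refl) p | _ , _ , inr refl , q = <-irrefl refl (snd (short (inner b x) st q))

 ∈-boundary⁻ : ∀ x n {h} -> h ∈ boundary x n -> ∃[ j ] j < n × h ≡ up (md N (x + j)) 1
 ∈-boundary⁻ x (suc n) 0th = 0 , s≤s z≤n , cong (\ y -> up (md N y) 1) (sym (+-identityʳ x))
 ∈-boundary⁻ x (suc n) (there p) with ∈-boundary⁻ (suc x) n p
 ... | j , j<n , e = suc j , s≤s j<n , trans e (cong (\ y -> up (md N y) 1) (sym (+-suc x j)))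

 ∈-boundary⁺ : ∀ x n {j} -> j < n -> up (md N (x + j)) 1 ∈ boundary x n
 ∈-boundary⁺ x (suc n) {zero} h = here (cong (\ y -> up (md N y) 1) (+-identityʳ x))
 ∈-boundary⁺ x (suc n) {suc j} (s≤s h) = there (subst (\ y -> up (md N y) 1 ∈ boundary (suc x) n) (sym (+-suc x j)) (∈-boundary⁺ (suc x) n h))

 up-inj : ∀ {i L j M} -> up i L ≡ up j M -> i ≡ j × L ≡ M
 up-inj refl = refl , refl

 Unique-boundary : ∀ x n -> n ≤ N -> Unique (boundary x n)
 Unique-boundary x zero h = []
 Unique-boundary x (suc n) h = Unique-∷ new (Unique-boundary (suc x) n (<⇒≤ h)) where
  new : up (md N x) 1 ∉ boundary (suc x) n
  new p with ∈-boundary⁻ (suc x) n p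
  ... | j , j<n , e with md-diff x {0} {suc j} N>0 (<-≤-trans (s≤s j<n) h) (trans (cong (md N) (+-identityʳ x)) (trans (fst (up-inj e)) (cong (md N) (sym (+-suc x j)))))
  ... | ()

 lift : ∀ a {k} -> k < N -> ∃[ d ] d < N × md N (a + d) ≡ k
 lift a {k} k<N = md N e , md-< e , trans (cong (md N) (+-comm a (md N e))) (trans (md-md+ e a) (trans (cong (md N) (+-comm e a)) (trans (sym (md-md+ a e)) (trans (cong (md N) shuffle) (trans (md-+N k) (md-small k<N)))))) where
  e = k + (N ∸ md N a)
  shuffle = trans (lia 3 (\ m k n -> [] ⊢ m :+ (k :+ n) :≡ k :+ (m :+ n)) (md N a) k (N ∸ md N a)) (cong (k +_) (m+[n∸m]≡n (<⇒≤ (md-< a))))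

 md-≢ : ∀ {x d} -> 1 ≤ d -> d < N -> md N x ≢ md N (x + d)
 md-≢ {x} {d} 1≤d d<N e = <-irrefl (md-window e (m≤m+n x d) (+-monoʳ-< x d<N)) (m<m+n x 1≤d)

 ends-≢ : ∀ x -> md N x ≢ md N (x + N-1)
 ends-≢ x = md-≢ {x} (≤-trans (s≤s z≤n) 2≤N-1) N-1<N

 module Facts (x : ℕ) (st : List Bool) (l : LastPair) (len : length st ≡ N ∸ 2) where

  K≡ = trans (cong suc len) (sym (+-∸-assoc 1 {N} {2} (≤-trans (s≤s (s≤s z≤n)) 3≤N)))

  A = sliceA x st l

  leaf-ray : ∀ l {t} -> t ∈ leafArcs x l -> ∃[ s ] (t ≡ tct (md N x) s ⊎ t ≡ tct (md N (x + N-1)) s)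
  leaf-ray lp1 0th = pl , inl refl
  leaf-ray lp1 1st = nt , inl refl
  leaf-ray lp2 0th = pl , inr refl
  leaf-ray lp2 1st = nt , inr refl
  leaf-ray lp3 0th = pl , inl refl
  leaf-ray lp3 1st = pl , inr refl
  leaf-ray lp4 0th = nt , inl refl
  leaf-ray lp4 1st = nt , inr refl

  arc-cases : ∀ {t} -> t ∈ A -> (∃[ y ] ∃[ L ] t ≡ tnc (md N y) L × t ∈ arcsC x st × x ≤ y × y + L ≤ x + N-1 × 2 ≤ L × L < N) ⊎ t ∈ leafArcs x l
  arc-cases p with ∈-++⁻ (arcsC x st) p
  ... | inr q = inr q
  ... | inl q with ∈-arcsC x st q
  ... | y , L , e , a , b , c , d = inl (y , L , e , q , a , subst (\ k -> y + L ≤ x + k) K≡ b , c , ≤-<-trans (subst (L ≤_) K≡ d) N-1<N)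

  tnc⁻ : ∀ {i L} -> tnc i L ∈ A -> tnc i L ∈ arcsC x st
  tnc⁻ p with ∈-++⁻ (arcsC x st) p
  ... | inl q = q
  ... | inr q with leaf-ray l q
  ... | s , inl ()
  ... | s , inr ()

  tct⁻ : ∀ {i s} -> tct i s ∈ A -> tct i s ∈ leafArcs x l
  tct⁻ p with arc-cases p
  ... | inr q = q
  ... | inl (_ , _ , () , _)

  tct⁺ : ∀ {t} -> t ∈ leafArcs x l -> t ∈ A
  tct⁺ p = ∈-++⁺ʳ (arcsC x st) p

  valid : Valid A
  valid p with arc-cases p
  ... | inl (y , L , refl , _ , _ , _ , c , d) = validTnc⁺ (md-< y) c d
  ... | inr q with leaf-ray l q
  ... | s , inl refl = <⇒<ᵇ≡ (md-< x)
  ... | s , inr refl = <⇒<ᵇ≡ (md-< (x + N-1))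

  sound : ∀ {h} -> h ∈ leafHalves x l ++ (halvesC x st ++ boundary x N) -> Expected A h
  sound p with ∈-++⁻ (leafHalves x l) p
  ... | inr q with ∈-++⁻ (halvesC x st) q
  ... | inr r with ∈-boundary⁻ x N r
  ... | j , _ , refl = md-< (x + j) , inl refl
  sound p | inr q | inl r with ∈-halvesC⁻ x st r
  ... | i , L , inl refl , m = chord-start (∈-arcsC x st m) , inr (∈-++⁺ˡ m) where
   chord-start : ∀ {i L} -> (∃[ y ] ∃[ L' ] tnc i L ≡ tnc (md N y) L' × _) -> i < N
   chord-start (y , _ , refl , _) = md-< y
  ... | i , L , inr refl , m = ∈-++⁺ˡ m
  sound p | inl q = go l (\ z -> tct⁺ z) (\ z -> tct⁻ z) q where
   no-nt : ∀ {i} -> tct i nt ∉ leafArcs x lp3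
   no-nt (there (there ()))
   no-pl : ∀ {i} -> tct i pl ∉ leafArcs x lp4
   no-pl (there (there ()))
   go : ∀ l -> (∀ {t} -> t ∈ leafArcs x l -> t ∈ A) -> (∀ {i s} -> tct i s ∈ A -> tct i s ∈ leafArcs x l) -> ∀ {h} -> h ∈ leafHalves x l -> Expected A h
   go lp1 f g 0th = f 0th , f 1st
   go lp2 f g 0th = f 0th , f 1st
   go lp3 f g 0th = f 1st , \ z -> no-nt (g z)
   go lp3 f g 1st = f 0th , \ z -> no-nt (g z)
   go lp3 f g 2nd = f 0th , \ z -> no-nt (g z)
   go lp3 f g 3rd = f 1st , \ z -> no-nt (g z)
   go lp4 f g 0th = f 1st , \ z -> no-pl (g z)
   go lp4 f g 1st = f 0th , \ z -> no-pl (g z)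
   go lp4 f g 2nd = f 0th , \ z -> no-pl (g z)
   go lp4 f g 3rd = f 1st , \ z -> no-pl (g z)

  in-arcs : ∀ {h} -> h ∈ halvesC x st -> h ∈ leafHalves x l ++ (halvesC x st ++ boundary x N)
  in-arcs p = ∈-++⁺ʳ (leafHalves x l) (∈-++⁺ˡ p)

  both-sides : ∀ l {i} s -> tct i s ∈ leafArcs x l -> tct i (opp s) ∉ leafArcs x l -> rr i s ∈ leafHalves x l × rl i s ∈ leafHalves x l
  both-sides lp1 pl 0th q = ⊥-elim (q 1st)
  both-sides lp1 pl (there (there ())) q
  both-sides lp1 nt 1st q = ⊥-elim (q 0th)
  both-sides lp2 pl 0th q = ⊥-elim (q 1st)
  both-sides lp2 pl (there (there ())) q
  both-sides lp2 nt 1st q = ⊥-elim (q 0th)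
  both-sides lp3 pl 0th q = 1st , 2nd
  both-sides lp3 pl 1st q = 3rd , 0th
  both-sides lp3 nt (there (there ())) q
  both-sides lp4 nt 0th q = 1st , 2nd
  both-sides lp4 nt 1st q = 3rd , 0th
  both-sides lp4 pl (there (there ())) q

  complete : ∀ {h} -> Expected A h -> h ∈ leafHalves x l ++ (halvesC x st ++ boundary x N)
  complete {up i L} (i<N , inl refl) with lift x i<N
  ... | d , d<N , refl = ∈-++⁺ʳ (leafHalves x l) (∈-++⁺ʳ (halvesC x st) (∈-boundary⁺ x N d<N))
  complete {up i L} (i<N , inr p) = in-arcs (fst (∈-halvesC⁺ x st (tnc⁻ p)))
  complete {dn i L} p = in-arcs (snd (∈-halvesC⁺ x st (tnc⁻ p)))
  complete {lp i} (p , q) = ∈-++⁺ˡ (go l (tct⁻ p) (tct⁻ q)) where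
   go : ∀ l -> tct i pl ∈ leafArcs x l -> tct i nt ∈ leafArcs x l -> lp i ∈ leafHalves x l
   go lp1 0th q = 0th
   go lp1 (there (there ())) q
   go lp2 0th q = 0th
   go lp2 (there (there ())) q
   go lp3 p (there (there ()))
   go lp4 (there (there ())) q
  complete {rr i s} (p , q) = ∈-++⁺ˡ (fst (both-sides l s (tct⁻ p) (\ z -> q (tct⁺ z))))
  complete {rl i s} (p , q) = ∈-++⁺ˡ (snd (both-sides l s (tct⁻ p) (\ z -> q (tct⁺ z))))

  four : ∀ s -> Unique (rl (md N (x + N-1)) s ∷ rr (md N x) s ∷ rl (md N x) s ∷ rr (md N (x + N-1)) s ∷ [])
  four s = Unique-∷ (\ { (there (here e)) -> ends-≢ x (sym (rl-inj e)) ; (there (there (there ()))) }) (Unique-∷ (\ { (there (here e)) -> ends-≢ x (rr-inj e) ; (there (there ())) }) (Unique-∷ (\ { (there ()) }) (Unique-∷ (\ ()) []))) where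
   rl-inj : ∀ {a b r q} -> rl a r ≡ rl b q -> a ≡ b
   rl-inj refl = refl
   rr-inj : ∀ {a b r q} -> rr a r ≡ rr b q -> a ≡ b
   rr-inj refl = refl

  Unique-leafHalves : ∀ l -> Unique (leafHalves x l)
  Unique-leafHalves lp1 = Unique-∷ (\ ()) []
  Unique-leafHalves lp2 = Unique-∷ (\ ()) []
  Unique-leafHalves lp3 = four pl
  Unique-leafHalves lp4 = four nt

  leaf-no-chord : ∀ l {i L} -> up i L ∉ leafHalves x l × dn i L ∉ leafHalves x l
  leaf-no-chord lp1 = (\ { (there ()) }) , (\ { (there ()) })
  leaf-no-chord lp2 = (\ { (there ()) }) , (\ { (there ()) })
  leaf-no-chord lp3 = (\ { (there (there (there (there ())))) }) , (\ { (there (there (there (there ())))) })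
  leaf-no-chord lp4 = (\ { (there (there (there (there ())))) }) , (\ { (there (there (there (there ())))) })

  uniq = Uniqueₚ.++⁺ (Unique-leafHalves l) (Uniqueₚ.++⁺ (Unique-halvesC x st) (Unique-boundary x N ≤-refl) disj₂) disj₁ where
   disj₂ : ∀ {h} -> ¬ (h ∈ halvesC x st × h ∈ boundary x N)
   disj₂ (p , q) with ∈-halvesC⁻ x st p | ∈-boundary⁻ x N q
   ... | i , L , inl refl , m | j , _ , e with snd (up-inj e)
   ... | refl = <-irrefl refl (fst (short x st m))
   disj₂ (p , q) | i , L , inr refl , m | j , _ , ()
   disj₁ : ∀ {h} -> ¬ (h ∈ leafHalves x l × h ∈ halvesC x st ++ boundary x N)
   disj₁ (p , q) with ∈-++⁻ (halvesC x st) q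
   ... | inr r with ∈-boundary⁻ x N r
   ... | j , _ , refl = fst (leaf-no-chord l) p
   disj₁ (p , q) | inl r with ∈-halvesC⁻ x st r
   ... | i , L , inl refl , m = fst (leaf-no-chord l) p
   ... | i , L , inr refl , m = snd (leaf-no-chord l) p

  trisC-ok : ∀ x st -> 1 + length st < N -> ∀ {Δ} -> Δ ∈ trisC x st -> TriOK Δ
  trisC-ok x (true ∷ st) h 0th = md-< x , s≤s z≤n , s≤s z≤n , subst (_≤ N) (+-comm 1 (1 + length st)) (<⇒≤ h)
  trisC-ok x (true ∷ st) h (there p) = trisC-ok x st (<⇒≤ h) p
  trisC-ok x (false ∷ st) h 0th = md-< x , s≤s z≤n , s≤s z≤n , <⇒≤ h
  trisC-ok x (false ∷ st) h (there p) = trisC-ok (suc x) st (<⇒≤ h) p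

  leaf-ok : ∀ l {Δ} -> Δ ∈ leafTris x l -> TriOK Δ
  leaf-ok lp1 0th = md-< x , <⇒≤ 2≤N-1 , s≤s z≤n , ≤-reflexive N-1+1
  leaf-ok lp2 0th = md-< _ , s≤s z≤n , <⇒≤ 2≤N-1 , ≤-reflexive 1+N-1
  leaf-ok lp3 0th = md-< x , <⇒≤ 2≤N-1 , N-1<N
  leaf-ok lp3 1st = md-< _ , s≤s z≤n , <⇒≤ 3≤N
  leaf-ok lp4 0th = md-< x , <⇒≤ 2≤N-1 , N-1<N
  leaf-ok lp4 1st = md-< _ , s≤s z≤n , <⇒≤ 3≤N

  triangulated : Triangles A (sliceT x st l)
  triangulated = record { ok = \ p -> ok' (∈-++⁻ (leafTris x l) p) ; uniq = Unique-resp-↭ (↭-sym e) uniq ; sound = \ p -> sound (∈-resp-↭ e p) ; complete = \ p -> ∈-resp-↭ (↭-sym e) (complete p) } where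
   e = sliceT-halves x st l len
   ok' : ∀ {Δ} -> Δ ∈ leafTris x l ⊎ Δ ∈ trisC x st -> TriOK Δ
   ok' (inl p) = leaf-ok l p
   ok' (inr p) = trisC-ok x st (subst (_< N) (sym K≡) N-1<N) p

 swap-last : ∀ m d N -> m + N + d ≡ m + d + N
 swap-last m d N = lia 3 (\ m d N -> [] ⊢ m :+ N :+ d :≡ m :+ d :+ N) m d N

 -- All pairs of lifts have to be excluded, not just the nested one. An offset with the right
 -- residue is either the nesting offset, where nothing crosses, or would identify two residues of
 -- positions less than a turn apart.
 nested-compat : ∀ {y L z M} -> y ≤ z -> z + M ≤ y + L -> L < N -> cross N (nc (md N y) L) (nc (md N z) M) ≡ false × cross N (nc (md N z) M) (nc (md N y) L) ≡ false
 nested-compat {y} {L} {z} {M} y≤z zM≤yL L<N with m≤n⇒∃[o]m+o≡n y≤z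
 ... | e , refl = ¬true⇒false (\ c -> bad₁ (cross-nn⁻ {md N y} {md N (y + e)} (md-< _) c)) , ¬true⇒false (\ c -> bad₂ (cross-nn⁻ {md N (y + e)} {md N y} (md-< y) c)) where
  eM≤L : e + M ≤ L
  eM≤L = lia 4 (\ y e M L -> (y :+ e :+ M :≤ y :+ L) ∷ [] ⊢ e :+ M :≤ L) y e M L zM≤yL
  e<N : e < N
  e<N = ≤-<-trans (≤-trans (m≤m+n e M) eM≤L) L<N
  wrap : ∀ {d} -> 0 < d -> d < M -> md N (y + (e + d)) ≢ md N y
  wrap {d} 0<d d<M = \ q -> md-≢ {y} {e + d} (≤-trans 0<d (m≤n+m d e)) (lia 5 (\ e d M L N -> (d :< M) ∷ (e :+ M :≤ L) ∷ (L :< N) ∷ [] ⊢ e :+ d :< N) e d M L N d<M eM≤L L<N) (sym q)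
  bad₁ : ∃[ u ] md N u ≡ md N (y + e) × ChordsCross (md N y + N) L u M -> ⊥
  bad₁ (u , eu , inl (a , b , c)) with m≤n⇒∃[o]m+o≡n (<⇒≤ a)
  ... | d , refl with md-diff y {d} {e} (<-trans (+-cancelˡ-< (md N y + N) d L b) L<N) e<N (trans (sym (trans (cong (md N) (swap-last (md N y) d N)) (trans (md-+N (md N y + d)) (md-md+ y d)))) eu)
  ... | refl = lia 4 (\ Y d M L -> (Y :+ L :< Y :+ d :+ M) ∷ (d :+ M :≤ L) ∷ [] ⊢ :⊥) (md N y + N) d M L c eM≤L
  bad₁ (u , eu , inr (a , b , c)) with m≤n⇒∃[o]m+o≡n (<⇒≤ a)
  ... | d , eq = wrap (lia 3 (\ u d Y -> (u :< Y) ∷ (u :+ d :≡ Y) ∷ [] ⊢ # 0 :< d) u d (md N y + N) a eq) (lia 4 (\ u d Y M -> (Y :< u :+ M) ∷ (u :+ d :≡ Y) ∷ [] ⊢ d :< M) u d (md N y + N) M b eq)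
   (trans (cong (md N) (sym (+-assoc y e d))) (trans (sym (md-cong d eu)) (trans (cong (md N) eq) (trans (md-+N (md N y)) (md-idem y)))))
  bad₂ : ∃[ u ] md N u ≡ md N y × ChordsCross (md N (y + e) + N) M u L -> ⊥
  bad₂ (u , eu , inl (a , b , c)) with m≤n⇒∃[o]m+o≡n (<⇒≤ a)
  ... | d , refl = wrap (lia 2 (\ Y d -> (Y :< Y :+ d) ∷ [] ⊢ # 0 :< d) (md N (y + e) + N) d a) (+-cancelˡ-< (md N (y + e) + N) d M b)
   (trans (cong (md N) (sym (+-assoc y e d))) (trans (sym (md-md+ (y + e) d)) (trans (sym (md-+N (md N (y + e) + d))) (trans (cong (md N) (sym (swap-last (md N (y + e)) d N))) eu))))
  bad₂ (u , eu , inr (a , b , c)) with m≤n⇒∃[o]m+o≡n (<⇒≤ a)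
  ... | d , eq with md-diff y {d} {e} (<-trans (lia 4 (\ u d Y M -> (Y :< u :+ M) ∷ (u :+ d :≡ Y) ∷ [] ⊢ d :< M) u d (md N (y + e) + N) L b eq) L<N) e<N (trans (sym (md-cong d eu)) (trans (cong (md N) eq) (trans (md-+N (md N (y + e))) (md-idem (y + e)))))
  ... | refl = lia 5 (\ u d Y M L -> (u :+ d :≡ Y) ∷ (u :+ L :< Y :+ M) ∷ (d :+ M :≤ L) ∷ [] ⊢ :⊥) u d (md N (y + d) + N) M L eq c eM≤L

 ray-compat : ∀ {x y L ρ} -> x ≤ y -> y + L ≤ x + N-1 -> md N ρ ≡ md N x ⊎ md N ρ ≡ md N (x + N-1) -> cross N (nc (md N y) L) (ct (md N ρ)) ≡ false
 ray-compat {x} {y} {L} {ρ} x≤y yL≤ at = ¬true⇒false \ c -> bad (cross-nr⁻ {md N y} {md N ρ} {L} (md-< ρ) c) where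
  bad : ∃[ u ] md N u ≡ md N ρ × md N y + N < u × u < md N y + N + L -> ⊥
  bad (u , eu , a , b) with m≤n⇒∃[o]m+o≡n (<⇒≤ a)
  ... | d , refl = go at where
   res = trans (sym (md-md+ y d)) (trans (sym (md-+N (md N y + d))) (trans (cong (md N) (m+n+o≡m+o+n (md N y) d N)) eu))
   0<d : 0 < d
   0<d = lia 2 (\ Y d -> (Y :< Y :+ d) ∷ [] ⊢ # 0 :< d) (md N y + N) d a
   d<L : d < L
   d<L = +-cancelˡ-< (md N y + N) d L b
   go : md N ρ ≡ md N x ⊎ md N ρ ≡ md N (x + N-1) -> ⊥
   go (inl e) = <-irrefl (md-window (sym (trans res e)) (≤-trans x≤y (m≤m+n y d)) (lia 6 (\ x y d L K N -> (y :+ L :≤ x :+ K) ∷ (d :< L) ∷ (K :< N) ∷ [] ⊢ y :+ d :< x :+ N) x y d L N-1 N yL≤ d<L N-1<N)) (≤-<-trans x≤y (m<m+n y 0<d))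
   go (inr e) = <-irrefl (md-window (trans res e) (<⇒≤ lt) (lia 5 (\ x y d K N -> (x :≤ y) ∷ (K :< N) ∷ [] ⊢ x :+ K :< y :+ d :+ N) x y d N-1 N x≤y N-1<N)) lt where
    lt : y + d < x + N-1
    lt = lia 5 (\ x y d L K -> (y :+ L :≤ x :+ K) ∷ (d :< L) ∷ [] ⊢ y :+ d :< x :+ K) x y d L N-1 yL≤ d<L

 chain-nested : ∀ x st {t t'} -> t ∈ arcsC x st -> t' ∈ arcsC x st -> 1 + length st < N -> tcross t t' ≡ false
 chain-nested x (b ∷ st) 0th 0th h = fst (nested-compat {x} {2 + length st} {x} {2 + length st} ≤-refl ≤-refl h)
 chain-nested x (b ∷ st) 0th (there q) h with ∈-arcsC x (b ∷ st) (there q)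
 ... | y , L , refl , a , c , _ = fst (nested-compat {x} {2 + length st} {y} {L} a c h)
 chain-nested x (b ∷ st) (there p) 0th h with ∈-arcsC x (b ∷ st) (there p)
 ... | y , L , refl , a , c , _ = snd (nested-compat {x} {2 + length st} {y} {L} a c h)
 chain-nested x (b ∷ st) (there p) (there q) h = chain-nested (inner b x) st p q (<⇒≤ h)

 module Compatible (x : ℕ) (st : List Bool) (l : LastPair) (len : length st ≡ N ∸ 2) where
  open Facts x st l len

  compat : NonCrossing A
  compat p q with arc-cases p | arc-cases q
  ... | inl (y , L , refl , p' , a , b , c , d) | inl (z , M , refl , q' , _) = chain-nested x st p' q' (subst (_< N) (sym K≡) N-1<N)
  ... | inl (y , L , refl , p' , a , b , c , d) | inr q' with leaf-ray l q'
  ... | s , inl refl = ray-compat {ρ = x} a b (inl refl)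
  ... | s , inr refl = ray-compat {ρ = x + N-1} a b (inr refl)
  compat p q | inr p' | inl (y , L , refl , q' , a , b , c , d) with leaf-ray l p'
  ... | s , inl refl = ray-compat {ρ = x} a b (inl refl)
  ... | s , inr refl = ray-compat {ρ = x + N-1} a b (inr refl)
  compat p q | inr p' | inr q' = rays l p' q' where
   pair : ∀ {t i} -> t ∈ tct i pl ∷ tct i nt ∷ [] -> ∃[ s ] t ≡ tct i s
   pair (here e) = pl , e
   pair (there (here e)) = nt , e
   at : ∀ i {t t'} -> ∃[ s ] t ≡ tct i s -> ∃[ s ] t' ≡ tct i s -> tcross t t' ≡ false
   at i (s , refl) (r , refl) = compat-at {i} {s} {r}
   rays : ∀ l {t t'} -> t ∈ leafArcs x l -> t' ∈ leafArcs x l -> tcross t t' ≡ false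
   rays lp1 p q = at (md N x) (pair p) (pair q)
   rays lp2 p q = at (md N (x + N-1)) (pair p) (pair q)
   rays lp3 0th 0th = refl
   rays lp3 0th 1st = refl
   rays lp3 1st 0th = refl
   rays lp3 1st 1st = refl
   rays lp4 0th 0th = refl
   rays lp4 0th 1st = refl
   rays lp4 1st 0th = refl
   rays lp4 1st 1st = refl

-- Slices are tagged triangulations.

module SliceTri (N : ℕ) (3≤N : 3 ≤ N) where
 open Slice N 3≤N public

 -- Only membership is compared, since the given list may contain its arcs in any order and with
 -- repetitions.
 record SliceLike (x : ℕ) (st : List Bool) (l : LastPair) (A : List TArc) : Set where
  field
   len : length st ≡ N ∸ 2
   to : ∀ {t} -> t ∈ A -> t ∈ sliceA x st l
   from : ∀ {t} -> t ∈ sliceA x st l -> t ∈ A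

 Triangles-resp : ∀ {A B Ts} -> (∀ {t} -> t ∈ A -> t ∈ B) -> (∀ {t} -> t ∈ B -> t ∈ A) -> Triangles A Ts -> Triangles B Ts
 Triangles-resp {A} {B} f g TT = record { ok = ok ; uniq = uniq ; sound = \ p -> tr⁺ f g (sound p) ; complete = \ p -> complete (tr⁺ g f p) } where
  open Triangles TT
  tr⁺ : ∀ {A B} -> (∀ {t} -> t ∈ A -> t ∈ B) -> (∀ {t} -> t ∈ B -> t ∈ A) -> ∀ {h} -> Expected A h -> Expected B h
  tr⁺ f g {up i L} (a , inl e) = a , inl e
  tr⁺ f g {up i L} (a , inr p) = a , inr (f p)
  tr⁺ f g {dn i L} p = f p
  tr⁺ f g {lp i} (p , q) = f p , f q
  tr⁺ f g {rr i s} (p , q) = f p , \ z -> q (g z)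
  tr⁺ f g {rl i s} (p , q) = f p , \ z -> q (g z)

 -- Validity keeps chords shorter than N and thus apart from the loops that represent the second
 -- tag.
 toPlain-inj : ∀ {t t'} -> validTArc N t ≡ true -> validTArc N t' ≡ true -> toPlain N t ≡ toPlain N t' -> t ≡ t'
 toPlain-inj {tnc i L} {tnc j M} v w refl = refl
 toPlain-inj {tct i pl} {tct j pl} v w refl = refl
 toPlain-inj {tct i nt} {tct j nt} v w refl = refl
 toPlain-inj {tnc i L} {tct j nt} v w refl = <-absurd (snd (snd (validTnc v)))
 toPlain-inj {tct i nt} {tnc j M} v w refl = <-absurd (snd (snd (validTnc w)))
 toPlain-inj {tct i pl} {tct j nt} v w ()
 toPlain-inj {tct i nt} {tct j pl} v w ()
 toPlain-inj {tct i pl} {tnc j M} v w ()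
 toPlain-inj {tnc i L} {tct j pl} v w ()

 length-two : {X : Set} {xs : List X} {a b : X} -> a ∈ xs -> b ∈ xs -> a ≢ b -> 2 ≤ length xs
 length-two 0th 0th ne = ⊥-elim (ne refl)
 length-two {xs = _ ∷ _ ∷ _} 0th (there q) ne = s≤s (s≤s z≤n)
 length-two {xs = _ ∷ _ ∷ _} (there p) q ne = s≤s (s≤s z≤n)

 module _ {A : List TArc} {Ts : List Tri} (TT : Triangles A Ts) (valid : Valid A) (compat : NonCrossing A) where
  open Geo TT valid compat using (module Maximal)

  chord-in : ∀ {i L} -> i < N -> 2 ≤ L -> L < N -> (∀ {t'} -> t' ∈ A -> tcross (tnc i L) t' ≡ false) -> tnc i L ∈ A
  chord-in {i} {L} i<N 2≤L L<N c = subst (\ k -> tnc k L ∈ A) ei (Maximal.chord {i + N} {L} (m≤n+m N i) 2≤L L<N (subst (\ k -> ∀ {t'} -> t' ∈ A -> tcross (tnc k L) t' ≡ false) (sym ei) c)) where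
   ei = trans (md-+N i) (md-small i<N)

  ray-in : ∀ {i s} -> i < N -> (∀ {t'} -> t' ∈ A -> tcross (tct i s) t' ≡ false) -> ∃[ r ] tct i r ∈ A
  ray-in {i} {s} i<N c = subst (\ k -> ∃[ r ] tct k r ∈ A) ei (Maximal.ray {i + N} {s} (m≤n+m N i) (subst (\ k -> ∀ {t'} -> t' ∈ A -> tcross (tct k s) t' ≡ false) (sym ei) c)) where
   ei = trans (md-+N i) (md-small i<N)

  -- The twins become a central arc and its loop. All central arcs end at k, so the self-folded
  -- triangle, lifted from k to k + N, is the only one at the puncture.
  tagged-loop : ∀ {k} -> k < N -> tct k pl ∈ A -> tct k nt ∈ A -> (∀ {i s} -> tct i s ∈ A -> i ≡ k) -> IsTaggedTriangulation N A
  tagged-loop {k} k<N p∈ n∈ at = All.tabulate valid , T , (All.tabulate valT , noncross , max) , inl (one , \ t v -> (\ p -> ∈⇒memA (∈-map⁺ (toPlain N) p)) , \ m -> back v (memA⇒∈ m)) where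
   T = map (toPlain N) A
   back : ∀ {t} -> validTArc N t ≡ true -> toPlain N t ∈ T -> t ∈ A
   back v m with ∈-map⁻ (toPlain N) m
   ... | t' , p , e with toPlain-inj v (valid p) e
   ... | refl = p
   valT : ∀ {a} -> a ∈ T -> validArc N a ≡ true
   valT m with ∈-map⁻ (toPlain N) m
   ... | t' , p , refl = valid-toPlain {t'} (valid p)
   pair : ∀ t t' -> t ∈ A -> t' ∈ A -> cross N (toPlain N t) (toPlain N t') ≡ false
   pair (tnc i L) (tnc j M) p q = compat p q
   pair (tnc i L) (tct j pl) p q = compat p q
   pair (tct i pl) (tnc j M) p q = compat p q
   pair (tct i pl) (tct j pl) p q = refl
   pair (tct i nt) (tct j nt) p q with at p | at q
   ... | refl | refl = loop-self k<N
   pair (tct i pl) (tct j nt) p q with at p | at q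
   ... | refl | refl = loop-ray-self k<N
   pair (tct i nt) (tct j pl) p q with at p | at q
   ... | refl | refl = loop-ray-self k<N
   pair (tnc i L) (tct j nt) p q with at q | validTnc {i} (valid p)
   ... | refl | a , b , d = ¬true⇒false \ e -> false≢true (compat p p∈) (chord-loop a b d k<N e)
   pair (tct j nt) (tnc i L) p q with at p | validTnc {i} (valid q)
   ... | refl | a , b , d = ¬true⇒false \ e -> false≢true (compat q p∈) (loop-chord a b d k<N e)
   noncross : ∀ a b -> a ∈ T -> b ∈ T -> cross N a b ≡ false
   noncross a b p q with ∈-map⁻ (toPlain N) p | ∈-map⁻ (toPlain N) q
   ... | t , p' , refl | t' , q' , refl = pair t t' p' q'
   max : ∀ a -> validArc N a ≡ true -> (∀ b -> b ∈ T -> cross N a b ≡ false) -> a ∈ T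
   max (ct i) v c with loop-cross-r {k} {i} k<N (<ᵇ≡⇒< v) (c (nc k N) (∈-map⁺ (toPlain N) n∈))
   ... | refl = ∈-map⁺ (toPlain N) p∈
   max (nc i L) v c with validNc {i} {L} v
   ... | i<N , 2≤L , L≤N with L ≟ N
   ... | yes refl with loop-cross-r {i} {k} i<N k<N (c (ct k) (∈-map⁺ (toPlain N) p∈))
   ... | refl = ∈-map⁺ (toPlain N) n∈
   max (nc i L) v c | i<N , 2≤L , L≤N | no ne = ∈-map⁺ (toPlain N) (chord-in i<N 2≤L (≤∧≢⇒< L≤N ne) free) where
    free : ∀ {t'} -> t' ∈ A -> tcross (tnc i L) t' ≡ false
    free {tnc j M} p = c (nc j M) (∈-map⁺ (toPlain N) p)
    free {tct j s} p with at p
    ... | refl = c (ct k) (∈-map⁺ (toPlain N) p∈)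
   open Lifts N T
   ray-k : ∀ {a} -> ct (md N a) ∈ T -> md N a ≡ k
   ray-k m with ∈-map⁻ (toPlain N) m
   ... | tct i pl , p , refl = at p
   one : d0 N T ≡ 1
   one = ↭-length {xs = filterᵇ isTrip (triangles N T)} {ys = trip k (k + N) ∷ []} (Unique-↭ (Unique-filterᵇ isTrip (Unique-trisIn 0 N-1)) (Unique-∷ (\ ()) []) f g) where
    f : ∀ {Δ} -> Δ ∈ filterᵇ isTrip (triangles N T) -> Δ ∈ trip k (k + N) ∷ []
    f {Δ} m with ∈-filterᵇ⁻ isTrip {Δ} {triangles N T} m
    f {tri _ _ _} m | _ , ()
    f {trip a b} m | q , _ with ∈-trisIn⁻ {0} {N-1} {trip a b} q
    ... | _ , a≤ , a<b , b≤ , ra , rb , _ with ray-k {a} (memA⇒∈ ra) | ray-k {b} (memA⇒∈ rb)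
    ... | ea | eb = here (cong₂ trip a≡k (trans b≡ (cong (_+ N) a≡k))) where
     a≡k = trans (sym (md-small (≤-trans (s≤s a≤) (≤-reflexive 1+N-1)))) ea
     b≡ : b ≡ a + N
     b≡ with m≤n⇒m<n∨m≡n b≤
     ... | inr e = e
     ... | inl h = ⊥-elim (<-irrefl (md-window (trans ea (sym eb)) (<⇒≤ a<b) h) a<b)
    g : ∀ {Δ} -> Δ ∈ trip k (k + N) ∷ [] -> Δ ∈ filterᵇ isTrip (triangles N T)
    g 0th = ∈-filterᵇ⁺ isTrip {trip k (k + N)} {triangles N T} (∈-trisIn⁺ {0} {N-1} {trip k (k + N)} z≤n (≤-pred (≤-trans k<N (≤-reflexive (sym 1+N-1)))) (m<m+n k N>0 , ≤-refl , ∈⇒memA (subst (\ i -> ct i ∈ T) (sym (md-small k<N)) (∈-map⁺ (toPlain N) p∈)) ,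
     ∈⇒memA (subst (\ i -> ct i ∈ T) (sym (trans (md-+N k) (md-small k<N))) (∈-map⁺ (toPlain N) p∈)) , ∨⁺ʳ {(k + N ∸ k) ≡ᵇ 1} (∧⁺ (≤⇒≤ᵇ≡ (subst (2 ≤_) (sym (m+n∸m≡n k N)) (≤-trans (s≤s (s≤s z≤n)) 3≤N))) (∧⁺ (≤⇒≤ᵇ≡ (≤-reflexive (m+n∸m≡n k N)))
     (∈⇒memA (subst₂ (\ i L -> nc i L ∈ T) (sym (md-small k<N)) (sym (m+n∸m≡n k N)) (∈-map⁺ (toPlain N) n∈))))))) refl

  -- The longest chord and the boundary segment joining its ends are the outer sides of two
  -- triangles at the puncture, which bounds `d0` from below.
  tagged-rays : ∀ {k k' s} -> k < N -> k' < N -> k ≢ k' -> tct k s ∈ A -> tct k' s ∈ A -> (∀ {i r} -> tct i r ∈ A -> r ≡ s) -> tnc k N-1 ∈ A -> md N (k + N-1) ≡ k' -> IsTaggedTriangulation N A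
  tagged-rays {k} {k'} {s} k<N k'<N k≢ k∈ k'∈ at top∈ ek = All.tabulate valid , T , (All.tabulate valT , noncross , max) , inr (two , s , \ t v -> f {t} , g {t}) where
   T = map untag A
   fromT : ∀ {i L} -> nc i L ∈ T -> tnc i L ∈ A
   fromT m with ∈-map⁻ untag m
   ... | tnc i L , p , refl = p
   fromRay : ∀ {i} -> ct i ∈ T -> tct i s ∈ A
   fromRay m with ∈-map⁻ untag m
   ... | tct i r , p , refl = subst (\ r -> tct i r ∈ A) (at p) p
   f : ∀ {t} -> t ∈ A -> tagRule T s t ≡ true
   f {tnc i L} p = ∈⇒memA (∈-map⁺ untag p)
   f {tct i r} p with at p
   ... | refl = ∧⁺ (tagEq-refl s) (∈⇒memA (∈-map⁺ untag p))
   g : ∀ {t} -> tagRule T s t ≡ true -> t ∈ A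
   g {tnc i L} e = fromT (memA⇒∈ e)
   g {tct i r} e with ∧⁻ {tagEq s r} e
   ... | a , b with tagEq⇒≡ s r a
   ... | refl = fromRay (memA⇒∈ b)
   valT : ∀ {a} -> a ∈ T -> validArc N a ≡ true
   valT m with ∈-map⁻ untag m
   ... | tct i r , p , refl = valid p
   ... | tnc i L , p , refl with validTnc {i} (valid p)
   ... | a , b , d = ∧⁺ (<⇒<ᵇ≡ a) (∧⁺ (≤⇒≤ᵇ≡ b) (≤⇒≤ᵇ≡ (<⇒≤ d)))
   pair : ∀ t t' -> t ∈ A -> t' ∈ A -> cross N (untag t) (untag t') ≡ false
   pair (tnc i L) (tnc j M) p q = compat p q
   pair (tnc i L) (tct j r) p q = compat p q
   pair (tct i r) (tnc j M) p q = compat p q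
   pair (tct i r) (tct j r') p q = refl
   noncross : ∀ a b -> a ∈ T -> b ∈ T -> cross N a b ≡ false
   noncross a b p q with ∈-map⁻ untag p | ∈-map⁻ untag q
   ... | t , p' , refl | t' , q' , refl = pair t t' p' q'
   max : ∀ a -> validArc N a ≡ true -> (∀ b -> b ∈ T -> cross N a b ≡ false) -> a ∈ T
   max (ct i) v c with ray-in {i} {s} (<ᵇ≡⇒< v) free where
    free : ∀ {t'} -> t' ∈ A -> tcross (tct i s) t' ≡ false
    free {tnc j M} p = c (nc j M) (∈-map⁺ untag p)
    free {tct j r} p with at p
    ... | refl = compat-same {i} {j} {s}
   ... | r , p = ∈-map⁺ untag p
   max (nc i L) v c with validNc {i} {L} v
   ... | i<N , 2≤L , L≤N with L ≟ N
   ... | yes refl = ⊥-elim (k≢ (trans (sym (loop-cross-r i<N k<N (c (ct k) (∈-map⁺ untag k∈)))) (loop-cross-r i<N k'<N (c (ct k') (∈-map⁺ untag k'∈)))))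
   ... | no ne = ∈-map⁺ untag (chord-in i<N 2≤L (≤∧≢⇒< L≤N ne) free) where
    free : ∀ {t'} -> t' ∈ A -> tcross (tnc i L) t' ≡ false
    free {tnc j M} p = c (nc j M) (∈-map⁺ untag p)
    free {tct j r} p = c (ct j) (∈-map⁺ untag p)
   open Lifts N T
   ray : ∀ {a} -> tct (md N a) s ∈ A -> rayIn N T a ≡ true
   ray p = ∈⇒memA (∈-map⁺ untag p)
   two : 2 ≤ d0 N T
   two = length-two {xs = filterᵇ isTrip (triangles N T)} (here₁ k<N first) (here₁ k'<N second) (\ e -> k≢ (cong start e)) where
    here₁ : ∀ {a b} -> a < N -> LiftTri (trip a b) -> trip a b ∈ filterᵇ isTrip (triangles N T)
    here₁ {a} {b} a<N q = ∈-filterᵇ⁺ isTrip {trip a b} {triangles N T} (∈-trisIn⁺ {0} {N-1} {trip a b} z≤n (≤-pred (≤-trans a<N (≤-reflexive (sym 1+N-1)))) q) refl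
    first : LiftTri (trip k (k + N-1))
    first = lia 2 (\ k K -> (# 2 :≤ K) ∷ [] ⊢ k :< k :+ K) k N-1 2≤N-1 , +-monoʳ-≤ k (<⇒≤ N-1<N) , ray {k} (subst (\ i -> tct i s ∈ A) (sym (md-small k<N)) k∈) , ray {k + N-1} (subst (\ i -> tct i s ∈ A) (sym ek) k'∈) ,
     ∨⁺ʳ {(k + N-1 ∸ k) ≡ᵇ 1} (∧⁺ (≤⇒≤ᵇ≡ (subst (2 ≤_) (sym (m+n∸m≡n k N-1)) 2≤N-1)) (∧⁺ (≤⇒≤ᵇ≡ (subst (_≤ N) (sym (m+n∸m≡n k N-1)) (<⇒≤ N-1<N))) (∈⇒memA (subst₂ (\ i L -> nc i L ∈ T) (sym (md-small k<N)) (sym (m+n∸m≡n k N-1)) (∈-map⁺ untag top∈)))))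
    second : LiftTri (trip k' (k' + 1))
    second = lia 1 (\ k -> [] ⊢ k :< k :+ # 1) k' , +-monoʳ-≤ k' N>0 , ray {k'} (subst (\ i -> tct i s ∈ A) (sym (md-small k'<N)) k'∈) , ray {k' + 1} (subst (\ i -> tct i s ∈ A) (sym (trans (cong (\ j -> md N (j + 1)) (sym ek)) (trans (end-next k) (md-small k<N)))) k∈) , ∨⁺ˡ (≡⇒≡ᵇ≡ (m+n∸m≡n k' 1))

 top-arc : ∀ x st -> 1 ≤ length st -> tnc (md N x) (1 + length st) ∈ arcsC x st
 top-arc x (b ∷ st) h = 0th

 slice-tagged : ∀ {x st l A} -> SliceLike x st l A -> IsTaggedTriangulation N A
 slice-tagged {x} {st} {l} {A} S = go l refl where
  open SliceLike S
  module F = Facts x st l len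
  module C = Compatible x st l len
  TT = Triangles-resp from to F.triangulated
  valid : Valid A
  valid p = F.valid (to p)
  compat : NonCrossing A
  compat p q = C.compat (to p) (to q)
  leaf : ∀ {t} -> t ∈ leafArcs x l -> t ∈ A
  leaf p = from (F.tct⁺ p)
  top∈ : tnc (md N x) N-1 ∈ A
  top∈ = subst (\ k -> tnc (md N x) k ∈ A) F.K≡ (from (∈-++⁺ˡ (top-arc x st (≤-pred (subst (2 ≤_) (sym F.K≡) 2≤N-1)))))
  go : ∀ l' -> l ≡ l' -> IsTaggedTriangulation N A
  go lp1 refl = tagged-loop TT valid compat (md-< x) (leaf 0th) (leaf 1st) (\ p -> at (F.tct⁻ (to p))) where
   at : ∀ {i s} -> tct i s ∈ leafArcs x lp1 -> i ≡ md N x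
   at 0th = refl
   at 1st = refl
  go lp2 refl = tagged-loop TT valid compat (md-< (x + N-1)) (leaf 0th) (leaf 1st) (\ p -> at (F.tct⁻ (to p))) where
   at : ∀ {i s} -> tct i s ∈ leafArcs x lp2 -> i ≡ md N (x + N-1)
   at 0th = refl
   at 1st = refl
  go lp3 refl = tagged-rays TT valid compat (md-< x) (md-< (x + N-1)) (ends-≢ x) (leaf 0th) (leaf 1st) (\ p -> at (F.tct⁻ (to p))) top∈ (md-md+ x N-1) where
   at : ∀ {i s} -> tct i s ∈ leafArcs x lp3 -> s ≡ pl
   at 0th = refl
   at 1st = refl
  go lp4 refl = tagged-rays TT valid compat (md-< x) (md-< (x + N-1)) (ends-≢ x) (leaf 0th) (leaf 1st) (\ p -> at (F.tct⁻ (to p))) top∈ (md-md+ x N-1) where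
   at : ∀ {i s} -> tct i s ∈ leafArcs x lp4 -> s ≡ nt
   at 0th = refl
   at 1st = refl

-- Reaching every arc through a sequence of slices.

module Path (N : ℕ) (3≤N : 3 ≤ N) where
 open SliceTri N 3≤N public

 flipAll : List TArc -> List (TArc × TArc) -> List TArc
 flipAll = foldl (\ A f -> flipArcs (fst f) (snd f) A)

 flipAll-run : ∀ S fs -> arcs (runFlips N S fs) ≡ flipAll (arcs S) fs
 flipAll-run S [] = refl
 flipAll-run S (f ∷ fs) = flipAll-run (step N S f) fs

 arcsC-mod : ∀ x st -> arcsC (x + N) st ≡ arcsC x st
 arcsC-mod x [] = refl
 arcsC-mod x (true ∷ st) = cong₂ (\ i -> tnc i (2 + length st) ∷_) (md-+N x) (arcsC-mod x st)
 arcsC-mod x (false ∷ st) = cong₂ (\ i -> tnc i (2 + length st) ∷_) (md-+N x) (arcsC-mod (suc x) st)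

 Unique-arcsC : ∀ x st -> Unique (arcsC x st)
 Unique-arcsC x [] = []
 Unique-arcsC x (b ∷ st) = Unique-∷ (\ p -> <-irrefl refl (snd (short (inner b x) st p))) (Unique-arcsC (inner b x) st)

 Unique-leaf : ∀ x l -> Unique (leafArcs x l)
 Unique-leaf x lp1 = Unique-∷ (\ { (there ()) }) (Unique-∷ (\ ()) [])
 Unique-leaf x lp2 = Unique-∷ (\ { (there ()) }) (Unique-∷ (\ ()) [])
 Unique-leaf x lp3 = Unique-∷ (\ { (here e) -> ends-≢ x (tct-inj e) ; (there ()) }) (Unique-∷ (\ ()) [])
 
 Unique-leaf x lp4 = Unique-∷ (\ { (here e) -> ends-≢ x (tct-inj e) ; (there ()) }) (Unique-∷ (\ ()) [])
 

 Unique-slice : ∀ x st l -> length st ≡ N ∸ 2 -> Unique (sliceA x st l)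
 Unique-slice x st l e = Uniqueₚ.++⁺ (Unique-arcsC x st) (Unique-leaf x l) disj where
  disj : ∀ {t} -> ¬ (t ∈ arcsC x st × t ∈ leafArcs x l)
  disj (p , q) with ∈-arcsC x st p | Facts.leaf-ray x st l e l q
  ... | y , L , refl , _ | s , inl ()
  ... | y , L , refl , _ | s , inr ()

 State : Set
 State = ℕ × List Bool × LastPair

 arcsS : State -> List TArc
 arcsS (x , st , l) = sliceA x st l

 OK : State -> Set
 OK (x , st , l) = length st ≡ N ∸ 2

 Move : List TArc -> List TArc -> Set
 Move A B = ∃[ γ ] ∃[ γ' ] ∃[ K ] A ↭ γ ∷ K × B ↭ γ' ∷ K × γ ≢ γ'

 Like : State -> List TArc -> Set
 Like (x , st , l) A = SliceLike x st l A

 -- Quantified over all lists with the arcs of S, because flips reorder the list; this is what lets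
 -- such paths be composed.
 Reach : State -> State -> Set
 Reach S S' = ∀ {A} -> Like S A -> ∃[ fs ] ValidFlips N A fs × Like S' (flipAll A fs)

 reach-refl : ∀ {S S'} -> arcsS S ≡ arcsS S' -> OK S' -> Reach S S'
 reach-refl e ok' L = [] , _ , record { len = ok' ; to = \ p -> subst (_ ∈_) e (SliceLike.to L p) ; from = \ p -> SliceLike.from L (subst (_ ∈_) (sym e) p) }

 valid-++ : ∀ A fs gs -> ValidFlips N A fs -> ValidFlips N (flipAll A fs) gs -> ValidFlips N A (fs ++ gs)
 valid-++ A [] gs v w = w
 valid-++ A ((γ , γ') ∷ fs) gs (a , b , c , v) w = a , b , c , valid-++ (flipArcs γ γ' A) fs gs v w

 flipAll-++ : ∀ A fs gs -> flipAll A (fs ++ gs) ≡ flipAll (flipAll A fs) gs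
 flipAll-++ A [] gs = refl
 flipAll-++ A (f ∷ fs) gs = flipAll-++ (flipArcs (fst f) (snd f) A) fs gs

 infixr 4 _▹_

 _▹_ : ∀ {S S' S''} -> Reach S S' -> Reach S' S'' -> Reach S S''
 _▹_ {S'' = S''} r r' {A} L with r L
 ... | fs , v , L' with r' L'
 ... | gs , w , L'' = fs ++ gs , valid-++ A fs gs v w , subst (Like S'') (sym (flipAll-++ A fs gs)) L''

 -- Slices are tagged triangulations, so two slices that differ in one arc are already joined by an
 -- admissible flip.
 reach-move : ∀ {S S'} -> OK S -> OK S' -> Move (arcsS S) (arcsS S') -> Reach S S'
 reach-move {S@(x , st , l)} {S'@(x' , st' , l')} ok ok' (γ , γ' , K , e , e' , ne) {A} L = (γ , γ') ∷ [] , (SliceLike.from L (∈-resp-↭ (↭-sym e) 0th) , γ'∉ , slice-tagged L' , _) , L' where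
  u = Unique-resp-↭ e (Unique-slice x st l ok)
  u' = Unique-resp-↭ e' (Unique-slice x' st' l' ok')
  γ'∉ : γ' ∉ A
  γ'∉ p with ∈-resp-↭ e (SliceLike.to L p)
  ... | here q = ne (sym q)
  ... | there q = Unique-head u' q
  L' : SliceLike x' st' l' (flipArcs γ γ' A)
  L' = record { len = ok' ; to = to ; from = \ p -> from (∈-resp-↭ e' p) } where
   to : ∀ {t} -> t ∈ flipArcs γ γ' A -> t ∈ sliceA x' st' l'
   to 0th = ∈-resp-↭ (↭-sym e') 0th
   to {t} (there p) with ∈-remove⁻ {γ} {t} {A} p
   ... | q , q≢ with ∈-resp-↭ e (SliceLike.to L q)
   ... | here r = ⊥-elim (q≢ r)
   ... | there r = ∈-resp-↭ (↭-sym e') (there r)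
   from : ∀ {t} -> t ∈ γ' ∷ K -> t ∈ flipArcs γ γ' A
   from 0th = 0th
   from {t} (there p) = there (∈-remove⁺ {γ} {t} {A} (SliceLike.from L (∈-resp-↭ (↭-sym e) (there p))) (\ { refl -> Unique-head u p }))

 move-++ʳ : ∀ {A B} C -> Move A B -> Move (A ++ C) (B ++ C)
 move-++ʳ C (γ , γ' , K , e , e' , ne) = γ , γ' , K ++ C , ++⁺ʳ C e , ++⁺ʳ C e' , ne

 move-++ˡ : ∀ {A B} C -> Move A B -> Move (C ++ A) (C ++ B)
 move-++ˡ C (γ , γ' , K , e , e' , ne) = γ , γ' , C ++ K , ↭-trans (++⁺ˡ C e) (shift γ C K) , ↭-trans (++⁺ˡ C e') (shift γ' C K) , ne

 md-suc-≢ : ∀ x -> md N (suc x) ≢ md N x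
 md-suc-≢ x e = md-≢ {x} {1} ≤-refl (<⇒≤ 3≤N) (trans (sym e) (cong (md N) (+-comm 1 x)))

 tnc-start : ∀ {i L j M} -> tnc i L ≡ tnc j M -> i ≡ j
 tnc-start refl = refl

 -- `comm` exchanges the single chord that lies between two successive steps. `last` changes no arc
 -- at all, as no chord lies below the final step.
 data _⟶_ : List Bool -> List Bool -> Set where
  comm : ∀ {st} -> (false ∷ true ∷ st) ⟶ (true ∷ false ∷ st)
  last : (false ∷ []) ⟶ (true ∷ [])
  same : ∀ {st} -> st ⟶ st
  cons : ∀ {b st st'} -> st ⟶ st' -> (b ∷ st) ⟶ (b ∷ st')
  _⨾_ : ∀ {st st' st''} -> st ⟶ st' -> st' ⟶ st'' -> st ⟶ st''

 ⟶-length : ∀ {st st'} -> st ⟶ st' -> length st ≡ length st'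
 ⟶-length comm = refl
 ⟶-length last = refl
 ⟶-length same = refl
 ⟶-length (cons m) = cong suc (⟶-length m)
 ⟶-length (m ⨾ n) = trans (⟶-length m) (⟶-length n)

 ⟶-reach : ∀ {x st st' l} -> length st ≡ N ∸ 2 -> st ⟶ st' -> Reach (x , st , l) (x , st' , l)
 ⟶-reach {x} {st} {st'} {l} ok m = go m [] ok where
  end : ℕ -> List Bool -> ℕ
  end y [] = y
  end y (b ∷ ps) = end (inner b y) ps
  split : ∀ y ps st n -> length st ≡ n -> ∃[ C ] (∀ st' -> length st' ≡ n -> arcsC y (ps ++ st') ≡ C ++ arcsC (end y ps) st')
  split y [] st n e = [] , \ _ _ -> refl
  split y (b ∷ ps) st n e with split (inner b y) ps st n e
  ... | C , f = tnc (md N y) (2 + length (ps ++ st)) ∷ C , \ st' e' -> cong₂ _∷_ (cong (\ k -> tnc (md N y) (2 + k)) (same-length ps st' (trans e' (sym e)))) (f st' e') where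
   same-length : ∀ ps st' -> length st' ≡ length st -> length (ps ++ st') ≡ length (ps ++ st)
   same-length [] st' e = e
   same-length (_ ∷ ps) st' e = cong suc (same-length ps st' e)
  lengths : ∀ ps {st st'} -> length st ≡ length st' -> length (ps ++ st) ≡ length (ps ++ st')
  lengths [] e = e
  lengths (_ ∷ ps) e = cong suc (lengths ps e)
  assoc : ∀ (ps : List Bool) b st -> ps ++ (b ∷ st) ≡ (ps ++ (b ∷ [])) ++ st
  assoc [] b st = refl
  assoc (p ∷ ps) b st = cong (p ∷_) (assoc ps b st)
  go : ∀ {st st'} -> st ⟶ st' -> ∀ ps -> length (ps ++ st) ≡ N ∸ 2 -> Reach (x , ps ++ st , l) (x , ps ++ st' , l)
  go {st₁} {st₂} comm ps ok = reach-move ok (trans (lengths ps {st₂} {st₁} refl) ok) (move-++ʳ (leafArcs x l) mv) where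
   C = fst (split x ps st₁ (length st₁) refl)
   f = snd (split x ps st₁ (length st₁) refl)
   w = end x ps
   mv : Move (arcsC x (ps ++ st₁)) (arcsC x (ps ++ st₂))
   mv = subst₂ Move (sym (f st₁ refl)) (sym (f st₂ refl)) (move-++ˡ C (_ , _ , _ , swap _ _ ↭-refl , swap _ _ ↭-refl , \ e -> md-suc-≢ w (tnc-start e)))
  go last ps ok = reach-refl (cong (_++ leafArcs x l) (trans (f (false ∷ []) refl) (sym (f (true ∷ []) refl)))) (trans (lengths ps {true ∷ []} {false ∷ []} refl) ok) where
   f = snd (split x ps (false ∷ []) 1 refl)
  go same ps ok = reach-refl refl ok
  go (cons {b} {st} {st'} m) ps ok {A} L = subst (\ q -> ∃[ fs ] ValidFlips N A fs × Like (x , q , l) (flipAll A fs)) (sym (assoc ps b st')) (go m (ps ++ (b ∷ [])) (trans (cong length (sym (assoc ps b st))) ok) {A} (subst (\ q -> Like (x , q , l) A) (assoc ps b st) L))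
  go (m ⨾ n) ps ok = go m ps ok ▹ go n ps (trans (lengths ps (sym (⟶-length m))) ok)

 -- The leading `false` is moved down the word by flips and absorbed at its end.
 bubble : ∀ n -> (false ∷ replicate n true) ⟶ replicate (suc n) true
 bubble zero = last
 bubble (suc n) = comm ⨾ cons (bubble n)

 all-true : ∀ st -> st ⟶ replicate (length st) true
 all-true [] = same
 all-true (true ∷ st) = cons (all-true st)
 all-true (false ∷ st) = cons (all-true st) ⨾ bubble (length st)

 n₀ = N ∸ 2

 fan : List Bool
 fan = replicate n₀ true

 length-rep : ∀ n -> length (replicate n true) ≡ n
 length-rep zero = refl
 length-rep (suc n) = cong suc (length-rep n)

 to-fan : ∀ {x st l} -> length st ≡ n₀ -> Reach (x , st , l) (x , fan , l)
 to-fan {x} {st} {l} e = ⟶-reach e (subst (\ n -> st ⟶ replicate n true) e (all-true st))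

 leaf-move : ∀ x st {l l'} -> length st ≡ n₀ -> Move (leafArcs x l) (leafArcs x l') -> Reach (x , st , l) (x , st , l')
 leaf-move x st e m = reach-move e e (move-++ˡ (arcsC x st) m)

 ends : ∀ {x s s'} -> tct (md N x) s ≢ tct (md N (x + N-1)) s'
 ends {x} e = ends-≢ x (tct-inj e)
 

 lp3-to-lp2 : ∀ x st -> length st ≡ n₀ -> Reach (x , st , lp3) (x , st , lp2)
 lp3-to-lp2 x st e = leaf-move x st {lp3} {lp2} e (_ , _ , _ , ↭-refl , swap _ _ ↭-refl , ends)

 to-lp2 : ∀ x st l -> length st ≡ n₀ -> Reach (x , st , l) (x , st , lp2)
 to-lp2 x st lp1 e = leaf-move x st {lp1} {lp3} e (_ , _ , _ , swap _ _ ↭-refl , swap _ _ ↭-refl , ends) ▹ lp3-to-lp2 x st e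
 to-lp2 x st lp2 e = reach-refl refl e
 to-lp2 x st lp3 e = lp3-to-lp2 x st e
 to-lp2 x st lp4 e = leaf-move x st {lp4} {lp2} e (_ , _ , _ , ↭-refl , ↭-refl , ends)

 n₁ = N ∸ 3

 n₀≡ : n₀ ≡ suc n₁
 n₀≡ = +-∸-assoc 1 {N} {3} 3≤N

 -- Exchanges the longest chord, from x to x - 1, for the one from x - 1 to x - 2. The twins at x -
 -- 1 stay and merely change from the second shape to the first, and the leading `false` keeps the
 -- shorter chords based at x.
 shift-down : ∀ x -> Reach (x , fan , lp2) (x + N-1 , false ∷ replicate n₁ true , lp1)
 shift-down x = reach-move (length-rep n₀) ok' (subst (\ f -> Move (sliceA x f lp2) (sliceA (x + N-1) (false ∷ replicate n₁ true) lp1)) (sym (cong (\ n -> replicate n true) n₀≡)) mv) where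
  ok' = trans (cong suc (length-rep n₁)) (sym n₀≡)
  below = trans (cong (\ y -> arcsC y (replicate n₁ true)) (trans (sym (+-suc x N-1)) (cong (x +_) 1+N-1))) (arcsC-mod x (replicate n₁ true))
  mv = _ , _ , arcsC x (replicate n₁ true) ++ leafArcs x lp2 , ↭-refl , ↭-reflexive (cong (\ z -> tnc (md N (x + N-1)) (2 + length (replicate n₁ true)) ∷ z ++ leafArcs x lp2) below) , \ e -> ends-≢ x (tnc-start e)

 rotate : ∀ x l -> Reach (x , fan , l) (x + N-1 , fan , lp1)
 rotate x l = to-lp2 x fan l (length-rep n₀) ▹ shift-down x ▹ to-fan (trans (cong suc (length-rep n₁)) (sym n₀≡))

 -- Each rotation lowers the base of the fan by one modulo N, so d rotations lead from a + d to a.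
 rotate-to : ∀ a d y -> md N (a + d) ≡ md N y -> ∃[ z ] md N z ≡ md N a × Reach (y , fan , lp1) (z , fan , lp1)
 rotate-to a zero y e = y , trans (sym e) (cong (md N) (+-identityʳ a)) , reach-refl refl (length-rep n₀)
 rotate-to a (suc d) y e with rotate-to a d (y + N-1) e' where
  e' = sym (trans (sym (md-cong N-1 e)) (trans (cong (md N) (trans (lia 3 (\ a d K -> [] ⊢ a :+ (# 1 :+ d) :+ K :≡ a :+ d :+ (# 1 :+ K)) a d N-1) (cong (a + d +_) 1+N-1))) (md-+N (a + d))))
 ... | z , ez , r = z , ez , (rotate y lp1 ▹ r)

 fan-arcs : ∀ x n {L} -> 2 ≤ L -> L ≤ 1 + n -> tnc (md N x) L ∈ arcsC x (replicate n true)
 fan-arcs x zero {L} a b = <-absurd (≤-trans a b)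
 fan-arcs x (suc n) {L} a b with m≤n⇒m<n∨m≡n b
 ... | inr refl = here (cong (\ k -> tnc (md N x) (2 + k)) (sym (length-rep n)))
 ... | inl h = there (fan-arcs x n a (≤-pred h))

 1+n₀ : 1 + n₀ ≡ N-1
 1+n₀ = sym (+-∸-assoc 1 {N} {2} (≤-trans (s≤s (s≤s z≤n)) 3≤N))

 startOf : Arc -> ℕ
 startOf (nc i _) = i
 startOf (ct i) = i

 fan-contains : ∀ {z D} -> validArc N D ≡ true -> md N z ≡ startOf D -> ofPlain N D ∈ sliceA z fan lp1
 fan-contains {z} {ct i} v refl = ∈-++⁺ʳ (arcsC z fan) 0th
 fan-contains {z} {nc i L} v refl with validNc {i} {L} v
 ... | i<N , 2≤L , L≤N with L ≟ N
 ... | yes refl = subst (_∈ sliceA z fan lp1) (sym (cong (if_then tct (md N z) nt else tnc (md N z) N) (≡⇒≡ᵇ≡ {N} refl))) (∈-++⁺ʳ (arcsC z fan) 1st)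
 ... | no ne = subst (_∈ sliceA z fan lp1) (sym (cong (if_then tct (md N z) nt else tnc (md N z) L) (≢⇒≡ᵇ≡ ne))) (∈-++⁺ˡ (fan-arcs z n₀ 2≤L (subst (L ≤_) (sym 1+n₀) (≤-pred (subst (L <_) (sym 1+N-1) (≤∧≢⇒< L≤N ne))))))

 startOf< : ∀ D -> validArc N D ≡ true -> startOf D < N
 startOf< (ct i) v = <ᵇ≡⇒< v
 startOf< (nc i L) v = fst (validNc {i} {L} v)

 reaches : ∀ {x st l Tt} -> SliceLike x st l Tt -> ∀ D -> validArc N D ≡ true -> ∃[ fs ] Reaches N Tt fs D
 reaches {x} {st} {l} {Tt} L D v = go (lift (startOf D) (md-< (x + N-1))) where
  finish : ∀ {z} -> md N z ≡ md N (startOf D) -> (∃[ fs ] ValidFlips N Tt fs × Like (z , fan , lp1) (flipAll Tt fs)) -> ∃[ fs ] Reaches N Tt fs D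
  finish {z} ez (fs , vf , L') = fs , vf , subst (ofPlain N D ∈_) (sym (flipAll-run (initSeed N Tt) fs)) (SliceLike.from L' (fan-contains {z} {D} v (trans ez (md-small (startOf< D v)))))
  rotated : (∃[ z ] md N z ≡ md N (startOf D) × Reach (x + N-1 , fan , lp1) (z , fan , lp1)) -> ∃[ fs ] Reaches N Tt fs D
  rotated (z , ez , r) = finish {z} ez ((to-fan (SliceLike.len L) ▹ rotate x l ▹ r) L)
  go : ∃[ d ] d < N × md N (startOf D + d) ≡ md N (x + N-1) -> ∃[ fs ] Reaches N Tt fs D
  go (d , _ , e) = rotated (rotate-to (startOf D) d (x + N-1) e)

-- From the given description of slices to words of steps.

module FromSlice (N : ℕ) (3≤N : 3 ≤ N) where
 open Path N 3≤N public

 Dij-chord : ∀ p q L -> md N q ≡ md N (p + L) -> 1 ≤ L -> L < N -> Dij N p q ≡ nc (md N p) L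
 Dij-chord p q L e 1≤L L<N = cong (nc (md N p)) (trans (cong (\ d -> if d ≡ᵇ 0 then N else d) d≡L) (cong (if_then N else L) (≢⇒≡ᵇ≡ (>⇒≢ 1≤L)))) where
  d≡L = trans (md-cancel (md N p) (trans (cong (md N) (m∸n+n≡m (≤-trans (<⇒≤ (md-< p)) (m≤n+m N q)))) (trans (md-+N q) (trans e (trans (sym (md-md+ p L)) (cong (md N) (+-comm (md N p) L))))))) (md-small L<N)

 Dij-loop : ∀ p -> Dij N p p ≡ nc (md N p) N
 Dij-loop p = cong (nc (md N p)) (cong (\ d -> if d ≡ᵇ 0 then N else d) d≡0) where
  d≡0 = trans (md-cancel {p + N ∸ md N p} {0} (md N p) (trans (cong (md N) (m∸n+n≡m (≤-trans (<⇒≤ (md-< p)) (m≤n+m N p)))) (trans (md-+N p) (sym (md-idem p))))) (md-small N>0)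

 -- The given slice grows from its shortest chord outwards, while a word lists the steps from the
 -- longest chord inwards; each step is therefore pushed onto the front.
 build : ℕ -> List Bool -> List Bool -> ℕ × List Bool
 build p st [] = p , st
 build p st (true ∷ bs) = build p (true ∷ st) bs
 build p st (false ∷ bs) = build (p + N-1) (false ∷ st) bs

 build-length : ∀ p st bs -> length (snd (build p st bs)) ≡ length bs + length st
 build-length p st [] = refl
 build-length p st (true ∷ bs) = trans (build-length p (true ∷ st) bs) (+-suc (length bs) (length st))
 build-length p st (false ∷ bs) = trans (build-length (p + N-1) (false ∷ st) bs) (+-suc (length bs) (length st))

 chainEnd-build : ∀ p st bs -> chainEnd N p bs ≡ md N (fst (build p st bs))
 chainEnd-build p st [] = refl
 chainEnd-build p st (true ∷ bs) = chainEnd-build p (true ∷ st) bs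
 chainEnd-build p st (false ∷ bs) = chainEnd-build (p + N-1) (false ∷ st) bs

 below : ℕ -> Bool -> List Bool -> List TArc
 below p b st = arcsC (inner b p) st

 sliceChain-build : ∀ p q b st bs -> md N q ≡ md N (p + (2 + length st)) -> 2 + length st + length bs < N -> sliceChain N p q bs ++ map (toPlain N) (below p b st) ↭ map (toPlain N) (arcsC (fst (build p (b ∷ st) bs)) (snd (build p (b ∷ st) bs)))
 sliceChain-build p q b st [] e h = ↭-reflexive (cong (_∷ map (toPlain N) (below p b st)) (Dij-chord p q (2 + length st) e (s≤s z≤n) (subst (_< N) (+-identityʳ _) h)))
 sliceChain-build p q b st (true ∷ bs) e h = ↭-trans (↭-reflexive (cong (_∷ sliceChain N p (suc q) bs ++ map (toPlain N) (below p b st)) head)) (↭-trans (↭-sym (shift (nc (md N p) (2 + length st)) (sliceChain N p (suc q) bs) (map (toPlain N) (below p b st))))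
  (sliceChain-build p (suc q) true (b ∷ st) bs e' (subst (_< N) (+-suc (2 + length st) (length bs)) h))) where
  head = Dij-chord p q (2 + length st) e (s≤s z≤n) (≤-<-trans (m≤m+n _ _) h)
  e' = trans (cong (md N) (+-comm 1 q)) (trans (md-cong 1 e) (cong (md N) (lia 2 (\ p n -> [] ⊢ p :+ (# 2 :+ n) :+ # 1 :≡ p :+ (# 3 :+ n)) p (length st))))
 sliceChain-build p q b st (false ∷ bs) e h = ↭-trans (↭-reflexive (cong₂ _∷_ head refl)) (↭-trans (↭-sym (shift (nc (md N p) (2 + length st)) (sliceChain N (p + N-1) q bs) (map (toPlain N) (below p b st))))
  (↭-trans (↭-reflexive (cong (\ z -> sliceChain N (p + N-1) q bs ++ map (toPlain N) z) (sym back))) (sliceChain-build (p + N-1) q false (b ∷ st) bs e' (subst (_< N) (+-suc (2 + length st) (length bs)) h)))) where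
  head = Dij-chord p q (2 + length st) e (s≤s z≤n) (≤-<-trans (m≤m+n _ _) h)
  back = trans (cong (\ y -> arcsC y (b ∷ st)) (trans (sym (+-suc p N-1)) (cong (p +_) 1+N-1))) (arcsC-mod p (b ∷ st))
  e' = trans e (trans (sym (md-+N (p + (2 + length st)))) (cong (md N) (trans (cong (p + (2 + length st) +_) (sym 1+N-1)) (lia 3 (\ p n K -> [] ⊢ p :+ (# 2 :+ n) :+ (# 1 :+ K) :≡ p :+ K :+ (# 3 :+ n)) p (length st) N-1))))

 lastArcs-leaf : ∀ x l -> lastArcs N (md N x) l ≡ map (toPlain N) (leafArcs x l)
 lastArcs-leaf x lp1 = cong₂ (\ a b -> a ∷ b ∷ []) (cong ct (md-idem x)) (trans (Dij-loop (md N x)) (cong (\ i -> nc i N) (md-idem x)))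
 lastArcs-leaf x lp2 = cong₂ (\ a b -> a ∷ b ∷ []) (cong ct (md-md+ x N-1)) (trans (Dij-loop (md N x + N-1)) (cong (\ i -> nc i N) (md-md+ x N-1)))
 lastArcs-leaf x lp3 = cong₂ (\ a b -> a ∷ b ∷ []) (cong ct (md-idem x)) (cong ct (md-md+ x N-1))
 lastArcs-leaf x lp4 = cong₂ (\ a b -> a ∷ b ∷ []) (trans (Dij-loop (md N x)) (cong (\ i -> nc i N) (md-idem x))) (trans (Dij-loop (md N x + N-1)) (cong (\ i -> nc i N) (md-md+ x N-1)))

 slice-like : ∀ {Tt} -> (Valid Tt) -> IsSlice N (map (toPlain N) Tt) -> ∃[ x ] ∃[ st ] ∃[ l ] SliceLike x st l Tt
 slice-like {Tt} valid (a , a<N , bs , lbs , l , iff) = x , st , l , record { len = lst ; to = to ; from = from } where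
  -- The initial letter describes the step below the shortest chord. It does not affect the arcs,
  -- and `true` is an arbitrary choice.
  x = fst (build a (true ∷ []) bs)
  st = snd (build a (true ∷ []) bs)
  lst = trans (build-length a (true ∷ []) bs) (trans (+-comm (length bs) 1) (trans (cong suc lbs) (sym n₀≡)))
  chain : sliceChain N a (a + 2) bs ↭ map (toPlain N) (arcsC x st)
  chain = subst (_↭ map (toPlain N) (arcsC x st)) (++-identityʳ' (sliceChain N a (a + 2) bs)) (sliceChain-build a (a + 2) true [] bs refl (subst (\ n -> 2 + n < N) (sym lbs) (≤-reflexive (m+[n∸m]≡n 3≤N)))) where
   ++-identityʳ' : ∀ (xs : List Arc) -> xs ++ [] ≡ xs
   ++-identityʳ' [] = refl
   ++-identityʳ' (y ∷ ys) = cong (y ∷_) (++-identityʳ' ys)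
  lasts = trans (cong (\ i -> lastArcs N i l) (chainEnd-build a (true ∷ []) bs)) (lastArcs-leaf x l)
  whole = ↭-trans (++⁺ʳ _ chain) (↭-reflexive (trans (cong (map (toPlain N) (arcsC x st) ++_) lasts) (sym (map-++ (arcsC x st))))) where
   map-++ : ∀ xs -> map (toPlain N) (xs ++ leafArcs x l) ≡ map (toPlain N) xs ++ map (toPlain N) (leafArcs x l)
   map-++ [] = refl
   map-++ (y ∷ ys) = cong (toPlain N y ∷_) (map-++ ys)
  module F = Facts x st l lst
  to : ∀ {t} -> t ∈ Tt -> t ∈ sliceA x st l
  to {t} p with ∈-map⁻ (toPlain N) (∈-resp-↭ whole (fst (iff (toPlain N t)) (∈-map⁺ (toPlain N) p)))
  ... | t' , q , e with toPlain-inj (valid p) (F.valid q) e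
  ... | refl = q
  from : ∀ {t} -> t ∈ sliceA x st l -> t ∈ Tt
  from {t} p with ∈-map⁻ (toPlain N) (snd (iff (toPlain N t)) (∈-resp-↭ (↭-sym whole) (∈-map⁺ (toPlain N) p)))
  ... | t' , q , e with toPlain-inj (F.valid p) (valid q) e
  ... | refl = q

-- Filling the polygon below a chord by ears.

Triple : Set
Triple = ℕ × ℕ × ℕ

-- the triangles (o , o+L , o+L+M) below (o , o+1+length st); o+L is the vertex cut off by the step
trisO : ℕ -> List Bool -> List Triple
trisO o [] = []
trisO o (true ∷ st) = (o , 1 + length st , 1) ∷ trisO o st
trisO o (false ∷ st) = (o , 1 , 1 + length st) ∷ trisO (suc o) st

trisO-bounds : ∀ o st {a L M} -> (a , L , M) ∈ trisO o st -> o ≤ a × 1 ≤ L × 1 ≤ M × a + (L + M) ≤ o + (1 + length st)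
trisO-bounds o (true ∷ st) 0th = ≤-refl , s≤s z≤n , s≤s z≤n , lia 2 (\ o n -> [] ⊢ o :+ (# 1 :+ n :+ # 1) :≤ o :+ (# 2 :+ n)) o (length st)
trisO-bounds o (true ∷ st) {a} {L} {M} (there p) with trisO-bounds o st p
... | a≤ , l , m , h = a≤ , l , m , lia 3 (\ s o n -> (s :≤ o :+ (# 1 :+ n)) ∷ [] ⊢ s :≤ o :+ (# 2 :+ n)) (a + (L + M)) o (length st) h
trisO-bounds o (false ∷ st) 0th = ≤-refl , s≤s z≤n , s≤s z≤n , ≤-refl
trisO-bounds o (false ∷ st) {a} {L} {M} (there p) with trisO-bounds (suc o) st p
... | a≤ , l , m , h = <⇒≤ a≤ , l , m , lia 3 (\ s o n -> (s :≤ # 1 :+ o :+ (# 1 :+ n)) ∷ [] ⊢ s :≤ o :+ (# 2 :+ n)) (a + (L + M)) o (length st) h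

-- The same chain is filled in three settings: positions in an unrolled polygon, positions between
-- two central arcs, and residues on the closed disc. They differ in points, triangles and invariant
-- `Q`, so the filling is carried out once for all; the points on the chain are addressed by offsets
-- up to `end`.
module Chain {P R : Set} (inc : P -> R -> Bool) (pt : ℕ -> P) (tg : ℕ -> ℕ -> ℕ -> R) (U : P -> Set) (end : ℕ) (U-pt : ∀ t -> t ≤ end -> U (pt t)) (inj : ∀ {t t'} -> t ≤ end -> t' ≤ end -> pt t ≡ pt t' -> t ≡ t') (hit : ∀ {o L M} -> 1 ≤ L -> 1 ≤ M -> o + (L + M) ≤ end ->
 inc (pt o) (tg o L M) ≡ true × inc (pt (o + L)) (tg o L M) ≡ true × inc (pt (o + (L + M))) (tg o L M) ≡ true) (only : ∀ {o L M v} -> 1 ≤ L -> 1 ≤ M -> o + (L + M) ≤ end -> U v -> inc v (tg o L M) ≡ true -> v ≡ pt o ⊎ v ≡ pt (o + L) ⊎ v ≡ pt (o + (L + M)))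
 (X : List P) (Q : List P -> List R -> Set) (Rec : ℕ -> ℕ -> ℕ -> Set) (grow : ∀ {V Ts o L M} -> 1 ≤ L -> 1 ≤ M -> o + (L + M) ≤ end -> PEar inc (X ++ V) Ts (pt o) (pt (o + L)) (pt (o + (L + M))) (tg o L M) -> pt o ∈ V -> pt (o + (L + M)) ∈ V ->
 (∀ {t} -> o < t -> t < o + (L + M) -> pt t ∉ X ++ V) -> Rec o L M -> Q V Ts -> Q (pt (o + L) ∷ V) (tg o L M ∷ Ts)) where

 addV : ℕ -> List Bool -> List P -> List P
 addV o [] V = V
 addV o (true ∷ st) V = addV o st (pt (o + (1 + length st)) ∷ V)
 addV o (false ∷ st) V = addV (suc o) st (pt (o + 1) ∷ V)

 addT : ℕ -> List Bool -> List R -> List R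
 addT o [] Ts = Ts
 addT o (true ∷ st) Ts = addT o st (tg o (1 + length st) 1 ∷ Ts)
 addT o (false ∷ st) Ts = addT (suc o) st (tg o 1 (1 + length st) ∷ Ts)

 record Ready (o ℓ : ℕ) (V : List P) (Ts : List R) : Set where
  field
   l∈ : pt o ∈ V
   r∈ : pt (o + ℓ) ∈ V
   uniq : Unique (X ++ V)
   known : ∀ {v} -> v ∈ X ++ V -> U v
   fresh : ∀ {t} -> o < t -> t < o + ℓ -> pt t ∉ X ++ V
   free : ∀ {t r} -> o < t -> t < o + ℓ -> r ∈ Ts -> inc (pt t) r ≡ false
   holds : Q V Ts

 private
  ear : ∀ {o L M V Ts} -> 1 ≤ L -> 1 ≤ M -> o + (L + M) ≤ end -> Rec o L M -> Ready o (L + M) V Ts -> Q (pt (o + L) ∷ V) (tg o L M ∷ Ts) × Unique (X ++ pt (o + L) ∷ V) × (∀ {v} -> v ∈ X ++ pt (o + L) ∷ V -> v ≡ pt (o + L) ⊎ v ∈ X ++ V)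
   × (∀ {t r} -> o < t -> t < o + (L + M) -> t ≢ o + L -> r ∈ tg o L M ∷ Ts -> inc (pt t) r ≡ false)
  ear {o} {L} {M} {V} {Ts} 1≤L 1≤M h rec rd = grow 1≤L 1≤M h pear l∈ r∈ fresh rec holds , Unique-resp-↭ (↭-sym (shift y X V)) uy , back , free' where
   open Ready rd
   y = pt (o + L)
   o<y : o < o + L
   o<y = m<m+n o 1≤L
   y<z : o + L < o + (L + M)
   y<z = m+n<m+[n+o] o L 1≤M
   uy = Unique-∷ (fresh o<y y<z) uniq
   back : ∀ {v} -> v ∈ X ++ y ∷ V -> v ≡ y ⊎ v ∈ X ++ V
   back p with ∈-resp-↭ (shift y X V) p
   ... | here e = inl e
   ... | there q = inr q
   pear = record { uniq = uy ; x≢z = \ e -> <-irrefl (inj (≤-trans (m≤m+n o (L + M)) h) h e) (<-trans o<y y<z) ; y∉Ts = free o<y y<z ; xΔ = fst (hit 1≤L 1≤M h) ; yΔ = fst (snd (hit 1≤L 1≤M h)) ; zΔ = snd (snd (hit 1≤L 1≤M h)) ; onlyΔ = \ p t -> pick p (only 1≤L 1≤M h (known p) t) } where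
    pick : ∀ {v} -> v ∈ X ++ V -> v ≡ pt o ⊎ v ≡ y ⊎ v ≡ pt (o + (L + M)) -> v ≡ pt o ⊎ v ≡ pt (o + (L + M))
    pick p (inl e) = inl e
    pick p (inr (inl refl)) = ⊥-elim (fresh o<y y<z p)
    pick p (inr (inr e)) = inr e
   free' : ∀ {t r} -> o < t -> t < o + (L + M) -> t ≢ o + L -> r ∈ tg o L M ∷ Ts -> inc (pt t) r ≡ false
   free' a b ne (there q) = free a b q
   free' {t} a b ne 0th = ¬true⇒false \ e -> bad (only 1≤L 1≤M h (U-pt t t≤) e) where
    t≤ : t ≤ end
    t≤ = ≤-trans (<⇒≤ b) h
    bad : pt t ≡ pt o ⊎ pt t ≡ y ⊎ pt t ≡ pt (o + (L + M)) -> ⊥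
    bad (inl e) = <-irrefl (sym (inj t≤ (≤-trans (m≤m+n o _) h) e)) a
    bad (inr (inl e)) = ne (inj t≤ (≤-trans (<⇒≤ y<z) h) e)
    bad (inr (inr e)) = <-irrefl (inj t≤ h e) b

 chain : ∀ st o V Ts -> o + (1 + length st) ≤ end -> (∀ {a L M} -> (a , L , M) ∈ trisO o st -> Rec a L M) -> Ready o (1 + length st) V Ts -> Q (addV o st V) (addT o st Ts) × Unique (X ++ addV o st V)
 chain [] o V Ts h rec rd = Ready.holds rd , Ready.uniq rd
 chain (true ∷ st) o V Ts h rec rd = go (ear {o} {1 + n} {1} (s≤s z≤n) (s≤s z≤n) (subst (\ k -> o + k ≤ end) (+-comm 1 (1 + n)) h) (rec 0th) (subst (\ k -> Ready o k V Ts) (+-comm 1 (1 + n)) rd)) where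
  n = length st
  open Ready rd
  y = pt (o + (1 + n))
  y≤ = ≤-trans (+-monoʳ-≤ o (n≤1+n (1 + n))) h
  go : _ -> _
  go (q , u , back , free') = chain st o (y ∷ V) (tg o (1 + n) 1 ∷ Ts) y≤ (\ p -> rec (there p)) (record { l∈ = there l∈ ; r∈ = 0th ; uniq = u ; known = \ p -> kn (back p) ; fresh = \ a b p -> fr a b (back p)
   ; free = \ a b p -> free' a (<-trans b (+-monoʳ-< o (subst (1 + n <_) (+-comm 1 (1 + n)) ≤-refl))) (\ e -> <-irrefl e b) p ; holds = q }) where
   kn : ∀ {v} -> v ≡ y ⊎ v ∈ X ++ V -> U v
   kn (inl refl) = U-pt _ y≤
   kn (inr p) = known p
   fr : ∀ {t} -> o < t -> t < o + (1 + n) -> pt t ≡ y ⊎ pt t ∈ X ++ V -> ⊥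
   fr a b (inl e) = <-irrefl (inj (≤-trans (<⇒≤ b) y≤) y≤ e) b
   fr a b (inr p) = fresh a (<-≤-trans b (+-monoʳ-≤ o (n≤1+n (1 + n)))) p
 chain (false ∷ st) o V Ts h rec rd = go (ear {o} {1} {1 + n} (s≤s z≤n) (s≤s z≤n) h (rec 0th) rd) where
  n = length st
  open Ready rd
  y = pt (o + 1)
  so : o + 1 ≡ suc o
  so = +-comm o 1
  y≤ : o + 1 ≤ end
  y≤ = ≤-trans (+-monoʳ-≤ o (s≤s z≤n)) h
  z≡ = sym (+-suc o (1 + n))
  go : _ -> _
  go (q , u , back , free') = chain st (suc o) (y ∷ V) (tg o 1 (1 + n) ∷ Ts) (subst (_≤ end) (sym z≡) h) (\ p -> rec (there p)) (record { l∈ = here (cong pt (sym so)) ; r∈ = there (subst (\ k -> pt k ∈ V) (sym z≡) r∈) ; uniq = u ; known = \ p -> kn (back p) ; fresh = \ a b p -> fr a b (back p)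
   ; free = \ {t} a b p -> free' (<⇒≤ a) (subst (t <_) z≡ b) (\ e -> <-irrefl (trans (sym so) (sym e)) a) p ; holds = q }) where
   kn : ∀ {v} -> v ≡ y ⊎ v ∈ X ++ V -> U v
   kn (inl refl) = U-pt _ y≤
   kn (inr p) = known p
   fr : ∀ {t} -> suc o < t -> t < suc o + (1 + n) -> pt t ≡ y ⊎ pt t ∈ X ++ V -> ⊥
   fr {t} a b (inl e) = <-irrefl (trans (sym so) (sym (inj (≤-trans (<⇒≤ (subst (t <_) z≡ b)) h) y≤ e))) a
   fr {t} a b (inr p) = fresh (<⇒≤ a) (subst (t <_) z≡ b) p

 ∈-addV⁻ : ∀ o st {V v} -> v ∈ addV o st V -> v ∈ V ⊎ (∃[ t ] o < t × t < o + (1 + length st) × v ≡ pt t)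
 ∈-addV⁻ o [] p = inl p
 ∈-addV⁻ o (true ∷ st) p with ∈-addV⁻ o st p
 ... | inl (here e) = inr (_ , lia 2 (\ o n -> [] ⊢ o :< o :+ (# 1 :+ n)) o (length st) , lia 2 (\ o n -> [] ⊢ o :+ (# 1 :+ n) :< o :+ (# 2 :+ n)) o (length st) , e)
 ... | inl (there q) = inl q
 ... | inr (t , a , b , e) = inr (t , a , <-≤-trans b (+-monoʳ-≤ o (n≤1+n _)) , e)
 ∈-addV⁻ o (false ∷ st) p with ∈-addV⁻ (suc o) st p
 ... | inl (here e) = inr (_ , lia 1 (\ o -> [] ⊢ o :< o :+ # 1) o , lia 2 (\ o n -> [] ⊢ o :+ # 1 :< o :+ (# 2 :+ n)) o (length st) , e)
 ... | inl (there q) = inl q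
 ... | inr (t , a , b , e) = inr (t , <⇒≤ a , subst (t <_) (sym (+-suc o (1 + length st))) b , e)

 ∈-addV-old : ∀ o st {V v} -> v ∈ V -> v ∈ addV o st V
 ∈-addV-old o [] p = p
 ∈-addV-old o (true ∷ st) p = ∈-addV-old o st (there p)
 ∈-addV-old o (false ∷ st) p = ∈-addV-old (suc o) st (there p)

 ∈-addV⁺ : ∀ o st {V t} -> o < t -> t < o + (1 + length st) -> pt t ∈ addV o st V
 ∈-addV⁺ o [] {t = t} a b = ⊥-elim (lia 2 (\ o t -> (o :< t) ∷ (t :< o :+ (# 1 :+ # 0)) ∷ [] ⊢ :⊥) o t a b)
 ∈-addV⁺ o (true ∷ st) {V} {t} a b with t ≟ o + (1 + length st)
 ... | yes refl = ∈-addV-old o st 0th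
 ... | no ne = ∈-addV⁺ o st a (≤∧≢⇒< (≤-pred (subst (t <_) (+-suc o (1 + length st)) b)) ne)
 ∈-addV⁺ o (false ∷ st) {V} {t} a b with t ≟ o + 1
 ... | yes refl = ∈-addV-old (suc o) st 0th
 ... | no ne = ∈-addV⁺ (suc o) st (≤∧≢⇒< a (\ e -> ne (trans (sym e) (+-comm 1 o)))) (subst (t <_) (+-suc o (1 + length st)) b)

 ∈-addT⁻ : ∀ o st {Ts r} -> r ∈ addT o st Ts -> r ∈ Ts ⊎ (∃[ a ] ∃[ L ] ∃[ M ] (a , L , M) ∈ trisO o st × r ≡ tg a L M)
 ∈-addT⁻ o [] p = inl p
 ∈-addT⁻ o (true ∷ st) p with ∈-addT⁻ o st p
 ... | inl (here e) = inr (_ , _ , _ , 0th , e)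
 ... | inl (there q) = inl q
 ... | inr (a , L , M , q , e) = inr (a , L , M , there q , e)
 ∈-addT⁻ o (false ∷ st) p with ∈-addT⁻ (suc o) st p
 ... | inl (here e) = inr (_ , _ , _ , 0th , e)
 ... | inl (there q) = inl q
 ... | inr (a , L , M , q , e) = inr (a , L , M , there q , e)

 ∈-addT-old : ∀ o st {Ts r} -> r ∈ Ts -> r ∈ addT o st Ts
 ∈-addT-old o [] p = p
 ∈-addT-old o (true ∷ st) p = ∈-addT-old o st (there p)
 ∈-addT-old o (false ∷ st) p = ∈-addT-old (suc o) st (there p)

 ∈-addT⁺ : ∀ o st {Ts a L M} -> (a , L , M) ∈ trisO o st -> tg a L M ∈ addT o st Ts
 ∈-addT⁺ o (true ∷ st) 0th = ∈-addT-old o st 0th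
 ∈-addT⁺ o (true ∷ st) (there p) = ∈-addT⁺ o st p
 ∈-addT⁺ o (false ∷ st) 0th = ∈-addT-old (suc o) st 0th
 ∈-addT⁺ o (false ∷ st) (there p) = ∈-addT⁺ (suc o) st p

 ChainAt : List Bool -> R -> Set
 ChainAt st r = ∃[ o ] ∃[ L ] ∃[ M ] (o , L , M) ∈ trisO 0 st × r ≡ tg o L M

 Filled : List Bool -> List P -> List R -> Set
 Filled st V Ts = ∃[ V' ] ∃[ Ts' ] Q V' Ts' × Unique (X ++ V') × (∀ {v} -> v ∈ V' -> v ∈ V ⊎ (∃[ t ] 0 < t × t < end × v ≡ pt t)) × (∀ {v} -> v ∈ V -> v ∈ V') × (∀ {t} -> 0 < t -> t < end -> pt t ∈ V')
  × (∀ {r} -> r ∈ Ts' -> r ∈ Ts ⊎ ChainAt st r) × (∀ {r} -> r ∈ Ts -> r ∈ Ts') × (∀ {r} -> ChainAt st r -> r ∈ Ts')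

 abstract
  fill : ∀ st {V Ts} -> 1 + length st ≡ end -> (∀ {o L M} -> (o , L , M) ∈ trisO 0 st -> Rec o L M) -> Ready 0 end V Ts -> Filled st V Ts
  fill st {V} {Ts} refl rec rd = addV 0 st V , addT 0 st Ts , fst (chain st 0 V Ts ≤-refl rec rd) , snd (chain st 0 V Ts ≤-refl rec rd) , ∈-addV⁻ 0 st , ∈-addV-old 0 st , ∈-addV⁺ 0 st , ∈-addT⁻ 0 st , ∈-addT-old 0 st , (\ { (o , L , M , p , refl) -> ∈-addT⁺ 0 st p })

-- the weight at offset t when the ends of the chain have weights u and z
chainW : ℤ² -> ℤ² -> List Bool -> ℕ -> ℤ²
chainW u z [] zero = u
chainW u z [] (suc t) = z
chainW u z (true ∷ st) t = if t ≡ᵇ 2 + length st then z else chainW u (u ⊕ z) st t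
chainW u z (false ∷ st) zero = u
chainW u z (false ∷ st) (suc t) = chainW (u ⊕ z) z st t

chainW-true : ∀ u z st {t} -> t ≤ 1 + length st -> chainW u z (true ∷ st) t ≡ chainW u (u ⊕ z) st t
chainW-true u z st {t} h = cong (if_then z else chainW u (u ⊕ z) st t) (≢⇒≡ᵇ≡ (<⇒≢ (s≤s h)))

chainW-start : ∀ u z st -> chainW u z st 0 ≡ u
chainW-start u z [] = refl
chainW-start u z (true ∷ st) = chainW-start u (u ⊕ z) st
chainW-start u z (false ∷ st) = refl

chainW-end : ∀ u z st -> chainW u z st (1 + length st) ≡ z
chainW-end u z [] = refl
chainW-end u z (true ∷ st) = cong (if_then z else chainW u (u ⊕ z) st (2 + length st)) (≡⇒≡ᵇ≡ {2 + length st} refl)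
chainW-end u z (false ∷ st) = chainW-end (u ⊕ z) z st

-- offsets count from d
chainW-rec : ∀ u z st d {a L M} -> (a , L , M) ∈ trisO d st -> ∃[ e ] d + e ≡ a × chainW u z st (e + L) ≡ chainW u z st e ⊕ chainW u z st (e + (L + M))
chainW-rec u z (true ∷ st) d 0th = 0 , +-identityʳ d , trans (chainW-true u z st ≤-refl) (trans (chainW-end u (u ⊕ z) st) (sym (cong₂ _⊕_ (trans (chainW-true u z st z≤n) (chainW-start u (u ⊕ z) st)) (trans (cong (chainW u z (true ∷ st)) (+-comm (1 + length st) 1)) (chainW-end u z (true ∷ st))))))
chainW-rec u z (true ∷ st) d {a} {L} {M} (there p) with chainW-rec u (u ⊕ z) st d p | trisO-bounds d st p
... | e , refl , q | _ , l , m , h = e , refl , trans (chainW-true u z st (≤-trans (+-monoʳ-≤ e (m≤m+n L M)) hi)) (trans q (sym (cong₂ _⊕_ (chainW-true u z st (≤-trans (m≤m+n e (L + M)) hi)) (chainW-true u z st hi)))) where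
 hi : e + (L + M) ≤ 1 + length st
 hi = lia 4 (\ d e s n -> (d :+ e :+ s :≤ d :+ (# 1 :+ n)) ∷ [] ⊢ e :+ s :≤ # 1 :+ n) d e (L + M) (length st) h
chainW-rec u z (false ∷ st) d 0th = 0 , +-identityʳ d , trans (chainW-start (u ⊕ z) z st) (sym (cong (u ⊕_) (chainW-end (u ⊕ z) z st)))
chainW-rec u z (false ∷ st) d (there p) with chainW-rec (u ⊕ z) z st (suc d) p
... | e , refl , q = suc e , +-suc d e , q

-- Inserting the mediant u ⊕ z leaves both new determinants at 1, as in the construction of Farey
-- fractions.
chainW-unit : ∀ u z st -> det u z ≡ 1ℤ -> ∀ t -> t ≤ length st -> det (chainW u z st t) (chainW u z st (suc t)) ≡ 1ℤ
chainW-unit u z [] e zero h = e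
chainW-unit u z (true ∷ st) e t h with m≤n⇒m<n∨m≡n h
... | inl (s≤s h') = trans (cong₂ det (chainW-true u z st (m≤n⇒m≤1+n h')) (chainW-true u z st (s≤s h'))) (chainW-unit u (u ⊕ z) st (trans (det-⊕ʳ u z u) (trans (cong₂ _+Z_ (det-self u) e) refl)) t h')
... | inr refl = trans (cong₂ det (trans (chainW-true u z st ≤-refl) (chainW-end u (u ⊕ z) st)) (chainW-end u z (true ∷ st))) (trans (det-⊕ˡ u z z) (trans (cong₂ _+Z_ e (det-self z)) refl))
chainW-unit u z (false ∷ st) e zero h = trans (cong (det u) (chainW-start (u ⊕ z) z st)) (trans (det-⊕ʳ u z u) (cong₂ _+Z_ (det-self u) e))
chainW-unit u z (false ∷ st) e (suc t) (s≤s h) = chainW-unit (u ⊕ z) z st (trans (det-⊕ˡ u z z) (cong₂ _+Z_ e (det-self z))) t h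

-- The ends of each chord were neighbours at the moment when the recursion arrived at it, and
-- neighbours have determinant 1.
chainW-arc : ∀ u z st -> det u z ≡ 1ℤ -> ∀ d {a L M} -> (a , L , M) ∈ trisO d st -> ∃[ e ] d + e ≡ a × det (chainW u z st e) (chainW u z st (e + (L + M))) ≡ 1ℤ
chainW-arc u z (true ∷ st) q d 0th = 0 , +-identityʳ d , trans (cong₂ det (trans (chainW-true u z st z≤n) (chainW-start u (u ⊕ z) st)) (trans (cong (chainW u z (true ∷ st)) (+-comm (1 + length st) 1)) (chainW-end u z (true ∷ st)))) q
chainW-arc u z (false ∷ st) q d 0th = 0 , +-identityʳ d , trans (cong (det u) (chainW-end (u ⊕ z) z st)) q
chainW-arc u z (true ∷ st) q d {a} {L} {M} (there p) with chainW-arc u (u ⊕ z) st (trans (det-⊕ʳ u z u) (cong₂ _+Z_ (det-self u) q)) d p | trisO-bounds d st p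
... | e , refl , r | _ , l , m , h = e , refl , trans (cong₂ det (chainW-true u z st (≤-trans (m≤m+n e (L + M)) hi)) (chainW-true u z st hi)) r where
 hi : e + (L + M) ≤ 1 + length st
 hi = lia 4 (\ d e s n -> (d :+ e :+ s :≤ d :+ (# 1 :+ n)) ∷ [] ⊢ e :+ s :≤ # 1 :+ n) d e (L + M) (length st) h
chainW-arc u z (false ∷ st) q d (there p) with chainW-arc (u ⊕ z) z st (trans (det-⊕ˡ u z z) (cong₂ _+Z_ q (det-self z))) (suc d) p
... | e , refl , r = suc e , +-suc d e , r

dv : ℕ -> ℕ -> ℕ
dv zero x = 0
dv (suc n) x = x DivMod./ suc n

shear : ℤ -> ℤ² -> ℤ²
shear k (a , b) = a , b +Z k *Z a

shear-⊕ : ∀ k u v -> shear k (u ⊕ v) ≡ shear k u ⊕ shear k v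
shear-⊕ k (a , b) (c , d) = cong (a +Z c ,_) (lemma k a b c d) where
 lemma : ∀ k a b c d -> b +Z d +Z k *Z (a +Z c) ≡ (b +Z k *Z a) +Z (d +Z k *Z c)
 lemma = solve-∀

det-shear : ∀ k u v -> det (shear k u) (shear k v) ≡ det u v
det-shear k (a , b) (c , d) = lemma k a b c d where
 lemma : ∀ k a b c d -> a *Z (d +Z k *Z c) -Z (b +Z k *Z a) *Z c ≡ a *Z d -Z b *Z c
 lemma = solve-∀

shear-shear : ∀ k l u -> shear k (shear l u) ≡ shear (k +Z l) u
shear-shear k l (a , b) = cong (a ,_) (lemma k l a b) where
 lemma : ∀ k l a b -> b +Z l *Z a +Z k *Z a ≡ b +Z (k +Z l) *Z a
 lemma = solve-∀

-- The periodic weights of a slice.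

module SliceWeights (N : ℕ) (3≤N : 3 ≤ N) where
 open FromSlice N 3≤N public

 dv-spec : ∀ t k -> t < N -> dv N (t + k * N) ≡ k
 dv-spec t k t<N = *-cancelʳ-≡ _ _ N {{>-nonZero N>0}} (+-cancelˡ-≡ t _ _ (trans (cong (_+ dv N d * N) (sym (trans (md-+kN t k) (md-small t<N)))) (sym (decomp N N>0)))) where
  d = t + k * N
  decomp : ∀ n -> 0 < n -> d ≡ md n d + dv n d * n
  decomp (suc n) _ = DivMod.m≡m%n+[m/n]*n d (suc n)

 -- Weights of the ends x and x + N - 1 of the longest chord; a point carrying a central arc of the
 -- slice has first coordinate 1. With twins at x, the vector (1, 0) becomes (1, 1) after a turn and
 -- the other end is their sum (2, 1). With twins at x + N - 1, the vector (1, 0) there was (1, -1)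
 -- a turn earlier, and x gets their sum (2, -1). With one central arc at each end both first
 -- coordinates are 1.
 leafU leafZ : LastPair -> ℤ²
 leafU lp1 = 1ℤ , 0ℤ
 leafU lp2 = pos 2 , -1ℤ
 leafU lp3 = 1ℤ , 0ℤ
 leafU lp4 = 1ℤ , 0ℤ
 leafZ lp1 = pos 2 , 1ℤ
 leafZ lp2 = 1ℤ , 0ℤ
 leafZ lp3 = 1ℤ , 1ℤ
 leafZ lp4 = 1ℤ , 1ℤ

 -- A tag that occurs in the slice gets 1. If the other tag is absent, the digon relation makes its
 -- constant the sum of the two outer sides, both of value 1.
 leafC : LastPair -> Tag -> ℤ
 leafC lp1 _ = 1ℤ
 leafC lp2 _ = 1ℤ
 leafC lp3 pl = 1ℤ
 leafC lp3 nt = pos 2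
 leafC lp4 pl = pos 2
 leafC lp4 nt = 1ℤ

 κ : LastPair -> ℤ
 κ l = leafC l pl *Z leafC l nt

 leaf-unit : ∀ l -> det (leafU l) (leafZ l) ≡ 1ℤ
 leaf-unit lp1 = refl
 leaf-unit lp2 = refl
 leaf-unit lp3 = refl
 leaf-unit lp4 = refl

 -- The determinant of the boundary segment that leads from the end of one turn to the start of the
 -- next.
 leaf-wrap : ∀ l -> det (leafZ l) (shear (κ l) (leafU l)) ≡ 1ℤ
 leaf-wrap lp1 = refl
 leaf-wrap lp2 = refl
 leaf-wrap lp3 = refl
 leaf-wrap lp4 = refl

 module SW (x : ℕ) (st : List Bool) (l : LastPair) (len : length st ≡ N ∸ 2) where
  open Facts x st l len public

  w : ℕ -> ℤ²
  w = chainW (leafU l) (leafZ l) st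

  -- The offset from x is divided into turns and a remainder; each turn applies the monodromy once
  -- more.
  Wd : ℕ -> ℤ²
  Wd d = shear (pos (dv N d) *Z κ l) (w (md N d))

  Wd-at : ∀ t k -> t < N -> Wd (t + k * N) ≡ shear (pos k *Z κ l) (w t)
  Wd-at t k t<N = cong₂ (\ a b -> shear (pos a *Z κ l) (w b)) (dv-spec t k t<N) (trans (md-+kN t k) (md-small t<N))

  -- Gives the positions over x offsets divisible by N without leaving the natural numbers; the
  -- additional turn shears all weights alike.
  shift₀ : ℕ
  shift₀ = N ∸ md N x

  W : ℕ -> ℤ²
  W y = Wd (y + shift₀)

  w-end : w N-1 ≡ leafZ l
  w-end = subst (\ k -> w k ≡ leafZ l) K≡ (chainW-end (leafU l) (leafZ l) st)

  w-start = chainW-start (leafU l) (leafZ l) st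

  Wd-next : ∀ d -> Wd (d + N) ≡ shear (κ l) (Wd d)
  Wd-next d with md-decomp d
  ... | k , e = trans (cong Wd eN) (trans (Wd-at (md N d) (suc k) (md-< d)) (sym (trans (cong (shear (κ l)) (trans (cong Wd e) (Wd-at (md N d) k (md-< d)))) (trans (shear-shear (κ l) (pos k *Z κ l) (w (md N d))) (cong (\ z -> shear z (w (md N d))) (lemma (κ l) (pos k))))))) where
   eN = trans (cong (_+ N) e) (lia 3 (\ m kn N -> [] ⊢ m :+ kn :+ N :≡ m :+ (N :+ kn)) (md N d) (k * N) N)
   lemma : ∀ κ k -> κ +Z k *Z κ ≡ (1ℤ +Z k) *Z κ
   lemma = solve-∀

  W-next : ∀ y -> W (y + N) ≡ shear (κ l) (W y)
  W-next y = trans (cong Wd (m+n+o≡m+o+n y N shift₀)) (Wd-next (y + shift₀))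

  Wd-unit : ∀ d -> det (Wd d) (Wd (d + 1)) ≡ 1ℤ
  Wd-unit d with md-decomp d
  ... | k , e with suc (md N d) <? N
  ... | yes h = trans (cong₂ det (trans (cong Wd e) (Wd-at t k (md-< d))) (trans (cong Wd (trans (cong (_+ 1) e) (lia 2 (\ m kn -> [] ⊢ m :+ kn :+ # 1 :≡ # 1 :+ m :+ kn) t (k * N)))) (Wd-at (suc t) k h)))
   (trans (det-shear (pos k *Z κ l) (w t) (w (suc t))) (chainW-unit (leafU l) (leafZ l) st (leaf-unit l) t (≤-pred (subst (suc t ≤_) (sym K≡) (≤-pred (subst (suc (suc t) ≤_) (sym 1+N-1) h)))))) where
   t = md N d
  -- The remainder is N - 1 here, so the next offset opens a new turn and `leaf-wrap` takes over
  -- from the chain.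
  ... | no h = trans (cong₂ det (trans (cong Wd e) (trans (Wd-at t k (md-< d)) (cong (\ m -> shear (pos k *Z κ l) (w m)) t≡)))
   (trans (cong Wd (trans (cong (_+ 1) e) (trans (cong (\ m -> m + k * N + 1) t≡) (trans (lia 2 (\ K kn -> [] ⊢ K :+ kn :+ # 1 :≡ # 0 :+ (# 1 :+ K :+ kn)) N-1 (k * N)) (cong (\ m -> 0 + (m + k * N)) 1+N-1))))) (Wd-at 0 (suc k) N>0)))
   (trans (cong₂ (\ a b -> det (shear (pos k *Z κ l) a) b) w-end (trans (cong (shear (pos (suc k) *Z κ l)) w-start) (trans (cong (\ z -> shear z (leafU l)) (lemma (κ l) (pos k))) (sym (shear-shear (pos k *Z κ l) (κ l) (leafU l))))))
   (trans (det-shear (pos k *Z κ l) (leafZ l) (shear (κ l) (leafU l))) (leaf-wrap l))) where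
   t = md N d
   t≡ = ≤-antisym (≤-pred (subst (suc t ≤_) (sym 1+N-1) (md-< d))) (≤-pred (subst (_≤ suc t) (sym 1+N-1) (≮⇒≥ h)))
   lemma : ∀ κ k -> (1ℤ +Z k) *Z κ ≡ k *Z κ +Z κ
   lemma = solve-∀

  weights : Weights N
  weights = record { W = W ; c = leafC l ; periodic = W-next ; unit = \ y -> trans (cong (det (W y)) (cong Wd (lia 2 (\ y s -> [] ⊢ y :+ # 1 :+ s :≡ y :+ s :+ # 1) y shift₀))) (Wd-unit (y + shift₀)) }

  level : ℕ -> ℤ
  level b = pos (dv N (b + shift₀)) *Z κ l

  W-at : ∀ {b} t -> md N b ≡ md N x -> t < N -> W (b + t) ≡ shear (level b) (w t)
  W-at {b} t e t<N with md-decomp (b + shift₀)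
  ... | k , q = trans (cong Wd (trans (lia 3 (\ b t s -> [] ⊢ b :+ t :+ s :≡ t :+ (b :+ s)) b t shift₀) (cong (t +_) bs≡))) (trans (Wd-at t k t<N) (cong (\ z -> shear (pos z *Z κ l) (w t)) (sym (trans (cong (dv N) bs≡) (dv-spec 0 k N>0))))) where
   bs≡ = trans q (cong (_+ k * N) (trans (md-cong shift₀ e) (trans (sym (md-md+ x shift₀)) (trans (cong (md N) (m+[n∸m]≡n (<⇒≤ (md-< x)))) (trans (md-+N 0) (md-small N>0))))))

  W-base : ∀ {b} -> md N b ≡ md N x -> W b ≡ shear (level b) (leafU l)
  W-base {b} e = trans (cong W (sym (+-identityʳ b))) (trans (W-at 0 e N>0) (cong (shear (level b)) w-start))

  W-top : ∀ {b} -> md N b ≡ md N x -> W (b + N-1) ≡ shear (level b) (leafZ l)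
  W-top {b} e = trans (W-at N-1 e N-1<N) (cong (shear (level b)) w-end)

  -- Shears are linear, so the ear relations of the first turn carry over to all turns.
  W-rec : ∀ {b} -> md N b ≡ md N x -> ∀ {o L M} -> (o , L , M) ∈ trisO 0 st -> W (b + (o + L)) ≡ W (b + o) ⊕ W (b + (o + (L + M)))
  W-rec {b} e {o} {L} {M} p with chainW-rec (leafU l) (leafZ l) st 0 p | trisO-bounds 0 st p
  ... | .o , refl , q | _ , _ , _ , h = trans (W-at (o + L) e (≤-<-trans (+-monoʳ-≤ o (m≤m+n L M)) hi)) (trans (cong (shear (level b)) q) (trans (shear-⊕ (level b) (w o) (w (o + (L + M)))) (sym (cong₂ _⊕_ (W-at o e (≤-<-trans (m≤m+n o _) hi)) (W-at (o + (L + M)) e hi))))) where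
   hi = ≤-<-trans (subst (o + (L + M) ≤_) K≡ h) N-1<N

  arcsC-triple : ∀ y o st {t} -> t ∈ arcsC (y + o) st -> ∃[ a ] ∃[ L ] ∃[ M ] (a , L , M) ∈ trisO o st × t ≡ tnc (md N (y + a)) (L + M)
  arcsC-triple y o (true ∷ st) 0th = _ , _ , _ , 0th , cong (tnc (md N (y + o))) (+-comm 1 (1 + length st))
  arcsC-triple y o (false ∷ st) 0th = _ , _ , _ , 0th , refl
  arcsC-triple y o (true ∷ st) (there p) with arcsC-triple y o st p
  ... | a , L , M , q , e = a , L , M , there q , e
  arcsC-triple y o (false ∷ st) {t} (there p) with arcsC-triple y (suc o) st {t} (subst (\ z -> t ∈ arcsC z st) (sym (+-suc y o)) p)
  ... | a , L , M , q , e = a , L , M , there q , e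

  arc-one : ∀ {t} -> t ∈ arcsC x st -> ∃[ y ] ∃[ K ] t ≡ tnc (md N y) K × det (W y) (W (y + K)) ≡ 1ℤ
  arc-one {t} p with arcsC-triple x 0 st (subst (\ z -> t ∈ arcsC z st) (sym (+-identityʳ x)) p)
  ... | o , L , M , q , e with chainW-arc (leafU l) (leafZ l) st (leaf-unit l) 0 q | trisO-bounds 0 st q
  ... | .o , refl , r | _ , _ , _ , h = x + o , L + M , e , trans (cong₂ det (W-at o refl (≤-<-trans (m≤m+n o _) hi)) (trans (cong W (+-assoc x o (L + M))) (W-at (o + (L + M)) refl hi))) (trans (det-shear (level x) (w o) (w (o + (L + M)))) r) where
   hi = ≤-<-trans (subst (o + (L + M) ≤_) K≡ h) N-1<N

-- Matchings in an unrolled polygon.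

incPos⁺ : ∀ {v} Δ -> v ∈ verts Δ -> incPos v Δ ≡ true
incPos⁺ {v} Δ p = any⁺ {f = _≡ᵇ v} {x = v} {xs = verts Δ} p (≡⇒≡ᵇ≡ {v} refl)

incPos⁻ : ∀ {v} Δ -> incPos v Δ ≡ true -> v ∈ verts Δ
incPos⁻ {v} Δ e with any⁻ (_≡ᵇ v) (verts Δ) e
... | u , p , q = subst (_∈ verts Δ) (≡ᵇ≡⇒≡ q) p

module _ {P R : Set} (inc : P -> R -> Bool) where
 open Matchings inc

 touches : List P -> R -> Bool
 touches ps r = any (\ p -> inc p r) ps

 private
  drops : ∀ ps ds rs -> (∀ {d} -> d ∈ ds -> touches ps d ≡ false) -> M ps (ds ++ rs) ≡ M ps rs
  drops ps [] rs h = refl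
  drops ps (d ∷ ds) rs h = trans (M-drop ps d (ds ++ rs) (\ {p} p∈ -> ¬true⇒false \ t -> false≢true (h 0th) (any⁺ {f = \ p -> inc p d} p∈ t))) (drops ps ds rs (\ q -> h (there q)))

  partition : ∀ (f : R -> Bool) rs -> rs ↭ filterᵇ (\ r -> not (f r)) rs ++ filterᵇ f rs
  partition f [] = ↭-refl
  partition f (r ∷ rs) with f r
  ... | true = ↭-trans (prep r (partition f rs)) (↭-sym (shift r (filterᵇ (\ r -> not (f r)) rs) (filterᵇ f rs)))
  ... | false = prep r (partition f rs)

 M-touching : ∀ ps rs -> M ps rs ≡ M ps (filterᵇ (touches ps) rs)
 M-touching ps rs = trans (M-↭ʳ ps (partition (touches ps) rs)) (drops ps (filterᵇ (\ r -> not (touches ps r)) rs) _ (\ {d} q -> not-true (snd (∈-filterᵇ⁻ (\ r -> not (touches ps r)) {d} {rs} q)))) where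
  not-true : ∀ {b} -> not b ≡ true -> b ≡ false
  not-true {false} _ = refl

 -- The polygon built by ears is larger than the window in the definition of a matching number; only
 -- regions that meet a point to be matched have to agree.
 M-cong : ∀ {ps ps' rs rs'} -> ps ↭ ps' -> Unique rs -> Unique rs' -> (∀ {r} -> r ∈ rs -> touches ps r ≡ true -> r ∈ rs') -> (∀ {r} -> r ∈ rs' -> touches ps r ≡ true -> r ∈ rs) -> M ps rs ≡ M ps' rs'
 M-cong {ps} {ps'} {rs} {rs'} e u u' f g = trans (M-touching ps rs) (trans (M-↭ʳ ps (Unique-↭ (Unique-filterᵇ (touches ps) u) (Unique-filterᵇ (touches ps) u') (mv rs rs' f) (mv rs' rs g))) (trans (sym (M-touching ps rs')) (M-↭ˡ rs' e))) where
  mv : ∀ rs rs' -> (∀ {r} -> r ∈ rs -> touches ps r ≡ true -> r ∈ rs') -> ∀ {r} -> r ∈ filterᵇ (touches ps) rs -> r ∈ filterᵇ (touches ps) rs'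
  mv rs rs' f {r} p with ∈-filterᵇ⁻ (touches ps) {r} {rs} p
  ... | q , t = ∈-filterᵇ⁺ (touches ps) {r} {rs'} (f q t) t

record Poly (w : ℕ -> ℤ²) (B : ℕ) (vs : List ℕ) (Ts : List LTri) : Set where
 field
  btw : Between incPos w vs Ts
  uq : Unique Ts
  uqv : Unique vs
  ins : ∀ {v Δ} -> Δ ∈ Ts -> v ∈ verts Δ -> v ∈ vs
  max : ∀ {v} -> v ∈ vs -> v ≤ B

-- B plays the role of the puncture.
poly-base : ∀ {w B x} -> x < B -> det (w x) (w B) ≡ 1ℤ -> Poly w B (x ∷ B ∷ []) []
poly-base {w} h d = record { btw = between-base incPos {w} h d ; uq = [] ; uqv = Unique-∷ (\ { (here e) -> <-irrefl e h }) (Unique-∷ (\ ()) []) ; ins = \ () ; max = \ { 0th -> <⇒≤ h ; 1st -> ≤-refl } }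

poly-grow : ∀ {w B vs Ts x y z Δ} -> Poly w B vs Ts -> x ∈ vs -> z ∈ vs -> x < y -> y < z -> (∀ {v} -> v ∈ vs -> v ≤ x ⊎ z ≤ v) -> w y ≡ w x ⊕ w z -> x ∈ verts Δ -> y ∈ verts Δ -> (z < B -> z ∈ verts Δ) -> (∀ {v} -> v ∈ verts Δ -> v ≡ x ⊎ v ≡ y ⊎ v ≡ z) -> Poly w B (y ∷ vs) (Δ ∷ Ts)
poly-grow {w} {B} {vs} {Ts} {x} {y} {z} {Δ} P x∈ z∈ x<y y<z gap wy xΔ yΔ zΔ only = record { btw = between-ear incPos {w} ear wy btw ; uq = Unique-∷ (\ p -> y∉ (ins p yΔ)) uq ; uqv = Unique-∷ y∉ uqv ; ins = ins' ; max = \ { 0th -> <⇒≤ (<-≤-trans y<z (max z∈)) ; (there p) -> max p } } where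
 open Poly P
 y∉ : y ∉ vs
 y∉ p with gap p
 ... | inl h = <-irrefl refl (<-≤-trans x<y h)
 ... | inr h = <-irrefl refl (<-≤-trans y<z h)
 ins' : ∀ {v r} -> r ∈ Δ ∷ Ts -> v ∈ verts r -> v ∈ y ∷ vs
 ins' (there p) q = there (ins p q)
 ins' 0th q with only q
 ... | inl refl = there x∈
 ... | inr (inl refl) = 0th
 ... | inr (inr refl) = there z∈
 pick : ∀ {v} -> v ∈ vs -> v ≡ x ⊎ v ≡ y ⊎ v ≡ z -> v ≡ x ⊎ v ≡ z
 pick p (inl e) = inl e
 pick p (inr (inl refl)) = ⊥-elim (y∉ p)
 pick p (inr (inr e)) = inr e
 ear : Ear incPos vs Ts x y z Δ
 ear = record { x∈ = x∈ ; z∈ = z∈ ; x<y = x<y ; y<z = y<z ; gap = gap ; y∉Ts = \ {r} p -> ¬true⇒false \ t -> y∉ (ins p (incPos⁻ r t)) ; xΔ = incPos⁺ Δ xΔ ; yΔ = incPos⁺ Δ yΔ ; zΔ = \ p h -> incPos⁺ Δ (zΔ (<-≤-trans h (max p))) ; onlyΔ = \ p t -> pick p (only (incPos⁻ Δ t)) }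

three : ∀ {x y z v : ℕ} -> v ∈ x ∷ y ∷ z ∷ [] -> v ≡ x ⊎ v ≡ y ⊎ v ≡ z
three (here e) = inl e
three (there (here e)) = inr (inl e)
three (there (there (here e))) = inr (inr e)

poly-tri : ∀ {w B vs Ts x y z} -> Poly w B vs Ts -> x ∈ vs -> z ∈ vs -> x < y -> y < z -> (∀ {v} -> v ∈ vs -> v ≤ x ⊎ z ≤ v) -> w y ≡ w x ⊕ w z -> Poly w B (y ∷ vs) (tri x y z ∷ Ts)
poly-tri {x = x} {y} {z} P x∈ z∈ a b gap wy = poly-grow {Δ = tri x y z} P x∈ z∈ a b gap wy 0th 1st (\ _ -> there 1st) three

-- B is the last vertex and so never has to be matched, which is why it may stand for the puncture
-- although `verts` of a `trip` omits it.
poly-trip : ∀ {w B vs Ts x y} -> Poly w B vs Ts -> x ∈ vs -> B ∈ vs -> x < y -> y < B -> (∀ {v} -> v ∈ vs -> v ≤ x ⊎ B ≤ v) -> w y ≡ w x ⊕ w B -> Poly w B (y ∷ vs) (trip x y ∷ Ts)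
poly-trip {x = x} {y} P x∈ z∈ a b gap wy = poly-grow {Δ = trip x y} P x∈ z∈ a b gap wy 0th 1st (\ h -> <-absurd h) (\ { (here e) -> inl e ; (there (here e)) -> inr (inl e) })

module PosChain (b end : ℕ) where

 tg : ℕ -> ℕ -> ℕ -> LTri
 tg o L M = tri (b + o) (b + (o + L)) (b + (o + (L + M)))

 hit : ∀ {o L M} -> 1 ≤ L -> 1 ≤ M -> o + (L + M) ≤ end -> incPos (b + o) (tg o L M) ≡ true × incPos (b + (o + L)) (tg o L M) ≡ true × incPos (b + (o + (L + M))) (tg o L M) ≡ true
 hit {o} {L} {M} _ _ _ = incPos⁺ (tg o L M) 0th , incPos⁺ (tg o L M) 1st , incPos⁺ (tg o L M) 2nd

 only : ∀ {o L M v} -> 1 ≤ L -> 1 ≤ M -> o + (L + M) ≤ end -> ⊤ -> incPos v (tg o L M) ≡ true -> v ≡ b + o ⊎ v ≡ b + (o + L) ⊎ v ≡ b + (o + (L + M))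
 only {o} {L} {M} _ _ _ _ t = three (incPos⁻ (tg o L M) t)

 inj : ∀ {t t'} -> t ≤ end -> t' ≤ end -> b + t ≡ b + t' -> t ≡ t'
 inj _ _ e = +-cancelˡ-≡ b _ _ e

 no-gap : ∀ {t} -> 0 < t -> t < end -> b + t ≤ b ⊎ b + end ≤ b + t -> ⊥
 no-gap {t} a c (inl h) = lia 2 (\ b t -> (# 0 :< t) ∷ (b :+ t :≤ b) ∷ [] ⊢ :⊥) b t a h
 no-gap {t} a c (inr h) = lia 3 (\ b t e -> (t :< e) ∷ (b :+ e :≤ b :+ t) ∷ [] ⊢ :⊥) b t end c h

module PolyChain (w : ℕ -> ℤ²) (B b end : ℕ) where
 open PosChain b end

 private
  Rec : ℕ -> ℕ -> ℕ -> Set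
  Rec o L M = w (b + (o + L)) ≡ w (b + o) ⊕ w (b + (o + (L + M)))

  grow : ∀ {V Ts o L M} -> 1 ≤ L -> 1 ≤ M -> o + (L + M) ≤ end -> PEar incPos V Ts (b + o) (b + (o + L)) (b + (o + (L + M))) (tg o L M) ->
   b + o ∈ V -> b + (o + (L + M)) ∈ V -> (∀ {t} -> o < t -> t < o + (L + M) -> b + t ∉ V) -> Rec o L M -> Poly w B V Ts -> Poly w B (b + (o + L) ∷ V) (tg o L M ∷ Ts)
  grow {V} {Ts} {o} {L} {M} 1≤L 1≤M h _ x∈ z∈ fresh rec P = poly-tri P x∈ z∈ (m+n<m+[n+o] b o 1≤L) (lia 4 (\ b o L M -> (# 1 :≤ M) ∷ [] ⊢ b :+ (o :+ L) :< b :+ (o :+ (L :+ M))) b o L M 1≤M) gap rec where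
   gap : ∀ {v} -> v ∈ V -> v ≤ b + o ⊎ b + (o + (L + M)) ≤ v
   gap {v} p with v ≤? b + o
   ... | yes q = inl q
   ... | no q with b + (o + (L + M)) ≤? v
   ... | yes r = inr r
   ... | no r with m≤n⇒∃[o]m+o≡n (≤-trans (m≤m+n b o) (<⇒≤ (≰⇒> q)))
   ... | t , refl = ⊥-elim (fresh (+-cancelˡ-< b o t (≰⇒> q)) (+-cancelˡ-< b t _ (≰⇒> r)) p)

 module Steps = Chain incPos (b +_) tg (\ _ -> ⊤) end (\ _ _ -> tt) inj hit only [] (Poly w B) Rec grow
 open Steps public using (ChainAt; Filled)

 fill : ∀ st {V Ts} -> 1 + length st ≡ end -> (∀ {o L M} -> (o , L , M) ∈ trisO 0 st -> Rec o L M) -> b ∈ V -> b + end ∈ V -> (∀ {v} -> v ∈ V -> v ≤ b ⊎ b + end ≤ v) -> Poly w B V Ts -> Filled st V Ts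
 fill st {V} len rec l∈ r∈ gap P = Steps.fill st len rec (record { l∈ = subst (_∈ V) (sym (+-identityʳ b)) l∈ ; r∈ = r∈ ; uniq = Poly.uqv P ; known = \ _ -> tt ; fresh = \ a c p -> no-gap a c (gap p) ; free = \ {t} {r} a c p -> ¬true⇒false \ e -> no-gap a c (gap (Poly.ins P p (incPos⁻ r e)))
  ; holds = P })

-- The lifted triangles of a slice.

module Lift (N : ℕ) (3≤N : 3 ≤ N) where
 open SliceWeights N 3≤N public

 -- T is the ideal triangulation underlying the tagged triangulation A.
 record Underlies (A : List TArc) (T : List Arc) : Set where
  field
   chord⁺ : ∀ {i L} -> tnc i L ∈ A -> nc i L ∈ T
   chord⁻ : ∀ {i L} -> nc i L ∈ T -> L < N -> tnc i L ∈ A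
   loop⁺ : ∀ {i} -> tct i pl ∈ A -> tct i nt ∈ A -> nc i N ∈ T
   loop⁻ : ∀ {i} -> nc i N ∈ T -> tct i pl ∈ A × tct i nt ∈ A
   ray⁺ : ∀ {i s} -> tct i s ∈ A -> ct i ∈ T
   ray⁻ : ∀ {i} -> ct i ∈ T -> ∃[ s ] tct i s ∈ A

 module LiftTris {A : List TArc} {Ts : List Tri} {T : List Arc} (TT : Triangles A Ts) (valid : Valid A) (compat : NonCrossing A) (und : Underlies A T) where
  open Geo TT valid compat
  open Underlies und
  open Lifts N T

  chordIn⁻ : ∀ {a L} -> chordIn N T a (a + L) ≡ true -> L ≡ 1 ⊎ Top A (md N a) L
  chordIn⁻ {a} {L} e with ∨⁻ {(a + L ∸ a) ≡ᵇ 1} e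
  ... | inl q = inl (trans (sym (m+n∸m≡n a L)) (≡ᵇ≡⇒≡ q))
  ... | inr q with ∧⁻ {2 ≤ᵇ (a + L ∸ a)} q
  ... | _ , q' with ∧⁻ {(a + L ∸ a) ≤ᵇ N} q'
  ... | le , m = go (subst (\ k -> nc (md N a) k ∈ T) (m+n∸m≡n a L) (memA⇒∈ m)) (subst (_≤ N) (m+n∸m≡n a L) (≤ᵇ≡⇒≤ {a + L ∸ a} le)) where
   go : nc (md N a) L ∈ T -> L ≤ N -> L ≡ 1 ⊎ Top A (md N a) L
   go m L≤N with L ≟ N
   ... | yes refl = inr (inl (refl , loop⁻ m))
   ... | no ne = inr (inr (≤∧≢⇒< L≤N ne , chord⁻ m (≤∧≢⇒< L≤N ne)))

  chordIn-1 : ∀ a -> chordIn N T a (a + 1) ≡ true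
  chordIn-1 a = ∨⁺ˡ (≡⇒≡ᵇ≡ (m+n∸m≡n a 1))

  chordIn-nc : ∀ {a L} -> 2 ≤ L -> L ≤ N -> nc (md N a) L ∈ T -> chordIn N T a (a + L) ≡ true
  chordIn-nc {a} {L} 2≤L L≤N m = ∨⁺ʳ {(a + L ∸ a) ≡ᵇ 1} (∧⁺ (≤⇒≤ᵇ≡ (subst (2 ≤_) (sym (m+n∸m≡n a L)) 2≤L)) (∧⁺ (≤⇒≤ᵇ≡ (subst (_≤ N) (sym (m+n∸m≡n a L)) L≤N)) (∈⇒memA (subst (\ k -> nc (md N a) k ∈ T) (sym (m+n∸m≡n a L)) m))))

  chordIn-top : ∀ {a L} -> Top A (md N a) L -> chordIn N T a (a + L) ≡ true
  chordIn-top {a} (inl (refl , p , q)) = chordIn-nc {a} (<⇒≤ 3≤N) ≤-refl (loop⁺ p q)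
  chordIn-top {a} (inr (h , p)) = chordIn-nc {a} (fst (snd (validTnc (valid p)))) (<⇒≤ h) (chord⁺ p)

  chordIn-side : ∀ {a L} -> Side A (md N a) L -> chordIn N T a (a + L) ≡ true
  chordIn-side {a} (inl refl) = chordIn-1 a
  chordIn-side {a} {L} (inr p) = chordIn-top {a} {L} (inr (snd (snd (validTnc (valid p))) , p))

  side : ∀ {a L} -> L < N -> L ≡ 1 ⊎ Top A (md N a) L -> Side A (md N a) L
  side h (inl e) = inl e
  side h (inr (inl (e , _))) = ⊥-elim (<-irrefl e h)
  side h (inr (inr (_ , p))) = inr p

  top₂ : ∀ {a L} -> 2 ≤ L -> L ≡ 1 ⊎ Top A (md N a) L -> Top A (md N a) L
  top₂ (s≤s ()) (inl refl)
  top₂ h (inr t) = t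

  md+N : ∀ a -> md N (a + N) ≡ md N a
  md+N = md-+N

  tri⁻ : ∀ {a b c} -> LiftTri (tri a b c) -> ∃[ L ] ∃[ M ] b ≡ a + L × c ≡ a + (L + M) × tr (md N a) L M ∈ Ts
  tri⁻ {a} {b} {c} (a<b , b<c , c≤ , e₁ , e₂ , e₃) with m≤n⇒∃[o]m+o≡n (<⇒≤ a<b)
  ... | L , refl with m≤n⇒∃[o]m+o≡n (<⇒≤ b<c)
  ... | M , refl = L , M , refl , +-assoc a L M , subst (\ i -> tr i L M ∈ Ts) (md+N a) (lift-tr {a + N} {L} {M} (m≤n+m N a) 1≤L 1≤M (subst (\ i -> Side A i L) (sym (md+N a)) (side {a} L<N (chordIn⁻ {a} {L} e₁)))
   (subst (\ i -> Side A i M) (sym (trans (cong (md N) shuf) (md+N (a + L)))) (side {a + L} M<N (chordIn⁻ {a + L} {M} e₂))) (subst (\ i -> Top A i (L + M)) (sym (md+N a)) (top₂ {a} (+-mono-≤ 1≤L 1≤M) (chordIn⁻ {a} {L + M} (subst (\ z -> chordIn N T a z ≡ true) (+-assoc a L M) e₃))))) where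
   1≤L : 1 ≤ L
   1≤L = lia 2 (\ a L -> (a :< a :+ L) ∷ [] ⊢ # 1 :≤ L) a L a<b
   1≤M : 1 ≤ M
   1≤M = lia 2 (\ a L -> (a :< a :+ L) ∷ [] ⊢ # 1 :≤ L) (a + L) M b<c
   L<N : L < N
   L<N = lia 4 (\ a L M N -> (a :+ L :+ M :≤ a :+ N) ∷ (# 1 :≤ M) ∷ [] ⊢ L :< N) a L M N c≤ 1≤M
   M<N : M < N
   M<N = lia 4 (\ a L M N -> (a :+ L :+ M :≤ a :+ N) ∷ (# 1 :≤ L) ∷ [] ⊢ M :< N) a L M N c≤ 1≤L
   shuf : a + N + L ≡ a + L + N
   shuf = m+n+o≡m+o+n a N L

  tri⁺ : ∀ {a L M} -> tr (md N a) L M ∈ Ts -> LiftTri (tri a (a + L) (a + (L + M)))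
  tri⁺ {a} {L} {M} p with tr-sides {a} p | ok-tr p
  ... | s₁ , s₂ , t | 1≤L , 1≤M , h = m<m+n a 1≤L , m+n<m+[n+o] a L 1≤M , +-monoʳ-≤ a h , chordIn-side {a} s₁ , subst (\ z -> chordIn N T (a + L) z ≡ true) (+-assoc a L M) (chordIn-side {a + L} s₂) , chordIn-top {a} t

  trip⁻ : ∀ {a b} -> LiftTri (trip a b) -> ∃[ L ] b ≡ a + L × ((∃[ s ] tp (md N a) L s ∈ Ts) ⊎ (L ≡ N × tct (md N a) pl ∈ A × tct (md N a) nt ∈ A))
  trip⁻ {a} {b} (a<b , b≤ , ra , rb , e) with m≤n⇒∃[o]m+o≡n (<⇒≤ a<b)
  ... | L , refl with m≤n⇒m<n∨m≡n (+-cancelˡ-≤ a L N b≤)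
  ... | inl L<N = L , refl , inl (subst (\ i -> ∃[ s ] tp i L s ∈ Ts) (md+N a) (lift-tp {a + N} {L} (m≤n+m N a) (lia 2 (\ a L -> (a :< a :+ L) ∷ [] ⊢ # 1 :≤ L) a L a<b) (subst (\ i -> Side A i L) (sym (md+N a)) (side {a} L<N (chordIn⁻ {a} {L} e)))
   (subst (\ i -> tct i (fst qa) ∈ A) (sym (md+N a)) (snd qa)) (subst (\ i -> tct i (fst qb) ∈ A) (sym (trans (cong (md N) shuf) (md+N (a + L)))) (snd qb)))) where
   qa = ray⁻ (memA⇒∈ ra)
   qb = ray⁻ (memA⇒∈ rb)
   shuf : a + N + L ≡ a + L + N
   shuf = m+n+o≡m+o+n a N L
  ... | inr refl = L , refl , inr (refl , loop (top₂ {a} (<⇒≤ 3≤N) (chordIn⁻ {a} {L} e))) where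
   loop : Top A (md N a) N -> tct (md N a) pl ∈ A × tct (md N a) nt ∈ A
   loop (inl (_ , p)) = p
   loop (inr (h , _)) = <-absurd h

  trip⁺ : ∀ {a L s} -> tp (md N a) L s ∈ Ts -> LiftTri (trip a (a + L))
  trip⁺ {a} {L} {s} p with tp-sides {a} p | ok p
  ... | sd , (ra , _) , (rb , _) | _ , 1≤L , L<N = m<m+n a 1≤L , +-monoʳ-≤ a (<⇒≤ L<N) , ∈⇒memA (ray⁺ ra) , ∈⇒memA (ray⁺ rb) , chordIn-side {a} sd

  selfFolded⁺ : ∀ {a} -> tct (md N a) pl ∈ A -> tct (md N a) nt ∈ A -> LiftTri (trip a (a + N))
  selfFolded⁺ {a} p q = m<m+n a N>0 , ≤-refl , ∈⇒memA (ray⁺ p) , ∈⇒memA (subst (\ i -> ct i ∈ T) (sym (md+N a)) (ray⁺ p)) , chordIn-top {a} {N} (inl (refl , p , q))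

 Two : LastPair -> Set
 Two l = l ≡ lp3 ⊎ l ≡ lp4

 module SliceLifts {x : ℕ} {st : List Bool} {l : LastPair} {A : List TArc} (S : SliceLike x st l A) {T : List Arc} (und : Underlies A T) where
  open SliceLike S
  private
   module F = Facts x st l len
   module C = Compatible x st l len
  TT = Triangles-resp from to F.triangulated
  valid : Valid A
  valid p = F.valid (to p)
  compat : NonCrossing A
  compat p q = C.compat (to p) (to q)
  open LiftTris TT valid compat und
  open Lifts N T public

  -- A classification of all lifted triangles, self-folded ones included, by the shape of the slice;
  -- case analysis on it replaces the search in `trisIn`.
  data Lifted : LTri -> Set where
   chain : ∀ {a b c o L M} -> (o , L , M) ∈ trisO 0 st -> md N a ≡ md N (x + o) -> b ≡ a + L -> c ≡ a + (L + M) -> Lifted (tri a b c)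
   tr1 : ∀ {a b c} -> l ≡ lp1 -> md N a ≡ md N x -> b ≡ a + N-1 -> c ≡ a + N -> Lifted (tri a b c)
   tp1 : ∀ {a b} -> l ≡ lp1 -> md N a ≡ md N x -> b ≡ a + N -> Lifted (trip a b)
   tr2 : ∀ {a b c} -> l ≡ lp2 -> md N a ≡ md N (x + N-1) -> b ≡ a + 1 -> c ≡ a + N -> Lifted (tri a b c)
   tp2 : ∀ {a b} -> l ≡ lp2 -> md N a ≡ md N (x + N-1) -> b ≡ a + N -> Lifted (trip a b)
   tpA : ∀ {a b} -> Two l -> md N a ≡ md N x -> b ≡ a + N-1 -> Lifted (trip a b)
   tpB : ∀ {a b} -> Two l -> md N a ≡ md N (x + N-1) -> b ≡ a + 1 -> Lifted (trip a b)

  private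
   trisC-triple : ∀ y o st {i L M} -> tr i L M ∈ trisC (y + o) st -> ∃[ a ] (a , L , M) ∈ trisO o st × i ≡ md N (y + a)
   trisC-triple y o (true ∷ st) 0th = o , 0th , refl
   trisC-triple y o (false ∷ st) 0th = o , 0th , refl
   trisC-triple y o (true ∷ st) (there p) with trisC-triple y o st p
   ... | a , q , e = a , there q , e
   trisC-triple y o (false ∷ st) {i} {L} {M} (there p) with trisC-triple y (suc o) st (subst (\ z -> tr i L M ∈ trisC z st) (sym (+-suc y o)) p)
   ... | a , q , e = a , there q , e
   triple-trisC : ∀ y o st {a L M} -> (a , L , M) ∈ trisO o st -> tr (md N (y + a)) L M ∈ trisC (y + o) st
   triple-trisC y o (true ∷ st) 0th = 0th
   triple-trisC y o (false ∷ st) 0th = 0th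
   triple-trisC y o (true ∷ st) (there p) = there (triple-trisC y o st p)
   triple-trisC y o (false ∷ st) {a} {L} {M} (there p) = there (subst (\ z -> tr (md N (y + a)) L M ∈ trisC z st) (+-suc y o) (triple-trisC y (suc o) st p))
   no-tp : ∀ y st {i L s} -> tp i L s ∉ trisC y st
   no-tp y (true ∷ st) (there p) = no-tp y st p
   no-tp y (false ∷ st) (there p) = no-tp (suc y) st p
   inT : ∀ {Δ} -> Δ ∈ trisC x st -> Δ ∈ sliceT x st l
   inT p = ∈-++⁺ʳ (leafTris x l) p

  fromTr : ∀ {a L M} -> tr (md N a) L M ∈ sliceT x st l -> Lifted (tri a (a + L) (a + (L + M)))
  fromTr {a} {L} {M} p with ∈-++⁻ (leafTris x l) p
  ... | inr q with trisC-triple x 0 st (subst (\ z -> tr (md N a) L M ∈ trisC z st) (sym (+-identityʳ x)) q)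
  ... | o , m , e = chain m e refl refl
  fromTr {a} {L} {M} p | inl q = go l refl q where
   inj : ∀ {i L M j L' M'} -> tr i L M ≡ tr j L' M' -> i ≡ j × L ≡ L' × M ≡ M'
   inj refl = refl , refl , refl
   go : ∀ l' -> l ≡ l' -> tr (md N a) L M ∈ leafTris x l' -> Lifted (tri a (a + L) (a + (L + M)))
   go lp1 e (here q) with inj q
   ... | e' , refl , refl = tr1 e e' refl (cong (a +_) N-1+1)
   go lp2 e (here q) with inj q
   ... | e' , refl , refl = tr2 e e' refl (cong (a +_) 1+N-1)
   go lp3 e (there (there ()))
   go lp4 e (there (there ()))

  fromTp : ∀ {a L s} -> tp (md N a) L s ∈ sliceT x st l -> Lifted (trip a (a + L))
  fromTp {a} {L} {s} p with ∈-++⁻ (leafTris x l) p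
  ... | inr q = ⊥-elim (no-tp x st q)
  ... | inl q = go l refl q where
   inj : ∀ {i L s j L' s'} -> tp i L s ≡ tp j L' s' -> i ≡ j × L ≡ L'
   inj refl = refl , refl
   go : ∀ l' -> l ≡ l' -> tp (md N a) L s ∈ leafTris x l' -> Lifted (trip a (a + L))
   go lp1 e (there ())
   go lp2 e (there ())
   go lp3 e (here q) with inj q
   ... | e' , refl = tpA (inl e) e' refl
   go lp3 e (there (here q)) with inj q
   ... | e' , refl = tpB (inl e) e' refl
   go lp4 e (here q) with inj q
   ... | e' , refl = tpA (inr e) e' refl
   go lp4 e (there (here q)) with inj q
   ... | e' , refl = tpB (inr e) e' refl

  lifted⁻ : ∀ {Δ} -> LiftTri Δ -> Lifted Δ
  lifted⁻ {tri a b c} h with tri⁻ h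
  ... | L , M , refl , refl , p = fromTr p
  lifted⁻ {trip a b} h with trip⁻ h
  ... | L , refl , inl (s , p) = fromTp p
  ... | L , refl , inr (refl , p , q) = go l refl (F.tct⁻ (to p)) (F.tct⁻ (to q)) where
   inj : ∀ {i s j r} -> tct i s ≡ tct j r -> i ≡ j
   inj refl = refl
   go : ∀ l' -> l ≡ l' -> tct (md N a) pl ∈ leafArcs x l' -> tct (md N a) nt ∈ leafArcs x l' -> Lifted (trip a (a + N))
   go lp1 e (here q) _ = tp1 e (inj q) refl
   go lp1 e (there (there ())) _
   go lp2 e (here q) _ = tp2 e (inj q) refl
   go lp2 e (there (there ())) _
   go lp3 e _ (there (there ()))
   go lp4 e (there (there ())) _

  lifted⁺ : ∀ {Δ} -> Lifted Δ -> LiftTri Δ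
  lifted⁺ (chain {a} {o = o} {L} {M} m e refl refl) = tri⁺ (subst (\ i -> tr i L M ∈ sliceT x st l) (sym e) (inT (subst (\ z -> tr (md N (x + o)) L M ∈ trisC z st) (+-identityʳ x) (triple-trisC x 0 st m))))
  lifted⁺ (tr1 {a} refl e refl refl) = subst (\ c -> LiftTri (tri a (a + N-1) c)) (cong (a +_) N-1+1) (tri⁺ {a} {N-1} {1} (here (cong (\ i -> tr i N-1 1) e)))
  lifted⁺ (tr2 {a} refl e refl refl) = subst (\ c -> LiftTri (tri a (a + 1) c)) (cong (a +_) 1+N-1) (tri⁺ {a} {1} {N-1} (here (cong (\ i -> tr i 1 N-1) e)))
  lifted⁺ (tp1 {a} refl e refl) = selfFolded⁺ {a} (from (F.tct⁺ (here (cong (\ i -> tct i pl) e)))) (from (F.tct⁺ (there (here (cong (\ i -> tct i nt) e)))))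
  lifted⁺ (tp2 {a} refl e refl) = selfFolded⁺ {a} (from (F.tct⁺ (here (cong (\ i -> tct i pl) e)))) (from (F.tct⁺ (there (here (cong (\ i -> tct i nt) e)))))
  lifted⁺ (tpA {a} (inl refl) e refl) = trip⁺ {a} (here (cong (\ i -> tp i N-1 pl) e))
  lifted⁺ (tpA {a} (inr refl) e refl) = trip⁺ {a} (here (cong (\ i -> tp i N-1 nt) e))
  lifted⁺ (tpB {a} (inl refl) e refl) = trip⁺ {a} (there (here (cong (\ i -> tp i 1 pl) e)))
  lifted⁺ (tpB {a} (inr refl) e refl) = trip⁺ {a} (there (here (cong (\ i -> tp i 1 nt) e)))

-- Matching numbers of non-central arcs.

puncture : ℤ²
puncture = 0ℤ , 1ℤ

module ChordCounts (N : ℕ) (3≤N : 3 ≤ N) where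
 open Lift N 3≤N public

 K : ℕ
 K = N-1

 K<N : K < N
 K<N = N-1<N

 K1 : K + 1 ≡ N
 K1 = N-1+1

 locate : ∀ {a c} -> md N a ≡ md N c -> a < c + N + N -> c < a + N -> a ≡ c ⊎ a ≡ c + N
 locate {a} {c} e h h' with a ≤? c
 ... | yes q = inl (md-window e q h')
 ... | no q with c + N ≤? a
 ... | yes r = inr (sym (md-window (trans (md-+N c) (sym e)) r h))
 ... | no r = ⊥-elim (<-irrefl (md-window (sym e) (<⇒≤ (≰⇒> q)) (≰⇒> r)) (≰⇒> q))

 module Counting {x : ℕ} {st : List Bool} {l : LastPair} {A : List TArc} (S : SliceLike x st l A) {T : List Arc} (und : Underlies A T) where
  open SliceLifts S und public
  open SW x st l (SliceLike.len S) public using (W; W-next; W-at; W-base; W-top; W-rec; level; K≡; weights)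

  module Core {b : ℕ} (eb : md N b ≡ md N x) where
   private
    l₁ : ∀ k -> 1ℤ +Z k *Z 1ℤ ≡ 0ℤ +Z k *Z 1ℤ +Z 1ℤ
    l₁ = solve-∀
    l₂ : ∀ k -> 0ℤ +Z k *Z 1ℤ +Z pos 2 *Z 1ℤ ≡ 1ℤ +Z k *Z 1ℤ +Z 1ℤ
    l₂ = solve-∀
    l₃ : ∀ k -> 0ℤ +Z k *Z 1ℤ +Z 1ℤ *Z 1ℤ ≡ 0ℤ +Z k *Z 1ℤ +Z 1ℤ
    l₃ = solve-∀
    l₄ : ∀ k -> 1ℤ +Z k *Z pos 2 ≡ 0ℤ +Z k *Z 1ℤ +Z (0ℤ +Z k *Z 1ℤ +Z 1ℤ *Z 1ℤ)
    l₄ = solve-∀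
   -- With (0, 1) as the weight of the puncture this is an ear relation: the triangle at the
   -- puncture has its tip at the far end of the longest chord.
   two-top : Two l -> W (b + K) ≡ W b ⊕ puncture
   two-top (inl refl) = trans (W-top eb) (trans (cong (1ℤ ,_) (l₁ (level b))) (cong (_⊕ puncture) (sym (W-base eb))))
   two-top (inr refl) = trans (W-top eb) (trans (cong (1ℤ ,_) (l₁ (level b))) (cong (_⊕ puncture) (sym (W-base eb))))
   two-next : Two l -> W (b + N) ≡ W (b + K) ⊕ puncture
   two-next (inl refl) = trans (W-next b) (trans (cong (shear (pos 2)) (W-base eb)) (trans (cong (1ℤ ,_) (l₂ (level b))) (cong (_⊕ puncture) (sym (W-top eb)))))
   two-next (inr refl) = trans (W-next b) (trans (cong (shear (pos 2)) (W-base eb)) (trans (cong (1ℤ ,_) (l₂ (level b))) (cong (_⊕ puncture) (sym (W-top eb)))))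
   two-ray : Two l -> fst (W b) ≡ 1ℤ
   two-ray (inl refl) = cong fst (W-base eb)
   two-ray (inr refl) = cong fst (W-base eb)
   two-ray' : Two l -> fst (W (b + K)) ≡ 1ℤ
   two-ray' t = trans (cong fst (two-top t)) (trans (ℤₚ.+-identityʳ _) (two-ray t))
   one-next : l ≡ lp1 -> W (b + N) ≡ W b ⊕ puncture
   one-next refl = trans (W-next b) (trans (cong (shear 1ℤ) (W-base eb)) (trans (cong (1ℤ ,_) (l₃ (level b))) (cong (_⊕ puncture) (sym (W-base eb)))))
   one-top : l ≡ lp1 -> W (b + K) ≡ W b ⊕ W (b + N)
   one-top refl = trans (W-top eb) (trans (cong (pos 2 ,_) (l₄ (level b))) (sym (cong₂ _⊕_ (W-base eb) (trans (W-next b) (cong (shear 1ℤ) (W-base eb))))))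
   one-ray : l ≡ lp1 -> fst (W b) ≡ 1ℤ
   one-ray refl = cong fst (W-base eb)
   one-ray' : l ≡ lp1 -> fst (W (b + K)) ≡ pos 2
   one-ray' refl = cong fst (W-top eb)
   fan-ray : l ≡ lp2 -> fst (W (b + K)) ≡ 1ℤ
   fan-ray refl = cong fst (W-top eb)
   fan-ray' : l ≡ lp2 -> fst (W b) ≡ pos 2
   fan-ray' refl = cong fst (W-base eb)
   module Prev {p : ℕ} (ep : p + 1 ≡ b) where
    top≡ = trans (cong (_+ K) (sym ep)) (trans (+-assoc p 1 K) (cong (p +_) 1+N-1))
    prev-ray : l ≡ lp2 -> fst (W p) ≡ 1ℤ
    prev-ray refl = trans (cong fst (sym (W-next p))) (trans (cong (\ y -> fst (W y)) (sym top≡)) (cong fst (W-top eb)))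
    fan-top : l ≡ lp2 -> W (b + K) ≡ W p ⊕ puncture
    fan-top refl = trans (cong W top≡) (trans (W-next p) (go (W p) (prev-ray refl))) where
     go : ∀ v -> fst v ≡ 1ℤ -> shear 1ℤ v ≡ v ⊕ puncture
     go (r , h) refl = cong (1ℤ ,_) refl
    fan-base : l ≡ lp2 -> W b ≡ W p ⊕ W (b + K)
    -- p precedes b and may lie in an earlier turn. Its weight is recovered from its image one turn
    -- later, which is the other end of the longest chord at b.
    fan-base refl = trans (W-base eb) (trans (go (W p) (level b) (prev-ray refl) (trans (sym (W-next p)) (trans (cong W (sym top≡)) (W-top eb)))) (cong (W p ⊕_) (sym (W-top eb)))) where
     go : ∀ v k -> fst v ≡ 1ℤ -> shear 1ℤ v ≡ shear k (1ℤ , 0ℤ) -> shear k (pos 2 , -1ℤ) ≡ v ⊕ shear k (1ℤ , 0ℤ)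
     go (r , h) k refl e = cong (pos 2 ,_) (trans (lemma k) (cong (_+Z (0ℤ +Z k *Z 1ℤ)) (sym (trans (lemma₂ h) (cong (_-Z 1ℤ) (cong snd e)))))) where
      lemma : ∀ k -> -1ℤ +Z k *Z pos 2 ≡ 0ℤ +Z k *Z 1ℤ -Z 1ℤ +Z (0ℤ +Z k *Z 1ℤ)
      lemma = solve-∀
      lemma₂ : ∀ h -> h ≡ h +Z 1ℤ *Z 1ℤ -Z 1ℤ
      lemma₂ = solve-∀

  one-not-two : Two l -> l ≢ lp1
  one-not-two (inl refl) ()
  one-not-two (inr refl) ()

  fan-not-two : Two l -> l ≢ lp2
  fan-not-two (inl refl) ()
  fan-not-two (inr refl) ()

  -- The counted window starts at n = b + d with b over x and d < N, so it ends within two turns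
  -- after b. With twins at x - 1 a triangle straddles b, hence the predecessor p. B lies three
  -- turns after b, beyond every position used.
  module Noncentral {p d L : ℕ} (eb : md N (p + 1) ≡ md N x) (d<N : d < N) (2≤L : 2 ≤ L) (L<N : L < N) where
   b = p + 1
   n = b + d
   B = b + (N + N + N)
   w : ℕ -> ℤ²
   w v = if v ≡ᵇ B then puncture else W v
   wW : ∀ {v} -> v < B -> w v ≡ W v
   wW {v} h = cong (if_then puncture else W v) (≢⇒≡ᵇ≡ (<⇒≢ h))
   wB = cong (if_then puncture else W B) (≡⇒≡ᵇ≡ {B} refl)
   step⊕ : ∀ {x y z} -> x < B -> y < B -> z < B -> W y ≡ W x ⊕ W z -> w y ≡ w x ⊕ w z
   step⊕ a b c e = trans (wW b) (trans e (sym (cong₂ _⊕_ (wW a) (wW c))))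
   stepB : ∀ {x y} -> x < B -> y < B -> W y ≡ W x ⊕ puncture -> w y ≡ w x ⊕ w B
   stepB a b e = trans (wW b) (trans e (sym (cong₂ _⊕_ (wW a) wB)))
   det-puncture : ∀ u -> det u puncture ≡ fst u
   det-puncture (a , h) = lemma a h where
    lemma : ∀ a h -> a *Z 1ℤ -Z h *Z 0ℤ ≡ a
    lemma = solve-∀
   baseB : ∀ {x} -> x < B -> fst (W x) ≡ 1ℤ -> Poly w B (x ∷ B ∷ []) []
   baseB {x} h e = poly-base h (trans (cong₂ det (wW h) wB) (trans (det-puncture (W x)) e))
   eb' = trans (md-+N b) eb
   chainAt : ℕ -> LTri -> Set
   chainAt c = PolyChain.ChainAt w B c K st
   K≤N : K ≤ N
   K≤N = <⇒≤ K<N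
   rec : ∀ {c} -> c ≤ b + N -> md N c ≡ md N x -> ∀ {o L M} -> (o , L , M) ∈ trisO 0 st -> w (c + (o + L)) ≡ w (c + o) ⊕ w (c + (o + (L + M)))
   rec {c} h e {o} {L} {M} p = step⊕ (under (≤-trans (m≤m+n o (L + M)) hi)) (under (≤-trans (+-monoʳ-≤ o (m≤m+n L M)) hi)) (under hi) (W-rec e p) where
    hi : o + (L + M) ≤ K
    hi = subst (o + (L + M) ≤_) K≡ (snd (snd (snd (trisO-bounds 0 st p))))
    under : ∀ {t} -> t ≤ K -> c + t < B
    under {t} q = lia 5 (\ b N K c t -> (c :≤ b :+ N) ∷ (t :≤ K) ∷ (K :< N) ∷ [] ⊢ c :+ t :< b :+ (N :+ N :+ N)) b N K c t h q K<N
   Gap : List ℕ -> Set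
   Gap V = ∀ {v} -> v ∈ V -> (v ≤ b ⊎ b + K ≤ v) × (v ≤ b + N ⊎ b + N + K ≤ v)
   block : ∀ {V c} -> c ∈ V -> c + K ∈ V -> (∀ {t} -> 0 < t -> t < K -> c + t ∈ V) -> ∀ t -> t < N -> c + t ∈ V
   block {V} {c} c∈ q∈ f zero h = subst (_∈ V) (sym (+-identityʳ c)) c∈
   block {V} {c} c∈ q∈ f (suc t) h with m≤n⇒m<n∨m≡n (≤-pred (subst (suc (suc t) ≤_) (sym 1+N-1) h))
   ... | inl r = f (s≤s z≤n) r
   ... | inr e = subst (\ k -> c + k ∈ V) (sym e) q∈
   covers : ∀ {V} -> b ∈ V -> b + K ∈ V -> b + N ∈ V -> b + N + K ∈ V -> (∀ {t} -> 0 < t -> t < K -> b + t ∈ V) -> (∀ {t} -> 0 < t -> t < K -> b + N + t ∈ V) -> ∀ {v} -> b ≤ v -> v < b + (N + N) -> v ∈ V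
   covers {V} b∈ q∈ b'∈ q'∈ in₁ in₂ {v} h h' with m≤n⇒∃[o]m+o≡n h
   ... | t , refl with t <? N
   ... | yes t<N = block b∈ q∈ in₁ t t<N
   ... | no t≥N with m≤n⇒∃[o]m+o≡n (≮⇒≥ t≥N)
   ... | u , refl = subst (_∈ V) (+-assoc b N u) (block b'∈ q'∈ in₂ u (lia 3 (\ b N u -> (b :+ (N :+ u) :< b :+ (N :+ N)) ∷ [] ⊢ u :< N) b N u h'))
   TwoFilled : List LTri -> Set
   TwoFilled T₀ = ∃[ V ] ∃[ Ts ] Poly w B V Ts × (∀ {v} -> b ≤ v -> v < b + (N + N) -> v ∈ V) × (∀ {Δ} -> Δ ∈ Ts -> Δ ∈ T₀ ⊎ chainAt b Δ ⊎ chainAt (b + N) Δ) × (∀ {Δ} -> Δ ∈ T₀ ⊎ chainAt b Δ ⊎ chainAt (b + N) Δ -> Δ ∈ Ts)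
   -- The window may reach into a second turn, so the chain is filled in twice, at b and at b + N.
   two-fills : ∀ {V₀ T₀} -> Poly w B V₀ T₀ -> b ∈ V₀ -> b + K ∈ V₀ -> b + N ∈ V₀ -> b + N + K ∈ V₀ -> Gap V₀ -> TwoFilled T₀
   two-fills {V₀} {T₀} P b∈ q∈ b'∈ q'∈ gap = first (PolyChain.fill w B b K st K≡ (rec (m≤m+n b N) eb) b∈ q∈ (\ p -> fst (gap p)) P) where
    first : PolyChain.Filled w B b K st V₀ T₀ -> TwoFilled T₀
    first (V₁ , T₁ , P₁ , _ , v⁻ , v⁺ , vin , t⁻ , t⁺ , tin) = second (PolyChain.fill w B (b + N) K st K≡ (rec ≤-refl eb') (v⁺ b'∈) (v⁺ q'∈) (\ p -> gap₂ (v⁻ p)) P₁) where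
     gap₂ : ∀ {v} -> v ∈ V₀ ⊎ (∃[ t ] 0 < t × t < K × v ≡ b + t) -> v ≤ b + N ⊎ b + N + K ≤ v
     gap₂ (inl q) = snd (gap q)
     gap₂ (inr (t , _ , h , refl)) = inl (+-monoʳ-≤ b (≤-trans (<⇒≤ h) K≤N))
     second : PolyChain.Filled w B (b + N) K st V₁ T₁ -> TwoFilled T₀
     second (V₂ , T₂ , P₂ , _ , w⁻ , w⁺ , win , s⁻ , s⁺ , sin) = V₂ , T₂ , P₂ , covers (w⁺ (v⁺ b∈)) (w⁺ (v⁺ q∈)) (w⁺ (v⁺ b'∈)) (w⁺ (v⁺ q'∈)) (\ a c -> w⁺ (vin a c)) win , (\ p -> down (s⁻ p)) , upw where
      down₁ : ∀ {Δ} -> Δ ∈ T₀ ⊎ chainAt b Δ -> Δ ∈ T₀ ⊎ chainAt b Δ ⊎ chainAt (b + N) Δ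
      down₁ (inl r) = inl r
      down₁ (inr r) = inr (inl r)
      down : ∀ {Δ} -> Δ ∈ T₁ ⊎ chainAt (b + N) Δ -> Δ ∈ T₀ ⊎ chainAt b Δ ⊎ chainAt (b + N) Δ
      down (inl q) = down₁ (t⁻ q)
      down (inr q) = inr (inr q)
      upw : ∀ {Δ} -> Δ ∈ T₀ ⊎ chainAt b Δ ⊎ chainAt (b + N) Δ -> Δ ∈ T₂
      upw (inl p) = s⁺ (t⁺ p)
      upw (inr (inl p)) = s⁺ (tin p)
      upw (inr (inr p)) = sin p
   Visible : LTri -> Set
   Visible Δ = ∃[ v ] v ∈ verts Δ × n < v × v < n + L
   chain-lifted : ∀ {c Δ} -> md N c ≡ md N x -> chainAt c Δ -> Lifted Δ
   chain-lifted {c} e (o , L , M , p , refl) = chain p (md-cong o e) (sym (+-assoc c o L)) (sym (+-assoc c o (L + M)))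
   vis-lo : ∀ {Δ v} -> Lifted Δ -> v ∈ verts Δ -> start Δ ≤ v
   vis-lo {tri a b c} h p with lifted⁺ h | p
   ... | a<b , b<c , _ | 0th = ≤-refl
   ... | a<b , b<c , _ | 1st = <⇒≤ a<b
   ... | a<b , b<c , _ | 2nd = <⇒≤ (<-trans a<b b<c)
   vis-lo {trip a b} h p with lifted⁺ h | p
   ... | a<b , _ | 0th = ≤-refl
   ... | a<b , _ | 1st = <⇒≤ a<b
   vis-hi : ∀ {Δ v} -> Lifted Δ -> v ∈ verts Δ -> v ≤ start Δ + N
   vis-hi {tri a b c} h p with lifted⁺ h | p
   ... | a<b , b<c , c≤ , _ | 0th = m≤m+n a N
   ... | a<b , b<c , c≤ , _ | 1st = ≤-trans (<⇒≤ b<c) c≤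
   ... | a<b , b<c , c≤ , _ | 2nd = c≤
   vis-hi {trip a b} h p with lifted⁺ h | p
   ... | a<b , b≤ , _ | 0th = m≤m+n a N
   ... | a<b , b≤ , _ | 1st = b≤
   n+L< : n + L < b + (N + N)
   n+L< = lia 4 (\ b d L N -> (d :< N) ∷ (L :< N) ∷ [] ⊢ b :+ d :+ L :< b :+ (N :+ N)) b d L N d<N L<N
   visible-chain : ∀ {a o L M} -> (o , L , M) ∈ trisO 0 st -> md N a ≡ md N (x + o) -> Visible (tri a (a + L) (a + (L + M))) -> chainAt b (tri a (a + L) (a + (L + M))) ⊎ chainAt (b + N) (tri a (a + L) (a + (L + M)))
   visible-chain {a} {o} {L'} {M} p e (v , v∈ , n<v , v<) with locate {a} {b + o} (trans e (sym (md-cong o eb))) lo hi where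
    oLM : o + (L' + M) ≤ K
    oLM = subst (o + (L' + M) ≤_) K≡ (snd (snd (snd (trisO-bounds 0 st p))))
    a≤v : a ≤ v
    a≤v = vis-lo (chain p e refl refl) v∈
    v≤ : v ≤ a + (L' + M)
    v≤ with three v∈
    ... | inl refl = m≤m+n a _
    ... | inr (inl refl) = +-monoʳ-≤ a (m≤m+n L' M)
    ... | inr (inr refl) = ≤-refl
    lo : a < b + o + N + N
    lo = lia 6 (\ a v s b o N -> (a :≤ v) ∷ (v :< s) ∷ (s :< b :+ (N :+ N)) ∷ [] ⊢ a :< b :+ o :+ N :+ N) a v (n + L) b o N a≤v v< n+L<
    hi : b + o < a + N
    hi = lia 8 (\ b d o v a s K N -> (b :+ d :< v) ∷ (v :≤ a :+ s) ∷ (o :+ s :≤ K) ∷ (K :< N) ∷ [] ⊢ b :+ o :< a :+ N) b d o v a (L' + M) K N n<v v≤ oLM K<N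
   ... | inl refl = inl (o , L' , M , p , cong₂ (tri (b + o)) (+-assoc b o L') (+-assoc b o (L' + M)))
   ... | inr refl = inr (o , L' , M , p , eq) where
    sh : ∀ t -> b + o + N + t ≡ b + N + (o + t)
    sh t = lia 4 (\ b o N t -> [] ⊢ b :+ o :+ N :+ t :≡ b :+ N :+ (o :+ t)) b o N t
    eq = trans (cong₂ (tri (b + o + N)) (sh L') (sh (L' + M))) (cong (\ a -> tri a (b + N + (o + L')) (b + N + (o + (L' + M)))) (m+n+o≡m+o+n b o N))
   pts : List ℕ
   pts = range (suc n) (n + L ∸ 1)
   regs : List LTri
   regs = filterᵇ (\ Δ -> any (\ v -> (n <ᵇ v) ∧ (v <ᵇ n + L)) (verts Δ)) (trisIn N T (suc n ∸ N) (n + L ∸ 1))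
   1≤n+L = ≤-trans (≤-trans (s≤s z≤n) 2≤L) (m≤n+m L n)
   under-end : ∀ {v} -> v < n + L -> v ≤ n + L ∸ 1
   under-end {v} h = ≤-pred (subst (v <_) (sym (m+[n∸m]≡n 1≤n+L)) h)
   under-end⁻ : ∀ {v} -> v ≤ n + L ∸ 1 -> v < n + L
   under-end⁻ {v} h = subst (v <_) (m+[n∸m]≡n 1≤n+L) (s≤s h)
   regs⁻ : ∀ {Δ} -> Δ ∈ regs -> LiftTri Δ
   regs⁻ {Δ} p = snd (snd (∈-trisIn⁻ {suc n ∸ N} {n + L ∸ 1} {Δ} (fst (∈-filterᵇ⁻ (\ Δ -> any (\ v -> (n <ᵇ v) ∧ (v <ᵇ n + L)) (verts Δ)) {Δ} {trisIn N T (suc n ∸ N) (n + L ∸ 1)} p))))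
   regs⁺ : ∀ {Δ} -> Lifted Δ -> Visible Δ -> Δ ∈ regs
   regs⁺ {Δ} lf (v , v∈ , a , c) = ∈-filterᵇ⁺ (\ Δ -> any (\ v -> (n <ᵇ v) ∧ (v <ᵇ n + L)) (verts Δ)) {Δ} {trisIn N T (suc n ∸ N) (n + L ∸ 1)}
    (∈-trisIn⁺ {suc n ∸ N} {n + L ∸ 1} {Δ} (m≤n+o⇒m∸n≤o (suc n) N (≤-trans a (subst (v ≤_) (+-comm (start Δ) N) (vis-hi lf v∈)))) (≤-trans (vis-lo lf v∈) (under-end c)) (lifted⁺ lf)) (any⁺ {f = \ v -> (n <ᵇ v) ∧ (v <ᵇ n + L)} {x = v} {xs = verts Δ} v∈ (∧⁺ (<⇒<ᵇ≡ a) (<⇒<ᵇ≡ c)))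
   Unique-regs = Unique-filterᵇ (\ Δ -> any (\ v -> (n <ᵇ v) ∧ (v <ᵇ n + L)) (verts Δ)) {trisIn N T (suc n ∸ N) (n + L ∸ 1)} (Unique-trisIn (suc n ∸ N) (n + L ∸ 1))
   count : ∀ {V Ts} ps R -> Unique ps -> Unique R -> (∀ {v} -> v ∈ ps -> n < v × v < n + L) -> (∀ {v} -> n < v -> v < n + L -> v ∈ ps) -> (∀ {Δ} -> Δ ∈ R -> LiftTri Δ) -> (∀ {Δ} -> Lifted Δ -> Visible Δ -> Δ ∈ R) -> Poly w B V Ts -> (∀ {v} -> b ≤ v -> v < b + (N + N) -> v ∈ V) ->
    (∀ {Δ} -> Δ ∈ Ts -> Lifted Δ) -> (∀ {Δ} -> Lifted Δ -> Visible Δ -> Δ ∈ Ts) -> pos (countMatch incPos ps R) ≡ det (W n) (W (n + L))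
   count {V} {Ts} ps R ups uR ps⁻ ps⁺ R⁻ R⁺ P cover lifts cmp = trans (cong pos (M-cong incPos {ps} {ps} ↭-refl uR (Poly.uq P) (\ {Δ} p t -> cmp (lifted⁻ (R⁻ p)) (visible Δ (any⁻ (\ p -> incPos p Δ) ps t))) (\ {Δ} p t -> R⁺ (lifts p) (visible Δ (any⁻ (\ p -> incPos p Δ) ps t)))))
    (trans (Poly.btw P n∈ nL∈ n<nL ps (ups , (\ p -> cover (≤-trans b≤n (<⇒≤ (fst (ps⁻ p)))) (<-trans (snd (ps⁻ p)) n+L<) , ps⁻ p) , \ _ a c -> ps⁺ a c)) (cong₂ det (wW (n<B (<-trans n<nL n+L<))) (wW (n<B n+L<)))) where
    n<nL : n < n + L
    n<nL = lia 2 (\ n L -> (# 2 :≤ L) ∷ [] ⊢ n :< n :+ L) n L 2≤L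
    b≤n : b ≤ n
    b≤n = m≤m+n b d
    n∈ : n ∈ V
    n∈ = cover b≤n (<-trans n<nL n+L<)
    nL∈ = cover (≤-trans b≤n (<⇒≤ n<nL)) n+L<
    n<B : ∀ {v} -> v < b + (N + N) -> v < B
    n<B {v} h = lia 3 (\ v b N -> (v :< b :+ (N :+ N)) ∷ [] ⊢ v :< b :+ (N :+ N :+ N)) v b N h
    visible : ∀ Δ -> ∃[ v ] v ∈ ps × incPos v Δ ≡ true -> Visible Δ
    visible Δ (v , p , q) = v , incPos⁻ Δ q , ps⁻ p
   Covering : Set
   Covering = ∃[ V ] ∃[ Ts ] Poly w B V Ts × (∀ {v} -> b ≤ v -> v < b + (N + N) -> v ∈ V) × (∀ {Δ} -> Δ ∈ Ts -> Lifted Δ) × (∀ {Δ} -> Lifted Δ -> Visible Δ -> Δ ∈ Ts)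
   counted : Covering -> pos (countMatch incPos pts regs) ≡ det (W n) (W (n + L))
   counted (V , Ts , P , cover , lifts , cmp) = count pts regs (Unique-range (suc n) (n + L ∸ 1)) Unique-regs (\ p -> fst (∈-range⁻ {suc n} {n + L ∸ 1} p) , under-end⁻ (snd (∈-range⁻ {suc n} {n + L ∸ 1} p))) (\ a c -> ∈-range⁺ a (under-end c)) regs⁻ regs⁺ P cover lifts cmp
   <B : ∀ {v} -> v ≤ b + N + N -> v < B
   <B {v} h = lia 3 (\ v b N -> (v :≤ b :+ N :+ N) ∷ (# 0 :< N) ∷ [] ⊢ v :< b :+ (N :+ N :+ N)) v b N h N>0
   b≤ : b ≤ b + N + N
   b≤ = lia 2 (\ b N -> [] ⊢ b :≤ b :+ N :+ N) b N
   q≤ : b + K ≤ b + N + N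
   q≤ = lia 3 (\ b K N -> (K :< N) ∷ [] ⊢ b :+ K :≤ b :+ N :+ N) b K N K<N
   b'≤ = m≤m+n (b + N) N
   q'≤ = +-monoʳ-≤ (b + N) K≤N
   0<K : 0 < K
   0<K = ≤-trans (s≤s z≤n) 2≤N-1
   b<q : b < b + K
   b<q = m<m+n b 0<K
   q<b' = +-monoʳ-< b K<N
   b'<q' : b + N < b + N + K
   b'<q' = m<m+n (b + N) 0<K
   q'<b'' = +-monoʳ-< (b + N) K<N
   B≥q = <⇒≤ (<B q≤)
   B≥q' = <⇒≤ (<B q'≤)
   eq' : ∀ {c} -> md N c ≡ md N x -> md N (c + K) ≡ md N (x + K)
   eq' e = md-cong K e
   covering-two : Two l -> Covering
   covering-two t = finish (two-fills P₃ 3rd 2nd 1st 0th gap) where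
    T₀ = trip (b + N) (b + N + K) ∷ trip (b + K) (b + N) ∷ trip b (b + K) ∷ []
    -- The points b, b + K, b + N and b + N + K enter in this order, each new one as the tip of an
    -- ear between its predecessor and the puncture.
    P₀ = baseB (<B b≤) (Core.two-ray eb t)
    P₁ = poly-trip P₀ 0th 1st b<q (<B q≤) (\ { 0th -> inl ≤-refl ; 1st -> inr ≤-refl }) (stepB (<B b≤) (<B q≤) (Core.two-top eb t))
    P₂ = poly-trip P₁ 0th 2nd q<b' (<B b'≤) (\ { 0th -> inl ≤-refl ; 1st -> inl (<⇒≤ b<q) ; 2nd -> inr ≤-refl }) (stepB (<B q≤) (<B b'≤) (Core.two-next eb t))
    P₃ = poly-trip P₂ 0th 3rd b'<q' (<B q'≤) (\ { 0th -> inl ≤-refl ; 1st -> inl (<⇒≤ q<b') ; 2nd -> inl (<⇒≤ (<-trans b<q q<b')) ; 3rd -> inr ≤-refl }) (stepB (<B b'≤) (<B q'≤) (Core.two-top eb' t))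
    gap : Gap (b + N + K ∷ b + N ∷ b + K ∷ b ∷ B ∷ [])
    gap 0th = inr (<⇒≤ (<-trans q<b' b'<q')) , inr ≤-refl
    gap 1st = inr (<⇒≤ q<b') , inl ≤-refl
    gap 2nd = inr ≤-refl , inl (<⇒≤ q<b')
    gap 3rd = inl ≤-refl , inl (<⇒≤ (<-trans b<q q<b'))
    gap 4th = inr B≥q , inr B≥q'
    core-lifted : ∀ {Δ} -> Δ ∈ T₀ -> Lifted Δ
    core-lifted 0th = tpA t eb' refl
    core-lifted 1st = tpB t (eq' eb) (trans (cong (b +_) (sym K1)) (sym (+-assoc b K 1)))
    core-lifted 2nd = tpA t eb refl
    visA : ∀ {a} -> md N a ≡ md N x -> Visible (trip a (a + K)) -> trip a (a + K) ∈ T₀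
    visA {a} e (v , v∈ , n<v , v<) with locate {a} {b} (trans e (sym eb)) lo hi where
     lf = tpA t e refl
     lo : a < b + N + N
     lo = lia 4 (\ a v s y -> (a :≤ v) ∷ (v :< s) ∷ (s :< y) ∷ [] ⊢ a :< y) a v (n + L) (b + N + N) (vis-lo lf v∈) v< (subst (n + L <_) (sym (+-assoc b N N)) n+L<)
     hi : b < a + N
     hi = lia 5 (\ b d v a N -> (b :+ d :< v) ∷ (v :≤ a :+ N) ∷ [] ⊢ b :< a :+ N) b d v a N n<v (vis-hi lf v∈)
    ... | inl refl = 2nd
    ... | inr refl = 0th
    visB : ∀ {a} -> md N a ≡ md N (x + K) -> Visible (trip a (a + 1)) -> trip a (a + 1) ∈ T₀
    visB {a} e (v , v∈ , n<v , v<) = there (here (cong₂ trip a≡ (trans (cong (_+ 1) a≡) (trans (+-assoc b K 1) (cong (b +_) K1))))) where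
     lf = tpB t e refl
     v≤ = case2 v∈ where
      case2 : v ∈ a ∷ a + 1 ∷ [] -> v ≤ a + 1
      case2 0th = m≤m+n a 1
      case2 1st = ≤-refl
     b≤a : b ≤ a
     b≤a = lia 4 (\ b d v a -> (b :+ d :< v) ∷ (v :≤ a :+ # 1) ∷ [] ⊢ b :≤ a) b d v a n<v v≤
     a< : a < b + K + N
     a< = lia 7 (\ a v b d L K N -> (a :≤ v) ∷ (v :< b :+ d :+ L) ∷ (d :< N) ∷ (L :< N) ∷ (K :+ # 1 :≡ N) ∷ [] ⊢ a :< b :+ K :+ N) a v b d L K N (vis-lo lf v∈) v< d<N L<N K1
     res≡ = trans e (sym (eq' eb))
     a≡ : a ≡ b + K
     a≡ with a ≤? b + K
     ... | yes h = md-window res≡ h (lia 4 (\ b K a N -> (b :≤ a) ∷ (K :< N) ∷ [] ⊢ b :+ K :< a :+ N) b K a N b≤a K<N)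
     ... | no h = sym (md-window (sym res≡) (<⇒≤ (≰⇒> h)) a<)
    finish : TwoFilled T₀ -> Covering
    finish (V , Ts , P , cover , down , upw) = V , Ts , P , cover , (\ p -> lifts (down p)) , \ lf vis -> upw (cmp lf vis) where
     lifts : ∀ {Δ} -> Δ ∈ T₀ ⊎ chainAt b Δ ⊎ chainAt (b + N) Δ -> Lifted Δ
     lifts (inl p) = core-lifted p
     lifts (inr (inl p)) = chain-lifted eb p
     lifts (inr (inr p)) = chain-lifted eb' p
     cmp : ∀ {Δ} -> Lifted Δ -> Visible Δ -> Δ ∈ T₀ ⊎ chainAt b Δ ⊎ chainAt (b + N) Δ
     cmp (chain p e refl refl) vis = inr (visible-chain p e vis)
     cmp (tpA _ e refl) vis = inl (visA e vis)
     cmp (tpB _ e refl) vis = inl (visB e vis)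
     cmp (tr1 q _ _ _) vis = ⊥-elim (one-not-two t q)
     cmp (tp1 q _ _) vis = ⊥-elim (one-not-two t q)
     cmp (tr2 q _ _ _) vis = ⊥-elim (fan-not-two t q)
     cmp (tp2 q _ _) vis = ⊥-elim (fan-not-two t q)
   locate-base : ∀ {a c Δ} -> Lifted Δ -> start Δ ≡ a -> md N a ≡ md N c -> c ≤ b -> b + (N + N) ≤ c + N + N + 1 -> Visible Δ -> a ≡ c ⊎ a ≡ c + N
   locate-base {a} {c} lf refl e c≤b b≤c (v , v∈ , n<v , v<) = locate e (lia 6 (\ a v b d L c+ -> (a :≤ v) ∷ (v :< b :+ d :+ L) ∷ (b :+ d :+ L :< c+) ∷ [] ⊢ a :< c+) a v b d L (c + N + N) (vis-lo lf v∈) v< far)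
    (lia 5 (\ c b d v aN -> (c :≤ b) ∷ (b :+ d :< v) ∷ (v :≤ aN) ∷ [] ⊢ c :< aN) c b d v (a + N) c≤b n<v (vis-hi lf v∈)) where
    far : b + d + L < c + N + N
    far = lia 5 (\ b d L c N -> (d :< N) ∷ (L :< N) ∷ (b :+ (N :+ N) :≤ c :+ N :+ N :+ # 1) ∷ [] ⊢ b :+ d :+ L :< c :+ N :+ N) b d L c N d<N L<N b≤c
   covering-one : l ≡ lp1 -> Covering
   covering-one refl = finish (two-fills P₄ 4th 1st 3rd 0th gap) where
    T₀ = tri (b + N) (b + N + K) (b + N + N) ∷ tri b (b + K) (b + N) ∷ trip (b + N) (b + N + N) ∷ trip b (b + N) ∷ []
    b<b' = <-trans b<q q<b'
    b'<b'' = <-trans b'<q' q'<b''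
    -- The lifts b, b + N and b + N + N of the base of the twins come first, over self-folded
    -- triangles; then each longest chord adds its far end between two of them.
    P₀ = baseB (<B b≤) (Core.one-ray eb refl)
    P₁ = poly-trip P₀ 0th 1st b<b' (<B b'≤) (\ { 0th -> inl ≤-refl ; 1st -> inr ≤-refl }) (stepB (<B b≤) (<B b'≤) (Core.one-next eb refl))
    P₂ = poly-trip P₁ 0th 2nd b'<b'' (<B ≤-refl) (\ { 0th -> inl ≤-refl ; 1st -> inl (<⇒≤ b<b') ; 2nd -> inr ≤-refl }) (stepB (<B b'≤) (<B ≤-refl) (Core.one-next eb' refl))
    P₃ = poly-tri P₂ 2nd 1st b<q q<b' (\ { 0th -> inr (<⇒≤ b'<b'') ; 1st -> inr ≤-refl ; 2nd -> inl ≤-refl ; 3rd -> inr (<⇒≤ (<B b'≤)) }) (step⊕ (<B b≤) (<B q≤) (<B b'≤) (Core.one-top eb refl))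
    P₄ = poly-tri P₃ 2nd 1st b'<q' q'<b'' (\ { 0th -> inl (<⇒≤ q<b') ; 1st -> inr ≤-refl ; 2nd -> inl ≤-refl ; 3rd -> inl (<⇒≤ b<b') ; 4th -> inr (<⇒≤ (<B ≤-refl)) }) (step⊕ (<B b'≤) (<B q'≤) (<B ≤-refl) (Core.one-top eb' refl))
    gap : Gap (b + N + K ∷ b + K ∷ b + N + N ∷ b + N ∷ b ∷ B ∷ [])
    gap 0th = inr (<⇒≤ (<-trans q<b' b'<q')) , inr ≤-refl
    gap 1st = inr ≤-refl , inl (<⇒≤ q<b')
    gap 2nd = inr (<⇒≤ (<-trans q<b' b'<b'')) , inr (<⇒≤ q'<b'')
    gap 3rd = inr (<⇒≤ q<b') , inl ≤-refl
    gap 4th = inl ≤-refl , inl (<⇒≤ b<b')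
    gap (there 4th) = inr B≥q , inr B≥q'
    core-lifted : ∀ {Δ} -> Δ ∈ T₀ -> Lifted Δ
    core-lifted 0th = tr1 refl eb' refl refl
    core-lifted 1st = tr1 refl eb refl refl
    core-lifted 2nd = tp1 refl eb' refl
    core-lifted 3rd = tp1 refl eb refl
    far : b + (N + N) ≤ b + N + N + 1
    far = lia 2 (\ b N -> [] ⊢ b :+ (N :+ N) :≤ b :+ N :+ N :+ # 1) b N
    finish : TwoFilled T₀ -> Covering
    finish (V , Ts , P , cover , down , upw) = V , Ts , P , cover , (\ p -> lifts (down p)) , \ lf vis -> upw (cmp lf vis) where
     lifts : ∀ {Δ} -> Δ ∈ T₀ ⊎ chainAt b Δ ⊎ chainAt (b + N) Δ -> Lifted Δ
     lifts (inl p) = core-lifted p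
     lifts (inr (inl p)) = chain-lifted eb p
     lifts (inr (inr p)) = chain-lifted eb' p
     cmp : ∀ {Δ} -> Lifted Δ -> Visible Δ -> Δ ∈ T₀ ⊎ chainAt b Δ ⊎ chainAt (b + N) Δ
     cmp (chain p e refl refl) vis = inr (visible-chain p e vis)
     cmp (tr1 q e refl refl) vis with locate-base (tr1 q e refl refl) refl (trans e (sym eb)) ≤-refl far vis
     ... | inl refl = inl 1st
     ... | inr refl = inl 0th
     cmp (tp1 q e refl) vis with locate-base (tp1 q e refl) refl (trans e (sym eb)) ≤-refl far vis
     ... | inl refl = inl 3rd
     ... | inr refl = inl 2nd
     cmp (tpA (inl ()) _ _) vis
     cmp (tpA (inr ()) _ _) vis
     cmp (tpB (inl ()) _ _) vis
     cmp (tpB (inr ()) _ _) vis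
   covering-fan : l ≡ lp2 -> Covering
   covering-fan refl = finish (two-fills P₄ 1st 3rd 0th 2nd gap) where
    q≡ = Core.Prev.top≡ eb {p} refl
    q'≡ : b + N + K ≡ b + K + N
    q'≡ = m+n+o≡m+o+n b N K
    b'≡ = trans (+-assoc b K 1) (cong (b +_) K1)
    p<b : p < b
    p<b = lia 1 (\ p -> [] ⊢ p :< p :+ # 1) p
    p≤ = ≤-trans (<⇒≤ p<b) b≤
    T₀ = tri (b + K) (b + N) (b + N + K) ∷ tri p b (b + K) ∷ trip (b + K) (b + N + K) ∷ trip p (b + K) ∷ []
    -- The twins lie at x - 1, whose lifts p, b + K and b + N + K therefore come first; b and b + N
    -- are then added between them.
    P₀ = baseB (<B p≤) (Core.Prev.prev-ray eb {p} refl refl)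
    P₁ = poly-trip P₀ 0th 1st (<-trans p<b b<q) (<B q≤) (\ { 0th -> inl ≤-refl ; 1st -> inr ≤-refl }) (stepB (<B p≤) (<B q≤) (Core.Prev.fan-top eb {p} refl refl))
    next = Core.Prev.fan-top eb' {b + K} b'≡ refl
    next' = Core.Prev.fan-base eb' {b + K} b'≡ refl
    P₂ = poly-trip P₁ 0th 2nd (<-trans q<b' b'<q') (<B q'≤) (\ { 0th -> inl ≤-refl ; 1st -> inl (<⇒≤ (<-trans p<b b<q)) ; 2nd -> inr ≤-refl }) (stepB (<B q≤) (<B q'≤) next)
    P₃ = poly-tri P₂ 2nd 1st p<b b<q (\ { 0th -> inr (<⇒≤ (<-trans q<b' b'<q')) ; 1st -> inr ≤-refl ; 2nd -> inl ≤-refl ; 3rd -> inr B≥q }) (step⊕ (<B p≤) (<B b≤) (<B q≤) (Core.Prev.fan-base eb {p} refl refl))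
    P₄ = poly-tri P₃ 2nd 1st q<b' b'<q' (\ { 0th -> inl (<⇒≤ b<q) ; 1st -> inr ≤-refl ; 2nd -> inl ≤-refl ; 3rd -> inl (<⇒≤ (<-trans p<b b<q)) ; 4th -> inr B≥q' }) (step⊕ (<B q≤) (<B b'≤) (<B q'≤) next')
    gap : Gap (b + N ∷ b ∷ b + N + K ∷ b + K ∷ p ∷ B ∷ [])
    gap 0th = inr (<⇒≤ q<b') , inl ≤-refl
    gap 1st = inl ≤-refl , inl (<⇒≤ (<-trans b<q q<b'))
    gap 2nd = inr (<⇒≤ (<-trans q<b' b'<q')) , inr ≤-refl
    gap 3rd = inr ≤-refl , inl (<⇒≤ q<b')
    gap 4th = inl (<⇒≤ p<b) , inl (<⇒≤ (<-trans p<b (<-trans b<q q<b')))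
    gap (there 4th) = inr B≥q , inr B≥q'
    ep = trans (sym (md-+N p)) (trans (cong (md N) (sym q≡)) (eq' eb))
    core-lifted : ∀ {Δ} -> Δ ∈ T₀ -> Lifted Δ
    core-lifted 0th = tr2 refl (eq' eb) (sym b'≡) q'≡
    core-lifted 1st = tr2 refl ep refl q≡
    core-lifted 2nd = tp2 refl (eq' eb) q'≡
    core-lifted 3rd = tp2 refl ep q≡
    far : b + (N + N) ≤ p + N + N + 1
    far = lia 2 (\ p N -> [] ⊢ p :+ # 1 :+ (N :+ N) :≤ p :+ N :+ N :+ # 1) p N
    finish : TwoFilled T₀ -> Covering
    finish (V , Ts , P , cover , down , upw) = V , Ts , P , cover , (\ z -> lifts (down z)) , \ lf vis -> upw (cmp lf vis) where
     lifts : ∀ {Δ} -> Δ ∈ T₀ ⊎ chainAt b Δ ⊎ chainAt (b + N) Δ -> Lifted Δ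
     lifts (inl z) = core-lifted z
     lifts (inr (inl z)) = chain-lifted eb z
     lifts (inr (inr z)) = chain-lifted eb' z
     cmp : ∀ {Δ} -> Lifted Δ -> Visible Δ -> Δ ∈ T₀ ⊎ chainAt b Δ ⊎ chainAt (b + N) Δ
     cmp (chain z e refl refl) vis = inr (visible-chain z e vis)
     cmp (tr2 {a} q e refl refl) vis with locate-base (tr2 q e refl refl) refl (trans e (sym ep)) (<⇒≤ p<b) far vis
     ... | inl refl = inl (there (here (cong (tri a (a + 1)) (sym q≡))))
     ... | inr a≡ = inl (here (trans (cong (\ a -> tri a (a + 1) (a + N)) (trans a≡ (sym q≡))) (cong₂ (tri (b + K)) b'≡ (sym q'≡))))
     cmp (tp2 {a} q e refl) vis with locate-base (tp2 q e refl) refl (trans e (sym ep)) (<⇒≤ p<b) far vis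
     ... | inl refl = inl (there (there (there (here (cong (trip a) (sym q≡))))))
     ... | inr a≡ = inl (there (there (here (trans (cong (\ a -> trip a (a + N)) (trans a≡ (sym q≡))) (cong (trip (b + K)) (sym q'≡))))))
     cmp (tpA (inl ()) _ _) vis
     cmp (tpA (inr ()) _ _) vis
     cmp (tpB (inl ()) _ _) vis
     cmp (tpB (inr ()) _ _) vis
   covering = go l refl where
    go : ∀ l' -> l ≡ l' -> Covering
    go lp1 e = covering-one e
    go lp2 e = covering-fan e
    go lp3 e = covering-two (inl e)
    go lp4 e = covering-two (inr e)
   noncentral = counted covering

  mNC-weight : ∀ {i L} -> i < N -> 2 ≤ L -> L < N -> pos (mNC N T i L) ≡ det (W (i + N)) (W (i + N + L))
  mNC-weight {i} {L} i<N 2≤L L<N = go (lift x i<N) where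
   go : ∃[ d ] d < N × md N (x + d) ≡ i -> pos (mNC N T i L) ≡ det (W (i + N)) (W (i + N + L))
   -- Leaving room for one more position below b provides the predecessor p as a natural number.
   go (d , d<N , e) = located (m≤n⇒∃[o]m+o≡n {suc d} {i + N} (≤-trans d<N (m≤n+m N i))) where
    located : ∃[ p ] suc d + p ≡ i + N -> pos (mNC N T i L) ≡ det (W (i + N)) (W (i + N + L))
    located (p , q) = subst (\ m -> pos (countMatch incPos (range (suc m) (m + L ∸ 1)) (filterᵇ (\ Δ -> any (\ v -> (m <ᵇ v) ∧ (v <ᵇ m + L)) (verts Δ)) (trisIn N T (suc m ∸ N) (m + L ∸ 1)))) ≡ det (W m) (W (m + L)))
     n≡ (Noncentral.noncentral {p} {d} {L} (md-cancel d (trans (cong (md N) n≡) (trans (md-+N i) (trans (md-small i<N) (sym e))))) d<N 2≤L L<N) where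
     n≡ = trans (lia 2 (\ p d -> [] ⊢ p :+ # 1 :+ d :≡ # 1 :+ d :+ p) p d) q

-- Matching numbers of central arcs.

findFirst-upTo : ∀ (f : ℕ -> Bool) (g : ℕ -> ℕ) n m d -> m < n -> f (g m) ≡ true -> (∀ {k} -> k < m -> f (g k) ≡ false) -> findFirst f (map g (upTo n)) d ≡ g m
findFirst-upTo f g n m d m<n t h = trans (cong (\ xs -> findFirst f xs d) (map-upTo g n)) (go g n m m<n t h) where
 go : ∀ g n m -> m < n -> f (g m) ≡ true -> (∀ {k} -> k < m -> f (g k) ≡ false) -> findFirst f (applyUpTo g n) d ≡ g m
 go g (suc n) zero _ t h = cong (if_then g 0 else findFirst f (applyUpTo (\ k -> g (suc k)) n) d) t
 go g (suc n) (suc m) (s≤s m<n) t h = trans (cong (if_then g 0 else findFirst f (applyUpTo (\ k -> g (suc k)) n) d) (h (s≤s z≤n))) (go (\ k -> g (suc k)) n m m<n t (\ p -> h (s≤s p)))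

all⁺ : {A : Set} {f : A -> Bool} (xs : List A) -> (∀ {x} -> x ∈ xs -> f x ≡ true) -> all f xs ≡ true
all⁺ [] h = refl
all⁺ (x ∷ xs) h = ∧⁺ (h 0th) (all⁺ xs (\ p -> h (there p)))

all⁻ : {A : Set} {f : A -> Bool} (xs : List A) -> all f xs ≡ true -> ∀ {x} -> x ∈ xs -> f x ≡ true
all⁻ (x ∷ xs) e 0th = fst (∧⁻ e)
all⁻ {f = f} (x ∷ xs) e (there p) = all⁻ xs (snd (∧⁻ {f x} e)) p

module _ {P R : Set} (inc : P -> R -> Bool) where
 open Matchings inc

 Grown : (P -> ℤ) -> List P -> List P -> List R -> Set
 Grown w X V Ts = Perfect inc w X V Ts × Unique Ts

 grown-ear : ∀ {w X V Ts x y z Δ} -> PEar inc (X ++ V) Ts x y z Δ -> x ∈ V -> z ∈ V -> w y ≡ w x +Z w z -> Grown w X V Ts -> Grown w X (y ∷ V) (Δ ∷ Ts)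
 grown-ear {X = X} ear x∈ z∈ e (p , u) = perfect-ear inc {X = X} ear x∈ z∈ e p , Unique-∷ (\ q -> false≢true (PEar.y∉Ts ear q) (PEar.yΔ ear)) u

 perfect-two : ∀ {w x y Δ} -> inc x Δ ≡ true -> inc y Δ ≡ true -> w x ≡ 1ℤ -> w y ≡ 1ℤ -> Perfect inc w [] (x ∷ y ∷ []) (Δ ∷ [])
 perfect-two {w} {x} {y} {Δ} hx hy wx wy = refl , go where
  go : ∀ {n} -> n ∈ x ∷ y ∷ [] -> ∀ ps -> n ∷ ps ↭ x ∷ y ∷ [] -> pos (M ps (Δ ∷ [])) ≡ w n
  go 0th ps e = trans (cong pos (trans (M-↭ˡ (Δ ∷ []) (drop-∷ e)) (M-forced y [] Δ [] hy (\ ())))) (sym wx)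
  go 1st ps e = trans (cong pos (trans (M-↭ˡ (Δ ∷ []) (drop-∷ (↭-trans e (swap x y ↭-refl)))) (M-forced x [] Δ [] hx (\ ())))) (sym wy)

 matchings₂ : ∀ {p q s t} β -> inc p s ≡ true -> inc p t ≡ true -> inc q s ≡ true -> inc q t ≡ β -> M (p ∷ q ∷ []) (s ∷ t ∷ []) ≡ (if β then 2 else 1)
 matchings₂ true a b c d rewrite a | b | c | d = refl
 matchings₂ false a b c d rewrite a | b | c | d = refl

 -- p can take either region. When x is left out, a second matching exists exactly if y meets both
 -- regions too, and symmetrically for y.
 perfect-three : ∀ {w p x y s t} βx βy -> inc p s ≡ true -> inc p t ≡ true -> inc x s ≡ true -> inc x t ≡ βx -> inc y s ≡ true -> inc y t ≡ βy -> w x ≡ pos (if βy then 2 else 1) -> w y ≡ pos (if βx then 2 else 1) -> Perfect inc w (p ∷ []) (x ∷ y ∷ []) (s ∷ t ∷ [])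
 perfect-three {w} {p} {x} {y} {s} {t} βx βy ps pt xs xt ys yt wx wy = refl , go where
  go : ∀ {n} -> n ∈ x ∷ y ∷ [] -> ∀ qs -> n ∷ qs ↭ p ∷ x ∷ y ∷ [] -> pos (M qs (s ∷ t ∷ [])) ≡ w n
  go 0th qs e = trans (cong pos (trans (M-↭ˡ (s ∷ t ∷ []) (drop-∷ (↭-trans e (swap p x ↭-refl)))) (matchings₂ βy ps pt ys yt))) (sym wx)
  go 1st qs e = trans (cong pos (trans (M-↭ˡ (s ∷ t ∷ []) (drop-∷ (↭-trans e (shift y (p ∷ x ∷ []) [])))) (matchings₂ βx ps pt xs xt))) (sym wy)

module FanChain (w : ℕ -> ℤ) (b end : ℕ) where
 open PosChain b end

 module Steps = Chain incPos (b +_) tg (\ _ -> ⊤) end (\ _ _ -> tt) inj hit only [] (Grown incPos w []) (\ o L M -> w (b + (o + L)) ≡ w (b + o) +Z w (b + (o + (L + M)))) (\ _ _ _ ear l∈ r∈ _ -> grown-ear incPos ear l∈ r∈)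

module RayCounts (N : ℕ) (3≤N : 3 ≤ N) where
 open ChordCounts N 3≤N public

 near : ∀ {a c} -> md N a ≡ md N c -> a < c + N -> c < a + N -> a ≡ c
 near {a} {c} e h h' with a ≤? c
 ... | yes q = md-window e q h'
 ... | no q = sym (md-window (sym e) (<⇒≤ (≰⇒> q)) h)

 module Central {x : ℕ} {st : List Bool} {l : LastPair} {A : List TArc} (S : SliceLike x st l A) {T : List Arc} (und : Underlies A T) where
  open Counting S und public
  open Underlies und

  ρ : ℕ -> ℤ
  ρ v = fst (W v)

  ρ-+N : ∀ v -> ρ (v + N) ≡ ρ v
  ρ-+N v = cong fst (W-next v)

  RayAt : LastPair -> ℕ -> Set
  RayAt lp1 v = md N v ≡ md N x
  RayAt lp2 v = md N v ≡ md N (x + K)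
  RayAt lp3 v = md N v ≡ md N x ⊎ md N v ≡ md N (x + K)
  RayAt lp4 v = md N v ≡ md N x ⊎ md N v ≡ md N (x + K)

  private
   residue : ∀ {i s j r} -> tct i s ≡ tct j r -> i ≡ j
   residue refl = refl

  rayIn⁻ : ∀ v -> rayIn N T v ≡ true -> RayAt l v
  rayIn⁻ v e = from-ray (ray⁻ (memA⇒∈ e)) where
   go : ∀ l {s} -> tct (md N v) s ∈ leafArcs x l -> RayAt l v
   go lp1 (here q) = residue q
   go lp1 (there (here q)) = residue q
   go lp2 (here q) = residue q
   go lp2 (there (here q)) = residue q
   go lp3 (here q) = inl (residue q)
   go lp3 (there (here q)) = inr (residue q)
   go lp4 (here q) = inl (residue q)
   go lp4 (there (here q)) = inr (residue q)
   from-ray : ∃[ s ] tct (md N v) s ∈ A -> RayAt l v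
   from-ray (s , p) = go l (Facts.tct⁻ x st l (SliceLike.len S) (SliceLike.to S p))

  rayIn⁺ : ∀ v -> RayAt l v -> rayIn N T v ≡ true
  rayIn⁺ v h = to-ray (go l h) where
   tc : ∀ {i j} s -> i ≡ j -> tct i s ≡ tct j s
   tc s = cong (\ i -> tct i s)
   go : ∀ l -> RayAt l v -> ∃[ s ] tct (md N v) s ∈ leafArcs x l
   go lp1 h = pl , here (tc pl h)
   go lp2 h = pl , here (tc pl h)
   go lp3 (inl h) = pl , here (tc pl h)
   go lp3 (inr h) = pl , there (here (tc pl h))
   go lp4 (inl h) = nt , here (tc nt h)
   go lp4 (inr h) = nt , there (here (tc nt h))
   to-ray : ∃[ s ] tct (md N v) s ∈ leafArcs x l -> rayIn N T v ≡ true
   to-ray (s , p) = ∈⇒memA (ray⁺ (SliceLike.from S (Facts.tct⁺ x st l (SliceLike.len S) p)))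

  -- The polygon P(i) unrolled, with k and j consecutive lifts of central arcs. V and Ts come from
  -- adding ears, and `T⁺` ensures that no lifted triangle inside the polygon has been missed.
  record Fan (k j : ℕ) : Set where
   field
    {V} : List ℕ
    {Ts} : List LTri
    k<j : k < j
    j≤ : j ≤ k + N
    rayˡ : RayAt l k
    rayʳ : RayAt l j
    rays : ∀ {v} -> k < v -> v < j -> ¬ RayAt l v
    perf : Grown incPos ρ [] V Ts
    uV : Unique V
    V⁻ : ∀ {v} -> v ∈ V -> k ≤ v × v ≤ j
    V⁺ : ∀ {v} -> k ≤ v -> v ≤ j -> v ∈ V
    T⁻ : ∀ {Δ} -> Δ ∈ Ts -> Lifted Δ × (∀ {v} -> v ∈ verts Δ -> v ∈ V)
    T⁺ : ∀ {Δ} -> Lifted Δ -> (∀ {v} -> v ∈ verts Δ -> k ≤ v × v ≤ j) -> Δ ∈ Ts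

  regions : ℕ -> ℕ -> List LTri
  regions k j = filterᵇ (\ Δ -> all (\ v -> (k ≤ᵇ v) ∧ (v ≤ᵇ j)) (verts Δ)) (trisIn N T k j)

  fan-count : ∀ {k j y} -> Fan k j -> k ≤ y -> y < j -> pos (countMatch incPos (filterᵇ (\ p -> not (p ≡ᵇ y)) (range k j)) (regions k j)) ≡ ρ y
  fan-count {k} {j} {y} F k≤y y<j = trans (cong pos (Matchings.M-↭ʳ incPos pts (Unique-↭ uR (snd perf) (\ {Δ} -> R⁻ {Δ}) R⁺))) (snd (fst perf) (V⁺ k≤y (<⇒≤ y<j)) pts (Unique-↭ (Unique-∷ y∉ (Unique-filterᵇ keep (Unique-range k j))) uV p⁻ p⁺)) where
   open Fan F
   keep = \ p -> not (p ≡ᵇ y)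
   pts = filterᵇ keep (range k j)
   window = \ Δ -> all (\ v -> (k ≤ᵇ v) ∧ (v ≤ᵇ j)) (verts Δ)
   not⁻ : ∀ {b} -> not b ≡ true -> b ≡ false
   not⁻ {false} _ = refl
   y∉ : y ∉ pts
   y∉ p = false≢true (not⁻ (snd (∈-filterᵇ⁻ keep {y} {range k j} p))) (≡⇒≡ᵇ≡ {y} refl)
   p⁻ : ∀ {v} -> v ∈ y ∷ pts -> v ∈ V
   p⁻ 0th = V⁺ k≤y (<⇒≤ y<j)
   p⁻ {v} (there p) = V⁺ (fst q) (snd q) where
    q = ∈-range⁻ {k} {j} (fst (∈-filterᵇ⁻ keep {v} {range k j} p))
   p⁺ : ∀ {v} -> v ∈ V -> v ∈ y ∷ pts
   p⁺ {v} p with v ≟ y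
   ... | yes e = here e
   ... | no ne = there (∈-filterᵇ⁺ keep {v} {range k j} (∈-range⁺ (fst (V⁻ p)) (snd (V⁻ p))) (cong not (≢⇒≡ᵇ≡ ne)))
   uR = Unique-filterᵇ window {trisIn N T k j} (Unique-trisIn k j)
   R⁻ : ∀ {Δ} -> Δ ∈ regions k j -> Δ ∈ Ts
   R⁻ {Δ} p = T⁺ (lifted⁻ (snd (snd (∈-trisIn⁻ {k} {j} {Δ} (fst q))))) (\ {v} v∈ -> bounds (∧⁻ {k ≤ᵇ v} (all⁻ {f = \ v -> (k ≤ᵇ v) ∧ (v ≤ᵇ j)} (verts Δ) (snd q) v∈))) where
    q = ∈-filterᵇ⁻ window {Δ} {trisIn N T k j} p
    bounds : ∀ {v} -> (k ≤ᵇ v) ≡ true × (v ≤ᵇ j) ≡ true -> k ≤ v × v ≤ j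
    bounds {v} (a , c) = ≤ᵇ≡⇒≤ {k} a , ≤ᵇ≡⇒≤ {v} c
   start∈ : ∀ Δ -> start Δ ∈ verts Δ
   start∈ (tri _ _ _) = 0th
   start∈ (trip _ _) = 0th
   R⁺ : ∀ {Δ} -> Δ ∈ Ts -> Δ ∈ regions k j
   R⁺ {Δ} p = ∈-filterᵇ⁺ window {Δ} {trisIn N T k j} (∈-trisIn⁺ {k} {j} {Δ} (fst (within (start∈ Δ))) (snd (within (start∈ Δ))) (lifted⁺ (fst (T⁻ p)))) (all⁺ (verts Δ) (\ {v} v∈ -> ∧⁺ (≤⇒≤ᵇ≡ (fst (within v∈))) (≤⇒≤ᵇ≡ (snd (within v∈))))) where
    within : ∀ {v} -> v ∈ verts Δ -> k ≤ v × v ≤ j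
    within v∈ = V⁻ (snd (T⁻ p) v∈)

  no-ray : ∀ {k j} -> Fan k j -> ∀ {v} -> k < v -> v < j -> rayIn N T v ≡ false
  no-ray F {v} a b = ¬true⇒false \ t -> Fan.rays F a b (rayIn⁻ v t)

  -- Both searches in the definition stop at the ends of the fan, since no central arc starts
  -- strictly inside.
  fan-mCt : ∀ {k j i} -> Fan k j -> k ≤ i + N -> i + N < j -> pos (mCt N T i) ≡ ρ (i + N)
  fan-mCt {k} {j} {i} F k≤y y<j = trans (cong₂ count first last′) (fan-count F k≤y y<j) where
   open Fan F
   y = i + N
   count = \ k j -> pos (countMatch incPos (filterᵇ (\ p -> not (p ≡ᵇ y)) (range k j)) (regions k j))
   first = trans (findFirst-upTo (rayIn N T) (y ∸_) N (y ∸ k) y (m<n+o⇒m∸n<o y k {{>-nonZero N>0}} (<-≤-trans y<j j≤)) (subst (\ v -> rayIn N T v ≡ true) (sym k≡) (rayIn⁺ k rayˡ)) (\ {m} h -> no-ray F (m<n∸o⇒o+m<n′ h) (≤-<-trans (m∸n≤m y m) y<j))) k≡ where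
    k≡ = m∸[m∸n]≡n k≤y
    m<n∸o⇒o+m<n′ : ∀ {m} -> m < y ∸ k -> k < y ∸ m
    m<n∸o⇒o+m<n′ {m} h = m+n≤o⇒m≤o∸n (suc k) (lia 4 (\ m d k y -> (m :< d) ∷ (d :+ k :≡ y) ∷ [] ⊢ # 1 :+ k :+ m :≤ y) m (y ∸ k) k y h (m∸n+n≡m k≤y))
   last′ = trans (findFirst-upTo (rayIn N T) (suc y +_) (suc (y + N) ∸ suc y) (j ∸ suc y) y (∸-monoˡ-< (s≤s (≤-trans j≤ (+-monoˡ-≤ N k≤y))) y<j)
    (subst (\ v -> rayIn N T v ≡ true) (sym j≡) (rayIn⁺ j rayʳ)) (\ {m} h -> no-ray F (≤-<-trans k≤y (s≤s (m≤m+n y m))) (subst (suc y + m <_) j≡ (+-monoʳ-< (suc y) h)))) j≡ where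
    j≡ = m+[n∸m]≡n y<j

  -- The polygon between two central arcs before the chain between c and c + K has been filled in.
  record Start (k j c : ℕ) (V : List ℕ) (Ts : List LTri) : Set where
   field
    perf : Grown incPos ρ [] V Ts
    uV : Unique V
    V⁻ : ∀ {v} -> v ∈ V -> (k ≤ v × v ≤ j) × (v ≤ c ⊎ c + K ≤ v)
    V⁺ : ∀ {v} -> k ≤ v -> v ≤ j -> v ≤ c ⊎ c + K ≤ v -> v ∈ V
    T⁻ : ∀ {Δ} -> Δ ∈ Ts -> Lifted Δ × (∀ {v} -> v ∈ verts Δ -> v ∈ V)

  module Fans {k j c : ℕ} (ec : md N c ≡ md N x) (k≤c : k ≤ c) (c≤k+1 : c ≤ k + 1) (cK≤j : c + K ≤ j) (j≤c+N : j ≤ c + N) where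
   module Fill = FanChain ρ c K
   0<K : 0 < K
   0<K = ≤-trans (s≤s z≤n) 2≤N-1
   chain-in : ∀ {a o L M} -> (o , L , M) ∈ trisO 0 st -> md N a ≡ md N (x + o) -> k ≤ a -> a + (L + M) ≤ j -> Fill.Steps.ChainAt st (tri a (a + L) (a + (L + M)))
   chain-in {a} {o} {L} {M} p e k≤a h with near {a} {c + o} (trans e (sym (md-cong o ec))) (lia 7 (\ a L M j c N o -> (a :+ (L :+ M) :≤ j) ∷ (j :≤ c :+ N) ∷ (# 1 :≤ L) ∷ [] ⊢ a :< c :+ o :+ N) a L M j c N o h j≤c+N (fst (snd bnd)))
    (lia 8 (\ a L M k c N o K -> (c :≤ k :+ # 1) ∷ (k :≤ a) ∷ (o :+ (L :+ M) :≤ K) ∷ (K :< N) ∷ (# 1 :≤ L) ∷ (# 1 :≤ M) ∷ [] ⊢ c :+ o :< a :+ N) a L M k c N o K c≤k+1 k≤a (subst (o + (L + M) ≤_) K≡ (snd (snd (snd bnd)))) K<N (fst (snd bnd)) (fst (snd (snd bnd)))) where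
    bnd = trisO-bounds 0 st p
   ... | refl = o , L , M , p , cong₂ (tri (c + o)) (+-assoc c o L) (+-assoc c o (L + M))
   inside : ∀ {V Ts} -> Start k j c V Ts -> Fill.Steps.Filled st V Ts
   inside {V} {Ts} C = Fill.Steps.fill st K≡ (\ p -> cong fst (W-rec ec p)) (record { l∈ = subst (_∈ V) (sym (+-identityʳ c)) (V⁺ k≤c (≤-trans (m≤m+n c K) cK≤j) (inl ≤-refl)) ; r∈ = V⁺ (≤-trans k≤c (m≤m+n c K)) cK≤j (inr ≤-refl) ; uniq = uV ; known = \ _ -> tt
    ; fresh = \ a b p -> PosChain.no-gap c K a b (snd (V⁻ p)) ; free = \ {t} {r} a b p -> ¬true⇒false \ e -> PosChain.no-gap c K a b (snd (V⁻ (snd (T⁻ p) (incPos⁻ r e)))) ; holds = perf }) where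
    open Start C
   mkFan : ∀ {V Ts} -> Start k j c V Ts -> RayAt l k -> RayAt l j -> (∀ {v} -> k < v -> v < j -> ¬ RayAt l v) -> j ≤ k + N -> (∀ {Δ} -> Lifted Δ -> (∀ {v} -> v ∈ verts Δ -> k ≤ v × v ≤ j) -> Δ ∈ Ts ⊎ Fill.Steps.ChainAt st Δ) -> Fan k j
   mkFan {V₀} {T₀} C rk rj rays j≤ cmp = go (inside C) where
    open Start C
    go : Fill.Steps.Filled st V₀ T₀ -> Fan k j
    go (V , Ts , G , u , v⁻ , v⁺ , vin , t⁻ , t⁺ , tin) = record { V = V ; Ts = Ts ; k<j = <-≤-trans (≤-<-trans k≤c (m<m+n c 0<K)) cK≤j ; j≤ = j≤ ; rayˡ = rk ; rayʳ = rj ; rays = rays ; perf = G ; uV = u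
     ; V⁻ = \ p -> low (v⁻ p) ; V⁺ = high ; T⁻ = \ p -> tris (t⁻ p) ; T⁺ = \ lf h -> back (cmp lf h) } where
     low : ∀ {v} -> v ∈ V₀ ⊎ (∃[ t ] 0 < t × t < K × v ≡ c + t) -> k ≤ v × v ≤ j
     low (inl p) = fst (V⁻ p)
     low (inr (t , _ , t<K , refl)) = ≤-trans k≤c (m≤m+n c t) , ≤-trans (+-monoʳ-≤ c (<⇒≤ t<K)) cK≤j
     high : ∀ {v} -> k ≤ v -> v ≤ j -> v ∈ V
     high {v} a b with v ≤? c
     ... | yes q = v⁺ (V⁺ a b (inl q))
     ... | no q with c + K ≤? v
     ... | yes r = v⁺ (V⁺ a b (inr r))
     ... | no r with m≤n⇒∃[o]m+o≡n (<⇒≤ (≰⇒> q))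
     ... | t , refl = vin (lia 2 (\ c t -> (c :< c :+ t) ∷ [] ⊢ # 0 :< t) c t (≰⇒> q)) (+-cancelˡ-< c t K (≰⇒> r))
     at : ∀ {t} -> t ≤ K -> c + t ∈ V
     at {t} h = high (≤-trans k≤c (m≤m+n c t)) (≤-trans (+-monoʳ-≤ c h) cK≤j)
     tris : ∀ {Δ} -> Δ ∈ T₀ ⊎ Fill.Steps.ChainAt st Δ -> Lifted Δ × (∀ {v} -> v ∈ verts Δ -> v ∈ V)
     tris (inl p) = fst (T⁻ p) , \ v∈ -> v⁺ (snd (T⁻ p) v∈)
     tris (inr (o , L , M , p , refl)) = chain p (md-cong o ec) (sym (+-assoc c o L)) (sym (+-assoc c o (L + M))) , \ v∈ -> corner (three v∈) where
      hi : o + (L + M) ≤ K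
      hi = subst (o + (L + M) ≤_) K≡ (snd (snd (snd (trisO-bounds 0 st p))))
      corner : ∀ {v} -> v ≡ c + o ⊎ v ≡ c + (o + L) ⊎ v ≡ c + (o + (L + M)) -> v ∈ V
      corner (inl refl) = at (≤-trans (m≤m+n o (L + M)) hi)
      corner (inr (inl refl)) = at (≤-trans (+-monoʳ-≤ o (m≤m+n L M)) hi)
      corner (inr (inr refl)) = at hi
     back : ∀ {Δ} -> Δ ∈ T₀ ⊎ Fill.Steps.ChainAt st Δ -> Δ ∈ Ts
     back (inl p) = t⁺ p
     back (inr p) = tin p

  -- Unrolled, the self-folded triangle becomes the base between two lifts of the same central arc,
  -- and leaving out either lift counts 1. The triangle on the loop is then the first ear.
  core₃ : ∀ {k y j} -> k < y -> y < j -> ρ k ≡ 1ℤ -> ρ j ≡ 1ℤ -> ρ y ≡ ρ k +Z ρ j -> Grown incPos ρ [] (y ∷ k ∷ j ∷ []) (tri k y j ∷ trip k j ∷ [])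
  core₃ {k} {y} {j} k<y y<j rk rj e = grown-ear incPos {ρ} {[]} (record { uniq = Unique-∷ (\ { 0th -> <-irrefl refl k<y ; 1st -> <-irrefl refl y<j }) (Unique-∷ (\ { 0th -> <-irrefl refl (<-trans k<y y<j) }) (Unique-∷ (\ ()) [])) ; x≢z = <⇒≢ (<-trans k<y y<j)
   ; y∉Ts = \ { 0th -> ¬true⇒false (\ t -> off (incPos⁻ (trip k j) t)) } ; xΔ = incPos⁺ (tri k y j) 0th ; yΔ = incPos⁺ (tri k y j) 1st ; zΔ = incPos⁺ (tri k y j) 2nd ; onlyΔ = \ { (here e) _ -> inl e ; (there (here e)) _ -> inr e } }) 0th 1st e
   (perfect-two incPos {ρ} (incPos⁺ (trip k j) 0th) (incPos⁺ (trip k j) 1st) rk rj , Unique-∷ (\ ()) []) where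
   off : y ∉ k ∷ j ∷ []
   off 0th = <-irrefl refl k<y
   off 1st = <-irrefl refl y<j

  unique₃ : ∀ {k y j : ℕ} -> k < y -> y < j -> Unique (y ∷ k ∷ j ∷ [])
  unique₃ k<y y<j = Unique-∷ (\ { 0th -> <-irrefl refl k<y ; 1st -> <-irrefl refl y<j }) (Unique-∷ (\ { 0th -> <-irrefl refl (<-trans k<y y<j) }) (Unique-∷ (\ ()) []))

  between⇒≢ : ∀ {k v} -> k < v -> v < k + N -> md N v ≢ md N k
  between⇒≢ {k} {v} a b e = <-irrefl (md-window (sym e) (<⇒≤ a) b) a

  same-start : ∀ {a b m} -> b ≤ a -> a + m ≤ b + m -> a ≡ b
  same-start {a} {b} {m} h h' = ≤-antisym (+-cancelʳ-≤ m a b h') h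

  fan-one : ∀ {b} -> l ≡ lp1 -> md N b ≡ md N x -> Fan b (b + N)
  fan-one {b} refl eb = Fans.mkFan {b} {b + N} {b} eb ≤-refl (m≤m+n b 1) (+-monoʳ-≤ b (<⇒≤ K<N)) ≤-refl {b + K ∷ b ∷ b + N ∷ []} {tri b (b + K) (b + N) ∷ trip b (b + N) ∷ []} (record
   { perf = core₃ b<q q<b' (Core.one-ray eb refl) (trans (ρ-+N b) (Core.one-ray eb refl)) (cong fst (Core.one-top eb refl)) ; uV = unique₃ b<q q<b' ; V⁻ = \ { 0th -> (<⇒≤ b<q , <⇒≤ q<b') , inr ≤-refl ; 1st -> (≤-refl , m≤m+n b N) , inl ≤-refl ; 2nd -> (m≤m+n b N , ≤-refl) , inr (<⇒≤ q<b') }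
   ; V⁺ = cover ; T⁻ = \ { 0th -> tr1 refl eb refl refl , (\ { (here e) -> there (here e) ; (there (here e)) -> here e ; (there (there (here e))) -> there (there (here e)) }) ; 1st -> tp1 refl eb refl , there } }) eb (trans (md-+N b) eb) (\ a c e -> between⇒≢ a c (trans e (sym eb))) ≤-refl cmp where
   b<q : b < b + K
   b<q = m<m+n b (≤-trans (s≤s z≤n) 2≤N-1)
   q<b' = +-monoʳ-< b K<N
   cover : ∀ {v} -> b ≤ v -> v ≤ b + N -> v ≤ b ⊎ b + K ≤ v -> v ∈ b + K ∷ b ∷ b + N ∷ []
   cover a _ (inl h) = there (here (≤-antisym h a))
   cover {v} _ a (inr h) with m≤n⇒m<n∨m≡n h
   ... | inr e = here (sym e)
   ... | inl h' = there (there (here (≤-antisym a (subst (_≤ v) (trans (sym (+-suc b K)) (cong (b +_) 1+N-1)) h'))))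
   cmp : ∀ {Δ} -> Lifted Δ -> (∀ {v} -> v ∈ verts Δ -> b ≤ v × v ≤ b + N) -> Δ ∈ tri b (b + K) (b + N) ∷ trip b (b + N) ∷ [] ⊎ FanChain.Steps.ChainAt ρ b K st Δ
   cmp (chain p e refl refl) h = inr (Fans.chain-in eb ≤-refl (m≤m+n b 1) (+-monoʳ-≤ b (<⇒≤ K<N)) ≤-refl p e (fst (h 0th)) (snd (h 2nd)))
   cmp (tr1 _ e refl refl) h with same-start {m = N} (fst (h 0th)) (snd (h 2nd))
   ... | refl = inl 0th
   cmp (tp1 _ e refl) h with same-start {m = N} (fst (h 0th)) (snd (h 1st))
   ... | refl = inl 1st
   cmp (tpA (inl ()) _ _) h
   cmp (tpA (inr ()) _ _) h
   cmp (tpB (inl ()) _ _) h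
   cmp (tpB (inr ()) _ _) h

  prev-residue : ∀ {p} -> md N (p + 1) ≡ md N x -> md N p ≡ md N (x + K)
  prev-residue {p} e = trans (sym (md-+N p)) (trans (cong (\ z -> md N (p + z)) (sym 1+N-1)) (trans (cong (md N) (sym (+-assoc p 1 K))) (md-cong K e)))

  fan-prev : ∀ {p} -> l ≡ lp2 -> md N (p + 1) ≡ md N x -> Fan p (p + N)
  fan-prev {p} refl eb = Fans.mkFan {p} {p + N} {p + 1} eb (m≤m+n p 1) ≤-refl (≤-reflexive q≡) (+-monoˡ-≤ N (m≤m+n p 1)) {p + 1 ∷ p ∷ p + N ∷ []} {tri p (p + 1) (p + N) ∷ trip p (p + N) ∷ []} (record
   { perf = core₃ p<b b<q ray (trans (ρ-+N p) ray) (trans (cong fst (Core.Prev.fan-base eb {p} refl refl)) (cong (\ y -> ρ p +Z ρ y) q≡)) ; uV = unique₃ p<b b<q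
   ; V⁻ = \ { 0th -> (<⇒≤ p<b , <⇒≤ b<q) , inl ≤-refl ; 1st -> (≤-refl , m≤m+n p N) , inl (<⇒≤ p<b) ; 2nd -> (m≤m+n p N , ≤-refl) , inr (≤-reflexive q≡) } ; V⁺ = cover
   ; T⁻ = \ { 0th -> tr2 refl ep refl refl , (\ { (here e) -> there (here e) ; (there (here e)) -> here e ; (there (there (here e))) -> there (there (here e)) }) ; 1st -> tp2 refl ep refl , there } }) ep (trans (md-+N p) ep) (\ a c e -> between⇒≢ a c (trans e (sym ep))) ≤-refl cmp where
   q≡ = Core.Prev.top≡ eb {p} refl
   ray = Core.Prev.prev-ray eb {p} refl refl
   ep = prev-residue eb
   p<b : p < p + 1
   p<b = m<m+n p (s≤s z≤n)
   b<q = +-monoʳ-< p (<⇒≤ 3≤N)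
   cover : ∀ {v} -> p ≤ v -> v ≤ p + N -> v ≤ p + 1 ⊎ p + 1 + K ≤ v -> v ∈ p + 1 ∷ p ∷ p + N ∷ []
   cover {v} _ a (inr h) = there (there (here (≤-antisym a (subst (_≤ v) q≡ h))))
   cover {v} a _ (inl h) with m≤n⇒m<n∨m≡n h
   ... | inr e = here e
   ... | inl h' = there (here (≤-antisym (≤-pred (subst (suc v ≤_) (+-comm p 1) h')) a))
   cmp : ∀ {Δ} -> Lifted Δ -> (∀ {v} -> v ∈ verts Δ -> p ≤ v × v ≤ p + N) -> Δ ∈ tri p (p + 1) (p + N) ∷ trip p (p + N) ∷ [] ⊎ FanChain.Steps.ChainAt ρ (p + 1) K st Δ
   cmp (chain q e refl refl) h = inr (Fans.chain-in eb (m≤m+n p 1) ≤-refl (≤-reflexive q≡) (+-monoˡ-≤ N (m≤m+n p 1)) q e (fst (h 0th)) (snd (h 2nd)))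
   cmp (tr2 _ e refl refl) h with same-start {m = N} (fst (h 0th)) (snd (h 2nd))
   ... | refl = inl 0th
   cmp (tp2 _ e refl) h with same-start {m = N} (fst (h 0th)) (snd (h 1st))
   ... | refl = inl 1st
   cmp (tpA (inl ()) _ _) h
   cmp (tpA (inr ()) _ _) h
   cmp (tpB (inl ()) _ _) h
   cmp (tpB (inr ()) _ _) h

  two-ray⁺ : Two l -> ∀ {v} -> md N v ≡ md N x ⊎ md N v ≡ md N (x + K) -> RayAt l v
  two-ray⁺ (inl refl) h = h
  two-ray⁺ (inr refl) h = h

  two-ray⁻ : Two l -> ∀ {v} -> RayAt l v -> md N v ≡ md N x ⊎ md N v ≡ md N (x + K)
  two-ray⁻ (inl refl) h = h
  two-ray⁻ (inr refl) h = h

  single : ∀ {k j} -> k < j -> ρ k ≡ 1ℤ -> ρ j ≡ 1ℤ -> Grown incPos ρ [] (k ∷ j ∷ []) (trip k j ∷ []) × Unique (k ∷ j ∷ [])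
  single {k} {j} k<j rk rj = (perfect-two incPos {ρ} (incPos⁺ (trip k j) 0th) (incPos⁺ (trip k j) 1st) rk rj , Unique-∷ (\ ()) []) , Unique-∷ (\ { 0th -> <-irrefl refl k<j }) (Unique-∷ (\ ()) [])

  fan-two : ∀ {b} -> Two l -> md N b ≡ md N x -> Fan b (b + K)
  fan-two {b} t eb = Fans.mkFan {b} {b + K} {b} eb ≤-refl (m≤m+n b 1) ≤-refl (<⇒≤ q<b') {b ∷ b + K ∷ []} {trip b (b + K) ∷ []} (record { perf = fst base ; uV = snd base ; V⁻ = \ { 0th -> (≤-refl , <⇒≤ b<q) , inl ≤-refl ; 1st -> (<⇒≤ b<q , ≤-refl) , inr ≤-refl }
   ; V⁺ = \ { a c (inl h) -> here (≤-antisym h a) ; a c (inr h) -> there (here (≤-antisym c h)) } ; T⁻ = \ { 0th -> tpA t eb refl , (\ v∈ -> v∈) } }) (two-ray⁺ t (inl eb)) (two-ray⁺ t (inr (md-cong K eb))) (\ a c e -> none a c (two-ray⁻ t e)) (<⇒≤ q<b') cmp where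
   b<q : b < b + K
   b<q = m<m+n b (≤-trans (s≤s z≤n) 2≤N-1)
   q<b' = +-monoʳ-< b K<N
   base = single b<q (Core.two-ray eb t) (Core.two-ray' eb t)
   before-top : ∀ {v} -> b ≤ v -> v < b + K -> md N v ≢ md N (x + K)
   before-top {v} a c e = <-irrefl (near (trans e (sym (md-cong K eb))) (<-trans c (m<m+n (b + K) N>0)) (<-≤-trans q<b' (+-monoˡ-≤ N a))) c
   none : ∀ {v} -> b < v -> v < b + K -> md N v ≡ md N x ⊎ md N v ≡ md N (x + K) -> ⊥
   none a c (inl e) = between⇒≢ a (<-trans c q<b') (trans e (sym eb))
   none a c (inr e) = before-top (<⇒≤ a) c e
   cmp : ∀ {Δ} -> Lifted Δ -> (∀ {v} -> v ∈ verts Δ -> b ≤ v × v ≤ b + K) -> Δ ∈ trip b (b + K) ∷ [] ⊎ FanChain.Steps.ChainAt ρ b K st Δ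
   cmp (chain p e refl refl) h = inr (Fans.chain-in eb ≤-refl (m≤m+n b 1) ≤-refl (<⇒≤ q<b') p e (fst (h 0th)) (snd (h 2nd)))
   cmp (tr1 e _ _ _) h = ⊥-elim (one-not-two t e)
   cmp (tp1 e _ _) h = ⊥-elim (one-not-two t e)
   cmp (tr2 e _ _ _) h = ⊥-elim (fan-not-two t e)
   cmp (tp2 e _ _) h = ⊥-elim (fan-not-two t e)
   cmp (tpA _ e refl) h with same-start {m = K} (fst (h 0th)) (snd (h 1st))
   ... | refl = inl 0th
   cmp (tpB {a} _ e refl) h = ⊥-elim (before-top (fst (h 0th)) (subst (_≤ b + K) (+-comm a 1) (snd (h 1st))) e)

  -- The fan over the single boundary segment from x - 1 to x; it is too short to contain any
  -- triangle of the chain.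
  fan-last : ∀ {b} -> Two l -> md N b ≡ md N x -> Fan (b + K) (b + K + 1)
  fan-last {b} t eb = record { V = q ∷ q + 1 ∷ [] ; Ts = trip q (q + 1) ∷ [] ; k<j = q<q+1 ; j≤ = +-monoʳ-≤ q N>0 ; rayˡ = two-ray⁺ t (inr eq) ; rayʳ = two-ray⁺ t (inl (trans (cong (md N) q+1≡) (trans (md-+N b) eb))) ; rays = \ {v} a c -> <-absurd (<-≤-trans a (≤-pred (subst (v <_) (+-comm q 1) c)))
   ; perf = fst base ; uV = snd base ; V⁻ = \ { 0th -> ≤-refl , m≤m+n q 1 ; 1st -> m≤m+n q 1 , ≤-refl } ; V⁺ = cover ; T⁻ = \ { 0th -> tpB t eq refl , (\ v∈ -> v∈) } ; T⁺ = cmp } where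
   q = b + K
   q<q+1 : q < q + 1
   q<q+1 = m<m+n q (s≤s z≤n)
   q+1≡ = trans (+-assoc b K 1) (cong (b +_) K1)
   eq = md-cong K eb
   base = single q<q+1 (Core.two-ray' eb t) (trans (cong ρ q+1≡) (trans (ρ-+N b) (Core.two-ray eb t)))
   cover : ∀ {v} -> q ≤ v -> v ≤ q + 1 -> v ∈ q ∷ q + 1 ∷ []
   cover {v} a c with m≤n⇒m<n∨m≡n a
   ... | inr e = here (sym e)
   ... | inl h = there (here (≤-antisym c (subst (_≤ v) (+-comm 1 q) h)))
   short-window : ∀ {a m} -> q ≤ a -> a + m ≤ q + 1 -> 2 ≤ m -> ⊥
   short-window {a} {m} g h i = lia 3 (\ q a m -> (q :≤ a) ∷ (a :+ m :≤ q :+ # 1) ∷ (# 2 :≤ m) ∷ [] ⊢ :⊥) q a m g h i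
   cmp : ∀ {Δ} -> Lifted Δ -> (∀ {v} -> v ∈ verts Δ -> q ≤ v × v ≤ q + 1) -> Δ ∈ trip q (q + 1) ∷ []
   cmp (chain p e refl refl) h = ⊥-elim (short-window (fst (h 0th)) (snd (h 2nd)) (+-mono-≤ (fst (snd (trisO-bounds 0 st p))) (fst (snd (snd (trisO-bounds 0 st p))))))
   cmp (tr1 e _ _ _) h = ⊥-elim (one-not-two t e)
   cmp (tp1 e _ _) h = ⊥-elim (one-not-two t e)
   cmp (tr2 e _ _ _) h = ⊥-elim (fan-not-two t e)
   cmp (tp2 e _ _) h = ⊥-elim (fan-not-two t e)
   cmp (tpA _ e refl) h = ⊥-elim (short-window (fst (h 0th)) (snd (h 1st)) 2≤N-1)
   cmp (tpB {a} _ e refl) h with same-start {m = 1} (fst (h 0th)) (snd (h 1st))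
   ... | refl = 0th

  mCt-weight : ∀ {i} -> i < N -> pos (mCt N T i) ≡ ρ (i + N)
  mCt-weight {i} i<N = go (lift x i<N) where
   go : ∃[ d ] d < N × md N (x + d) ≡ i -> pos (mCt N T i) ≡ ρ (i + N)
   go (d , d<N , e) = located (m≤n⇒∃[o]m+o≡n {suc d} {i + N} (≤-trans d<N (m≤n+m N i))) where
    located : ∃[ p ] suc d + p ≡ i + N -> pos (mCt N T i) ≡ ρ (i + N)
    located (p , q) = by l refl where
     y≡ = trans (lia 2 (\ p d -> [] ⊢ p :+ # 1 :+ d :≡ # 1 :+ d :+ p) p d) q
     eb = md-cancel d (trans (cong (md N) y≡) (trans (md-+N i) (trans (md-small i<N) (sym e))))
     b≤y : p + 1 ≤ i + N
     b≤y = subst (p + 1 ≤_) y≡ (m≤m+n (p + 1) d)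
     below-top : ∀ {m} -> d < m -> i + N < p + 1 + m
     below-top {m} h = subst (_< p + 1 + m) y≡ (+-monoʳ-< (p + 1) h)
     top≡ : ¬ d < K -> p + 1 + K ≡ i + N
     top≡ h = trans (cong (p + 1 +_) (≤-antisym (≮⇒≥ h) (≤-pred (subst (suc d ≤_) (sym 1+N-1) d<N)))) y≡
     two : Two l -> pos (mCt N T i) ≡ ρ (i + N)
     two t with d <? K
     ... | yes h = fan-mCt (fan-two t eb) b≤y (below-top h)
     ... | no h = fan-mCt (fan-last t eb) (≤-reflexive (top≡ h)) (subst (_< p + 1 + K + 1) (top≡ h) (m<m+n (p + 1 + K) (s≤s z≤n)))
     by : ∀ l' -> l ≡ l' -> pos (mCt N T i) ≡ ρ (i + N)
     by lp1 t = fan-mCt (fan-one t eb) b≤y (below-top d<N)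
     by lp2 t with d <? K
     ... | yes h = fan-mCt (fan-prev t eb) (≤-trans (m≤m+n p 1) b≤y) (subst (i + N <_) (trans (+-assoc p 1 K) (cong (p +_) 1+N-1)) (below-top h))
     -- At the last offset i lies over x - 1 and carries the central arc itself. The search towards
     -- smaller positions stops there at once, so the fan of the next turn is the right one.
     ... | no h = fan-mCt {i + N} {i + N + N} (fan-prev t (trans (cong (md N) (lia 5 (\ p K y N o -> (p :+ # 1 :+ K :≡ y) ∷ (K :+ # 1 :≡ N) ∷ [] ⊢ y :+ # 1 :≡ p :+ # 1 :+ N) p K (i + N) N 1 (top≡ h) K1)) (trans (md-+N (p + 1)) eb))) ≤-refl (m<m+n (i + N) N>0)
     by lp3 t = two (inl t)
     by lp4 t = two (inr t)

-- Matching numbers of loops.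

module LoopCounts (N : ℕ) (3≤N : 3 ≤ N) where
 open RayCounts N 3≤N public

 corner⁺ : ∀ {p v} Δ -> v ∈ verts Δ -> md N v ≡ p -> incSurf N (bd p) Δ ≡ true
 corner⁺ {p} {v} Δ v∈ e = any⁺ {f = \ v -> md N v ≡ᵇ p} {x = v} {xs = verts Δ} v∈ (≡⇒≡ᵇ≡ e)

 corner⁻ : ∀ {p} Δ -> incSurf N (bd p) Δ ≡ true -> ∃[ v ] v ∈ verts Δ × md N v ≡ p
 corner⁻ {p} Δ e with any⁻ (\ v -> md N v ≡ᵇ p) (verts Δ) e
 ... | v , v∈ , q = v , v∈ , ≡ᵇ≡⇒≡ q

 incPunc : ∀ a y -> incSurf N punc (tri a y (a + N)) ≡ true
 incPunc a y = ≡⇒≡ᵇ≡ (m+n∸m≡n a N)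

 md-+K+1 : ∀ y -> md N (y + K + 1) ≡ md N y
 md-+K+1 y = trans (cong (md N) (trans (+-assoc y K 1) (cong (y +_) K1))) (md-+N y)

 module Loops {x : ℕ} {st : List Bool} {l : LastPair} {A : List TArc} (S : SliceLike x st l A) {T : List Arc} (und : Underlies A T) where
  open Central S und public
  open Exchange.Values N 3≤N weights public using (r-md)

  -- `κ l` is 1 with twins and 2 without. The puncture is always matched and never the point left
  -- out, so its entry 0 is a mere filler.
  weight : Pt -> ℤ
  weight (bd v) = κ l *Z ρ v
  weight punc = 0ℤ

  site : ℕ -> Pt
  site t = bd (md N (x + t))

  -- The one lift of a chain triangle that `triangles` lists, namely the one starting below N.
  piece : ℕ -> ℕ -> ℕ -> LTri
  piece o L M = tri (md N (x + o)) (md N (x + o) + L) (md N (x + o) + (L + M))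

  <N : ∀ {t} -> t ≤ K -> t < N
  <N h = ≤-<-trans h K<N

  site-inj : ∀ {t t'} -> t ≤ K -> t' ≤ K -> site t ≡ site t' -> t ≡ t'
  site-inj h h' e = md-diff x (<N h) (<N h') (go e) where
   go : ∀ {a b} -> bd a ≡ bd b -> a ≡ b
   go refl = refl

  md-piece : ∀ o t -> md N (md N (x + o) + t) ≡ md N (x + (o + t))
  md-piece o t = trans (md-md+ (x + o) t) (cong (md N) (+-assoc x o t))

  hit : ∀ {o L M} -> 1 ≤ L -> 1 ≤ M -> o + (L + M) ≤ K -> incSurf N (site o) (piece o L M) ≡ true × incSurf N (site (o + L)) (piece o L M) ≡ true × incSurf N (site (o + (L + M))) (piece o L M) ≡ true
  hit {o} {L} {M} _ _ _ = corner⁺ (piece o L M) 0th (md-idem (x + o)) , corner⁺ (piece o L M) 1st (md-piece o L) , corner⁺ (piece o L M) 2nd (md-piece o (L + M))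

  only : ∀ {o L M v} -> 1 ≤ L -> 1 ≤ M -> o + (L + M) ≤ K -> ⊤ -> incSurf N v (piece o L M) ≡ true -> v ≡ site o ⊎ v ≡ site (o + L) ⊎ v ≡ site (o + (L + M))
  -- A triangle of the chain spans less than a turn, so none of its sides is a loop and it does not
  -- meet the puncture.
  only {o} {L} {M} {punc} _ _ h _ e = ⊥-elim (<-irrefl (trans (sym (m+n∸m≡n (md N (x + o)) (L + M))) (≡ᵇ≡⇒≡ e)) (<N (≤-trans (m≤n+m (L + M) o) h)))
  only {o} {L} {M} {bd p} _ _ h _ e with corner⁻ (piece o L M) e
  ... | v , 0th , q = inl (cong bd (trans (sym q) (md-idem (x + o))))
  ... | v , 1st , q = inr (inl (cong bd (trans (sym q) (md-piece o L))))
  ... | v , 2nd , q = inr (inr (cong bd (trans (sym q) (md-piece o (L + M)))))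

  module Around = Chain (incSurf N) site piece (\ _ -> ⊤) K (\ _ _ -> tt) site-inj hit only (punc ∷ []) (Grown (incSurf N) weight (punc ∷ [])) (\ o L M -> weight (site (o + L)) ≡ weight (site o) +Z weight (site (o + (L + M)))) (\ _ _ _ ear l∈ r∈ _ -> grown-ear (incSurf N) ear l∈ r∈)

  -- The two regions nearest to the puncture, on the ends of the longest chord; they are the base to
  -- which the chain is added by ears.
  record Hub (Ts : List LTri) : Set where
   field
    perf : Grown (incSurf N) weight (punc ∷ []) (site 0 ∷ site K ∷ []) Ts
    corners : ∀ {Δ v} -> Δ ∈ Ts -> v ∈ verts Δ -> md N v ≡ md N x ⊎ md N v ≡ md N (x + K)
    T⁻ : ∀ {Δ} -> Δ ∈ Ts -> Lifted Δ × start Δ < N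
    T⁺ : ∀ {Δ} -> Lifted Δ -> start Δ < N -> Δ ∈ Ts ⊎ Around.ChainAt st Δ

  weight-site : ∀ t -> weight (site t) ≡ κ l *Z ρ (x + t)
  weight-site t = cong (κ l *Z_) (r-md (x + t))

  around : ∀ {Ts} -> Hub Ts -> Around.Filled st (site 0 ∷ site K ∷ []) Ts
  around {Ts} H = Around.fill st K≡ (\ {o} {L} {M} p -> trans (weight-site (o + L)) (trans (cong (κ l *Z_) (cong fst (W-rec {x} refl p))) (trans (ℤₚ.*-distribˡ-+ (κ l) (ρ (x + o)) (ρ (x + (o + (L + M))))) (sym (cong₂ _+Z_ (weight-site o) (weight-site (o + (L + M)))))))) (record { l∈ = 0th ; r∈ = 1st
   ; uniq = Unique-∷ (\ { (there (there ())) }) (Unique-∷ (\ { (here e) -> <-irrefl (site-inj z≤n ≤-refl e) (≤-trans (s≤s z≤n) 2≤N-1) ; (there ()) }) (Unique-∷ (\ ()) [])) ; known = \ _ -> tt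
   ; fresh = \ { a b (there (here e)) -> <-irrefl (sym (site-inj (<⇒≤ b) z≤n e)) a ; a b (there (there (here e))) -> <-irrefl (site-inj (<⇒≤ b) ≤-refl e) b } ; free = \ {t} {Δ} a b p -> ¬true⇒false \ e -> off a b p (corner⁻ Δ e) ; holds = Hub.perf H }) where
   off : ∀ {t Δ} -> 0 < t -> t < K -> Δ ∈ Ts -> ∃[ v ] v ∈ verts Δ × md N v ≡ md N (x + t) -> ⊥
   off {t} a b p (v , v∈ , e) with Hub.corners H p v∈
   ... | inl q = <-irrefl (md-diff x N>0 (<N (<⇒≤ b)) (trans (cong (md N) (+-identityʳ x)) (trans (sym q) e))) a
   ... | inr q = <-irrefl (md-diff x (<N (<⇒≤ b)) K<N (trans (sym e) q)) b

  others : ℕ -> List Pt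
  others i = map bd (filterᵇ (\ p -> not (p ≡ᵇ i)) (upTo N)) ++ (punc ∷ [])

  hub-mLoop : ∀ {Ts i} -> Hub Ts -> i < N -> pos (mLoop N T i) ≡ κ l *Z ρ i
  hub-mLoop {T₀} {i} H i<N = go (around H) where
   open Hub H
   keep = \ p -> not (p ≡ᵇ i)
   not⁻ : ∀ {b} -> not b ≡ true -> b ≡ false
   not⁻ {false} _ = refl
   bd-inj : ∀ {a b} -> bd a ≡ bd b -> a ≡ b
   bd-inj refl = refl
   go : Around.Filled st (site 0 ∷ site K ∷ []) T₀ -> pos (mLoop N T i) ≡ κ l *Z ρ i
   go (V , Ts , G , u , v⁻ , v⁺ , vin , t⁻ , t⁺ , tin) = trans (cong pos (Matchings.M-↭ʳ (incSurf N) (others i) (Unique-↭ (Unique-trisIn 0 K) (snd G) (\ {Δ} p -> R⁻ (∈-trisIn⁻ {0} {K} {Δ} p)) (\ p -> R⁺ (t⁻ p)))))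
    (snd (fst G) (cover i<N) (others i) (Unique-↭ (Unique-∷ (\ p -> fresh (∈-++⁻ (map bd (filterᵇ keep (upTo N))) p)) u-others) u p⁻ p⁺)) where
    cover : ∀ {v} -> v < N -> bd v ∈ V
    cover v<N with lift x v<N
    ... | zero , _ , e = v⁺ (here (cong bd (sym e)))
    ... | suc t , d<N , e with m≤n⇒m<n∨m≡n (≤-pred (subst (suc (suc t) ≤_) (sym 1+N-1) d<N))
    ... | inl h = subst (_∈ V) (cong bd e) (vin (s≤s z≤n) h)
    ... | inr h = v⁺ (there (here (trans (cong bd (sym e)) (cong site h))))
    residues : ∀ {v} -> v ∈ V -> ∃[ t ] v ≡ site t
    residues p with v⁻ p
    ... | inl (here e) = 0 , e
    ... | inl (there (here e)) = K , e
    ... | inr (t , _ , _ , e) = t , e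
    fresh : bd i ∈ map bd (filterᵇ keep (upTo N)) ⊎ bd i ∈ punc ∷ [] -> ⊥
    fresh (inl p) with ∈-map⁻ bd p
    ... | v , q , refl = false≢true (not⁻ (snd (∈-filterᵇ⁻ keep {v} {upTo N} q))) (≡⇒≡ᵇ≡ {v} refl)
    fresh (inr (there ()))
    u-others = Uniqueₚ.++⁺ (Uniqueₚ.map⁺ bd-inj (Unique-filterᵇ keep (Uniqueₚ.upTo⁺ N))) (Unique-∷ (\ ()) []) \ { (p , here refl) -> no-punc p } where
     no-punc : punc ∉ map bd (filterᵇ keep (upTo N))
     no-punc p with ∈-map⁻ bd p
     ... | _ , _ , ()
    p⁻ : ∀ {v} -> v ∈ bd i ∷ others i -> v ∈ punc ∷ V
    p⁻ 0th = there (cover i<N)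
    p⁻ (there p) with ∈-++⁻ (map bd (filterᵇ keep (upTo N))) p
    ... | inr 0th = 0th
    ... | inl q with ∈-map⁻ bd q
    ... | v , m , refl = there (cover (∈-upTo⁻ (fst (∈-filterᵇ⁻ keep {v} {upTo N} m))))
    p⁺ : ∀ {v} -> v ∈ punc ∷ V -> v ∈ bd i ∷ others i
    p⁺ 0th = there (∈-++⁺ʳ (map bd (filterᵇ keep (upTo N))) 0th)
    p⁺ (there p) with residues p
    ... | t , refl with md N (x + t) ≟ i
    ... | yes e = here (cong bd e)
    ... | no ne = there (∈-++⁺ˡ (∈-map⁺ bd (∈-filterᵇ⁺ keep {md N (x + t)} {upTo N} (∈-upTo⁺ (md-< (x + t))) (cong not (≢⇒≡ᵇ≡ ne)))))
    R⁻ : ∀ {Δ} -> 0 ≤ start Δ × start Δ ≤ K × LiftTri Δ -> Δ ∈ Ts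
    R⁻ (_ , h , lf) with T⁺ (lifted⁻ lf) (<N h)
    ... | inl p = t⁺ p
    ... | inr p = tin p
    R⁺ : ∀ {Δ} -> Δ ∈ T₀ ⊎ Around.ChainAt st Δ -> Δ ∈ triangles N T
    R⁺ {Δ} (inl p) = ∈-trisIn⁺ {0} {K} {Δ} z≤n (≤-pred (subst (suc (start Δ) ≤_) (sym 1+N-1) (snd (T⁻ p)))) (lifted⁺ (fst (T⁻ p)))
    R⁺ {Δ} (inr (o , L , M , p , refl)) = ∈-trisIn⁺ {0} {K} {Δ} z≤n (≤-pred (subst (suc (start Δ) ≤_) (sym 1+N-1) (md-< (x + o)))) (lifted⁺ (chain p (md-idem (x + o)) refl refl))

  chain-around : ∀ {a o L M} -> (o , L , M) ∈ trisO 0 st -> md N a ≡ md N (x + o) -> a < N -> Around.ChainAt st (tri a (a + L) (a + (L + M)))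
  chain-around {a} {o} {L} {M} p e a<N = o , L , M , p , cong (\ a -> tri a (a + L) (a + (L + M))) (trans (sym (md-small a<N)) e)

  base-at : ∀ {a y} -> md N a ≡ md N y -> a < N -> a ≡ md N y
  base-at e a<N = trans (sym (md-small a<N)) e

  private
   ρ₀ ρK : ℤ
   ρ₀ = ρ (x + 0)
   ρK = ρ (x + K)
   ρ₀≡ = cong ρ (+-identityʳ x)
   x₀ = cong (md N) (+-identityʳ x)

  weigh : ∀ t {k u} -> κ l ≡ k -> ρ (x + t) ≡ u -> weight (site t) ≡ k *Z u
  weigh t e e' = trans (weight-site t) (cong₂ _*Z_ e e')

  -- Since the triangle on the loop counts as incident with the puncture, the puncture can go to
  -- either region. The end x - 1 meets only the triangle on the loop, so 1 and 2 matchings arise,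
  -- in agreement with the first coordinates of the ends.
  hub-one : l ≡ lp1 -> Hub (tri (md N x) (md N x + K) (md N x + N) ∷ trip (md N x) (md N x + N) ∷ [])
  hub-one refl = record { perf = perfect-three (incSurf N) true false (incPunc a (a + K)) refl (corner⁺ Δ₁ 0th a₀) (corner⁺ Δ₂ 0th a₀) (corner⁺ Δ₁ 1st (md-md+ x K)) (¬true⇒false \ e -> off (corner⁻ Δ₂ e))
   (weigh 0 refl (trans ρ₀≡ (Core.one-ray {x} refl refl))) (weigh K refl (Core.one-ray' {x} refl refl)) , Unique-∷ (\ { (there ()) }) (Unique-∷ (\ ()) []) ; corners = \ { 0th p -> at₁ p ; 1st p -> at₂ p }
   ; T⁻ = \ { 0th -> tr1 refl (md-idem x) refl refl , md-< x ; 1st -> tp1 refl (md-idem x) refl , md-< x } ; T⁺ = cmp } where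
   a = md N x
   Δ₁ = tri a (a + K) (a + N)
   Δ₂ = trip a (a + N)
   a₀ = trans (md-idem x) (sym x₀)
   aN = trans (md-+N a) (md-idem x)
   at₁ : ∀ {v} -> v ∈ verts Δ₁ -> md N v ≡ md N x ⊎ md N v ≡ md N (x + K)
   at₁ 0th = inl (md-idem x)
   at₁ 1st = inr (md-md+ x K)
   at₁ 2nd = inl aN
   at₂ : ∀ {v} -> v ∈ verts Δ₂ -> md N v ≡ md N x ⊎ md N v ≡ md N (x + K)
   at₂ 0th = inl (md-idem x)
   at₂ 1st = inl aN
   off : ∃[ v ] v ∈ verts Δ₂ × md N v ≡ md N (x + K) -> ⊥
   off (v , 0th , e) = ends-≢ x (trans (sym (md-idem x)) e)
   off (v , 1st , e) = ends-≢ x (trans (sym aN) e)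
   cmp : ∀ {Δ} -> Lifted Δ -> start Δ < N -> Δ ∈ Δ₁ ∷ Δ₂ ∷ [] ⊎ Around.ChainAt st Δ
   cmp (chain p e refl refl) h = inr (chain-around p e h)
   cmp (tr1 _ e refl refl) h = inl (here (cong (\ a -> tri a (a + K) (a + N)) (base-at e h)))
   cmp (tp1 _ e refl) h = inl (there (here (cong (\ a -> trip a (a + N)) (base-at e h))))
   cmp (tpA (inl ()) _ _) h
   cmp (tpA (inr ()) _ _) h
   cmp (tpB (inl ()) _ _) h
   cmp (tpB (inr ()) _ _) h

  hub-prev : l ≡ lp2 -> Hub (tri (md N (x + K)) (md N (x + K) + 1) (md N (x + K) + N) ∷ trip (md N (x + K)) (md N (x + K) + N) ∷ [])
  hub-prev refl = record { perf = perfect-three (incSurf N) false true (incPunc a (a + 1)) refl (corner⁺ Δ₁ 1st (trans a1 (sym x₀))) (¬true⇒false \ e -> off (corner⁻ Δ₂ e)) (corner⁺ Δ₁ 0th aK) (corner⁺ Δ₂ 0th aK)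
   (weigh 0 refl (trans ρ₀≡ (Core.fan-ray' {x} refl refl))) (weigh K refl (Core.fan-ray {x} refl refl)) , Unique-∷ (\ { (there ()) }) (Unique-∷ (\ ()) []) ; corners = \ { 0th p -> at₁ p ; 1st p -> at₂ p }
   ; T⁻ = \ { 0th -> tr2 refl aK refl refl , md-< (x + K) ; 1st -> tp2 refl aK refl , md-< (x + K) } ; T⁺ = cmp } where
   a = md N (x + K)
   Δ₁ = tri a (a + 1) (a + N)
   Δ₂ = trip a (a + N)
   aK = md-idem (x + K)
   a1 = trans (md-md+ (x + K) 1) (md-+K+1 x)
   aN = trans (md-+N a) aK
   at₁ : ∀ {v} -> v ∈ verts Δ₁ -> md N v ≡ md N x ⊎ md N v ≡ md N (x + K)
   at₁ 0th = inr aK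
   at₁ 1st = inl a1
   at₁ 2nd = inr aN
   at₂ : ∀ {v} -> v ∈ verts Δ₂ -> md N v ≡ md N x ⊎ md N v ≡ md N (x + K)
   at₂ 0th = inr aK
   at₂ 1st = inr aN
   off : ∃[ v ] v ∈ verts Δ₂ × md N v ≡ md N (x + 0) -> ⊥
   off (v , 0th , e) = ends-≢ x (trans (sym x₀) (trans (sym e) aK))
   off (v , 1st , e) = ends-≢ x (trans (sym x₀) (trans (sym e) aN))
   cmp : ∀ {Δ} -> Lifted Δ -> start Δ < N -> Δ ∈ Δ₁ ∷ Δ₂ ∷ [] ⊎ Around.ChainAt st Δ
   cmp (chain p e refl refl) h = inr (chain-around p e h)
   cmp (tr2 _ e refl refl) h = inl (here (cong (\ a -> tri a (a + 1) (a + N)) (base-at e h)))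
   cmp (tp2 _ e refl) h = inl (there (here (cong (\ a -> trip a (a + N)) (base-at e h))))
   cmp (tpA (inl ()) _ _) h
   cmp (tpA (inr ()) _ _) h
   cmp (tpB (inl ()) _ _) h
   cmp (tpB (inr ()) _ _) h

  -- Both regions meet the puncture and both ends, so two matchings remain whichever end is left
  -- out; this is the constant 2 of the absent tag.
  hub-two : Two l -> Hub (trip (md N x) (md N x + K) ∷ trip (md N (x + K)) (md N (x + K) + 1) ∷ [])
  hub-two t = record { perf = perfect-three (incSurf N) true true refl refl (corner⁺ Δ₁ 0th (trans (md-idem x) (sym x₀))) (corner⁺ Δ₂ 1st (trans b1 (sym x₀))) (corner⁺ Δ₁ 1st (md-md+ x K)) (corner⁺ Δ₂ 0th bK)
   (weigh 0 (κ≡ t) (trans ρ₀≡ (Core.two-ray {x} refl t))) (weigh K (κ≡ t) (Core.two-ray' {x} refl t)) , Unique-∷ (\ { (here e) -> ends-≢ x (starts e) }) (Unique-∷ (\ ()) []) ; corners = \ { 0th p -> at₁ p ; 1st p -> at₂ p }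
   ; T⁻ = \ { 0th -> tpA t (md-idem x) refl , md-< x ; 1st -> tpB t bK refl , md-< (x + K) } ; T⁺ = cmp } where
   a = md N x
   b = md N (x + K)
   Δ₁ = trip a (a + K)
   Δ₂ = trip b (b + 1)
   κ≡ : Two l -> κ l ≡ pos 2
   κ≡ (inl refl) = refl
   κ≡ (inr refl) = refl
   starts : ∀ {a b c d} -> trip a b ≡ trip c d -> a ≡ c
   starts refl = refl
   bK = md-idem (x + K)
   b1 = trans (md-md+ (x + K) 1) (md-+K+1 x)
   at₁ : ∀ {v} -> v ∈ verts Δ₁ -> md N v ≡ md N x ⊎ md N v ≡ md N (x + K)
   at₁ 0th = inl (md-idem x)
   at₁ 1st = inr (md-md+ x K)
   at₂ : ∀ {v} -> v ∈ verts Δ₂ -> md N v ≡ md N x ⊎ md N v ≡ md N (x + K)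
   at₂ 0th = inr bK
   at₂ 1st = inl b1
   cmp : ∀ {Δ} -> Lifted Δ -> start Δ < N -> Δ ∈ Δ₁ ∷ Δ₂ ∷ [] ⊎ Around.ChainAt st Δ
   cmp (chain p e refl refl) h = inr (chain-around p e h)
   cmp (tpA _ e refl) h = inl (here (cong (\ a -> trip a (a + K)) (base-at e h)))
   cmp (tpB _ e refl) h = inl (there (here (cong (\ a -> trip a (a + 1)) (base-at e h))))
   cmp (tr1 e _ _ _) h = ⊥-elim (one-not-two t e)
   cmp (tp1 e _ _) h = ⊥-elim (one-not-two t e)
   cmp (tr2 e _ _ _) h = ⊥-elim (fan-not-two t e)
   cmp (tp2 e _ _) h = ⊥-elim (fan-not-two t e)

  mLoop-weight : ∀ {i} -> i < N -> pos (mLoop N T i) ≡ κ l *Z ρ i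
  mLoop-weight {i} i<N = by l refl where
   by : ∀ l' -> l ≡ l' -> pos (mLoop N T i) ≡ κ l *Z ρ i
   by lp1 e = hub-mLoop (hub-one e) i<N
   by lp2 e = hub-mLoop (hub-prev e) i<N
   by lp3 e = hub-mLoop (hub-two (inl e)) i<N
   by lp4 e = hub-mLoop (hub-two (inr e)) i<N

-- The initial exchange matrix.

bool-≡ : ∀ {a b} -> (a ≡ true -> b ≡ true) -> (b ≡ true -> a ≡ true) -> a ≡ b
bool-≡ {true} {b} f g = sym (f refl)
bool-≡ {false} {true} f g = g refl
bool-≡ {false} {false} f g = refl

total : {A : Set} -> (A -> ℤ) -> List A -> ℤ
total g [] = 0ℤ
total g (x ∷ xs) = g x +Z total g xs

total-↭ : {A : Set} (g : A -> ℤ) {xs ys : List A} -> xs ↭ ys -> total g xs ≡ total g ys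
total-↭ g Perm.refl = refl
total-↭ g (prep x p) = cong (\ t -> g x +Z t) (total-↭ g p)
total-↭ g (swap x y p) = trans (cong (\ t -> g x +Z (g y +Z t)) (total-↭ g p)) (lemma (g x) (g y) _) where
 lemma : ∀ a b c -> a +Z (b +Z c) ≡ b +Z (a +Z c)
 lemma = solve-∀
total-↭ g (Perm.trans p q) = trans (total-↭ g p) (total-↭ g q)

sumℤ-total : {A : Set} (g : A -> ℤ) (xs : List A) -> sumℤ (map g xs) ≡ total g xs
sumℤ-total g xs = trans (go xs 0ℤ) (ℤₚ.+-identityˡ _) where
 go : ∀ xs z -> foldl _+Z_ z (map g xs) ≡ z +Z total g xs
 go [] z = sym (ℤₚ.+-identityʳ z)
 go (x ∷ xs) z = trans (go xs (z +Z g x)) (ℤₚ.+-assoc z (g x) (total g xs))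

private
 unit : Bool -> ℤ
 unit b = pos (if b then 1 else 0)

 and-unit : ∀ a b -> (if a ∧ b then pos 1 else pos 0) ≡ unit a *Z unit b
 and-unit true true = refl
 and-unit true false = refl
 and-unit false true = refl
 and-unit false false = refl

 and-minus : ∀ a b -> (if a ∧ b then -1ℤ else pos 0) ≡ -Z (unit a *Z unit b)
 and-minus true true = refl
 and-minus true false = refl
 and-minus false true = refl
 and-minus false false = refl

bPair-val : ∀ {α' β' α β} s s' h h' -> isA α' s ≡ memT α (arcsOf h) -> isA α' s' ≡ memT α (arcsOf h') -> isA β' s ≡ memT β (arcsOf h) -> isA β' s' ≡ memT β (arcsOf h') -> bPair α' β' s s' ≡ indℤ h α *Z indℤ h' β -Z indℤ h' α *Z indℤ h β
bPair-val {α = α} {β} s s' h h' a a' b b' = cong₂ _+Z_ (trans (cong₂ (\ x y -> if x ∧ y then pos 1 else pos 0) a b') (and-unit (memT α (arcsOf h)) (memT β (arcsOf h')))) (trans (cong₂ (\ x y -> if x ∧ y then -1ℤ else pos 0) a' b) (and-minus (memT α (arcsOf h')) (memT β (arcsOf h))))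

T3-val : ∀ {A : List TArc} (lab : TArc -> Arc) s₁ s₂ s₃ h₁ h₂ h₃ -> (∀ {γ} -> γ ∈ A -> isA (lab γ) s₁ ≡ memT γ (arcsOf h₁)) -> (∀ {γ} -> γ ∈ A -> isA (lab γ) s₂ ≡ memT γ (arcsOf h₂)) -> (∀ {γ} -> γ ∈ A -> isA (lab γ) s₃ ≡ memT γ (arcsOf h₃)) ->
 ∀ {α β} -> α ∈ A -> β ∈ A -> bPair (lab α) (lab β) s₁ s₂ +Z (bPair (lab α) (lab β) s₂ s₃ +Z bPair (lab α) (lab β) s₃ s₁) ≡ T3 h₁ h₂ h₃ α β
T3-val lab s₁ s₂ s₃ h₁ h₂ h₃ e₁ e₂ e₃ {α} {β} p q = cong₂ _+Z_ (bp s₁ s₂ h₁ h₂ (e₁ p) (e₂ p) (e₁ q) (e₂ q)) (cong₂ _+Z_ (bp s₂ s₃ h₂ h₃ (e₂ p) (e₃ p) (e₂ q) (e₃ q)) (bp s₃ s₁ h₃ h₁ (e₃ p) (e₁ p) (e₃ q) (e₁ q))) where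
 bp = bPair-val {lab α} {lab β} {α} {β}

module Comparison (N : ℕ) (3≤N : 3 ≤ N) where
 open LoopCounts N 3≤N public

 -- The self-folded triangle is not in the image, in agreement with its omission from the sum in
 -- `Bplain`.
 ideal : Tri -> LTri
 ideal (tr i L M) = tri i (i + L) (i + (L + M))
 ideal (tp i L s) = trip i (i + L)

 -- The first two vertices recover the first half-edge of the glued triangle, and no half-edge
 -- occurs twice.
 Unique-ideal : ∀ Ts -> Unique (concatMap halves Ts) -> Unique (map ideal Ts)
 Unique-ideal [] u = []
 Unique-ideal (Δ ∷ Ts) u = Unique-∷ (\ p -> fresh Δ u (∈-map⁻ ideal p)) (Unique-ideal Ts (rest Δ u)) where
  rest : ∀ Δ -> Unique (halves Δ ++ concatMap halves Ts) -> Unique (concatMap halves Ts)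
  rest (tr _ _ _) u = Unique-tail (Unique-tail (Unique-tail u))
  rest (tp _ _ _) u = Unique-tail (Unique-tail (Unique-tail u))
  first : LTri -> Half
  first (tri a b _) = up a (b ∸ a)
  first (trip a b) = up a (b ∸ a)
  base : Tri -> Half
  base (tr i L _) = up i L
  base (tp i L _) = up i L
  first-ideal : ∀ Δ -> first (ideal Δ) ≡ base Δ
  first-ideal (tr i L _) = cong (up i) (m+n∸m≡n i L)
  first-ideal (tp i L _) = cong (up i) (m+n∸m≡n i L)
  base∈ : ∀ Δ -> base Δ ∈ halves Δ
  base∈ (tr _ _ _) = 0th
  base∈ (tp _ _ _) = 0th
  base∉ : ∀ Δ -> Unique (halves Δ ++ concatMap halves Ts) -> base Δ ∉ concatMap halves Ts
  base∉ (tr _ _ _) u p = Unique-head u (there (there p))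
  base∉ (tp _ _ _) u p = Unique-head u (there (there p))
  fresh : ∀ Δ -> Unique (halves Δ ++ concatMap halves Ts) -> ∃[ Δ' ] Δ' ∈ Ts × ideal Δ ≡ ideal Δ' -> ⊥
  fresh Δ u (Δ' , p , e) = base∉ Δ u (subst (_∈ concatMap halves Ts) (trans (sym (first-ideal Δ')) (trans (cong first (sym e)) (first-ideal Δ))) (∈-concatMap⁺ {f = halves} p (base∈ Δ')))

 nc-inj : ∀ {i L j M} -> nc i L ≡ nc j M -> i ≡ j × L ≡ M
 nc-inj refl = refl , refl

 ct-inj : ∀ {i j} -> ct i ≡ ct j -> i ≡ j
 ct-inj refl = refl

 module Initial {x : ℕ} {st : List Bool} {l : LastPair} {A : List TArc} (S : SliceLike x st l A) (und : Underlies A (map (labelT N A) A)) where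
  open SliceLifts S und
  open Underlies und
  private
   label = labelT N A
   T = map (labelT N A) A
   Ts = sliceT x st l
   open module LT = LiftTris TT valid compat und using (tri⁻; tri⁺; trip⁻; trip⁺)
   open Triangles TT
   open Structure TT using (half; tp-sides; tr-sides)

  -- The arc by which the matrix identifies t, after a radius of a self-folded triangle has been
  -- replaced by its loop; twins get the same label, just as they share `lp`.
  lab : TArc -> Arc
  lab t = piT N T (label t)

  label-tnc : ∀ i L -> label (tnc i L) ≡ nc i L
  label-tnc i L with 2 ≤ᵇ numNotched N A
  ... | true = refl
  ... | false = refl

  label-tct : ∀ i s -> label (tct i s) ≡ ct i ⊎ label (tct i s) ≡ nc i N
  label-tct i s with 2 ≤ᵇ numNotched N A
  ... | true = inl refl
  label-tct i pl | false = inl refl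
  label-tct i nt | false = inr refl

  lab-tnc : ∀ i L -> lab (tnc i L) ≡ nc i L
  lab-tnc i L = cong (piT N T) (label-tnc i L)

  pair : ∀ {i} s -> tct i s ∈ A -> tct i (opp s) ∈ A -> tct i pl ∈ A × tct i nt ∈ A
  pair pl p q = p , q
  pair nt p q = q , p

  lab-tct : ∀ {i s} -> tct i s ∈ A -> (tct i (opp s) ∈ A × lab (tct i s) ≡ nc i N) ⊎ (tct i (opp s) ∉ A × lab (tct i s) ≡ ct i)
  lab-tct {i} {s} p with ∈T? (tct i (opp s)) A | label-tct i s
  ... | inl q | inl e = inl (q , trans (cong (piT N T) e) (cong (if_then nc i N else ct i) (∈⇒memA (loop⁺ (fst (pair s p q)) (snd (pair s p q))))))
  ... | inl q | inr e = inl (q , cong (piT N T) e)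
  ... | inr q | inl e = inr (q , trans (cong (piT N T) e) (cong (if_then nc i N else ct i) (¬true⇒false \ t -> q (both (fst (loop⁻ (memA⇒∈ t))) (snd (loop⁻ (memA⇒∈ t))) (opp s)))))
  ... | inr q | inr e = ⊥-elim (q (both (fst (loop⁻ m)) (snd (loop⁻ m)) (opp s))) where
   m = subst (_∈ T) e (∈-map⁺ label p)

  private
   chord-free : ∀ {α i L} -> α ∈ A -> L < N -> lab α ≡ nc i L -> α ≡ tnc i L
   chord-free {tnc j M} p L<N e with nc-inj (trans (sym (lab-tnc j M)) e)
   ... | refl , refl = refl
   chord-free {tct j s} p L<N e with lab-tct p
   ... | inl (_ , q) = ⊥-elim (<-irrefl (sym (snd (nc-inj (trans (sym q) e)))) L<N)
   ... | inr (_ , q) with trans (sym q) e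
   ... | ()
   loop-ray : ∀ {α i} -> α ∈ A -> lab α ≡ nc i N -> ∃[ s ] α ≡ tct i s
   loop-ray {tnc j M} p e = ⊥-elim (<-irrefl (snd (nc-inj (trans (sym (lab-tnc j M)) e))) (snd (snd (validTnc (valid p)))))
   loop-ray {tct j s} p e with lab-tct p
   ... | inl (_ , q) = s , cong (\ i -> tct i s) (fst (nc-inj (trans (sym q) e)))
   ... | inr (_ , q) with trans (sym q) e
   ... | ()
   plain-ray : ∀ {α i} -> α ∈ A -> lab α ≡ ct i -> ∃[ s ] α ≡ tct i s
   plain-ray {tnc j M} p e with trans (sym (lab-tnc j M)) e
   ... | ()
   plain-ray {tct j s} p e with lab-tct p
   ... | inr (_ , q) = s , cong (\ i -> tct i s) (ct-inj (trans (sym q) e))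
   ... | inl (_ , q) with trans (sym q) e
   ... | ()
   chordArc-1 : ∀ a -> chordArc N a (a + 1) ≡ nothing
   chordArc-1 a = cong (if_then nothing else just (nc (md N a) (a + 1 ∸ a))) (≡⇒≡ᵇ≡ (m+n∸m≡n a 1))
   chordArc-2 : ∀ a {L} -> L ≢ 1 -> chordArc N a (a + L) ≡ just (nc (md N a) L)
   chordArc-2 a {L} ne = trans (cong (if_then nothing else just (nc (md N a) (a + L ∸ a))) (≢⇒≡ᵇ≡ (\ e -> ne (trans (sym (m+n∸m≡n a L)) e)))) (cong (\ L -> just (nc (md N a) L)) (m+n∸m≡n a L))
   eq⁺ : ∀ {a b} -> a ≡ b -> arcEq a b ≡ true
   eq⁺ {a} refl = arcEq-refl a

  is-chord : ∀ {α} a {L} -> α ∈ A -> L < N -> isA (lab α) (chordArc N a (a + L)) ≡ memT α (tnc (md N a) L ∷ [])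
  is-chord {α} a {L} p L<N with L ≟ 1
  ... | yes refl = trans (cong (isA (lab α)) (chordArc-1 a)) (sym (∉⇒memT {α} {tnc (md N a) 1 ∷ []} \ { 0th -> <-irrefl refl (fst (snd (validTnc (valid p)))) }))
  ... | no ne = trans (cong (isA (lab α)) (chordArc-2 a ne)) (bool-≡ (\ t -> ∈⇒memT {α} {tnc (md N a) L ∷ []} (here (chord-free p L<N (arcEq⇒≡ (lab α) _ t)))) (\ t -> back (memT⇒∈ t))) where
   back : α ∈ tnc (md N a) L ∷ [] -> arcEq (lab α) (nc (md N a) L) ≡ true
   back 0th = eq⁺ (lab-tnc (md N a) L)

  is-top : ∀ {α} a {L} -> α ∈ A -> 2 ≤ L -> Top A (md N a) L -> isA (lab α) (chordArc N a (a + L)) ≡ memT α (arcsOf (top (md N a) L))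
  is-top {α} a {L} p 2≤L (inr (L<N , _)) = trans (is-chord a p L<N) (cong (\ h -> memT α (arcsOf h)) (sym (top-chord (<⇒≢ L<N))))
  is-top {α} a {L} p 2≤L (inl (refl , q , q')) = trans (cong (isA (lab α)) (chordArc-2 a (\ e -> <-irrefl (sym e) 2≤L))) (trans (bool-≡ (\ t -> ∈⇒memT (there′ (loop-ray p (arcEq⇒≡ (lab α) _ t)))) (\ t -> back (memT⇒∈ t))) (cong (\ h -> memT α (arcsOf h)) (sym (top-loop {md N a} refl)))) where
   there′ : ∃[ s ] α ≡ tct (md N a) s -> α ∈ tct (md N a) pl ∷ tct (md N a) nt ∷ []
   there′ (pl , e) = here e
   there′ (nt , e) = there (here e)
   loopy : ∀ {s} -> tct (md N a) s ∈ A -> lab (tct (md N a) s) ≡ nc (md N a) N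
   loopy {s} m with lab-tct m
   ... | inl (_ , e) = e
   ... | inr (n , _) = ⊥-elim (n (both q q' (opp s)))
   back : α ∈ tct (md N a) pl ∷ tct (md N a) nt ∷ [] -> arcEq (lab α) (nc (md N a) N) ≡ true
   back 0th = eq⁺ (loopy p)
   back 1st = eq⁺ (loopy p)

  is-ray : ∀ {α k s} -> α ∈ A -> tct k s ∈ A × tct k (opp s) ∉ A -> isA (lab α) (just (ct k)) ≡ memT α (tct k s ∷ [])
  is-ray {α} {k} {s} p (q , q') = bool-≡ (\ t -> ∈⇒memT {α} {tct k s ∷ []} (here (forth (plain-ray p (arcEq⇒≡ (lab α) _ t))))) (\ t -> back (memT⇒∈ t)) where
   forth : ∃[ r ] α ≡ tct k r -> α ≡ tct k s
   forth (r , e) with tag-cases s r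
   ... | inl refl = e
   ... | inr refl = ⊥-elim (q' (subst (_∈ A) e p))
   back : α ∈ tct k s ∷ [] -> arcEq (lab α) (ct k) ≡ true
   back 0th with lab-tct q
   ... | inl (m , _) = ⊥-elim (q' m)
   ... | inr (_ , e) = eq⁺ e

  ideal-form : ∀ {α β Δ} -> α ∈ A -> β ∈ A -> Δ ∈ Ts -> bTri N (ideal Δ) (lab α) (lab β) ≡ formOf (halves Δ) α β
  ideal-form {α} {β} {tr i L M} p q m = T3-val lab (chordArc N i (i + L)) (chordArc N (i + L) (i + (L + M))) (chordArc N i (i + (L + M))) (up i L) (up j M) (top i (L + M)) s₁ s₂ s₃ p q where
   j = md N (i + L)
   i<N = fst (ok m)
   1≤L = fst (snd (ok m))
   1≤M = fst (snd (snd (ok m)))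
   le = snd (snd (snd (ok m)))
   i≡ = md-small i<N
   s₁ : ∀ {γ} -> γ ∈ A -> isA (lab γ) (chordArc N i (i + L)) ≡ memT γ (tnc i L ∷ [])
   s₁ {γ} r = trans (is-chord i r (lia 3 (\ L M N -> (# 1 :≤ M) ∷ (L :+ M :≤ N) ∷ [] ⊢ L :< N) L M N 1≤M le)) (cong (\ i -> memT γ (tnc i L ∷ [])) i≡)
   s₂ : ∀ {γ} -> γ ∈ A -> isA (lab γ) (chordArc N (i + L) (i + (L + M))) ≡ memT γ (tnc j M ∷ [])
   s₂ {γ} r = trans (cong (\ z -> isA (lab γ) (chordArc N (i + L) z)) (sym (+-assoc i L M))) (is-chord (i + L) r (lia 3 (\ L M N -> (# 1 :≤ L) ∷ (L :+ M :≤ N) ∷ [] ⊢ M :< N) L M N 1≤L le))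
   s₃ : ∀ {γ} -> γ ∈ A -> isA (lab γ) (chordArc N i (i + (L + M))) ≡ memT γ (arcsOf (top i (L + M)))
   s₃ {γ} r = trans (is-top i r (+-mono-≤ 1≤L 1≤M) (snd (snd (tr-sides (subst (\ i -> tr i L M ∈ Ts) (sym i≡) m))))) (cong (\ i -> memT γ (arcsOf (top i (L + M)))) i≡)
  ideal-form {α} {β} {tp i L s} p q m = T3-val lab (chordArc N i (i + L)) (just (ct j)) (just (ct (md N i))) (up i L) (rl j s) (rr i s) s₁ s₂ s₃ p q where
   j = md N (i + L)
   i≡ = md-small (fst (ok m))
   s₁ : ∀ {γ} -> γ ∈ A -> isA (lab γ) (chordArc N i (i + L)) ≡ memT γ (tnc i L ∷ [])
   s₁ {γ} r = trans (is-chord i r (snd (snd (ok m)))) (cong (\ i -> memT γ (tnc i L ∷ [])) i≡)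
   s₂ : ∀ {γ} -> γ ∈ A -> isA (lab γ) (just (ct j)) ≡ memT γ (tct j s ∷ [])
   s₂ r = is-ray r (half m 1st)
   s₃ : ∀ {γ} -> γ ∈ A -> isA (lab γ) (just (ct (md N i))) ≡ memT γ (tct i s ∷ [])
   s₃ {γ} r = trans (cong (\ i -> isA (lab γ) (just (ct i))) i≡) (is-ray r (half m 2nd))

  open Exchange N 3≤N using (form)

  private
   proper : LTri -> Bool
   proper Δ = not (selfFolded N Δ)
   R : List LTri
   R = filterᵇ proper (triangles N T)
   not-false : ∀ {b} -> b ≡ false -> not b ≡ true
   not-false refl = refl
   R⁻ : ∀ {Δ} -> start Δ < N -> LiftTri Δ -> proper Δ ≡ true -> Δ ∈ map ideal Ts
   R⁻ {tri a b c} a<N lf _ with tri⁻ lf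
   ... | L , M , refl , refl , m = ∈-map⁺ ideal (subst (\ i -> tr i L M ∈ Ts) (md-small a<N) m)
   R⁻ {trip a b} a<N lf e with trip⁻ lf
   ... | L , refl , inl (s , m) = ∈-map⁺ ideal (subst (\ i -> tp i L s ∈ Ts) (md-small a<N) m)
   ... | L , refl , inr (refl , _) = ⊥-elim (false≢true (cong not (≡⇒≡ᵇ≡ (m+n∸m≡n a N))) e)
   K≤ : ∀ {a} -> a < N -> a ≤ N-1
   K≤ {a} h = ≤-pred (subst (suc a ≤_) (sym 1+N-1) h)
   R⁺ : ∀ Δ -> Δ ∈ Ts -> ideal Δ ∈ R
   R⁺ (tr i L M) m = ∈-filterᵇ⁺ proper {ideal (tr i L M)} {triangles N T} (∈-trisIn⁺ {0} {N-1} {ideal (tr i L M)} z≤n (K≤ (fst (ok m))) (tri⁺ (subst (\ i -> tr i L M ∈ Ts) (sym (md-small (fst (ok m)))) m))) refl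
   R⁺ (tp i L s) m = ∈-filterᵇ⁺ proper {ideal (tp i L s)} {triangles N T} (∈-trisIn⁺ {0} {N-1} {ideal (tp i L s)} z≤n (K≤ (fst (ok m))) (trip⁺ (subst (\ i -> tp i L s ∈ Ts) (sym (md-small (fst (ok m)))) m))) (not-false (≢⇒≡ᵇ≡ (\ e -> <-irrefl (trans (sym (m+n∸m≡n i L)) e) (snd (snd (ok m))))))
   R-↭ = Unique-↭ (Unique-filterᵇ proper {triangles N T} (Unique-trisIn 0 N-1)) (Unique-ideal Ts uniq) (\ {Δ} p -> in⁻ Δ (∈-filterᵇ⁻ proper {Δ} {triangles N T} p)) (\ p -> in⁺ (∈-map⁻ ideal p)) where
    in⁻ : ∀ Δ -> Δ ∈ triangles N T × proper Δ ≡ true -> Δ ∈ map ideal Ts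
    in⁻ Δ (p , e) = go (∈-trisIn⁻ {0} {N-1} {Δ} p) where
     go : 0 ≤ start Δ × start Δ ≤ N-1 × LiftTri Δ -> Δ ∈ map ideal Ts
     go (_ , h , lf) = R⁻ (≤-<-trans h N-1<N) lf e
    in⁺ : ∀ {Δ} -> ∃[ Δ' ] Δ' ∈ Ts × Δ ≡ ideal Δ' -> Δ ∈ R
    in⁺ (Δ' , p , refl) = R⁺ Δ' p

  Btag-form : ∀ {α β} -> α ∈ A -> β ∈ A -> Btag N A α β ≡ form Ts α β
  Btag-form {α} {β} p q = trans (sumℤ-total g R) (trans (total-↭ g R-↭) (go Ts (\ m -> m))) where
   g = \ Δ -> bTri N Δ (lab α) (lab β)
   go : ∀ Us -> (∀ {Δ} -> Δ ∈ Us -> Δ ∈ Ts) -> total g (map ideal Us) ≡ form Us α β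
   go [] h = refl
   go (Δ ∷ Us) h = cong₂ _+Z_ (ideal-form p q (h 0th)) (go Us (\ m -> h (there m)))

 -- Comparison of matching numbers with cluster values.

 module Start {x : ℕ} {st : List Bool} {l : LastPair} {A : List TArc} (S : SliceLike x st l A) where
  open SliceLike S
  private
   module F = Facts x st l len
   W' = SW.weights x st l len

  tct-leaf : ∀ {i s} -> tct i s ∈ A -> tct i s ∈ leafArcs x l
  tct-leaf p = F.tct⁻ (to p)

  leaf-tct : ∀ {i s} -> tct i s ∈ leafArcs x l -> tct i s ∈ A
  leaf-tct p = from (F.tct⁺ p)

  valid : Valid A
  valid p = F.valid (to p)

  -- Except in the fourth shape, a central arc with tag -1 has its twin in the slice, so the loop
  -- replacing it does enclose a central arc.
  und-plain : l ≢ lp4 -> Underlies A (map (toPlain N) A)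
  und-plain l≢ = record { chord⁺ = ∈-map⁺ (toPlain N) ; chord⁻ = \ m h -> chord h (∈-map⁻ (toPlain N) m) ; loop⁺ = \ _ q -> ∈-map⁺ (toPlain N) q ; loop⁻ = \ m -> loop (∈-map⁻ (toPlain N) m) ; ray⁺ = \ {i} {s} p -> ∈-map⁺ (toPlain N) (plain s p) ; ray⁻ = \ m -> ray (∈-map⁻ (toPlain N) m) } where
   plain : ∀ {i} s -> tct i s ∈ A -> tct i pl ∈ A
   plain pl p = p
   plain {i} nt p = leaf-tct (go l l≢ (tct-leaf p)) where
    tc : ∀ {j} -> tct i nt ≡ tct j nt -> tct i pl ≡ tct j pl
    tc refl = refl
    go : ∀ l -> l ≢ lp4 -> tct i nt ∈ leafArcs x l -> tct i pl ∈ leafArcs x l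
    go lp1 _ (there (here e)) = here (tc e)
    go lp2 _ (there (here e)) = here (tc e)
    go lp3 _ (there (there ()))
    go lp4 n _ = ⊥-elim (n refl)
   chord : ∀ {i L} -> L < N -> ∃[ t ] t ∈ A × nc i L ≡ toPlain N t -> tnc i L ∈ A
   chord h (tnc i L , p , refl) = p
   chord h (tct i nt , p , refl) = <-absurd h
   loop : ∀ {i} -> ∃[ t ] t ∈ A × nc i N ≡ toPlain N t -> tct i pl ∈ A × tct i nt ∈ A
   loop (tnc i L , p , refl) = <-absurd (snd (snd (validTnc (valid p))))
   loop (tct i nt , p , refl) = plain nt p , p
   ray : ∀ {i} -> ∃[ t ] t ∈ A × ct i ≡ toPlain N t -> ∃[ s ] tct i s ∈ A
   ray (tct i pl , p , refl) = pl , p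

  -- All central arcs carry the tag -1 here; forgetting the tags produces no loop.
  und-untag : l ≡ lp4 -> Underlies A (map untag A)
  und-untag refl = record { chord⁺ = ∈-map⁺ untag ; chord⁻ = \ m _ -> chord (∈-map⁻ untag m) ; loop⁺ = \ p _ -> ⊥-elim (no-pl (tct-leaf p)) ; loop⁻ = \ m -> <-absurd (snd (snd (validTnc (valid (chord (∈-map⁻ untag m)))))) ; ray⁺ = \ p -> ∈-map⁺ untag p ; ray⁻ = \ m -> ray (∈-map⁻ untag m) } where
   no-pl : ∀ {i} -> tct i pl ∉ leafArcs x lp4
   no-pl (there (there ()))
   chord : ∀ {i L} -> ∃[ t ] t ∈ A × nc i L ≡ untag t -> tnc i L ∈ A
   chord (tnc i L , p , refl) = p
   ray : ∀ {i} -> ∃[ t ] t ∈ A × ct i ≡ untag t -> ∃[ s ] tct i s ∈ A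
   ray (tct i s , p , refl) = s , p

  private
   count : ∀ js -> Unique js -> (∀ {i} -> tct i nt ∈ leafArcs x l -> i ∈ js) -> (∀ {i} -> i ∈ js -> tct i nt ∈ leafArcs x l) -> numNotched N A ≡ length js
   count js u f g = ↭-length (Unique-↭ (Unique-filterᵇ notched (Uniqueₚ.upTo⁺ N)) u (\ {i} p -> f (tct-leaf (memT⇒∈ (snd (∈-filterᵇ⁻ notched {i} {upTo N} p))))) (\ {i} p -> ∈-filterᵇ⁺ notched {i} {upTo N} (∈-upTo⁺ (<ᵇ≡⇒< (valid (leaf-tct (g p))))) (∈⇒memT (leaf-tct (g p))))) where
    notched = \ i -> memT (tct i nt) A
   i≡ : ∀ {i s j r} -> tct i s ≡ tct j r -> i ≡ j
   i≡ refl = refl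

  few-notched : l ≢ lp4 -> numNotched N A ≤ 1
  few-notched l≢ = go l refl where
   at : ∀ {i j} -> i ≡ j -> tct i nt ≡ tct j nt
   at = cong (\ i -> tct i nt)
   go : ∀ l' -> l ≡ l' -> numNotched N A ≤ 1
   go lp1 refl = ≤-reflexive (count (md N x ∷ []) (Unique-∷ (\ ()) []) (\ { (there (here e)) -> here (i≡ e) }) (\ { (here e) -> there (here (at e)) }))
   go lp2 refl = ≤-reflexive (count (md N (x + N-1) ∷ []) (Unique-∷ (\ ()) []) (\ { (there (here e)) -> here (i≡ e) }) (\ { (here e) -> there (here (at e)) }))
   go lp3 refl = ≤-trans (≤-reflexive (count [] [] (\ { (there (there ())) }) (\ ()))) z≤n
   go lp4 e = ⊥-elim (l≢ e)

  two-notched : l ≡ lp4 -> numNotched N A ≡ 2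
  two-notched refl = count (md N x ∷ md N (x + N-1) ∷ []) (Unique-∷ (\ { (here e) -> ends-≢ x e }) (Unique-∷ (\ ()) [])) (\ { (here e) -> here (i≡ e) ; (there (here e)) -> there (here (i≡ e)) }) (\ { (here e) -> here (at e) ; (there (here e)) -> there (here (at e)) }) where
   at : ∀ {i j} -> i ≡ j -> tct i nt ≡ tct j nt
   at = cong (\ i -> tct i nt)

  lp4? = go l where
   go : ∀ l -> l ≡ lp4 ⊎ l ≢ lp4
   go lp1 = inr \ ()
   go lp2 = inr \ ()
   go lp3 = inr \ ()
   go lp4 = inl refl

  underlies : Underlies A (map (labelT N A) A)
  underlies with lp4?
  ... | inl e = subst (Underlies A) (map-cong (\ t -> sym (cong (\ b -> if b then untag t else toPlain N t) (≤⇒≤ᵇ≡ {2} (≤-reflexive (sym (two-notched e)))))) A) (und-untag e)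
  ... | inr n = subst (Underlies A) (map-cong (\ t -> sym (cong (\ b -> if b then untag t else toPlain N t) (¬true⇒false \ h -> <-irrefl refl (≤-trans (≤ᵇ≡⇒≤ {2} h) (few-notched n))))) A) (und-plain n)

  module C = Classify N 3≤N W'
  open Exchange.Values N 3≤N W' using (v; len-md; r-md; r-+N; len-+N; Good)

  start-one : ∀ {t} -> t ∈ A -> v t ≡ 1ℤ
  start-one {t} p with F.arc-cases (to p)
  ... | inl (_ , _ , _ , q , _) with SW.arc-one x st l len q
  ... | y , L , refl , e = trans (len-md y L) e
  start-one {t} p | inr q = go l refl q where
   module U = Loops S underlies
   ray : ∀ y s -> leafC l s ≡ 1ℤ -> U.ρ y ≡ 1ℤ -> leafC l s *Z U.ρ (md N y) ≡ 1ℤ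
   ray y s e e' = cong₂ _*Z_ e (trans (r-md y) e')
   go : ∀ l' -> l ≡ l' -> t ∈ leafArcs x l' -> v t ≡ 1ℤ
   go lp1 refl 0th = ray x pl refl (U.Core.one-ray refl refl)
   go lp1 refl 1st = ray x nt refl (U.Core.one-ray refl refl)
   go lp2 refl 0th = ray (x + K) pl refl (U.Core.fan-ray refl refl)
   go lp2 refl 1st = ray (x + K) nt refl (U.Core.fan-ray refl refl)
   go lp3 refl 0th = ray x pl refl (U.Core.two-ray refl (inl refl))
   go lp3 refl 1st = ray (x + K) pl refl (U.Core.two-ray' refl (inl refl))
   go lp4 refl 0th = ray x nt refl (U.Core.two-ray refl (inr refl))
   go lp4 refl 1st = ray (x + K) nt refl (U.Core.two-ray' refl (inr refl))

  start-good : Good (initSeed N A) (sliceT x st l)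
  start-good = record { TT = Triangles-resp from to F.triangulated ; matOK = Initial.Btag-form S underlies ; valOK = \ p -> subst (oneF ≈ᶠ_) (sym (start-one p)) one-≈ }

  module Numbers {T : List Arc} (und : Underlies A T) where
   open Loops S und using (mNC-weight; mCt-weight; mLoop-weight)
   noncentral : ∀ {i L} -> i < N -> 2 ≤ L -> L < N -> pos (mNC N T i L) ≡ v (tnc i L)
   noncentral {i} {L} a b c = trans (mNC-weight a b c) (len-+N i L)
   central : ∀ {i} s -> leafC l s ≡ 1ℤ -> i < N -> pos (mCt N T i) ≡ v (tct i s)
   central {i} s e h = trans (mCt-weight h) (trans (r-+N i) (trans (sym (ℤₚ.*-identityˡ _)) (cong (_*Z _) (sym e))))
   loop : ∀ {i} s -> κ l ≡ leafC l s -> i < N -> pos (mLoop N T i) ≡ v (tct i s)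
   loop s e h = trans (mLoop-weight h) (cong (_*Z _) e)

  -- A loop stands for tag -1. As the constant of tag 1 is 1, the factor found for loops is exactly
  -- the constant of tag -1.
  cPl : l ≢ lp4 -> leafC l pl ≡ 1ℤ × κ l ≡ leafC l nt
  cPl n = go l n where
   go : ∀ l -> l ≢ lp4 -> leafC l pl ≡ 1ℤ × κ l ≡ leafC l nt
   go lp1 _ = refl , refl
   go lp2 _ = refl , refl
   go lp3 _ = refl , refl
   go lp4 n = ⊥-elim (n refl)

  private
   bool : ∀ {b} c -> b ≡ c -> ∀ {A : Set} {y z : A} -> (if b then y else z) ≡ (if c then y else z)
   bool c refl = refl

  -- In the fourth shape the constants of the two tags are interchanged, and so are the numbers that
  -- `FTag` assigns to loops and to central arcs.
  FTag-value : ∀ D -> validArc N D ≡ true -> pos (FTag N A D) ≡ v (ofPlain N D)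
  FTag-value D vD with lp4?
  ... | inr n = trans (cong pos (bool true (≤⇒≤ᵇ≡ (few-notched n)))) (go D vD) where
   open Numbers (und-plain n)
   go : ∀ D -> validArc N D ≡ true -> pos (FT N (map (toPlain N) A) D) ≡ v (ofPlain N D)
   go (ct i) h = central pl (fst (cPl n)) (<ᵇ≡⇒< h)
   go (nc i L) h with L ≟ N
   ... | yes e = trans (cong pos (bool true (≡⇒≡ᵇ≡ e))) (trans (loop nt (snd (cPl n)) (fst (validNc {i} {L} h))) (cong v (sym (bool true (≡⇒≡ᵇ≡ e)))))
   ... | no ne = trans (cong pos (bool false (≢⇒≡ᵇ≡ ne))) (trans (noncentral (fst (validNc {i} {L} h)) (fst (snd (validNc {i} {L} h))) (≤∧≢⇒< (snd (snd (validNc {i} {L} h))) ne)) (cong v (sym (bool false (≢⇒≡ᵇ≡ ne)))))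
  FTag-value (ct i) vD | inl refl = trans (cong pos (bool false (¬true⇒false \ h -> <-irrefl refl (subst (_≤ 1) (two-notched refl) (≤ᵇ≡⇒≤ h))))) (Numbers.loop (und-untag refl) pl refl (<ᵇ≡⇒< vD))
  FTag-value (nc i L) vD | inl refl = trans (cong pos (bool false (¬true⇒false \ h -> <-irrefl refl (subst (_≤ 1) (two-notched refl) (≤ᵇ≡⇒≤ h))))) go where
   open Numbers (und-untag refl)
   go : pos (if L ≡ᵇ N then mCt N (map untag A) i else mNC N (map untag A) i L) ≡ v (ofPlain N (nc i L))
   go with L ≟ N
   ... | yes e = trans (cong pos (bool true (≡⇒≡ᵇ≡ e))) (trans (central nt refl (fst (validNc {i} {L} vD))) (cong v (sym (bool true (≡⇒≡ᵇ≡ e)))))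
   ... | no ne = trans (cong pos (bool false (≢⇒≡ᵇ≡ ne))) (trans (noncentral (fst (validNc {i} {L} vD)) (fst (snd (validNc {i} {L} vD))) (≤∧≢⇒< (snd (snd (validNc {i} {L} vD))) ne)) (cong v (sym (bool false (≢⇒≡ᵇ≡ ne)))))

  value : IsTaggedTriangulation N A -> ∀ D -> validArc N D ≡ true -> ∀ fs -> Reaches N A fs D -> fst (clusterValue N A fs D) ≡ FTag N A D * snd (clusterValue N A fs D)
  value it D vD fs (vf , m) with C.run fs (C.tagTri it) start-good vf
  ... | Ts' , good with Good.valOK good m
  ... | frac e = ℤₚ.+-injective (trans e (trans (cong (_*Z pos (snd (clusterValue N A fs D))) (sym (FTag-value D vD))) (sym (ℤₚ.pos-* (FTag N A D) (snd (clusterValue N A fs D))))))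

theorem6p6 : (N : ℕ) → 3 ≤ N → (Tt : List TArc) → IsTaggedTriangulation N Tt →
 IsSlice N (map (toPlain N) Tt) → (D : Arc) → validArc N D ≡ true →
 (Σ (List (TArc × TArc)) λ fs → Reaches N Tt fs D)
 × (∀ fs → Reaches N Tt fs D →
 proj₁ (clusterValue N Tt fs D) ≡ FTag N Tt D * proj₂ (clusterValue N Tt fs D))
theorem6p6 N 3≤N Tt it sl D vD with Comparison.slice-like N 3≤N (All.lookup (proj₁ it)) sl
... | x , st , l , S = Comparison.reaches N 3≤N S D vD , λ fs → Comparison.Start.value N 3≤N S it D vD fs
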